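{- There is a universal constant $\kappa>0$ such that for all finite sets $\mathcal X,\mathcal Y$, every $f:\mathcal X\times\mathcal Y\to\{0,1\}$, every product distribution $\mu(xy)=\mu(x)\cdot\mu(y)$ on $\mathcal X\times\mathcal Y$, every integer $n\ge1$ and every $C>1/\kappa$: if $\mathsf{adv}_\mu(C,f)<\kappa$, then $$\mathsf{adv}_{\mu^n}\Big(\frac{\kappa Cn}{\log^2(Cn)},\,f^{\oplus n}\Big)<\exp(-\kappa n).$$
   Context: We write $xy$ for $(x,y)$; logs are base 2. $f^{\oplus n}:\mathcal X^n\times\mathcal Y^n\to\{0,1\}$ is $f^{\oplus n}(xy)=f(x_1y_1)\oplus\cdots\oplus f(x_ny_n)$, and $\mu^n(xy)=\prod_{j=1}^n\mu(x_jy_j)$ on $\mathcal X^n\times\mathcal Y^n$. A randomized two-party communication protocol $\pi$: Alice receives $x$, Bob receives $y$, they have public and private randomness and exchange bits; the output $\pi(xy)$ is determined by the transcript together with the public randomness. $\|\pi\|$ is the maximum number of bits exchanged (public randomness not counted). For a distribution $\nu$ on inputs and a Boolean function $g$, $$\mathsf{adv}_\nu(C,g)=\sup_{\|\pi\|\le C}\mathbb E\big[(-1)^{\pi(xy)+g(xy)}\big],$$ the expectation being over $xy\sim\nu$ and the randomness of $\pi$. -}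

module Defs where

open import Algebra.Bundles using (CommutativeRing; Semiring)
import Algebra.Definitions.RawMonoid as RawMonoidDefs
import Algebra.Definitions.RawSemiring as RawSemiringDefs
import Algebra.Structures as AlgStructures
open import Data.Bool.Base using (Bool; true; false; _xor_)
open import Data.Fin.Base using (Fin)
open import Data.Fin.Properties using (*↔×; 1↔⊤)
open import Data.Nat.Base as ℕ using (ℕ; zero; suc; _⊔_; _!)
open import Data.Product.Base using (_×_; _,_; ∃; ∃-syntax)
open import Data.Product.Function.NonDependent.Propositional using (_×-↔_)
open import Data.Unit.Base using (⊤; tt)
open import Data.Vec.Base as Vec using (Vec; []; _∷_)
import Data.Vec.Functional as Vector
open import Function.Bundles using (_↔_; Inverse; mk↔ₛ′)
open import Function.Construct.Composition using (_↔-∘_)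
open import Function.Construct.Identity using (↔-id)
open import Function.Construct.Symmetry using (↔-sym)
open import Level using (0ℓ)
import Relation.Binary.Construct.NonStrictToStrict as ToStrict
open import Relation.Binary.PropositionalEquality.Core using (refl)
open import Relation.Binary.Structures using (IsDecTotalOrder)
open import Relation.Nullary.Negation.Core using (¬_)
open import Relation.Unary using (Pred; Satisfiable)

-- The real numbers, given by their classical axioms: a Dedekind-complete
-- ordered field.

record CompleteOrderedField : Set₁ where
  infix  4 _≈_ _≤_
  infixl 6 _+_
  infixl 7 _*_
  infix  8 -_
  infix  9 _⁻¹
  field
    Carrier : Set
    _≈_ _≤_ : Carrier → Carrier → Set
    _+_ _*_ : Carrier → Carrier → Carrier
    -_      : Carrier → Carrier
    0# 1#   : Carrier

  open AlgStructures _≈_ using (IsCommutativeRing)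

  IsUpperBound : Pred Carrier 0ℓ → Pred Carrier 0ℓ
  IsUpperBound S b = ∀ {x} → S x → x ≤ b

  -- The operations _⁻¹ and sup are total; nothing is assumed about the inverse
  -- of zero, or about the supremum of an empty or unbounded set.
  field
    isCommutativeRing : IsCommutativeRing _+_ _*_ -_ 0# 1#
    0≉1               : ¬ (0# ≈ 1#)
    _⁻¹               : Carrier → Carrier
    *-inverseʳ        : ∀ x → ¬ (x ≈ 0#) → x * x ⁻¹ ≈ 1#
    isDecTotalOrder   : IsDecTotalOrder _≈_ _≤_
    +-monoˡ-≤         : ∀ z {x y} → x ≤ y → x + z ≤ y + z
    *-nonNeg          : ∀ {x y} → 0# ≤ x → 0# ≤ y → 0# ≤ x * y
    sup               : Pred Carrier 0ℓ → Carrier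
    sup-upper         : ∀ S → Satisfiable S → Satisfiable (IsUpperBound S) →
                        IsUpperBound S (sup S)
    sup-least         : ∀ S → Satisfiable S → ∀ {b} → IsUpperBound S b →
                        sup S ≤ b

  commutativeRing : CommutativeRing 0ℓ 0ℓ
  commutativeRing = record { isCommutativeRing = isCommutativeRing }

  open CommutativeRing commutativeRing public
    using (semiring; +-rawMonoid)

  open ToStrict _≈_ _≤_ public using (_<_)
  open RawSemiringDefs (Semiring.rawSemiring semiring) public using (_^_)
  open RawMonoidDefs +-rawMonoid public using (sum)
  open RawMonoidDefs +-rawMonoid using () renaming (_×_ to _·_)

  infixl 7 _/_
  _/_ : Carrier → Carrier → Carrier
  x / y = x * y ⁻¹

  fromℕ : ℕ → Carrier
  fromℕ n = n · 1#

  -- The limit inferior, which is the limit of every convergent sequence.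
  lim : (ℕ → Carrier) → Carrier
  lim a = sup (λ y → ∃[ N ] (∀ m → N ℕ.≤ m → y ≤ a m))

  partialSum : (ℕ → Carrier) → ℕ → Carrier
  partialSum a zero    = 0#
  partialSum a (suc N) = partialSum a N + a N

  exp : Carrier → Carrier
  exp x = lim (partialSum (λ k → x ^ k / fromℕ (k !)))

  -- For y > 0 this is the inverse function of exp.
  ln : Carrier → Carrier
  ln y = sup (λ x → exp x ≤ y)

  log₂ : Carrier → Carrier
  log₂ y = ln y / ln (fromℕ 2)

record FinSet : Set₁ where
  field
    Elem : Set
    size : ℕ
    enum : Elem ↔ Fin size

open FinSet public using (Elem; size; enum)

fin : ℕ → FinSet
fin k = record { Elem = Fin k ; size = k ; enum = ↔-id (Fin k) }

infixr 2 _×ᶠ_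
_×ᶠ_ : FinSet → FinSet → FinSet
X ×ᶠ Y = record
  { Elem = Elem X × Elem Y
  ; size = size X ℕ.* size Y
  ; enum = ↔-sym *↔× ↔-∘ (enum X ×-↔ enum Y)
  }

private
  Vec₀↔⊤ : ∀ {A : Set} → Vec A 0 ↔ ⊤
  Vec₀↔⊤ = mk↔ₛ′ (λ _ → tt) (λ _ → []) (λ _ → refl) (λ { [] → refl })

  Vec-suc↔× : ∀ {A : Set} {n} → Vec A (suc n) ↔ (A × Vec A n)
  Vec-suc↔× = mk↔ₛ′ (λ { (x ∷ xs) → x , xs }) (λ { (x , xs) → x ∷ xs })
                    (λ _ → refl) (λ { (_ ∷ _) → refl })

  enumVec : ∀ X n → Vec (Elem X) n ↔ Fin (size X ℕ.^ n)
  enumVec X zero    = ↔-sym 1↔⊤ ↔-∘ Vec₀↔⊤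
  enumVec X (suc n) = ↔-sym *↔× ↔-∘ ((enum X ×-↔ enumVec X n) ↔-∘ Vec-suc↔×)

infixr 8 _^ᶠ_
_^ᶠ_ : FinSet → ℕ → FinSet
X ^ᶠ n = record
  { Elem = Vec (Elem X) n ; size = size X ℕ.^ n ; enum = enumVec X n }

-- Deterministic protocol trees: at an inner node the named party sends one bit
-- computed from its own data, and the leaf reached, i.e. the transcript,
-- determines the output.

data Tree (A B : Set) : Set where
  output : Bool → Tree A B
  alice  : (A → Bool) → (Bool → Tree A B) → Tree A B
  bob    : (B → Bool) → (Bool → Tree A B) → Tree A B

run : ∀ {A B} → Tree A B → A → B → Bool
run (output z)  a b = z
run (alice m t) a b = run (t (m a)) a b
run (bob m t)   a b = run (t (m b)) a b

depth : ∀ {A B} → Tree A B → ℕ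
depth (output z)  = 0
depth (alice m t) = suc (depth (t false) ⊔ depth (t true))
depth (bob m t)   = suc (depth (t false) ⊔ depth (t true))

xorPower : ∀ {A B : Set} → (A × B → Bool) → ∀ n → Vec A n × Vec B n → Bool
xorPower f n (xs , ys) =
  Vec.foldr′ _xor_ false (Vec.zipWith (λ x y → f (x , y)) xs ys)

module Communication (ℝ : CompleteOrderedField) where
  open CompleteOrderedField ℝ

  ∑ : (X : FinSet) → (Elem X → Carrier) → Carrier
  ∑ X F = sum (λ i → F (Inverse.from (enum X) i))

  record Distribution (X : FinSet) : Set where
    field
      weight        : Elem X → Carrier
      weight-nonNeg : ∀ x → 0# ≤ weight x
      weight-total  : ∑ X weight ≈ 1#

  open Distribution public

  marginalˡ : ∀ {X Y} → (Elem (X ×ᶠ Y) → Carrier) → Elem X → Carrier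
  marginalˡ {X} {Y} ν x = ∑ Y (λ y → ν (x , y))

  marginalʳ : ∀ {X Y} → (Elem (X ×ᶠ Y) → Carrier) → Elem Y → Carrier
  marginalʳ {X} {Y} ν y = ∑ X (λ x → ν (x , y))

  IsProduct : ∀ {X Y} → Distribution (X ×ᶠ Y) → Set
  IsProduct {X} {Y} μ = ∀ x y →
    weight μ (x , y) ≈
      marginalˡ {X} {Y} (weight μ) x * marginalʳ {X} {Y} (weight μ) y

  productPower : ∀ {A B : Set} → (A × B → Carrier) → ∀ n →
                 Vec A n × Vec B n → Carrier
  productPower ν n (xs , ys) =
    Vec.foldr′ _*_ 1# (Vec.zipWith (λ x y → ν (x , y)) xs ys)

  -- The three sources of randomness are independent.  The whole tree,
  -- including the output labels, may depend on the public seed; a message may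
  -- depend in addition on the sender's input and private seed.
  record Protocol (X Y : FinSet) : Set where
    field
      pubSize aliceSize bobSize : ℕ
      public-coins : Distribution (fin pubSize)
      alice-coins  : Distribution (fin aliceSize)
      bob-coins    : Distribution (fin bobSize)
      tree         : Fin pubSize →
                     Tree (Elem X × Fin aliceSize) (Elem Y × Fin bobSize)

  cost : ∀ {X Y} → Protocol X Y → ℕ
  cost π = Vector.foldr _⊔_ 0 (λ r → depth (tree r))
    where open Protocol π

  sign : Bool → Carrier
  sign false = 1#
  sign true  = - 1#

  advantage : ∀ {X Y} → (Elem (X ×ᶠ Y) → Carrier) → (Elem (X ×ᶠ Y) → Bool) →
              Protocol X Y → Carrier
  advantage {X} {Y} ν g π =
    ∑ (X ×ᶠ Y) λ (x , y) →
    ∑ (fin pubSize) λ r → ∑ (fin aliceSize) λ a → ∑ (fin bobSize) λ b →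
      ν (x , y) * weight public-coins r * weight alice-coins a
        * weight bob-coins b
        * sign (run (tree r) (x , a) (y , b) xor g (x , y))
    where open Protocol π

  adv : ∀ X Y → (Elem (X ×ᶠ Y) → Carrier) → Carrier →
        (Elem (X ×ᶠ Y) → Bool) → Carrier
  adv X Y ν C g =
    sup (λ v → ∃ λ (π : Protocol X Y) →
               (fromℕ (cost π) ≤ C) × (v ≈ advantage ν g π))

-- Suppose that a tree of depth T on n copies has advantage exp(-2κn). The inputs
-- that reach a leaf form a rectangle, and exposing them one coordinate at a time,
-- Alice's from the left and Bob's from the right, writes each f(xᵢ, yᵢ) as the xor of
-- the signs of two consecutive biases; one sign is known to Alice and one to Bob.
-- The advantage is at most the probability of the event that all n of these
-- equations hold. Conditioning on this event costs only 2κn nats, so by the chain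
-- rule, for an average i and given the transcript, x before i and y after i, the
-- pair (xᵢ, yᵢ) stays close to μ in divergence, while both bits remain correct.
--
-- One copy is then solved in one of two ways. If T is at most a small multiple of n,
-- the transcript reveals little about (xᵢ, yᵢ): it is sampled publicly and only the
-- two bits are sent. Otherwise the players walk down the transcript tree with
-- public coins and follow their likelihood ratios U and V against the public law.
-- When a ratio has doubled they accept the point reached by rejection sampling, at
-- the price of announcing its position, and restart from there. A ratio can double
-- only O(T/n) times, so the cost is O((T/n) log²), which is below C. Either way the
-- advantage on one copy exceeds κ.

module Submission where

open import Defs
open import Data.Bool.Base using (Bool)
open import Data.Nat.Base as ℕ using (ℕ)
open import Data.Product.Base using (_×_; ∃-syntax)
open import Algebra.Bundles using (CommutativeRing)
import Algebra.Properties.CommutativeMonoid.Sum as MonoidSum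
import Algebra.Properties.Ring as RingProps
import Algebra.Properties.Semiring.Sum as SemiringSum
import Algebra.Solver.Ring as RingSolver
open import Algebra.Solver.Ring.AlmostCommutativeRing using (AlmostCommutativeRing; fromCommutativeRing; _-Raw-AlmostCommutative⟶_)
open import Data.Bool.Base using (true; false; _∧_; _xor_; not; if_then_else_; _∨_)
import Data.Bool.Properties as Boolₚ
open import Data.Empty using (⊥-elim; ⊥)
open import Data.Fin.Base as Fin using (Fin; zero; suc; _↑ˡ_; _↑ʳ_; remQuot; toℕ; fromℕ<)
import Data.Fin.Properties as Finₚ
open import Data.Integer.Base as ℤ using (ℤ; +_; -[1+_]; +0)
import Data.Integer.Properties as ℤₚ
open import Data.List.Base as List using (List; []; _∷_; take; drop)
import Data.List.Properties as Listₚ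
open import Data.Maybe.Base using (Maybe; just; nothing)
open import Data.Nat.Base using (zero; suc; _!; _⊔_; _⊓_)
import Data.Nat.DivMod as DivMod
import Data.Nat.Properties as ℕₚ
open import Data.Nat.Solver using (module +-*-Solver)
open import Data.Product.Base using (_,_; proj₁; ∃; proj₂; Σ-syntax)
open import Data.Product.Properties using (≡-dec; ,-injectiveˡ; ,-injectiveʳ)
open import Data.Sum.Base using (_⊎_; inj₁; inj₂)
open import Data.Unit.Base using (tt; ⊤)
import Data.Unit.Properties as ⊤ₚ
open import Data.Vec.Base as Vec using (Vec; []; _∷_; lookup; toList)
import Data.Vec.Functional as Vector
open import Function.Base using (case_of_; _∘_; id)
open import Function.Bundles using (Inverse)
open import Relation.Binary.Bundles using (Poset)
open import Relation.Binary.Definitions using (DecidableEquality)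
import Relation.Binary.Properties.Poset as PosetProps
open import Relation.Binary.PropositionalEquality as ≡ using (_≡_)
import Relation.Binary.Reasoning.Setoid as SetoidReasoning
open import Relation.Binary.Structures using (IsDecTotalOrder)
open import Relation.Nullary using (¬_; Dec; yes; no; does; contradiction)
open import Relation.Nullary.Decidable using (yes; no; ¬?; _×-dec_; decidable-stable; map′)

-- The event is not a rectangle, so the two inputs are dependent given the transcript. The walk
-- therefore draws each message from its law given the earlier transcript and the speaker's own
-- entry of the pair. The price is the divergence of the true law from this simulated one. Summed
-- over the coordinates, the contributions of the transcript telescope and leave a bound free of its
-- length, and E ln r + 1 ≤ E r turns this divergence into the mass that the simulation keeps.
--
-- The information in the transcript enters through a cap on the likelihood ratio UV: leaves above
-- 2^O(1 + T/n) are given up, and this cap limits the number of restarts. The limit is proved with a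
-- martingale that majorises the square root of UV by the arithmetic-geometric mean inequality and
-- gains a constant factor at each restart.
--
-- One logarithm is the length of an announced position, the other the number of rejection rounds
-- that make a failure unlikely over all restarts. If C is below a constant times log², not even one
-- position may be affordable, which forces the separate argument for short transcripts.

module Development (ℝ : CompleteOrderedField) where

  -- A ring solver with integer coefficients for the real field.

  module IntegerCoefficients where
    open CompleteOrderedField ℝ hiding (commutativeRing)
    open CommutativeRing (CompleteOrderedField.commutativeRing ℝ)
      using (setoid; refl; sym; trans; reflexive; +-cong; *-cong; -‿cong;
             +-identityˡ; +-identityʳ; +-assoc; +-comm; distribʳ; distribˡ; *-identityˡ; zeroˡ; zeroʳ;
             -‿inverseʳ; -‿inverseˡ; ring)
    open RingProps ring using (-0#≈0#; -‿+-comm; -‿distribˡ-*; -‿distribʳ-*; -‿involutive)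
    open SetoidReasoning setoid

    almost : AlmostCommutativeRing _ _
    almost = fromCommutativeRing (CompleteOrderedField.commutativeRing ℝ)

    -- The separate clauses make the constants 0 and 1 evaluate to 0# and 1#.
    fromℤ : ℤ → Carrier
    fromℤ (+ 0) = 0#
    fromℤ (+ 1) = 1#
    fromℤ (+ suc (suc n)) = 1# + fromℕ (suc n)
    fromℤ -[1+ n ] = - fromℕ (suc n)

    fromℤ-+ : ∀ n → fromℤ (+ n) ≈ fromℕ n
    fromℤ-+ 0 = refl
    fromℤ-+ 1 = sym (+-identityʳ 1#)
    fromℤ-+ (suc (suc n)) = refl

    fromℕ-+ : ∀ m n → fromℕ (m ℕ.+ n) ≈ fromℕ m + fromℕ n
    fromℕ-+ zero n = sym (+-identityˡ _)
    fromℕ-+ (suc m) n = trans (+-cong refl (fromℕ-+ m n)) (sym (+-assoc _ _ _))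

    fromℕ-* : ∀ m n → fromℕ (m ℕ.* n) ≈ fromℕ m * fromℕ n
    fromℕ-* zero n = sym (zeroˡ _)
    fromℕ-* (suc m) n = trans (fromℕ-+ n (m ℕ.* n))
      (trans (+-cong (sym (*-identityˡ _)) (fromℕ-* m n)) (sym (distribʳ _ _ _)))

    private
      cancel : ∀ a b c → (a + b) + - (a + c) ≈ b + - c
      cancel a b c = begin
        (a + b) + - (a + c)   ≈⟨ +-cong (+-comm a b) (sym (-‿+-comm a c)) ⟩
        (b + a) + (- a + - c) ≈⟨ +-assoc b a _ ⟩
        b + (a + (- a + - c)) ≈⟨ +-cong refl (sym (+-assoc a _ _)) ⟩
        b + (a + - a + - c)   ≈⟨ +-cong refl (+-cong (-‿inverseʳ a) refl) ⟩
        b + (0# + - c)        ≈⟨ +-cong refl (+-identityˡ _) ⟩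
        b + - c ∎

      ⊖-homo : ∀ m n → fromℤ (m ℤ.⊖ n) ≈ fromℕ m + - fromℕ n
      ⊖-homo m zero = trans (fromℤ-+ m)
        (sym (trans (+-cong refl -0#≈0#) (+-identityʳ _)))
      ⊖-homo zero (suc n) = sym (+-identityˡ _)
      ⊖-homo (suc m) (suc n) = trans (reflexive (≡.cong fromℤ (ℤₚ.[1+m]⊖[1+n]≡m⊖n m n)))
        (trans (⊖-homo m n) (sym (cancel 1# (fromℕ m) (fromℕ n))))

      neg-homo : ∀ i → fromℤ (ℤ.- i) ≈ - fromℤ i
      neg-homo +0 = sym -0#≈0#
      neg-homo (+ suc n) = -‿cong (sym (fromℤ-+ (suc n)))
      neg-homo -[1+ n ] = trans (fromℤ-+ (suc n)) (sym (-‿involutive _))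

      add-homo : ∀ i j → fromℤ (i ℤ.+ j) ≈ fromℤ i + fromℤ j
      add-homo (+ m) (+ n) = trans (fromℤ-+ (m ℕ.+ n)) (trans (fromℕ-+ m n)
        (+-cong (sym (fromℤ-+ m)) (sym (fromℤ-+ n))))
      add-homo (+ m) -[1+ n ] = trans (⊖-homo m (suc n)) (+-cong (sym (fromℤ-+ m)) refl)
      add-homo -[1+ m ] (+ n) = trans (⊖-homo n (suc m))
        (trans (+-comm _ _) (+-cong refl (sym (fromℤ-+ n))))
      add-homo -[1+ m ] -[1+ n ] = trans
        (-‿cong (trans (reflexive (≡.cong fromℕ (≡.cong suc (≡.sym (ℕₚ.+-suc m n)))))
          (fromℕ-+ (suc m) (suc n)))) (sym (-‿+-comm _ _))

      ◃-pos : ∀ m n → fromℤ (+ m ℤ.* + n) ≈ fromℤ (+ m) * fromℤ (+ n)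
      ◃-pos m n = trans (reflexive (≡.cong fromℤ (≡.sym (ℤₚ.pos-* m n))))
        (trans (fromℤ-+ (m ℕ.* n)) (trans (fromℕ-* m n)
          (*-cong (sym (fromℤ-+ m)) (sym (fromℤ-+ n)))))

      mul-homo : ∀ i j → fromℤ (i ℤ.* j) ≈ fromℤ i * fromℤ j
      mul-homo (+ m) (+ n) = ◃-pos m n
      mul-homo (+ m) -[1+ n ] = trans (reflexive (≡.cong fromℤ (≡.sym (ℤₚ.neg-distribʳ-* (+ m) (+ suc n)))))
        (trans (neg-homo (+ m ℤ.* + suc n)) (trans (-‿cong (◃-pos m (suc n)))
        (trans (-‿distribʳ-* _ _) (*-cong refl (-‿cong (fromℤ-+ (suc n)))))))
      mul-homo -[1+ m ] (+ n) = trans (reflexive (≡.cong fromℤ (≡.sym (ℤₚ.neg-distribˡ-* (+ suc m) (+ n)))))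
        (trans (neg-homo (+ suc m ℤ.* + n)) (trans (-‿cong (◃-pos (suc m) n))
        (trans (-‿distribˡ-* _ _) (*-cong (-‿cong (fromℤ-+ (suc m))) refl))))
      mul-homo -[1+ m ] -[1+ n ] = trans (fromℤ-+ (suc m ℕ.* suc n)) (trans (fromℕ-* (suc m) (suc n))
        (sym (trans (sym (-‿distribˡ-* _ _)) (trans (-‿cong (sym (-‿distribʳ-* _ _))) (-‿involutive _)))))

    -- The solver normalises over ℤ, where equality of coefficients computes; equality in an
    -- abstract field is decidable but does not reduce.
    morphism : ℤ.+-*-rawRing -Raw-AlmostCommutative⟶ almost
    morphism = record
      { ⟦_⟧ = fromℤ
      ; +-homo = add-homo ; *-homo = mul-homo ; -‿homo = neg-homo
      ; 0-homo = refl ; 1-homo = refl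
      }

    coefficient-eq : ∀ i j → Maybe (fromℤ i ≈ fromℤ j)
    coefficient-eq i j with i ℤₚ.≟ j
    ... | yes eq = just (reflexive (≡.cong fromℤ eq))
    ... | no _ = nothing

    module Solver = RingSolver ℤ.+-*-rawRing almost morphism coefficient-eq

    open Solver public using () renaming
      (solve to ring; _:+_ to infixl 6 _⊕_; _:-_ to infixl 6 _⊖_; _:*_ to infixl 7 _⊗_; :-_ to infix 8 ⊝_; _:=_ to infix 4 _⊜_)

    infix 9 #_
    #_ : ∀ {n} → ℕ → Solver.Polynomial n
    # k = Solver.con (+ k)

  -- Inequalities in a complete ordered field.

  module OrderedField where
    open IntegerCoefficients public using (fromℕ-+; fromℕ-*; ring; _⊕_; _⊖_; _⊗_; ⊝_; _⊜_; #_)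

    open CompleteOrderedField ℝ public hiding (commutativeRing)
    open CommutativeRing (CompleteOrderedField.commutativeRing ℝ) public
      using (setoid; refl; sym; trans; reflexive; +-cong; +-congˡ; +-congʳ; *-cong; *-congˡ; *-congʳ; -‿cong;
             +-identityˡ; +-identityʳ; *-identityˡ; *-identityʳ; zeroˡ; zeroʳ; *-comm; +-comm; *-assoc; +-assoc;
             +-commutativeMonoid)
    open IsDecTotalOrder isDecTotalOrder public
      using (_≟_; _≤?_; total; antisym)
      renaming (reflexive to ≤-reflexive; trans to ≤-trans; refl to ≤-refl; ≤-respʳ-≈ to ≤-respʳ; ≤-respˡ-≈ to ≤-respˡ)

    poset : Poset _ _ _
    poset = record { isPartialOrder = IsDecTotalOrder.isPartialOrder isDecTotalOrder }

    open PosetProps poset public using (<-irrefl; <-trans; <-respʳ-≈; <-respˡ-≈; <-asym; ≤⇒≯; <⇒≱)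

    <⇒≤ : ∀ {x y} → x < y → x ≤ y
    <⇒≤ = proj₁

    ≤-<-trans : ∀ {x y z} → x ≤ y → y < z → x < z
    ≤-<-trans p (q , n) = ≤-trans p q , λ e → n (antisym q (≤-respˡ e p))

    <-≤-trans : ∀ {x y z} → x < y → y ≤ z → x < z
    <-≤-trans (p , n) q = ≤-trans p q , λ e → n (antisym p (≤-respʳ (sym e) q))

    infixl 6 _-_
    _-_ : Carrier → Carrier → Carrier
    x - y = x + - y

    abstract
      _<?_ : ∀ x y → Dec (x < y)
      x <? y = (x ≤? y) ×-dec ¬? (x ≟ y)

    ≰⇒> : ∀ {x y} → ¬ (x ≤ y) → y < x
    ≰⇒> {x} {y} h with total x y
    ... | inj₁ p = ⊥-elim (h p)
    ... | inj₂ p = p , λ e → h (≤-reflexive (sym e))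

    ≮⇒≥ : ∀ {x y} → ¬ (x < y) → y ≤ x
    ≮⇒≥ {x} {y} h with y ≤? x
    ... | yes p = p
    ... | no p = ⊥-elim (h (≰⇒> p))

    infixl 6 _⊞_
    _⊞_ : ∀ {a b c d} → a ≤ b → c ≤ d → a + c ≤ b + d
    _⊞_ {a} {b} {c} {d} p q = ≤-trans (+-monoˡ-≤ c p)
      (≤-respˡ (+-comm c b) (≤-respʳ (+-comm d b) (+-monoˡ-≤ b q)))

    -- Linear arithmetic: y - x is the difference of the two sides of a known inequality.
    by≤ : ∀ {a b x y} → a ≤ b → y + a ≈ x + b → x ≤ y
    by≤ {a} {b} {x} {y} p e = ≤-respˡ e₁ (≤-respʳ e₂ (+-monoˡ-≤ (x - a) p))
      where
      e₁ : a + (x - a) ≈ x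
      e₁ = ring 2 (λ a b → a ⊕ (b ⊖ a) ⊜ b) refl _ _
      e₂ : b + (x - a) ≈ y
      e₂ = trans (trans (b-eq) (+-cong (sym e) refl)) y-eq
        where
        b-eq : b + (x - a) ≈ (x + b) - a
        b-eq = ring 3 (λ a b c → a ⊕ (b ⊖ c) ⊜ b ⊕ a ⊖ c) refl _ _ _
        y-eq : (y + a) - a ≈ y
        y-eq = ring 2 (λ a b → a ⊕ b ⊖ b ⊜ a) refl _ _

    by≈ : ∀ {a b x y} → a ≈ b → y + a ≈ x + b → x ≈ y
    by≈ p e = antisym (by≤ (≤-reflexive p) e)
      (by≤ (≤-reflexive (sym p)) (trans (trans (+-comm _ _) (trans (+-comm _ _) (sym e))) refl))

    by< : ∀ {a b x y} → a < b → y + a ≈ x + b → x < y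
    by< {a} {b} {x} {y} (p , n) e = by≤ p e , λ x≈y → n (by≈ {x} {y} {a} {b} x≈y (trans (+-comm b x) (trans (sym e) (+-comm y a))))

    0≤-diff : ∀ {x y} → x ≤ y → 0# ≤ y - x
    0≤-diff p = by≤ p (ring 2 (λ a b → a ⊖ b ⊕ b ⊜ # 0 ⊕ a) refl _ _)

    diff-0≤ : ∀ {x y} → 0# ≤ y - x → x ≤ y
    diff-0≤ p = by≤ p (ring 2 (λ a b → a ⊕ # 0 ⊜ b ⊕ (a ⊖ b)) refl _ _)

    *-monoˡ-≤ : ∀ {c a b} → 0# ≤ c → a ≤ b → c * a ≤ c * b
    *-monoˡ-≤ c≥0 p = by≤ (*-nonNeg c≥0 (0≤-diff p)) (ring 3 (λ a b c → a ⊗ b ⊕ # 0 ⊜ a ⊗ c ⊕ a ⊗ (b ⊖ c)) refl _ _ _)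

    *-monoʳ-≤ : ∀ {c a b} → 0# ≤ c → a ≤ b → a * c ≤ b * c
    *-monoʳ-≤ c≥0 p = by≤ (*-nonNeg c≥0 (0≤-diff p)) (ring 3 (λ a b c → a ⊗ b ⊕ # 0 ⊜ c ⊗ b ⊕ b ⊗ (a ⊖ c)) refl _ _ _)

    *-mono-≤ : ∀ {a b c d} → 0# ≤ a → 0# ≤ d → a ≤ b → c ≤ d → a * c ≤ b * d
    *-mono-≤ a≥0 d≥0 p q = ≤-trans (*-monoˡ-≤ a≥0 q) (*-monoʳ-≤ d≥0 p)

    sq-nonNeg : ∀ x → 0# ≤ x * x
    sq-nonNeg x with total 0# x
    ... | inj₁ p = *-nonNeg p p
    ... | inj₂ p = by≤ (*-nonNeg -x≥0 -x≥0) (ring 1 (λ a → a ⊗ a ⊕ # 0 ⊜ # 0 ⊕ ⊝ a ⊗ ⊝ a) refl _)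
      where -x≥0 : 0# ≤ - x
            -x≥0 = by≤ p (ring 1 (λ a → ⊝ a ⊕ a ⊜ # 0 ⊕ # 0) refl _)

    0≤1 : 0# ≤ 1#
    0≤1 = ≤-respʳ (*-identityˡ 1#) (sq-nonNeg 1#)

    0<1 : 0# < 1#
    0<1 = 0≤1 , 0≉1

    +-nonNeg : ∀ {x y} → 0# ≤ x → 0# ≤ y → 0# ≤ x + y
    +-nonNeg p q = by≤ (p ⊞ q) (ring 2 (λ a b → a ⊕ b ⊕ (# 0 ⊕ # 0) ⊜ # 0 ⊕ (a ⊕ b)) refl _ _)

    +-pos : ∀ {x y} → 0# < x → 0# ≤ y → 0# < x + y
    +-pos {x} {y} p q = <-≤-trans p (by≤ q (ring 2 (λ a b → a ⊕ b ⊕ # 0 ⊜ a ⊕ b) refl _ _))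

    *-cancel-0 : ∀ {x y} → ¬ (x ≈ 0#) → x * y ≈ 0# → y ≈ 0#
    *-cancel-0 {x} {y} x≉0 e = trans e₁ (trans (*-congˡ e) (zeroʳ _))
      where e₁ : y ≈ x ⁻¹ * (x * y)
            e₁ = trans (sym (*-identityˡ y)) (trans (*-congʳ (sym (*-inverseʳ x x≉0))) r)
              where r : x * x ⁻¹ * y ≈ x ⁻¹ * (x * y)
                    r = ring 3 (λ a b c → a ⊗ b ⊗ c ⊜ b ⊗ (a ⊗ c)) refl _ _ _

    pos⇒≉0 : ∀ {x} → 0# < x → ¬ (x ≈ 0#)
    pos⇒≉0 (_ , n) e = n (sym e)

    *-pos : ∀ {x y} → 0# < x → 0# < y → 0# < x * y
    *-pos p q = *-nonNeg (<⇒≤ p) (<⇒≤ q) , λ e → pos⇒≉0 q (*-cancel-0 (pos⇒≉0 p) (sym e))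

    *-inv : ∀ {x} → 0# < x → x * x ⁻¹ ≈ 1#
    *-inv p = *-inverseʳ _ (pos⇒≉0 p)

    inv-pos : ∀ {x} → 0# < x → 0# < x ⁻¹
    inv-pos {x} p = ≰⇒> λ q → <⇒≱ 0<1 (≤-respˡ (*-inv p) (by≤ (*-nonNeg (<⇒≤ p) (0≤-diff q)) (by x (x ⁻¹))))
      where by = ring 2 (λ a b → # 0 ⊕ # 0 ⊜ a ⊗ b ⊕ a ⊗ (# 0 ⊖ b)) refl

    *-cancelˡ-≤ : ∀ {c x y} → 0# < c → c * x ≤ c * y → x ≤ y
    *-cancelˡ-≤ {c} {x} {y} p h = ≤-respˡ (e x) (≤-respʳ (e y) (*-monoˡ-≤ (<⇒≤ (inv-pos p)) h))
      where e : ∀ z → c ⁻¹ * (c * z) ≈ z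
            e z = trans r (trans (*-congʳ (*-inv p)) (*-identityˡ z))
              where r : c ⁻¹ * (c * z) ≈ c * c ⁻¹ * z
                    r = ring 3 (λ a b c → a ⊗ (b ⊗ c) ⊜ b ⊗ a ⊗ c) refl _ _ _

    *-cancelˡ-≈ : ∀ {c x y} → 0# < c → c * x ≈ c * y → x ≈ y
    *-cancelˡ-≈ p h = antisym (*-cancelˡ-≤ p (≤-reflexive h)) (*-cancelˡ-≤ p (≤-reflexive (sym h)))

    *-monoˡ-< : ∀ {c a b} → 0# < c → a < b → c * a < c * b
    *-monoˡ-< p (h , n) = *-monoˡ-≤ (<⇒≤ p) h , λ e → n (*-cancelˡ-≈ p e)

    *-mono-< : ∀ {a b c d} → 0# ≤ c → 0# < b → a < b → c < d → a * c < b * d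
    *-mono-< {a} {b} {c} {d} c≥0 b>0 p q = ≤-<-trans (*-monoʳ-≤ c≥0 (<⇒≤ p)) (*-monoˡ-< b>0 q)

    /-≤ : ∀ {x y z} → 0# < y → x ≤ z * y → x / y ≤ z
    /-≤ {x} {y} {z} p h = ≤-respʳ (trans (*-assoc z y _) (trans (*-congˡ (*-inv p)) (*-identityʳ z)))
      (*-monoʳ-≤ (<⇒≤ (inv-pos p)) h)

    ≤-/ : ∀ {x y z} → 0# < y → z * y ≤ x → z ≤ x / y
    ≤-/ {x} {y} {z} p h = ≤-respˡ (trans (*-assoc z y _) (trans (*-congˡ (*-inv p)) (*-identityʳ z)))
      (*-monoʳ-≤ (<⇒≤ (inv-pos p)) h)

    /-* : ∀ {x y} → 0# < y → x / y * y ≈ x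
    /-* {x} {y} p = trans r (trans (*-congˡ (*-inv p)) (*-identityʳ x))
      where r : x * y ⁻¹ * y ≈ x * (y * y ⁻¹)
            r = ring 3 (λ a b c → a ⊗ b ⊗ c ⊜ a ⊗ (c ⊗ b)) refl _ _ _

    fromℕ-nonNeg : ∀ n → 0# ≤ fromℕ n
    fromℕ-nonNeg zero = ≤-refl
    fromℕ-nonNeg (suc n) = +-nonNeg 0≤1 (fromℕ-nonNeg n)

    fromℕ-pos : ∀ n → 0# < fromℕ (suc n)
    fromℕ-pos n = +-pos 0<1 (fromℕ-nonNeg n)

    fromℕ-mono : ∀ {m n} → m ℕ.≤ n → fromℕ m ≤ fromℕ n
    fromℕ-mono {n = n} ℕ.z≤n = fromℕ-nonNeg n
    fromℕ-mono (ℕ.s≤s {m} {n} p) = ≤-refl ⊞ fromℕ-mono {m} {n} p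

    -- If s were the supremum of the naturals, s - 1 would be an upper bound as well, because n + 1
    -- lies below s.
    archimedean : ∀ x → ¬ (∀ n → fromℕ n ≤ x)
    archimedean x h = <⇒≱ (by< {b = 1#} 0<1 (ring 1 (λ a → a ⊕ # 0 ⊜ a ⊖ # 1 ⊕ # 1) refl _)) sup≤sup-1
      where
      S : Carrier → Set
      S y = ∃[ n ] y ≈ fromℕ n
      nonempty : ∃ S
      nonempty = fromℕ 0 , 0 , refl
      bounded : ∃ (IsUpperBound S)
      bounded = x , λ (n , e) → ≤-respˡ (sym e) (h n)
      sup≤sup-1 : sup S ≤ sup S - 1#
      sup≤sup-1 = sup-least S nonempty λ {y} (n , e) →
        by≤ {1# + y} {sup S} (≤-respˡ (+-congˡ (sym e)) (sup-upper S nonempty bounded (suc n , refl))) (ring 2 (λ a b → a ⊖ # 1 ⊕ (# 1 ⊕ b) ⊜ b ⊕ a) refl _ _)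

    -- The archimedean property is only available up to double negation, which a decidable goal absorbs.
    with-bound : ∀ {G : Set} → Dec G → ∀ x → (∀ n → x ≤ fromℕ n → G) → G
    with-bound dec x k = decidable-stable dec λ ¬g → archimedean x λ n →
      case total x (fromℕ n) of λ where
        (inj₁ p) → ⊥-elim (¬g (k n p))
        (inj₂ p) → p

    ∣_∣ : Carrier → Carrier
    ∣ x ∣ with 0# ≤? x
    ... | yes _ = x
    ... | no _ = - x

    abs-nonNeg : ∀ x → 0# ≤ ∣ x ∣
    abs-nonNeg x with 0# ≤? x
    ... | yes p = p
    ... | no p = by≤ (<⇒≤ (≰⇒> p)) (ring 1 (λ a → ⊝ a ⊕ a ⊜ # 0 ⊕ # 0) refl _)

    ≤-abs : ∀ x → x ≤ ∣ x ∣
    ≤-abs x with 0# ≤? x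
    ... | yes p = ≤-refl
    ... | no p = by≤ (<⇒≤ (≰⇒> p) ⊞ <⇒≤ (≰⇒> p)) (ring 1 (λ a → ⊝ a ⊕ (a ⊕ a) ⊜ a ⊕ (# 0 ⊕ # 0)) refl _)

    neg≤-abs : ∀ x → - x ≤ ∣ x ∣
    neg≤-abs x with 0# ≤? x
    ... | yes p = by≤ (p ⊞ p) (ring 1 (λ a → a ⊕ (# 0 ⊕ # 0) ⊜ ⊝ a ⊕ (a ⊕ a)) refl _)
    ... | no p = ≤-refl

    abs-least : ∀ {x y} → x ≤ y → - x ≤ y → ∣ x ∣ ≤ y
    abs-least {x} p q with 0# ≤? x
    ... | yes _ = p
    ... | no _ = q

    abs-cong : ∀ {x y} → x ≈ y → ∣ x ∣ ≈ ∣ y ∣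
    abs-cong {x} {y} e = antisym (le e) (le (sym e))
      where le : ∀ {x y} → x ≈ y → ∣ x ∣ ≤ ∣ y ∣
            le {x} {y} e = abs-least (≤-respˡ (sym e) (≤-abs y)) (≤-respˡ (-‿cong (sym e)) (neg≤-abs y))

    abs-pos : ∀ {x} → 0# ≤ x → ∣ x ∣ ≈ x
    abs-pos {x} p with 0# ≤? x
    ... | yes _ = refl
    ... | no ¬p = ⊥-elim (¬p p)

    abs-+ : ∀ x y → ∣ x + y ∣ ≤ ∣ x ∣ + ∣ y ∣
    abs-+ x y = abs-least (≤-abs x ⊞ ≤-abs y) (by≤ (neg≤-abs x ⊞ neg≤-abs y) (ring 4 (λ a b c d → a ⊕ b ⊕ (⊝ c ⊖ d) ⊜ ⊝ (c ⊕ d) ⊕ (a ⊕ b)) refl _ _ _ _))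

    abs-* : ∀ x y → ∣ x * y ∣ ≈ ∣ x ∣ * ∣ y ∣
    abs-* x y with 0# ≤? x | 0# ≤? y
    ... | yes p | yes q = abs-pos (*-nonNeg p q)
    ... | yes p | no q = trans (abs-cong (flip′ x y)) (trans (abs-neg (*-nonNeg p y′)) (ring 2 (λ a b → a ⊗ ⊝ b ⊜ a ⊗ ⊝ b) refl _ _))
      where y′ : 0# ≤ - y
            y′ = by≤ (<⇒≤ (≰⇒> q)) (ring 1 (λ a → ⊝ a ⊕ a ⊜ # 0 ⊕ # 0) refl _)
            flip′ = ring 2 (λ x y → x ⊗ y ⊜ ⊝ (x ⊗ ⊝ y)) refl
            abs-neg : ∀ {z} → 0# ≤ z → ∣ - z ∣ ≈ z
            abs-neg {z} p = antisym (abs-least (by≤ (p ⊞ p) (ring 1 (λ a → a ⊕ (# 0 ⊕ # 0) ⊜ ⊝ a ⊕ (a ⊕ a)) refl _)) (≤-reflexive (ring 1 (λ a → ⊝ ⊝ a ⊜ a) refl _))) (≤-respˡ (ring 1 (λ a → ⊝ ⊝ a ⊜ a) refl _) (neg≤-abs (- z)))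
    ... | no p | yes q = trans (abs-cong (flip′ x y)) (trans (abs-neg (*-nonNeg x′ q)) (ring 2 (λ a b → ⊝ a ⊗ b ⊜ ⊝ a ⊗ b) refl _ _))
      where x′ : 0# ≤ - x
            x′ = by≤ (<⇒≤ (≰⇒> p)) (ring 1 (λ a → ⊝ a ⊕ a ⊜ # 0 ⊕ # 0) refl _)
            flip′ = ring 2 (λ x y → x ⊗ y ⊜ ⊝ (⊝ x ⊗ y)) refl
            abs-neg : ∀ {z} → 0# ≤ z → ∣ - z ∣ ≈ z
            abs-neg {z} p = antisym (abs-least (by≤ (p ⊞ p) (ring 1 (λ a → a ⊕ (# 0 ⊕ # 0) ⊜ ⊝ a ⊕ (a ⊕ a)) refl _)) (≤-reflexive (ring 1 (λ a → ⊝ ⊝ a ⊜ a) refl _))) (≤-respˡ (ring 1 (λ a → ⊝ ⊝ a ⊜ a) refl _) (neg≤-abs (- z)))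
    ... | no p | no q = trans (abs-cong flip′) (abs-pos (*-nonNeg x′ y′))
      where x′ : 0# ≤ - x
            x′ = by≤ (<⇒≤ (≰⇒> p)) (ring 1 (λ a → ⊝ a ⊕ a ⊜ # 0 ⊕ # 0) refl _)
            y′ : 0# ≤ - y
            y′ = by≤ (<⇒≤ (≰⇒> q)) (ring 1 (λ a → ⊝ a ⊕ a ⊜ # 0 ⊕ # 0) refl _)
            flip′ : x * y ≈ - x * - y
            flip′ = ring 2 (λ a b → a ⊗ b ⊜ ⊝ a ⊗ ⊝ b) refl _ _

    ^-nonNeg : ∀ {x} k → 0# ≤ x → 0# ≤ x ^ k
    ^-nonNeg zero p = 0≤1
    ^-nonNeg (suc k) p = *-nonNeg p (^-nonNeg k p)

    ^-pos : ∀ {x} k → 0# < x → 0# < x ^ k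
    ^-pos zero p = 0<1
    ^-pos (suc k) p = *-pos p (^-pos k p)

    ^-mono : ∀ {x y} k → 0# ≤ x → x ≤ y → x ^ k ≤ y ^ k
    ^-mono zero p q = ≤-refl
    ^-mono (suc k) p q = *-mono-≤ p (^-nonNeg k (≤-trans p q)) q (^-mono k p q)

    ^-+ : ∀ x m n → x ^ (m ℕ.+ n) ≈ x ^ m * x ^ n
    ^-+ x zero n = sym (*-identityˡ _)
    ^-+ x (suc m) n = trans (*-congˡ (^-+ x m n)) (ring 3 (λ a b c → a ⊗ (b ⊗ c) ⊜ a ⊗ b ⊗ c) refl _ _ _)

    ^-cong : ∀ {x y} k → x ≈ y → x ^ k ≈ y ^ k
    ^-cong zero e = refl
    ^-cong (suc k) e = *-cong e (^-cong k e)

    ^-distrib : ∀ x y k → (x * y) ^ k ≈ x ^ k * y ^ k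
    ^-distrib x y zero = ring 0 (# 1 ⊜ # 1 ⊗ # 1) refl
    ^-distrib x y (suc k) = trans (*-congˡ (^-distrib x y k)) (ring 4 (λ a b c d → a ⊗ b ⊗ (c ⊗ d) ⊜ a ⊗ c ⊗ (b ⊗ d)) refl _ _ _ _)

    1^ : ∀ k → 1# ^ k ≈ 1#
    1^ zero = refl
    1^ (suc k) = trans (*-identityˡ _) (1^ k)

    ^-≤1 : ∀ {x} k → 0# ≤ x → x ≤ 1# → x ^ k ≤ 1#
    ^-≤1 k p q = ≤-respʳ (1^ k) (^-mono k p q)

    bernoulli : ∀ {x} n → 0# ≤ 1# + x → 0# ≤ x ⊎ x ≤ 0# → 1# + fromℕ n * x ≤ (1# + x) ^ n
    bernoulli {x} zero _ _ = ≤-reflexive (ring 1 (λ a → # 1 ⊕ # 0 ⊗ a ⊜ # 1) refl _)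
    bernoulli {x} (suc n) p d = ≤-trans
      (by≤ (*-nonNeg (fromℕ-nonNeg n) (sq-nonNeg x)) (ring 2 (λ a b → (# 1 ⊕ a) ⊗ (# 1 ⊕ b ⊗ a) ⊕ # 0 ⊜ # 1 ⊕ (# 1 ⊕ b) ⊗ a ⊕ b ⊗ (a ⊗ a)) refl _ _))
      (*-monoˡ-≤ p (bernoulli n p d))

    inv-unique : ∀ {x y} → 0# < x → x * y ≈ 1# → y ≈ x ⁻¹
    inv-unique p e = *-cancelˡ-≈ p (trans e (sym (*-inv p)))

    inv-cong : ∀ {x y} → 0# < x → x ≈ y → x ⁻¹ ≈ y ⁻¹
    inv-cong p e = inv-unique (<-respʳ-≈ e p) (trans (*-congʳ (sym e)) (*-inv p))

    inv-≤ : ∀ {x y} → 0# < x → x ≤ y → y ⁻¹ ≤ x ⁻¹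
    inv-≤ {x} {y} p q = *-cancelˡ-≤ p (≤-respʳ (sym (*-inv p)) (≤-respʳ (*-inv y>0) (*-monoʳ-≤ (<⇒≤ (inv-pos y>0)) q)))
      where y>0 = <-≤-trans p q

  -- The exponential series and the logarithm.

  module ExponentialLogarithm where
    open OrderedField

    private
      Seq = ℕ → Carrier

      shift : Seq → Seq
      shift a k = a (suc k)

    ps-dom : ∀ {a b : Seq} → (∀ k → ∣ a k ∣ ≤ b k) → ∀ k N →
      ∣ partialSum a (k ℕ.+ N) - partialSum a N ∣ ≤ partialSum b (k ℕ.+ N) - partialSum b N
    ps-dom {a} {b} h zero N = abs-least (by≤ (≤-refl {0#}) (ring 2 (λ a b → a ⊖ a ⊕ # 0 ⊜ b ⊖ b ⊕ # 0) refl _ _)) (by≤ (≤-refl {0#}) (ring 2 (λ a b → a ⊖ a ⊕ # 0 ⊜ ⊝ (b ⊖ b) ⊕ # 0) refl _ _))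
    ps-dom {a} {b} h (suc k) N = abs-least
      (by≤ (≤-abs (partialSum a (k ℕ.+ N) - partialSum a N) ⊞ ps-dom h k N ⊞ ≤-abs (a (k ℕ.+ N)) ⊞ h (k ℕ.+ N)) (ring 8 (λ a b c d e f g h → a ⊕ b ⊖ c ⊕ (d ⊖ e ⊕ f ⊕ g ⊕ h) ⊜ d ⊕ g ⊖ e ⊕ (f ⊕ (a ⊖ c) ⊕ h ⊕ b)) refl _ _ _ _ _ _ _ _))
      (by≤ (neg≤-abs (partialSum a (k ℕ.+ N) - partialSum a N) ⊞ ps-dom h k N ⊞ neg≤-abs (a (k ℕ.+ N)) ⊞ h (k ℕ.+ N)) (ring 8 (λ a b c d e f g h → a ⊕ b ⊖ c ⊕ (⊝ (d ⊖ e) ⊕ f ⊖ g ⊕ h) ⊜ ⊝ (d ⊕ g ⊖ e) ⊕ (f ⊕ (a ⊖ c) ⊕ h ⊕ b)) refl _ _ _ _ _ _ _ _))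

    ps-dom₀ : ∀ {a b : Seq} → (∀ k → ∣ a k ∣ ≤ b k) → ∀ N → ∣ partialSum a N ∣ ≤ partialSum b N
    ps-dom₀ {a} {b} h zero = abs-least ≤-refl (by≤ (≤-refl {0#}) (ring 0 (# 0 ⊕ # 0 ⊜ ⊝ # 0 ⊕ # 0) refl))
    ps-dom₀ {a} {b} h (suc N) = ≤-trans (abs-+ _ _) (ps-dom₀ h N ⊞ h N)

    ps-cong : ∀ {a b : Seq} → (∀ k → a k ≈ b k) → ∀ N → partialSum a N ≈ partialSum b N
    ps-cong h zero = refl
    ps-cong h (suc N) = +-cong (ps-cong h N) (h N)

    ps-nonNeg : ∀ {a : Seq} → (∀ k → 0# ≤ a k) → ∀ N → 0# ≤ partialSum a N
    ps-nonNeg h zero = ≤-refl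
    ps-nonNeg h (suc N) = +-nonNeg (ps-nonNeg h N) (h N)

    ps-mono : ∀ {a : Seq} → (∀ k → 0# ≤ a k) → ∀ k N → partialSum a N ≤ partialSum a (k ℕ.+ N)
    ps-mono h zero N = ≤-refl
    ps-mono h (suc k) N = by≤ (ps-mono h k N ⊞ h (k ℕ.+ N)) (ring 3 (λ a b c → a ⊕ b ⊕ (c ⊕ # 0) ⊜ c ⊕ (a ⊕ b)) refl _ _ _)

    ps-left : ∀ (a : Seq) N → partialSum a (suc N) ≈ a 0 + partialSum (shift a) N
    ps-left a zero = ring 1 (λ a → # 0 ⊕ a ⊜ a ⊕ # 0) refl _
    ps-left a (suc N) = trans (+-congʳ (ps-left a N)) (ring 3 (λ a b c → a ⊕ b ⊕ c ⊜ a ⊕ (b ⊕ c)) refl _ _ _)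

    -- The coefficient of index N in the Cauchy product of two power series.
    conv : Seq → Seq → Seq
    conv a b zero = a 0 * b 0
    conv a b (suc N) = a 0 * b (suc N) + conv (shift a) b N

    conv-cong : ∀ {a a′ b b′ : Seq} → (∀ k → a k ≈ a′ k) → (∀ k → b k ≈ b′ k) → ∀ N → conv a b N ≈ conv a′ b′ N
    conv-cong p q zero = *-cong (p 0) (q 0)
    conv-cong p q (suc N) = +-cong (*-cong (p 0) (q (suc N))) (conv-cong (λ k → p (suc k)) q N)

    conv-+ : ∀ (a a′ b : Seq) N → conv (λ k → a k + a′ k) b N ≈ conv a b N + conv a′ b N
    conv-+ a a′ b zero = ring 3 (λ a b c → (a ⊕ b) ⊗ c ⊜ a ⊗ c ⊕ b ⊗ c) refl _ _ _
    conv-+ a a′ b (suc N) = trans (+-congˡ (conv-+ (shift a) (shift a′) b N)) (ring 5 (λ a b c d e → (a ⊕ b) ⊗ c ⊕ (d ⊕ e) ⊜ a ⊗ c ⊕ d ⊕ (b ⊗ c ⊕ e)) refl _ _ _ _ _)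

    conv-scaleˡ : ∀ x (a b : Seq) N → conv (λ k → x * a k) b N ≈ x * conv a b N
    conv-scaleˡ x a b zero = ring 3 (λ a b c → a ⊗ b ⊗ c ⊜ a ⊗ (b ⊗ c)) refl _ _ _
    conv-scaleˡ x a b (suc N) = trans (+-congˡ (conv-scaleˡ x (shift a) b N)) (ring 4 (λ a b c d → a ⊗ b ⊗ c ⊕ a ⊗ d ⊜ a ⊗ (b ⊗ c ⊕ d)) refl _ _ _ _)

    conv-scaleʳ : ∀ x (a b : Seq) N → conv a (λ k → x * b k) N ≈ x * conv a b N
    conv-scaleʳ x a b zero = ring 3 (λ a b c → a ⊗ (b ⊗ c) ⊜ b ⊗ (a ⊗ c)) refl _ _ _
    conv-scaleʳ x a b (suc N) = trans (+-congˡ (conv-scaleʳ x (shift a) b N)) (ring 4 (λ a b c d → a ⊗ (b ⊗ c) ⊕ b ⊗ d ⊜ b ⊗ (a ⊗ c ⊕ d)) refl _ _ _ _)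

    deriv : Seq → Seq
    deriv a k = fromℕ (suc k) * a (suc k)

    -- The product rule for formal power series, `deriv` being the formal derivative. With the
    -- recursion `term-suc` it identifies the terms of the exponential series at x + y without
    -- binomial coefficients.
    conv-deriv : ∀ (a b : Seq) N → fromℕ (suc N) * conv a b (suc N) ≈ conv (deriv a) b N + conv a (deriv b) N
    conv-deriv a b zero = ring 4 (λ a b c d → (# 1 ⊕ # 0) ⊗ (a ⊗ b ⊕ c ⊗ d) ⊜ (# 1 ⊕ # 0) ⊗ c ⊗ d ⊕ a ⊗ ((# 1 ⊕ # 0) ⊗ b)) refl _ _ _ _
    conv-deriv a b (suc M) = trans lhs (trans (+-congˡ (conv-deriv (shift a) b M)) (trans (ring 8 (λ a b c d e f g h → (# 1 ⊕ (# 1 ⊕ a)) ⊗ (b ⊗ c) ⊕ (d ⊗ e ⊕ f) ⊕ (g ⊕ h) ⊜ (# 1 ⊕ # 0) ⊗ d ⊗ e ⊕ (f ⊕ g) ⊕ (b ⊗ ((# 1 ⊕ (# 1 ⊕ a)) ⊗ c) ⊕ h)) refl _ _ _ _ _ _ _ _) (sym rhs)))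
      where
      lhs : fromℕ (suc (suc M)) * (a 0 * b (suc (suc M)) + conv (shift a) b (suc M)) ≈
            (fromℕ (suc (suc M)) * (a 0 * b (suc (suc M))) + conv (shift a) b (suc M))
            + fromℕ (suc M) * conv (shift a) b (suc M)
      lhs = dist (fromℕ (suc M)) (a 0 * b (suc (suc M))) (conv (shift a) b (suc M))
        where dist = ring 3 (λ m p c → (# 1 ⊕ m) ⊗ (p ⊕ c) ⊜ (# 1 ⊕ m) ⊗ p ⊕ c ⊕ m ⊗ c) refl
      rhs : conv (deriv a) b (suc M) + conv a (deriv b) (suc M) ≈
            deriv a 0 * b (suc M) + (conv (shift (shift a)) b M + conv (deriv (shift a)) b M)
            + conv a (deriv b) (suc M)
      rhs = +-congʳ (+-congˡ (trans (conv-cong (λ k → dist (fromℕ (suc k)) (a (suc (suc k)))) (λ _ → refl) M)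
        (conv-+ (shift (shift a)) (deriv (shift a)) b M)))
        where dist = ring 2 (λ m p → (# 1 ⊕ m) ⊗ p ⊜ p ⊕ m ⊗ p) refl

    -- The sum of the products of coefficients over the triangle i + j < N, arranged by i.
    convSum : Seq → Seq → Seq
    convSum a b zero = 0#
    convSum a b (suc N) = a 0 * partialSum b (suc N) + convSum (shift a) b N

    convSum-suc : ∀ (a b : Seq) N → convSum a b (suc N) ≈ convSum a b N + conv a b N
    convSum-suc a b zero = ring 2 (λ a b → a ⊗ (# 0 ⊕ b) ⊕ # 0 ⊜ # 0 ⊕ a ⊗ b) refl _ _
    convSum-suc a b (suc N) = trans (+-congˡ (convSum-suc (shift a) b N)) (ring 6 (λ a b c d e f → a ⊗ (b ⊕ c ⊕ d) ⊕ (e ⊕ f) ⊜ a ⊗ (b ⊕ c) ⊕ e ⊕ (a ⊗ d ⊕ f)) refl _ _ _ _ _ _)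

    ps-conv : ∀ (a b : Seq) N → partialSum (conv a b) N ≈ convSum a b N
    ps-conv a b zero = refl
    ps-conv a b (suc N) = trans (+-congʳ (ps-conv a b N)) (sym (convSum-suc a b N))

    private
      -- The part of the product of two partial sums that lies in the rectangle i < N, j < M but
      -- outside the triangle i + j < N. It is the error term of the exponential law.
      gap : Seq → Seq → ℕ → ℕ → Carrier
      gap a b zero M = 0#
      gap a b (suc N) M = a 0 * (partialSum b M - partialSum b (suc N)) + gap (shift a) b N M

      gap-eq : ∀ (a b : Seq) N M → gap a b N M ≈ partialSum a N * partialSum b M - convSum a b N
      gap-eq a b zero M = ring 1 (λ a → # 0 ⊜ # 0 ⊗ a ⊖ # 0) refl _
      gap-eq a b (suc N) M = trans (+-congˡ (gap-eq (shift a) b N M))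
        (trans (ring 6 (λ a b c d e f → a ⊗ (b ⊖ (c ⊕ d)) ⊕ (e ⊗ b ⊖ f) ⊜ (a ⊕ e) ⊗ b ⊖ (a ⊗ (c ⊕ d) ⊕ f)) refl _ _ _ _ _ _) (+-congʳ (*-congʳ (sym (ps-left a N)))))

      gap-abs : ∀ {a b a′ b′ : Seq} → (∀ k → ∣ a k ∣ ≤ a′ k) → (∀ k → ∣ b k ∣ ≤ b′ k) →
        ∀ N k → ∣ gap a b N (k ℕ.+ N) ∣ ≤ gap a′ b′ N (k ℕ.+ N)
      gap-abs p q zero k = abs-least ≤-refl (by≤ (≤-refl {0#}) (ring 0 (# 0 ⊕ # 0 ⊜ ⊝ # 0 ⊕ # 0) refl))
      gap-abs {a} {b} {a′} {b′} p q (suc N) k = ≤-trans (abs-+ _ _)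
        (≤-trans (≤-reflexive (abs-* _ _))
          (*-mono-≤ (abs-nonNeg _) (≤-trans (abs-nonNeg _) (ps-dom q k (suc N))) (p 0) (ps-dom q k (suc N)))
         ⊞ ≡.subst (λ m → ∣ gap (shift a) b N m ∣ ≤ gap (shift a′) b′ N m) (≡.sym (ℕₚ.+-suc k N))
             (gap-abs (λ j → p (suc j)) q N (suc k)))

      -- The rectangle with sides N and M is contained in the triangle i + j < N + M.
      convSum-lower : ∀ {a b : Seq} → (∀ k → 0# ≤ a k) → (∀ k → 0# ≤ b k) →
        ∀ N M → partialSum a N * partialSum b M ≤ convSum a b (N ℕ.+ M)
      convSum-lower {a} {b} p q zero M = ≤-trans (≤-reflexive (zeroˡ _)) (nonNeg M p)
        where nonNeg : ∀ M {a} → (∀ k → 0# ≤ a k) → 0# ≤ convSum a b M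
              nonNeg zero p = ≤-refl
              nonNeg (suc M) p = +-nonNeg (*-nonNeg (p 0) (ps-nonNeg q (suc M))) (nonNeg M (λ k → p (suc k)))
      convSum-lower {a} {b} p q (suc N) M = ≤-trans (≤-reflexive (trans (*-congʳ (ps-left a N)) dist))
        (*-monoˡ-≤ (p 0) (ps-mono q (suc N) M) ⊞ convSum-lower (λ k → p (suc k)) q N M)
        where dist : (a 0 + partialSum (shift a) N) * partialSum b M ≈
                     a 0 * partialSum b M + partialSum (shift a) N * partialSum b M
              dist = ring 3 (λ a b c → (a ⊕ b) ⊗ c ⊜ a ⊗ c ⊕ b ⊗ c) refl _ _ _

    fact-pos : ∀ k → 0# < fromℕ (k !)
    fact-pos k = <-≤-trans (fromℕ-pos 0) (fromℕ-mono {1} {k !} (ℕₚ.1≤n! k))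

    term : Carrier → Seq
    term x k = x ^ k / fromℕ (k !)

    e : Carrier → Seq
    e x = partialSum (term x)

    inv-1 : (fromℕ 1) ⁻¹ ≈ 1#
    inv-1 = sym (inv-unique (fromℕ-pos 0) (ring 0 ((# 1 ⊕ # 0) ⊗ # 1 ⊜ # 1) refl))

    term-zero : ∀ x → term x 0 ≈ 1#
    term-zero x = trans (*-congˡ inv-1) (ring 0 (# 1 ⊗ # 1 ⊜ # 1) refl)

    term-suc : ∀ x k → fromℕ (suc k) * term x (suc k) ≈ x * term x k
    term-suc x k = trans r (*-congˡ (*-congˡ (inv-unique (fact-pos k) eq)))
      where
      s = fromℕ (suc k)
      D = fromℕ (suc k !)
      r : fromℕ (suc k) * (x ^ suc k * fromℕ (suc k !) ⁻¹) ≈ x * (x ^ k * (fromℕ (suc k) * fromℕ (suc k !) ⁻¹))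
      r = perm (fromℕ (suc k)) x (x ^ k) (fromℕ (suc k !) ⁻¹)
        where perm = ring 4 (λ a b c d → a ⊗ (b ⊗ c ⊗ d) ⊜ b ⊗ (c ⊗ (a ⊗ d))) refl
      eq : fromℕ (k !) * (s * D ⁻¹) ≈ 1#
      eq = trans (perm (fromℕ (k !)) s (D ⁻¹)) (trans (*-congʳ (sym (fromℕ-* (suc k) (k !)))) (*-inv (fact-pos (suc k))))
        where perm = ring 3 (λ a b c → a ⊗ (b ⊗ c) ⊜ b ⊗ a ⊗ c) refl

    term-+ : ∀ x y N → term (x + y) N ≈ conv (term x) (term y) N
    term-+ x y zero = trans (term-zero (x + y)) (sym (trans (*-cong (term-zero x) (term-zero y)) (ring 0 (# 1 ⊗ # 1 ⊜ # 1) refl)))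
    term-+ x y (suc N) = *-cancelˡ-≈ (fromℕ-pos N) (trans (term-suc (x + y) N)
      (trans (*-congˡ (term-+ x y N)) (trans (dist x y (conv (term x) (term y) N)) (sym (trans (conv-deriv (term x) (term y) N)
      (+-cong (trans (conv-cong (term-suc x) (λ _ → refl) N) (conv-scaleˡ x (term x) (term y) N))
              (trans (conv-cong (λ _ → refl) (term-suc y) N) (conv-scaleʳ y (term x) (term y) N))))))))
      where dist = ring 3 (λ x y c → (x ⊕ y) ⊗ c ⊜ x ⊗ c ⊕ y ⊗ c) refl

    e-+ : ∀ x y N → e (x + y) N ≈ convSum (term x) (term y) N
    e-+ x y N = trans (ps-cong (term-+ x y) N) (ps-conv (term x) (term y) N)

    abs-^ : ∀ x k → ∣ x ^ k ∣ ≈ ∣ x ∣ ^ k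
    abs-^ x zero = abs-pos 0≤1
    abs-^ x (suc k) = trans (abs-* x (x ^ k)) (*-congˡ (abs-^ x k))

    term-nonNeg : ∀ {x} → 0# ≤ x → ∀ k → 0# ≤ term x k
    term-nonNeg p k = *-nonNeg (^-nonNeg k p) (<⇒≤ (inv-pos (fact-pos k)))

    term-dom : ∀ {x z} → ∣ x ∣ ≤ z → ∀ k → ∣ term x k ∣ ≤ term z k
    term-dom {x} {z} h k = ≤-trans (≤-reflexive (trans (abs-* _ _) (*-cong (abs-^ x k) (abs-pos i≥0))))
      (*-monoʳ-≤ i≥0 (^-mono k (abs-nonNeg x) h))
      where i≥0 = <⇒≤ (inv-pos (fact-pos k))

    e-submult : ∀ {x y} → 0# ≤ x → 0# ≤ y → ∀ N → e (x + y) N ≤ e x N * e y N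
    e-submult {x} {y} p q N = ≤-trans (≤-reflexive (e-+ x y N)) (diff-0≤ (≤-respʳ (gap-eq (term x) (term y) N N)
      (≤-trans (abs-nonNeg _) (gap-abs (dom p) (dom q) N 0))))
      where dom : ∀ {x} → 0# ≤ x → ∀ k → ∣ term x k ∣ ≤ term x k
            dom p = term-dom (≤-reflexive (abs-pos p))

    e-supermult : ∀ {x y} → 0# ≤ x → 0# ≤ y → ∀ N → e x N * e y N ≤ e (x + y) (N ℕ.+ N)
    e-supermult {x} {y} p q N = ≤-respʳ (sym (e-+ x y (N ℕ.+ N)))
      (convSum-lower (term-nonNeg p) (term-nonNeg q) N N)

    -- The error is a sum over the part of the square outside the triangle, so the same part for ∣ x
    -- ∣ and ∣ y ∣ dominates it. There all terms are nonnegative and the full square fits into the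
    -- triangle of size 2N, which leaves a tail of the series.
    e-product-error : ∀ x y N → ∣ e x N * e y N - e (x + y) N ∣ ≤
      e (∣ x ∣ + ∣ y ∣) (N ℕ.+ N) - e (∣ x ∣ + ∣ y ∣) N
    e-product-error x y N = ≤-respˡ (abs-cong (trans (gap-eq (term x) (term y) N N) (+-congˡ (-‿cong (sym (e-+ x y N))))))
      (≤-trans (gap-abs (term-dom {x} ≤-refl) (term-dom {y} ≤-refl) N 0)
        (≤-respˡ (sym (trans (gap-eq (term ∣ x ∣) (term ∣ y ∣) N N) (+-congˡ (-‿cong (sym (e-+ ∣ x ∣ ∣ y ∣ N))))))
          (e-supermult (abs-nonNeg x) (abs-nonNeg y) N ⊞ ≤-refl)))

    e-geometric : ∀ {h} → 0# ≤ h → h ≤ 1# → ∀ N → e h N * (1# - h) ≤ 1# - h ^ N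
    e-geometric {h} p q zero = by≤ (≤-refl {0#}) (ring 1 (λ a → # 1 ⊖ # 1 ⊕ # 0 ⊜ # 0 ⊗ (# 1 ⊖ a) ⊕ # 0) refl _)
    e-geometric {h} p q (suc N) = by≤ (e-geometric p q N ⊞ *-monoʳ-≤ (0≤-diff q) t≤) (ring 4 (λ a b c d → # 1 ⊖ a ⊗ b ⊕ (c ⊗ (# 1 ⊖ a) ⊕ b ⊗ d ⊗ (# 1 ⊖ a)) ⊜ (c ⊕ b ⊗ d) ⊗ (# 1 ⊖ a) ⊕ (# 1 ⊖ b ⊕ b ⊗ (# 1 ⊖ a))) refl _ _ _ _)
      where t≤ : term h N ≤ h ^ N
            t≤ = /-≤ (fact-pos N) (≤-respˡ (*-identityʳ _) (*-monoˡ-≤ (^-nonNeg N p)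
                   (≤-respˡ (+-identityʳ 1#) (fromℕ-mono {1} {N !} (ℕₚ.1≤n! N)))))

    Bounded : Carrier → Set
    Bounded z = ∃[ B ] (∀ N → e z N ≤ B)

    half : Carrier
    half = fromℕ 2 ⁻¹

    2*half : fromℕ 2 * half ≈ 1#
    2*half = *-inv (fromℕ-pos 1)

    half-pos : 0# < half
    half-pos = inv-pos (fromℕ-pos 1)

    e-cong : ∀ {x y} → x ≈ y → ∀ N → e x N ≈ e y N
    e-cong h N = ps-cong (λ k → *-congʳ (^-cong k h)) N

    e-nonNeg : ∀ {x} → 0# ≤ x → ∀ N → 0# ≤ e x N
    e-nonNeg p = ps-nonNeg (term-nonNeg p)

    e-bounded : ∀ {h} → 0# ≤ h → h ≤ half → ∀ m N → e (fromℕ m * h) N ≤ fromℕ 2 ^ m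
    e-bounded {h} p q zero N = ≤-trans (≤-reflexive (e-cong {y = 0#} (zeroˡ h) N))
      (by≤ (e-geometric {0#} ≤-refl 0≤1 N ⊞ ^-nonNeg {0#} N ≤-refl) (ring 2 (λ a b → # 1 ⊕ (a ⊗ (# 1 ⊖ # 0) ⊕ # 0) ⊜ a ⊕ (# 1 ⊖ b ⊕ b)) refl _ _))
    e-bounded {h} p q (suc m) N = ≤-trans (≤-reflexive (e-cong dist N))
      (≤-trans (e-submult p (*-nonNeg (fromℕ-nonNeg m) p) N)
        (*-mono-≤ (e-nonNeg p N) (^-nonNeg m (fromℕ-nonNeg 2)) e≤2 (e-bounded p q m N)))
      where
      dist : fromℕ (suc m) * h ≈ h + fromℕ m * h
      dist = r (fromℕ m)
        where r : ∀ a → (1# + a) * h ≈ h + a * h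
              r a = ring 2 (λ a b → (# 1 ⊕ a) ⊗ b ⊜ b ⊕ a ⊗ b) refl _ _
      half≤1-h : half ≤ 1# - h
      half≤1-h = by≤ (q ⊞ ≤-reflexive 2*half) (ring 2 (λ a b → # 1 ⊖ a ⊕ (a ⊕ # 2 ⊗ b) ⊜ b ⊕ (b ⊕ # 1)) refl _ _)
      h≤1 : h ≤ 1#
      h≤1 = by≤ (half≤1-h ⊞ <⇒≤ half-pos) (ring 2 (λ a b → # 1 ⊕ (a ⊕ # 0) ⊜ b ⊕ (# 1 ⊖ b ⊕ a)) refl _ _)
      e≤2 : e h N ≤ fromℕ 2
      e≤2 = by≤ (*-monoˡ-≤ (fromℕ-nonNeg 2) (≤-trans (*-monoˡ-≤ (e-nonNeg p N) half≤1-h)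
          (≤-trans (e-geometric p h≤1 N) (by≤ {0#} {h ^ N} {1# - h ^ N} {1#} (^-nonNeg N p) (ring 1 (λ a → # 1 ⊕ # 0 ⊜ # 1 ⊖ a ⊕ a) refl _))))
          ⊞ ≤-reflexive (*-congʳ {e h N} (sym 2*half))) (ring 2 (λ a b → # 2 ⊕ (# 2 ⊗ (a ⊗ b) ⊕ # 1 ⊗ a) ⊜ a ⊕ (# 2 ⊗ # 1 ⊕ # 2 ⊗ b ⊗ a)) refl _ _)

    -- z is cut into equal pieces of size at most `half`, and `e-bounded` gives a factor two for
    -- each. The number of pieces comes from the archimedean property, hence the decidable goal.
    with-Bounded : ∀ {G : Set} → Dec G → ∀ {z} → 0# ≤ z → (Bounded z → G) → G
    with-Bounded dec {z} p k = with-bound dec (fromℕ 2 * z) λ n h →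
      let m>0 = fromℕ-pos n
          w = z / fromℕ (suc n)
          w≥0 = *-nonNeg p (<⇒≤ (inv-pos m>0))
          2w≤1 = *-cancelˡ-≤ {x = fromℕ 2 * w} {1#} m>0 (≤-trans (≤-reflexive (trans (perm (fromℕ (suc n)) w) (*-congˡ (/-* m>0))))
                   (≤-trans h (by≤ 0≤1 (one (fromℕ n)))))
          w≤half = *-cancelˡ-≤ (fromℕ-pos 1) (≤-respʳ (sym 2*half) 2w≤1)
      in k (fromℕ 2 ^ suc n , λ N → ≤-respˡ (e-cong (trans (*-comm _ _) (/-* m>0)) N) (e-bounded w≥0 w≤half (suc n) N))
      where
      perm : ∀ a b → a * (fromℕ 2 * b) ≈ fromℕ 2 * (b * a)
      perm a b = ring 2 (λ a b → a ⊗ (# 2 ⊗ b) ⊜ # 2 ⊗ (b ⊗ a)) refl a b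
      one : ∀ a → (1# + a) * 1# + 0# ≈ a + 1#
      one a = ring 1 (λ a → (# 1 ⊕ a) ⊗ # 1 ⊕ # 0 ⊜ a ⊕ # 1) refl a

    private
      -- By the definition of `lim`, `exp x` is the supremum of this set.
      Below : Carrier → Carrier → Set
      Below x y = ∃[ N ] (∀ m → N ℕ.≤ m → y ≤ e x m)

      to-+ : ∀ {N m} → N ℕ.≤ m → (m ℕ.∸ N) ℕ.+ N ≡ m
      to-+ = ℕₚ.m∸n+n≡m

    module _ {z} (z≥0 : 0# ≤ z) (bd : Bounded z) where
      private
        B = proj₁ bd
        below-e : ∀ N → Below z (e z N)
        below-e N = N , λ m N≤m → ≡.subst (λ j → e z N ≤ e z j) (to-+ N≤m) (ps-mono (term-nonNeg z≥0) (m ℕ.∸ N) N)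
        upper : IsUpperBound (Below z) B
        upper (N , h) = ≤-trans (h N ℕₚ.≤-refl) (proj₂ bd N)

      e≤exp : ∀ N → e z N ≤ exp z
      e≤exp N = sup-upper (Below z) (_ , below-e 0) (B , upper) (below-e N)

      exp-least : ∀ {b} → (∀ N → e z N ≤ b) → exp z ≤ b
      exp-least h = sup-least (Below z) (_ , below-e 0) λ (N , l) → ≤-trans (l N ℕₚ.≤-refl) (h N)

      private
        module _ {x} (x≤z : ∣ x ∣ ≤ z) (N : ℕ) where
          close : ∀ m → N ℕ.≤ m → ∣ e x m - e x N ∣ ≤ exp z - e z N
          close m N≤m = ≡.subst (λ j → ∣ e x j - e x N ∣ ≤ exp z - e z N) (to-+ N≤m)
            (≤-trans (ps-dom (term-dom x≤z) (m ℕ.∸ N) N) (e≤exp ((m ℕ.∸ N) ℕ.+ N) ⊞ ≤-refl))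
          lower : Below x (e x N - (exp z - e z N))
          lower = N , λ m N≤m → by≤ (neg≤-abs (e x m - e x N) ⊞ close m N≤m) (ring 5 (λ a b c d e → a ⊕ (⊝ (a ⊖ b) ⊕ c) ⊜ b ⊖ (d ⊖ e) ⊕ (c ⊕ (d ⊖ e))) refl _ _ _ _ _)
          up : IsUpperBound (Below x) (e x N + (exp z - e z N))
          up {y} (N′ , l) = by≤ (l (N ℕ.⊔ N′) (ℕₚ.m≤n⊔m N N′) ⊞ ≤-abs (e x (N ℕ.⊔ N′) - e x N) ⊞ close (N ℕ.⊔ N′) (ℕₚ.m≤m⊔n N N′)) (ring 6 (λ a b c d e f → a ⊕ (b ⊖ c) ⊕ (d ⊕ (e ⊖ a) ⊕ f) ⊜ d ⊕ (e ⊕ f ⊕ (b ⊖ c))) refl _ _ _ _ _ _)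

      exp-approx : ∀ {x} → ∣ x ∣ ≤ z → ∀ N → ∣ exp x - e x N ∣ ≤ exp z - e z N
      exp-approx {x} x≤z N = abs-least (by≤ hi (ring 4 (λ a b c d → a ⊖ b ⊕ c ⊜ c ⊖ d ⊕ (d ⊕ (a ⊖ b))) refl _ _ _ _)) (by≤ lo (ring 4 (λ a b c d → a ⊖ b ⊕ (c ⊖ (a ⊖ b)) ⊜ ⊝ (d ⊖ c) ⊕ d) refl _ _ _ _))
        where
        hi : exp x ≤ e x N + (exp z - e z N)
        hi = sup-least (Below x) (_ , lower x≤z N) (up x≤z N)
        lo : e x N - (exp z - e z N) ≤ exp x
        lo = sup-upper (Below x) (_ , lower x≤z N) (_ , up x≤z N) (lower x≤z N)

      exp-term-mono : ∀ {x y} → ∣ x ∣ ≤ z → ∣ y ∣ ≤ z → (∀ m → e x m ≤ e y m) → exp x ≤ exp y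
      exp-term-mono {x} {y} x≤z y≤z h = sup-least (Below x) (_ , lower x≤z 0) λ (N , l) →
        sup-upper (Below y) (_ , lower y≤z 0) (_ , up y≤z 0) (N , λ m p → ≤-trans (l m p) (h m))

      -- If all tails exceeded ε, exp z - ε would still bound the partial sums.
      exp-tail : ∀ {ε} → 0# < ε → ¬ (∀ N → ¬ (exp z - e z N ≤ ε))
      exp-tail {ε} ε>0 h = <⇒≱ (by< {y = exp z} ε>0 (ring 2 (λ a b → a ⊕ # 0 ⊜ a ⊖ b ⊕ b) refl _ _)) (exp-least {exp z - ε} λ N → by≤ (<⇒≤ (≰⇒> (h N))) (ring 3 (λ a b c → a ⊖ b ⊕ b ⊜ c ⊕ (a ⊖ c)) refl _ _ _))

    minus-0 : ∀ x → x - 0# ≈ x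
    minus-0 x = ring 1 (λ x → x ⊖ # 0 ⊜ x) refl x

    exp-+ : ∀ x y → exp (x + y) ≈ exp x * exp y
    exp-+ x y = with-Bounded (exp (x + y) ≟ exp x * exp y) z≥0 λ bd →
      decidable-stable (exp (x + y) ≟ exp x * exp y) λ neq → contra bd neq
      where
      z = ∣ x ∣ + ∣ y ∣
      z≥0 = +-nonNeg (abs-nonNeg x) (abs-nonNeg y)
      d = ∣ exp x * exp y - exp (x + y) ∣
      module _ (bd : Bounded z) (neq : ¬ (exp (x + y) ≈ exp x * exp y)) where
        Z≥0 : 0# ≤ exp z
        Z≥0 = e≤exp z≥0 bd 0
        x≤z : ∣ x ∣ ≤ z
        x≤z = by≤ (abs-nonNeg y) (ring 2 (λ a b → a ⊕ b ⊕ # 0 ⊜ a ⊕ b) refl _ _)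
        y≤z : ∣ y ∣ ≤ z
        y≤z = by≤ (abs-nonNeg x) (ring 2 (λ a b → a ⊕ b ⊕ # 0 ⊜ b ⊕ a) refl _ _)
        c = fromℕ 2 + fromℕ 2 * exp z
        c>0 : 0# < c
        c>0 = +-pos (fromℕ-pos 1) (*-nonNeg (fromℕ-nonNeg 2) Z≥0)
        d>0 : 0# < d
        d>0 = ≰⇒> λ d≤0 → neq (antisym
          (by≤ (neg≤-abs (exp x * exp y - exp (x + y)) ⊞ d≤0) (ring 4 (λ a b c d → a ⊗ b ⊕ (⊝ (a ⊗ b ⊖ c) ⊕ d) ⊜ c ⊕ (d ⊕ # 0)) refl _ _ _ _))
          (by≤ (≤-abs (exp x * exp y - exp (x + y)) ⊞ d≤0) (ring 4 (λ a b c d → a ⊕ (b ⊗ c ⊖ a ⊕ d) ⊜ b ⊗ c ⊕ (d ⊕ # 0)) refl _ _ _ _)))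
        -- c collects the four error terms of `bound`, so a tail of at most ε would give d ≤ d/2.
        ε = d * half / c
        ε>0 : 0# < ε
        ε>0 = *-pos (*-pos d>0 half-pos) (inv-pos c>0)
        absE : ∀ {a b} → ∣ a ∣ ≤ ε → ∣ b ∣ ≤ exp z → ∣ a * b ∣ ≤ ε * exp z
        absE p q = ≤-trans (≤-reflexive (abs-* _ _)) (*-mono-≤ (abs-nonNeg _) Z≥0 p q)
        exp-abs : ∣ exp y ∣ ≤ exp z
        exp-abs = ≤-trans (≤-reflexive (abs-cong r)) (≤-trans (exp-approx z≥0 bd y≤z 0) (≤-reflexive (minus-0 (exp z))))
          where r : exp y ≈ exp y - e y 0
                r = ring 1 (λ a → a ⊜ a ⊖ # 0) refl _
        bound : ∀ N → exp z - e z N ≤ ε → d ≤ ε * c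
        bound N small = ≤-trans (≤-reflexive (abs-cong (split (exp x) (exp y) (exp (x + y)) (e x N) (e y N) (e (x + y) N))))
          (≤-trans (abs-+ _ _) (≤-trans (≤-trans (abs-+ _ _) (≤-trans (abs-+ _ _)
            (absE (≤-trans (exp-approx z≥0 bd x≤z N) small) exp-abs
             ⊞ absE (≤-trans (exp-approx z≥0 bd y≤z N) small) (≤-trans (ps-dom₀ (term-dom x≤z) N) (e≤exp z≥0 bd N)))
            ⊞ ≤-trans (e-product-error x y N) (≤-trans (e≤exp z≥0 bd (N ℕ.+ N) ⊞ ≤-refl) small))
            ⊞ ≤-trans (≤-trans (≤-reflexive (abs-flip (e (x + y) N) (exp (x + y)))) (exp-approx z≥0 bd (abs-+ x y) N)) small) (≤-reflexive (r ε (exp z)))))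
          where
          split = ring 6 (λ X Y W a b w → X ⊗ Y ⊖ W ⊜ (X ⊖ a) ⊗ Y ⊕ (Y ⊖ b) ⊗ a ⊕ (a ⊗ b ⊖ w) ⊕ (w ⊖ W)) refl
          r = ring 2 (λ ε Z → ε ⊗ Z ⊕ ε ⊗ Z ⊕ ε ⊕ ε ⊜ ε ⊗ (# 2 ⊕ # 2 ⊗ Z)) refl
          abs-flip : ∀ a b → ∣ a - b ∣ ≈ ∣ b - a ∣
          abs-flip a b = antisym (le a b) (le b a)
            where le : ∀ a b → ∣ a - b ∣ ≤ ∣ b - a ∣
                  le a b = abs-least (≤-respˡ (ring 2 (λ a b → ⊝ (a ⊖ b) ⊜ b ⊖ a) refl _ _) (neg≤-abs (b - a))) (≤-respˡ (ring 2 (λ a b → a ⊖ b ⊜ ⊝ (b ⊖ a)) refl _ _) (≤-abs (b - a)))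
        contra : ⊥
        contra = exp-tail z≥0 bd ε>0 λ N small → <⇒≱ (≤-<-trans (bound N small) small-d) ≤-refl
          where
          small-d : ε * c < d
          small-d = ≤-<-trans (≤-reflexive (/-* c>0)) (by< (*-pos d>0 half-pos) (trans (+-congʳ (trans (sym (*-identityʳ d)) (*-congˡ (sym 2*half)))) (ring 2 (λ a b → a ⊗ (# 2 ⊗ b) ⊕ # 0 ⊜ a ⊗ b ⊕ a ⊗ b) refl _ _)))

    exp-0 : exp 0# ≈ 1#
    exp-0 = with-Bounded (exp 0# ≟ 1#) {0#} ≤-refl λ bd → antisym
      (exp-least ≤-refl bd λ N → by≤ {x = e 0# N} (e-geometric {0#} ≤-refl 0≤1 N ⊞ ^-nonNeg {0#} N ≤-refl) (ring 2 (λ a b → # 1 ⊕ (a ⊗ (# 1 ⊖ # 0) ⊕ # 0) ⊜ a ⊕ (# 1 ⊖ b ⊕ b)) refl _ _))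
      (≤-respˡ (trans (+-identityˡ _) (term-zero 0#)) (e≤exp ≤-refl bd 1))

    exp-cong : ∀ {x y} → x ≈ y → exp x ≈ exp y
    exp-cong x≈y = antisym (le x≈y) (le (sym x≈y))
      where
      le : ∀ {x y} → x ≈ y → exp x ≤ exp y
      le {x} {y} eq = with-Bounded (exp x ≤? exp y) (abs-nonNeg x) λ bd →
        exp-term-mono (abs-nonNeg x) bd ≤-refl (≤-reflexive (abs-cong (sym eq))) λ m → ≤-reflexive (e-cong eq m)

    exp-inverse : ∀ x → exp x * exp (- x) ≈ 1#
    exp-inverse x = trans (sym (exp-+ x (- x))) (trans (exp-cong {y = 0#} (ring 1 (λ a → a ⊖ a ⊜ # 0) refl _)) exp-0)

    halves : ∀ x → x * half + x * half ≈ x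
    halves x = trans (r x half) (trans (*-congˡ 2*half) (*-identityʳ x))
      where r = ring 2 (λ a b → a ⊗ b ⊕ a ⊗ b ⊜ a ⊗ (# 2 ⊗ b)) refl

    exp-pos : ∀ x → 0# < exp x
    exp-pos x = ≤-respʳ (trans (sym (exp-+ _ _)) (exp-cong (halves x))) (sq-nonNeg (exp (x * half))) ,
      λ eq → 0≉1 (trans (sym (zeroˡ (exp (- x)))) (trans (*-congʳ eq) (exp-inverse x)))

    -- Two terms of the series suffice for x ≥ 0. For -1 < x ≤ 0 the geometric series bounds exp(-x)
    -- by 1/(1 + x), and for x ≤ -1 the left side is not positive.
    1+x≤exp : ∀ x → 1# + x ≤ exp x
    1+x≤exp x with total 0# x
    ... | inj₁ x≥0 = with-Bounded ((1# + x) ≤? exp x) x≥0 λ bd → ≤-respˡ two-terms (e≤exp x≥0 bd 2)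
      where
      two-terms : e x 2 ≈ 1# + x
      two-terms = trans (r (term x 0) (term x 1)) (+-cong (term-zero x) (trans (term-suc x 0) (trans (*-congˡ (term-zero x)) (ring 1 (λ a → a ⊗ # 1 ⊜ a) refl _))))
        where r = ring 2 (λ a b → # 0 ⊕ a ⊕ b ⊜ a ⊕ (# 1 ⊕ # 0) ⊗ b) refl
    ... | inj₂ x≤0 with (- x) <? 1#
    ...   | no ¬p = ≤-trans (by≤ (≮⇒≥ ¬p) (ring 1 (λ a → # 0 ⊕ # 1 ⊜ # 1 ⊕ a ⊖ a) refl _)) (<⇒≤ (exp-pos x))
    ...   | yes p = with-Bounded ((1# + x) ≤? exp x) h≥0 λ bd →
      ≤-trans (≤-reflexive (sym (trans (*-congˡ (trans (*-comm (exp (- x)) (exp x)) (exp-inverse x))) (ring 1 (λ a → (# 1 ⊕ a) ⊗ # 1 ⊜ # 1 ⊕ a) refl _))))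
      (≤-trans (≤-reflexive (sym (*-assoc (1# + x) (exp (- x)) (exp x)))) (≤-respʳ (*-identityˡ _)
      (*-monoʳ-≤ (<⇒≤ (exp-pos x)) (≤-trans (*-monoˡ-≤ (<⇒≤ g>0) (exp-least h≥0 bd geo)) (≤-reflexive (*-inv g>0))))))
      where
      h≥0 : 0# ≤ - x
      h≥0 = by≤ x≤0 (ring 1 (λ a → ⊝ a ⊕ a ⊜ # 0 ⊕ # 0) refl _)
      g>0 : 0# < 1# + x
      g>0 = by< p (ring 1 (λ a → # 1 ⊕ a ⊖ a ⊜ # 0 ⊕ # 1) refl _)
      geo : ∀ N → e (- x) N ≤ (1# + x) ⁻¹
      geo N = *-cancelˡ-≤ g>0 (≤-respʳ (sym (*-inv g>0)) (by≤ (e-geometric h≥0 (<⇒≤ p) N ⊞ ^-nonNeg N h≥0) (ring 3 (λ a b c → # 1 ⊕ (a ⊗ (# 1 ⊖ ⊝ b) ⊕ # 0) ⊜ (# 1 ⊕ b) ⊗ a ⊕ (# 1 ⊖ c ⊕ c)) refl _ _ _)))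

    exp-strict : ∀ {x y} → x < y → exp x < exp y
    exp-strict {x} {y} p = <-≤-trans (by< {y = exp x * (1# + (y - x))} (*-pos (exp-pos x) d>0) (ring 3 (λ a b c → a ⊗ (# 1 ⊕ (b ⊖ c)) ⊕ # 0 ⊜ a ⊕ a ⊗ (b ⊖ c)) refl _ _ _))
      (≤-trans (*-monoˡ-≤ (<⇒≤ (exp-pos x)) (1+x≤exp (y - x))) (≤-reflexive (trans (sym (exp-+ x (y - x))) (exp-cong (ring 2 (λ a b → a ⊕ (b ⊖ a) ⊜ b) refl _ _)))))
      where d>0 : 0# < y - x
            d>0 = by< p (ring 2 (λ a b → a ⊖ b ⊕ b ⊜ # 0 ⊕ a) refl _ _)

    exp-mono : ∀ {x y} → x ≤ y → exp x ≤ exp y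
    exp-mono {x} {y} p with x ≟ y
    ... | yes x≈y = ≤-reflexive (exp-cong x≈y)
    ... | no x≉y = <⇒≤ (exp-strict (p , x≉y))

    exp-cancel-≤ : ∀ {x y} → exp x ≤ exp y → x ≤ y
    exp-cancel-≤ h = ≮⇒≥ λ p → <⇒≱ (exp-strict p) h

    exp-injective : ∀ {x y} → exp x ≈ exp y → x ≈ y
    exp-injective h = antisym (exp-cancel-≤ (≤-reflexive h)) (exp-cancel-≤ (≤-reflexive (sym h)))

    exp-neg-bound : ∀ h → exp (- h) * (1# + h) ≤ 1#
    exp-neg-bound h = ≤-trans (*-monoˡ-≤ (<⇒≤ (exp-pos _)) (1+x≤exp h)) (≤-reflexive (trans (*-comm _ _) (exp-inverse h)))

    module _ {y} (y>0 : 0# < y) where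
      private
        S : Carrier → Set
        S x = exp x ≤ y
        nonempty : ∃ S
        -- exp(-1/y) (1 + 1/y) ≤ 1, and multiplying by y gives (y + 1) exp(-1/y) ≤ y.
        nonempty = - y ⁻¹ , ≤-trans (by≤ (*-nonNeg (<⇒≤ y>0) (<⇒≤ (exp-pos (- y ⁻¹)))) r)
          (≤-trans (*-monoˡ-≤ (<⇒≤ y>0) (exp-neg-bound (y ⁻¹))) (≤-reflexive (*-identityʳ y)))
          where
          E = exp (- y ⁻¹)
          r : y * (E * (1# + y ⁻¹)) + 0# ≈ E + y * E
          r = trans (rr y E (y ⁻¹)) (trans (+-congʳ (*-congˡ (*-inv y>0))) (rr′ y E))
            where rr = ring 3 (λ y E i → y ⊗ (E ⊗ (# 1 ⊕ i)) ⊕ # 0 ⊜ E ⊗ (y ⊗ i) ⊕ y ⊗ E) refl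
                  rr′ = ring 2 (λ y E → E ⊗ # 1 ⊕ y ⊗ E ⊜ E ⊕ y ⊗ E) refl
        bounded : ∃ (IsUpperBound S)
        bounded = y - 1# , λ {x} h → by≤ (≤-trans (1+x≤exp x) h) (ring 2 (λ a b → a ⊖ # 1 ⊕ (# 1 ⊕ b) ⊜ b ⊕ a) refl _ _)
        s = ln y

      -- Were exp s below y, then s + h with h = 1 - exp s / y would still lie in the set, since
      -- exp(-h) ≥ 1 - h. Were it above, s - h with h = 1 - y / exp s would be a smaller upper
      -- bound.
      exp-ln : exp (ln y) ≈ y
      exp-ln = antisym (≮⇒≥ too-big) (≮⇒≥ too-small)
        where
        too-small : ¬ (exp s < y)
        too-small p = <⇒≱ (by< h>0 (r s h)) (sup-upper S nonempty bounded up)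
          where
          h = 1# - exp s / y
          r = ring 2 (λ s h → s ⊕ h ⊕ # 0 ⊜ s ⊕ h) refl
          q<1 : exp s / y < 1#
          q<1 = <-respʳ-≈ (*-inv y>0) (<-respˡ-≈ (*-comm _ _) (<-respʳ-≈ (*-comm _ _) (*-monoˡ-< (inv-pos y>0) p)))
          h>0 : 0# < h
          h>0 = by< q<1 (ring 2 (λ a b → # 1 ⊖ a ⊗ b ⊕ a ⊗ b ⊜ # 0 ⊕ # 1) refl _ _)
          1-h : exp s / y ≈ 1# - h
          1-h = r₃ (exp s / y)
            where r₃ = ring 1 (λ a → a ⊜ # 1 ⊖ (# 1 ⊖ a)) refl
          step : exp (s + h) * (exp s / y) ≤ exp s
          step = ≤-trans (*-mono-≤ (<⇒≤ (exp-pos _)) (<⇒≤ (exp-pos (- h))) (≤-reflexive (exp-+ s h))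
                   (≤-respˡ (sym 1-h) (1+x≤exp (- h))))
                 (≤-reflexive (trans (*-assoc _ _ _) (trans (*-congˡ (exp-inverse h)) (*-identityʳ _))))
          up : exp (s + h) ≤ y
          up = *-cancelˡ-≤ (exp-pos s) (≤-trans (≤-reflexive (trans (*-comm _ _) (*-congˡ (sym (/-* y>0)))))
                (≤-trans (≤-reflexive (sym (*-assoc _ _ _)))
                (≤-trans (*-monoʳ-≤ (<⇒≤ y>0) step) ≤-refl)))
        too-big : ¬ (y < exp s)
        too-big p = <⇒≱ (by< h>0 (r s h)) (sup-least S nonempty λ {x} Sx → ≮⇒≥ λ q →
            <⇒≱ (≤-<-trans y≤ (exp-strict q)) Sx)
          where
          h = 1# - y / exp s
          r = ring 2 (λ s h → s ⊕ # 0 ⊜ s ⊖ h ⊕ h) refl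
          q<1 : y / exp s < 1#
          q<1 = <-respʳ-≈ (*-inv (exp-pos s)) (<-respˡ-≈ (*-comm _ _) (<-respʳ-≈ (*-comm _ _) (*-monoˡ-< (inv-pos (exp-pos s)) p)))
          h>0 : 0# < h
          h>0 = by< q<1 (ring 2 (λ a b → # 1 ⊖ a ⊗ b ⊕ a ⊗ b ⊜ # 0 ⊕ # 1) refl _ _)
          y≤ : y ≤ exp (s - h)
          y≤ = ≤-trans (≤-reflexive (trans (sym (/-* (exp-pos s))) (r₁ (y / exp s) (exp s))))
            (≤-trans (*-monoˡ-≤ (<⇒≤ (exp-pos s)) (1+x≤exp (- h))) (≤-reflexive (sym (exp-+ s (- h)))))
            where r₁ = ring 2 (λ a b → a ⊗ b ⊜ b ⊗ (# 1 ⊖ (# 1 ⊖ a))) refl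

    ln-exp : ∀ x → ln (exp x) ≈ x
    ln-exp x = exp-injective (exp-ln (exp-pos x))

    ln-mono : ∀ {x y} → 0# < x → x ≤ y → ln x ≤ ln y
    ln-mono p q = exp-cancel-≤ (≤-respˡ (sym (exp-ln p)) (≤-respʳ (sym (exp-ln (<-≤-trans p q))) q))

    ln-cong : ∀ {x y} → 0# < x → x ≈ y → ln x ≈ ln y
    ln-cong p q = antisym (ln-mono p (≤-reflexive q)) (ln-mono (<-respʳ-≈ q p) (≤-reflexive (sym q)))

    ln-* : ∀ {x y} → 0# < x → 0# < y → ln (x * y) ≈ ln x + ln y
    ln-* {x} {y} p q = exp-injective (trans (exp-ln (*-pos p q)) (sym (trans (exp-+ (ln x) (ln y)) (*-cong (exp-ln p) (exp-ln q)))))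

    ln≤ : ∀ {x} → 0# < x → ln x ≤ x - 1#
    ln≤ {x} p = by≤ (≤-respʳ (exp-ln p) (1+x≤exp (ln x))) (ring 2 (λ a b → a ⊖ # 1 ⊕ (# 1 ⊕ b) ⊜ b ⊕ a) refl _ _)

    ln-1 : ln 1# ≈ 0#
    ln-1 = trans (ln-cong 0<1 (sym exp-0)) (ln-exp 0#)

    ln-inv : ∀ {x} → 0# < x → ln (x ⁻¹) ≈ - ln x
    ln-inv {x} p = by≈ (trans (sym (ln-* p (inv-pos p))) (trans (ln-cong (*-pos p (inv-pos p)) (*-inv p)) ln-1)) (ring 2 (λ a b → ⊝ a ⊕ (a ⊕ b) ⊜ b ⊕ # 0) refl _ _)

    ln-/ : ∀ {x y} → 0# < x → 0# < y → ln (x / y) ≈ ln x - ln y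
    ln-/ p q = trans (ln-* p (inv-pos q)) (+-congˡ (ln-inv q))

    ln-^ : ∀ {x} k → 0# < x → ln (x ^ k) ≈ fromℕ k * ln x
    ln-^ zero p = trans ln-1 (sym (zeroˡ _))
    ln-^ {x} (suc k) p = trans (ln-* p (^-pos k p)) (trans (+-congˡ (ln-^ k p)) (r (ln x) (fromℕ k)))
      where r = ring 2 (λ a b → a ⊕ b ⊗ a ⊜ (# 1 ⊕ b) ⊗ a) refl

    ln-2-pos : 0# < ln (fromℕ 2)
    ln-2-pos = ≰⇒> λ h → <⇒≱ (by< {x = 1#} {y = fromℕ 2} 0<1 (ring 0 (# 2 ⊕ # 0 ⊜ # 1 ⊕ # 1) refl)) (≤-respˡ (exp-ln (fromℕ-pos 1)) (≤-respʳ exp-0 (exp-mono h)))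

    ≤-log₂ : ∀ {y} L → fromℕ 2 ^ L ≤ y → fromℕ L ≤ log₂ y
    ≤-log₂ L h = ≤-/ ln-2-pos (≤-respˡ (ln-^ L (fromℕ-pos 1)) (ln-mono (^-pos L (fromℕ-pos 1)) h))

  -- Sums over finite sets.

  module FiniteSums where
    open OrderedField

    open Communication ℝ public renaming (∑ to ∑ᶠ)

    private
      module MS = MonoidSum +-commutativeMonoid
      module SS = SemiringSum (CommutativeRing.semiring (CompleteOrderedField.commutativeRing ℝ))

      sum-mono : ∀ {n} {f g : Fin n → Carrier} → (∀ i → f i ≤ g i) → sum f ≤ sum g
      sum-mono {zero} h = ≤-refl
      sum-mono {suc n} h = h zero ⊞ sum-mono (λ i → h (suc i))

      sum-↑ : ∀ m {n} (f : Fin (m ℕ.+ n) → Carrier) →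
        sum f ≈ sum (λ i → f (i ↑ˡ n)) + sum (λ j → f (m ↑ʳ j))
      sum-↑ zero f = sym (+-identityˡ _)
      sum-↑ (suc m) f = trans (+-congˡ (sum-↑ m (f ∘ suc))) (sym (+-assoc _ _ _))

      sum-remQuot : ∀ m n (g : Fin m × Fin n → Carrier) →
        sum (λ k → g (remQuot {m} n k)) ≈ sum (λ i → sum (λ j → g (i , j)))
      sum-remQuot zero n g = refl
      sum-remQuot (suc m) n g = trans (sum-↑ n (λ k → g (remQuot {suc m} n k)))
        (+-cong (MS.sum-cong-≋ λ j → reflexive (≡.cong g (head j)))
                (trans (MS.sum-cong-≋ λ k → reflexive (≡.cong g (tail k)))
                       (sum-remQuot m n (λ (i , j) → g (suc i , j)))))
        where
        head : ∀ j → remQuot {suc m} n (j ↑ˡ (m ℕ.* n)) ≡ (zero , j)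
        head j rewrite Finₚ.splitAt-↑ˡ n j (m ℕ.* n) = ≡.refl
        tail : ∀ k → remQuot {suc m} n (n ↑ʳ k) ≡ (suc (proj₁ (remQuot {m} n k)) , proj₂ (remQuot {m} n k))
        tail k rewrite Finₚ.splitAt-↑ʳ n (m ℕ.* n) k = ≡.refl

    ⟦_⟧ : Bool → Carrier
    ⟦ true ⟧ = 1#
    ⟦ false ⟧ = 0#

    ⟦⟧-nonNeg : ∀ b → 0# ≤ ⟦ b ⟧
    ⟦⟧-nonNeg true = 0≤1
    ⟦⟧-nonNeg false = ≤-refl

    ⟦⟧-≤1 : ∀ b → ⟦ b ⟧ ≤ 1#
    ⟦⟧-≤1 true = ≤-refl
    ⟦⟧-≤1 false = 0≤1

    ⟦⟧-∧ : ∀ a b → ⟦ a ∧ b ⟧ ≈ ⟦ a ⟧ * ⟦ b ⟧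
    ⟦⟧-∧ true b = sym (*-identityˡ _)
    ⟦⟧-∧ false b = sym (zeroˡ _)

    abstract
      _≟ᴱ_ : ∀ {X : FinSet} → DecidableEquality (Elem X)
      _≟ᴱ_ {X} x y = map′ (λ p → ≡.trans (≡.sym (Inverse.strictlyInverseʳ (enum X) x))
          (≡.trans (≡.cong (Inverse.from (enum X)) p) (Inverse.strictlyInverseʳ (enum X) y))) (≡.cong (Inverse.to (enum X)))
        (Inverse.to (enum X) x Finₚ.≟ Inverse.to (enum X) y)

    -- Sealed, so that the summand can be inferred.
    abstract
      ∑ : (X : FinSet) → (Elem X → Carrier) → Carrier
      ∑ = ∑ᶠ

      ∑≡∑ᶠ : ∀ X F → ∑ X F ≡ ∑ᶠ X F
      ∑≡∑ᶠ X F = ≡.refl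

    module _ (X : FinSet) where
      private
        fr = Inverse.from (enum X)

      abstract
        ∑-cong : ∀ {F G : Elem X → Carrier} → (∀ x → F x ≈ G x) → ∑ X F ≈ ∑ X G
        ∑-cong {F} {G} h = MS.sum-cong-≋ {size X} {λ i → F (fr i)} {λ i → G (fr i)} λ i → h (fr i)

        ∑-+ : ∀ (F G : Elem X → Carrier) → ∑ X (λ x → F x + G x) ≈ ∑ X F + ∑ X G
        ∑-+ F G = MS.∑-distrib-+ {size X} (λ i → F (fr i)) (λ i → G (fr i))

        ∑-*ˡ : ∀ c (F : Elem X → Carrier) → ∑ X (λ x → c * F x) ≈ c * ∑ X F
        ∑-*ˡ c F = sym (SS.*-distribˡ-sum {size X} c (λ i → F (fr i)))

        ∑-*ʳ : ∀ c (F : Elem X → Carrier) → ∑ X (λ x → F x * c) ≈ ∑ X F * c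
        ∑-*ʳ c F = sym (SS.*-distribʳ-sum {size X} c (λ i → F (fr i)))

        ∑-swap : ∀ (Y : FinSet) (F : Elem X → Elem Y → Carrier) →
          ∑ X (λ x → ∑ Y (λ y → F x y)) ≈ ∑ Y (λ y → ∑ X (λ x → F x y))
        ∑-swap Y F = MS.∑-comm {size X} {size Y} (λ i j → F (fr i) (Inverse.from (enum Y) j))

        ∑-mono : ∀ {F G : Elem X → Carrier} → (∀ x → F x ≤ G x) → ∑ X F ≤ ∑ X G
        ∑-mono {F} {G} h = sum-mono {size X} {λ i → F (fr i)} {λ i → G (fr i)} λ i → h (fr i)

        ∑-point : ∀ a (F : Elem X → Carrier) → ∑ X (λ x → ⟦ does (_≟ᴱ_ {X} a x) ⟧ * F x) ≈ F a
        ∑-point a F = trans (MS.sum-cong-≋ {size X} {λ j → ⟦ does (_≟ᴱ_ {X} a (fr j)) ⟧ * F (fr j)} {λ j → ⟦ does (Inverse.to (enum X) a Finₚ.≟ j) ⟧ * F (fr j)} λ j → *-congʳ (reflexive (≡.cong (λ k → ⟦ does (Inverse.to (enum X) a Finₚ.≟ k) ⟧)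
            (Inverse.strictlyInverseˡ (enum X) j))))
          (trans (point (Inverse.to (enum X) a) (λ j → F (Inverse.from (enum X) j)))
            (reflexive (≡.cong F (Inverse.strictlyInverseʳ (enum X) a))))
          where
          zeros : ∀ {n} (g : Fin n → Carrier) → sum (λ j → 0# * g j) ≈ 0#
          zeros g = trans (sym (SS.*-distribˡ-sum 0# g)) (zeroˡ _)
          point : ∀ {n} (i : Fin n) (g : Fin n → Carrier) → sum (λ j → ⟦ does (i Finₚ.≟ j) ⟧ * g j) ≈ g i
          point zero g = trans (+-cong (*-identityˡ _) (zeros (g ∘ suc))) (+-identityʳ _)
          point (suc i) g = trans (+-cong (zeroˡ _) (point i (g ∘ suc))) (+-identityˡ _)

      ∑-neg : ∀ (F : Elem X → Carrier) → ∑ X (λ x → - F x) ≈ - ∑ X F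
      ∑-neg F = trans (∑-cong λ x → r (F x)) (trans (∑-*ˡ (- 1#) F) (sym (r _)))
        where r = ring 1 (λ a → ⊝ a ⊜ ⊝ # 1 ⊗ a) refl

      ∑-sub : ∀ (F G : Elem X → Carrier) → ∑ X (λ x → F x - G x) ≈ ∑ X F - ∑ X G
      ∑-sub F G = trans (∑-+ F (λ x → - G x)) (+-congˡ (∑-neg G))

      ∑-zero : ∀ {F : Elem X → Carrier} → (∀ x → F x ≈ 0#) → ∑ X F ≈ 0#
      ∑-zero {F} h = trans (∑-cong λ x → trans (h x) (sym (zeroˡ 0#))) (trans (∑-*ˡ 0# (λ _ → 0#)) (zeroˡ _))

      ∑-nonNeg : ∀ {F : Elem X → Carrier} → (∀ x → 0# ≤ F x) → 0# ≤ ∑ X F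
      ∑-nonNeg h = ≤-respˡ (∑-zero λ _ → refl) (∑-mono h)

      ∑-≥ : ∀ {F : Elem X → Carrier} → (∀ x → 0# ≤ F x) → ∀ a → F a ≤ ∑ X F
      ∑-≥ {F} h a = ≤-respˡ (∑-point a F) (∑-mono λ x → ≤-respʳ (*-identityˡ _) (*-monoʳ-≤ (h x) (⟦⟧-≤1 (does (_≟ᴱ_ {X} a x)))))

      -- The comparison is required only at points of positive weight, where masses are known to be
      -- positive and their logarithms obey the usual laws.
      ∑-support : ∀ {w F G : Elem X → Carrier} → (∀ x → 0# ≤ w x) → (∀ x → 0# < w x → F x ≤ G x) →
        ∑ X (λ x → w x * F x) ≤ ∑ X (λ x → w x * G x)
      ∑-support {w} {F} {G} w≥0 h = ∑-mono term
        where
        term : ∀ x → w x * F x ≤ w x * G x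
        term x with w x ≟ 0#
        ... | yes e = ≤-reflexive (trans (trans (*-congʳ e) (zeroˡ _)) (sym (trans (*-congʳ e) (zeroˡ _))))
        ... | no ne = *-monoˡ-≤ (w≥0 x) (h x (w≥0 x , λ e → ne (sym e)))

      ∑-support-cong : ∀ {w F G : Elem X → Carrier} → (∀ x → 0# ≤ w x) → (∀ x → 0# < w x → F x ≈ G x) →
        ∑ X (λ x → w x * F x) ≈ ∑ X (λ x → w x * G x)
      ∑-support-cong w≥0 h = antisym (∑-support w≥0 λ x p → ≤-reflexive (h x p))
        (∑-support w≥0 λ x p → ≤-reflexive (sym (h x p)))

    abstract
      ∑-× : ∀ (X Y : FinSet) (F : Elem X × Elem Y → Carrier) → ∑ (X ×ᶠ Y) F ≈ ∑ X (λ x → ∑ Y (λ y → F (x , y)))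
      ∑-× X Y F = sum-remQuot (size X) (size Y) (λ (i , j) → F (Inverse.from (enum X) i , Inverse.from (enum Y) j))

      ∑-[] : ∀ (X : FinSet) (F : Vec (Elem X) 0 → Carrier) → ∑ (X ^ᶠ 0) F ≈ F []
      ∑-[] X F = +-identityʳ _

      ∑-∷ : ∀ (X : FinSet) n (F : Vec (Elem X) (suc n) → Carrier) →
        ∑ (X ^ᶠ suc n) F ≈ ∑ X (λ x → ∑ (X ^ᶠ n) (λ xs → F (x ∷ xs)))
      ∑-∷ X n F = sum-remQuot (size X) (size X ℕ.^ n)
        (λ (i , j) → F (Inverse.from (enum X) i ∷ Inverse.from (enum (X ^ᶠ n)) j))

      -- Replaces the sums of the statement by their sealed copies, which unfold only inside an
      -- `abstract` block.
      advantage≡∑ : ∀ {X Y} (ν : Elem (X ×ᶠ Y) → Carrier) g (π : Protocol X Y) → advantage {X} {Y} ν g π ≡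
        (∑ (X ×ᶠ Y) λ (x , y) → ∑ (fin (Protocol.pubSize π)) λ r → ∑ (fin (Protocol.aliceSize π)) λ a → ∑ (fin (Protocol.bobSize π)) λ b →
          ν (x , y) * weight (Protocol.public-coins π) r * weight (Protocol.alice-coins π) a * weight (Protocol.bob-coins π) b
            * sign (run (Protocol.tree π r) (x , a) (y , b) xor g (x , y)))
      advantage≡∑ ν g π = ≡.refl

      marginalˡ≡∑ : ∀ {X Y} (ν : Elem (X ×ᶠ Y) → Carrier) x → marginalˡ {X} {Y} ν x ≡ ∑ Y (λ y → ν (x , y))
      marginalˡ≡∑ ν x = ≡.refl

      marginalʳ≡∑ : ∀ {X Y} (ν : Elem (X ×ᶠ Y) → Carrier) y → marginalʳ {X} {Y} ν y ≡ ∑ X (λ x → ν (x , y))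
      marginalʳ≡∑ ν y = ≡.refl

  -- Entropies of unnormalised weights.

  module Entropies where
    open OrderedField
    open ExponentialLogarithm
    open FiniteSums

    -- A random variable of which only the partition into level sets matters. Decidable equality of
    -- values admits lists, pairs and a trivial value alike, and makes `same` the indicator of a
    -- common class.
    record Observable (Ω : Set) : Set₁ where
      field
        {Value} : Set
        value : Ω → Value
        _≟ⱽ_ : DecidableEquality Value

      same : Ω → Ω → Carrier
      same ω ω′ = ⟦ does (value ω ≟ⱽ value ω′) ⟧

      same-yes : ∀ {ω ω′} → value ω ≡ value ω′ → same ω ω′ ≈ 1#
      same-yes {ω} {ω′} p with value ω ≟ⱽ value ω′
      ... | yes _ = refl
      ... | no q = ⊥-elim (q p)

      same-no : ∀ {ω ω′} → ¬ (value ω ≡ value ω′) → same ω ω′ ≈ 0#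
      same-no {ω} {ω′} p with value ω ≟ⱽ value ω′
      ... | yes q = ⊥-elim (p q)
      ... | no _ = refl

      same-nonNeg : ∀ ω ω′ → 0# ≤ same ω ω′
      same-nonNeg ω ω′ = ⟦⟧-nonNeg (does (value ω ≟ⱽ value ω′))

      same-≤1 : ∀ ω ω′ → same ω ω′ ≤ 1#
      same-≤1 ω ω′ = ⟦⟧-≤1 (does (value ω ≟ⱽ value ω′))

      same-pos : ∀ {ω ω′} → 0# < same ω ω′ → value ω ≡ value ω′
      same-pos {ω} {ω′} p with value ω ≟ⱽ value ω′
      ... | yes q = q
      ... | no _ = ⊥-elim (<-irrefl refl p)

    open Observable public

    _refines_ : ∀ {Ω} → Observable Ω → Observable Ω → Set
    A refines B = ∀ {ω ω′} → value A ω ≡ value A ω′ → value B ω ≡ value B ω′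

    same-cong : ∀ {Ω} (A B : Observable Ω) → A refines B → B refines A → ∀ ω ω′ → same A ω ω′ ≈ same B ω ω′
    same-cong A B p q ω ω′ with _≟ⱽ_ A (value A ω) (value A ω′)
    ... | yes e = sym (same-yes B (p e))
    ... | no ne = sym (same-no B λ e → ne (q e))

    *-pos-factorˡ : ∀ {a b} → 0# ≤ a → 0# < a * b → 0# < a
    *-pos-factorˡ {a} {b} p q = p , λ e → pos⇒≉0 q (trans (*-congʳ (sym e)) (zeroˡ b))

    *-pos-factorʳ : ∀ {a b} → 0# ≤ b → 0# < a * b → 0# < b
    *-pos-factorʳ {a} {b} p q = p , λ e → pos⇒≉0 q (trans (*-congˡ (sym e)) (zeroʳ a))

    module Weighted (Ω : FinSet) where
      Weight : Set
      Weight = Elem Ω → Carrier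

      NonNeg : Weight → Set
      NonNeg w = ∀ ω → 0# ≤ w ω

      mass : Observable (Elem Ω) → Weight → Weight
      mass A w ω = ∑ Ω λ ω′ → w ω′ * same A ω ω′

      -- The sign is opposite to Shannon's: for a total weight of one this is minus the entropy of
      -- A. Leaving weights unnormalised makes the quantities additive over the nodes of a tree,
      -- without division by weights that may vanish.
      entropy : Observable (Elem Ω) → Weight → Carrier
      entropy A w = ∑ Ω λ ω → w ω * ln (mass A w ω)

      ∑-normalised : ∀ {v m : Weight} → NonNeg v → (∀ ω → 0# < v ω → ∑ Ω v ≤ m ω) →
        ∑ Ω (λ ω → v ω * m ω ⁻¹) ≤ 1#
      ∑-normalised {v} {m} v≥0 h with ∑ Ω v ≟ 0#
      ... | yes e = ≤-trans (≤-reflexive (∑-zero Ω λ ω → trans (*-congʳ (antisym (≤-trans (∑-≥ Ω v≥0 ω) (≤-reflexive e)) (v≥0 ω))) (zeroˡ _))) 0≤1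
      ... | no ne = ≤-trans (∑-support Ω v≥0 λ ω p → inv-≤ s>0 (h ω p))
          (≤-reflexive (trans (∑-*ʳ Ω _ v) (*-inv s>0)))
        where s>0 : 0# < ∑ Ω v
              s>0 = ∑-nonNeg Ω v≥0 , λ e → ne (sym e)

      module _ {w : Weight} (w≥0 : NonNeg w) where

        weight≤mass : ∀ A ω → w ω ≤ mass A w ω
        weight≤mass A ω = ≤-respˡ (trans (*-congˡ (same-yes A ≡.refl)) (*-identityʳ _))
          (∑-≥ Ω (λ ω′ → *-nonNeg (w≥0 ω′) (same-nonNeg A ω ω′)) ω)

        mass-pos : ∀ A ω → 0# < w ω → 0# < mass A w ω
        mass-pos A ω p = <-≤-trans p (weight≤mass A ω)

        total-nonNeg : 0# ≤ ∑ Ω w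
        total-nonNeg = ∑-nonNeg Ω w≥0

        -- Integrates ln r ≤ r - 1. For r the density of another law this is the nonnegativity of
        -- divergence.
        gibbs : ∀ {r : Weight} → (∀ ω → 0# < w ω → 0# < r ω) →
          ∑ Ω (λ ω → w ω * ln (r ω)) + ∑ Ω w ≤ ∑ Ω (λ ω → w ω * r ω)
        gibbs {r} r>0 = ≤-trans (≤-reflexive (sym (∑-+ Ω _ _)))
          (≤-trans (∑-mono Ω λ ω → ≤-reflexive (d (w ω) (ln (r ω))))
          (∑-support Ω w≥0 λ ω p → by≤ (ln≤ (r>0 ω p)) (ring 2 (λ a b → a ⊕ b ⊜ b ⊕ # 1 ⊕ (a ⊖ # 1)) refl _ _)))
          where d = ring 2 (λ a b → a ⊗ b ⊕ a ⊜ a ⊗ (b ⊕ # 1)) refl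

        -- Each class of A has total weight one after division by its mass.
        ∑-over-mass : ∀ A {v : Weight} → NonNeg v → (∀ ω → v ω ≤ w ω) →
          (∀ ω ω′ → 0# < v ω → 0# < v ω′ → value A ω ≡ value A ω′) →
          ∑ Ω (λ ω → v ω * mass A w ω ⁻¹) ≤ 1#
        ∑-over-mass A {v} v≥0 v≤w one-class = ∑-normalised v≥0 λ ω p → ∑-mono Ω λ ω′ → le ω p ω′
          where
          le : ∀ ω → 0# < v ω → ∀ ω′ → v ω′ ≤ w ω′ * same A ω ω′
          le ω p ω′ with v ω′ ≟ 0#
          ... | yes e = ≤-respˡ (sym e) (*-nonNeg (w≥0 ω′) (same-nonNeg A ω ω′))
          ... | no ne = ≤-respʳ (trans (sym (*-identityʳ _)) (*-congˡ (sym (same-yes A (one-class ω ω′ p (v≥0 ω′ , λ e → ne (sym e))))))) (v≤w ω′)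

        mass-same : ∀ A {ω ω′} → value A ω ≡ value A ω′ → mass A w ω ≈ mass A w ω′
        mass-same A {ω} {ω′} p = ∑-cong Ω λ ω″ → *-congˡ (eq ω″)
          where eq : ∀ ω″ → same A ω ω″ ≈ same A ω′ ω″
                eq ω″ = reflexive (≡.cong (λ v → ⟦ does (_≟ⱽ_ A v (value A ω″)) ⟧) p)

        -- A fibre of x lies in one class of A, so its weights divided by the mass of that class add
        -- up to at most one.
        ∑-pushforward : ∀ {X : FinSet} (x : Elem Ω → Elem X) (A : Observable (Elem Ω)) →
          (∀ {ω ω′} → x ω ≡ x ω′ → value A ω ≡ value A ω′) →
          ∀ {F : Elem X → Carrier} → (∀ a → 0# ≤ F a) →
          ∑ Ω (λ ω → w ω * (F (x ω) * mass A w ω ⁻¹)) ≤ ∑ X F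
        ∑-pushforward {X} x A xA {F} F≥0 = ≤-trans (≤-reflexive eq) (∑-mono X λ a → ≤-respʳ (*-identityʳ _) (*-monoˡ-≤ (F≥0 a) (one a)))
          where
          δ : Elem Ω → Elem X → Carrier
          δ ω a = ⟦ does (_≟ᴱ_ {X} (x ω) a) ⟧
          eq : ∑ Ω (λ ω → w ω * (F (x ω) * mass A w ω ⁻¹)) ≈ ∑ X (λ a → F a * ∑ Ω (λ ω → w ω * δ ω a * mass A w ω ⁻¹))
          eq = trans (∑-cong Ω λ ω → trans (*-congˡ (*-congʳ (sym (∑-point X (x ω) F))))
                       (trans (r₁ (w ω) _ (mass A w ω ⁻¹)) (sym (∑-*ˡ X _ _))))
               (trans (∑-swap Ω X _) (∑-cong X λ a → trans (∑-cong Ω λ ω → r₂ (w ω) (mass A w ω ⁻¹) (δ ω a) (F a)) (∑-*ˡ Ω _ _)))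
            where r₁ = ring 3 (λ a b c → a ⊗ (b ⊗ c) ⊜ a ⊗ c ⊗ b) refl
                  r₂ = ring 4 (λ a b c d → a ⊗ b ⊗ (c ⊗ d) ⊜ d ⊗ (a ⊗ c ⊗ b)) refl
          one : ∀ a → ∑ Ω (λ ω → w ω * δ ω a * mass A w ω ⁻¹) ≤ 1#
          one a = ∑-over-mass A (λ ω → *-nonNeg (w≥0 ω) (⟦⟧-nonNeg (does (_≟ᴱ_ {X} (x ω) a))))
              (λ ω → ≤-respʳ (*-identityʳ _) (*-monoˡ-≤ (w≥0 ω) (⟦⟧-≤1 (does (_≟ᴱ_ {X} (x ω) a)))))
              (λ ω ω′ p q → xA (≡.trans (at ω p) (≡.sym (at ω′ q))))
            where
            at : ∀ ω → 0# < w ω * δ ω a → x ω ≡ a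
            at ω p with _≟ᴱ_ {X} (x ω) a
            ... | yes e = e
            ... | no _ = ⊥-elim (<-irrefl (sym (zeroʳ _)) p)

        -- In Shannon's sign this contains the nonnegativity of the mutual information of A and B
        -- given C. The density r given to `gibbs` compares the law that makes A and B independent
        -- given C with the law of D.
        supermodular : ∀ (A B C D : Observable (Elem Ω)) → A refines C → B refines C →
          (∀ {ω ω′} → value A ω ≡ value A ω′ → value B ω ≡ value B ω′ → value D ω ≡ value D ω′) →
          entropy A w + entropy B w ≤ entropy C w + entropy D w
        supermodular A B C D AC BC ABD = by≤ (≤-trans (gibbs {r} r>0) bound) (eq-chain)
          where
          r : Weight
          r ω = mass A w ω * mass B w ω * (mass C w ω ⁻¹ * mass D w ω ⁻¹)
          r>0 : ∀ ω → 0# < w ω → 0# < r ω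
          r>0 ω p = *-pos (*-pos (mass-pos A ω p) (mass-pos B ω p)) (*-pos (inv-pos (mass-pos C ω p)) (inv-pos (mass-pos D ω p)))
          ln-r : ∑ Ω (λ ω → w ω * ln (r ω)) ≈ entropy A w + entropy B w - (entropy C w + entropy D w)
          ln-r = trans (∑-support-cong Ω w≥0 λ ω p → split ω p)
            (trans (∑-cong Ω λ ω → dist (w ω) (ln (mass A w ω)) (ln (mass B w ω)) (ln (mass C w ω)) (ln (mass D w ω)))
            (trans (∑-sub Ω _ _) (+-cong (∑-+ Ω _ _) (-‿cong (∑-+ Ω _ _)))))
            where
            split : ∀ ω → 0# < w ω → ln (r ω) ≈ ln (mass A w ω) + ln (mass B w ω) - (ln (mass C w ω) + ln (mass D w ω))
            split ω p = trans (ln-* (*-pos (mass-pos A ω p) (mass-pos B ω p)) (*-pos (inv-pos (mass-pos C ω p)) (inv-pos (mass-pos D ω p))))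
              (+-cong (ln-* (mass-pos A ω p) (mass-pos B ω p))
                (trans (ln-* (inv-pos (mass-pos C ω p)) (inv-pos (mass-pos D ω p)))
                (trans (+-cong (ln-inv (mass-pos C ω p)) (ln-inv (mass-pos D ω p))) (ring 2 (λ a b → ⊝ a ⊖ b ⊜ ⊝ (a ⊕ b)) refl _ _))))
            dist = ring 5 (λ w a b c d → w ⊗ (a ⊕ b ⊖ (c ⊕ d)) ⊜ w ⊗ a ⊕ w ⊗ b ⊖ (w ⊗ c ⊕ w ⊗ d)) refl
          eq-chain : (entropy C w + entropy D w) + (∑ Ω (λ ω → w ω * ln (r ω)) + ∑ Ω w) ≈ (entropy A w + entropy B w) + ∑ Ω w
          eq-chain = trans (+-congˡ (+-congʳ ln-r)) (ring 5 (λ a b c d e → a ⊕ b ⊕ (c ⊕ d ⊖ (a ⊕ b) ⊕ e) ⊜ c ⊕ d ⊕ e) refl _ _ _ _ _)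
          -- With the masses of A and B expanded as sums over ω₁ and ω₂, all ω matching ω₁ in A and
          -- ω₂ in B lie in one class of D, so `∑-over-mass` applies; if there is such an ω, then ω₁
          -- and ω₂ share their class of C.
          inner : ∀ ω₁ ω₂ → 0# < w ω₁ →
            ∑ Ω (λ ω → w ω * same A ω ω₁ * same B ω ω₂ * (mass C w ω ⁻¹ * mass D w ω ⁻¹)) ≤ same C ω₁ ω₂ * mass C w ω₁ ⁻¹
          inner ω₁ ω₂ p₁ = ≤-trans (∑-support Ω v≥0 step) (≤-trans (≤-reflexive (trans (∑-cong Ω λ ω → assoc′ (v ω) (mass D w ω ⁻¹) (same C ω₁ ω₂ * mass C w ω₁ ⁻¹)) (∑-*ʳ Ω _ _)))
              (≤-respʳ (*-identityˡ _) (*-monoʳ-≤ (*-nonNeg (same-nonNeg C ω₁ ω₂) (<⇒≤ (inv-pos (mass-pos C ω₁ p₁)))) one)))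
            where
            v : Weight
            v ω = w ω * same A ω ω₁ * same B ω ω₂
            wA≥0 : ∀ ω → 0# ≤ w ω * same A ω ω₁
            wA≥0 ω = *-nonNeg (w≥0 ω) (same-nonNeg A ω ω₁)
            v≥0 : NonNeg v
            v≥0 ω = *-nonNeg (wA≥0 ω) (same-nonNeg B ω ω₂)
            inA : ∀ ω → 0# < v ω → value A ω ≡ value A ω₁
            inA ω p = same-pos A (*-pos-factorʳ (same-nonNeg A ω ω₁) (*-pos-factorˡ (wA≥0 ω) p))
            inB : ∀ ω → 0# < v ω → value B ω ≡ value B ω₂
            inB ω p = same-pos B (*-pos-factorʳ (same-nonNeg B ω ω₂) p)
            inW : ∀ ω → 0# < v ω → 0# < w ω
            inW ω p = *-pos-factorˡ (w≥0 ω) (*-pos-factorˡ (wA≥0 ω) p)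
            step : ∀ ω → 0# < v ω → mass C w ω ⁻¹ * mass D w ω ⁻¹ ≤ mass D w ω ⁻¹ * (same C ω₁ ω₂ * mass C w ω₁ ⁻¹)
            step ω p = ≤-reflexive (trans (*-comm _ _) (*-congˡ (trans (inv-cong (mass-pos C ω (inW ω p)) (mass-same C (AC (inA ω p))))
              (trans (sym (*-identityˡ _)) (*-congʳ (sym (same-yes C (≡.trans (≡.sym (AC (inA ω p))) (BC (inB ω p))))))))))
            one : ∑ Ω (λ ω → v ω * mass D w ω ⁻¹) ≤ 1#
            one = ∑-over-mass D v≥0
              (λ ω → ≤-trans (≤-respʳ (*-identityʳ _) (*-monoˡ-≤ (wA≥0 ω) (same-≤1 B ω ω₂))) (≤-respʳ (*-identityʳ _) (*-monoˡ-≤ (w≥0 ω) (same-≤1 A ω ω₁))))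
              (λ ω ω′ p q → ABD (≡.trans (inA ω p) (≡.sym (inA ω′ q))) (≡.trans (inB ω p) (≡.sym (inB ω′ q))))
            assoc′ = ring 3 (λ a b c → a ⊗ (b ⊗ c) ⊜ a ⊗ b ⊗ c) refl
          expand : ∑ Ω (λ ω → w ω * r ω) ≈ ∑ Ω (λ ω₁ → w ω₁ * ∑ Ω (λ ω₂ → w ω₂ *
            ∑ Ω (λ ω → w ω * same A ω ω₁ * same B ω ω₂ * (mass C w ω ⁻¹ * mass D w ω ⁻¹))))
          expand = trans (∑-cong Ω λ ω → trans (r₀ (w ω) (mass A w ω) (mass B w ω) (mass C w ω ⁻¹ * mass D w ω ⁻¹))
                (trans (sym (∑-*ʳ Ω _ _)) (∑-cong Ω λ ω₁ → r₁ (w ω₁) (same A ω ω₁) _)))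
              (trans (∑-swap Ω Ω _) (∑-cong Ω λ ω₁ → trans (∑-*ˡ Ω _ _) (*-congˡ
                (trans (∑-cong Ω λ ω → trans (r₂ (same A ω ω₁) (mass B w ω) (w ω) (mass C w ω ⁻¹ * mass D w ω ⁻¹)) (trans (sym (∑-*ʳ Ω _ _))
                    (∑-cong Ω λ ω₂ → r₃ (w ω₂) (same B ω ω₂) (same A ω ω₁) (w ω) (mass C w ω ⁻¹ * mass D w ω ⁻¹))))
                  (trans (∑-swap Ω Ω _) (∑-cong Ω λ ω₂ → ∑-*ˡ Ω _ _))))))
            where
            r₀ = ring 4 (λ w a b c → w ⊗ (a ⊗ b ⊗ c) ⊜ a ⊗ (b ⊗ w ⊗ c)) refl
            r₁ = ring 3 (λ w s c → w ⊗ s ⊗ c ⊜ w ⊗ (s ⊗ c)) refl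
            r₂ = ring 4 (λ s b w c → s ⊗ (b ⊗ w ⊗ c) ⊜ b ⊗ (s ⊗ w ⊗ c)) refl
            r₃ = ring 5 (λ w₂ s t w c → w₂ ⊗ s ⊗ (t ⊗ w ⊗ c) ⊜ w₂ ⊗ (w ⊗ t ⊗ s ⊗ c)) refl
          bound : ∑ Ω (λ ω → w ω * r ω) ≤ ∑ Ω w
          bound = ≤-trans (≤-reflexive expand) (≤-trans
            (∑-support Ω w≥0 λ ω₁ p → ∑-support Ω w≥0 λ ω₂ _ → inner ω₁ ω₂ p)
            (≤-trans (∑-support Ω w≥0 λ ω₁ p → ≤-reflexive (fin-sum ω₁ p)) (≤-reflexive (∑-cong Ω λ ω₁ → *-identityʳ _))))
            where
            fin-sum : ∀ ω₁ → 0# < w ω₁ → ∑ Ω (λ ω₂ → w ω₂ * (same C ω₁ ω₂ * mass C w ω₁ ⁻¹)) ≈ 1#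
            fin-sum ω₁ p = trans (∑-cong Ω λ ω₂ → sym (*-assoc _ _ _)) (trans (∑-*ʳ Ω _ _) (*-inv (mass-pos C ω₁ p)))

  -- Biases of the xor and the event that they predict every coordinate.

  module XorBias where
    open OrderedField
    open FiniteSums

    negative? : Carrier → Bool
    negative? c = not (does (0# ≤? c))

    sign-abs : ∀ c → sign (negative? c) * c ≈ ∣ c ∣
    sign-abs c with 0# ≤? c
    ... | yes _ = *-identityˡ c
    ... | no _ = ring 1 (λ a → ⊝ # 1 ⊗ a ⊜ ⊝ a) refl _

    sign-abs′ : ∀ c → c ≈ sign (negative? c) * ∣ c ∣
    sign-abs′ c with 0# ≤? c
    ... | yes _ = sym (*-identityˡ c)
    ... | no _ = ring 1 (λ a → a ⊜ ⊝ # 1 ⊗ ⊝ a) refl _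

    sign-xor : ∀ a b → sign (a xor b) ≈ sign a * sign b
    sign-xor false b = sym (*-identityˡ _)
    sign-xor true false = ring 0 (⊝ # 1 ⊜ ⊝ # 1 ⊗ # 1) refl
    sign-xor true true = ring 0 (# 1 ⊜ ⊝ # 1 ⊗ ⊝ # 1) refl

    sign-≤1 : ∀ a → sign a ≤ 1#
    sign-≤1 false = ≤-refl
    sign-≤1 true = by≤ (0≤1 ⊞ 0≤1) (ring 0 (# 1 ⊕ (# 0 ⊕ # 0) ⊜ ⊝ # 1 ⊕ (# 1 ⊕ # 1)) refl)

    -1≤sign : ∀ a → - 1# ≤ sign a
    -1≤sign false = by≤ (0≤1 ⊞ 0≤1) (ring 0 (# 1 ⊕ (# 0 ⊕ # 0) ⊜ ⊝ # 1 ⊕ (# 1 ⊕ # 1)) refl)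
    -1≤sign true = ≤-refl

    infix 5 _==_
    _==_ : Bool → Bool → Bool
    a == b = not (a xor b)

    ==-true : ∀ a b → a == b ≡ true → a ≡ b
    ==-true false false p = ≡.refl
    ==-true true true p = ≡.refl

    sign-agree : ∀ u v w → sign u * (sign v * sign w) ≤ ⟦ v == (u xor w) ⟧
    sign-agree false false false = ≤-reflexive (ring 0 (# 1 ⊗ (# 1 ⊗ # 1) ⊜ # 1) refl)
    sign-agree false false true = by≤ 0≤1 (ring 0 (# 0 ⊕ # 0 ⊜ # 1 ⊗ (# 1 ⊗ ⊝ # 1) ⊕ # 1) refl)
    sign-agree false true false = by≤ 0≤1 (ring 0 (# 0 ⊕ # 0 ⊜ # 1 ⊗ (⊝ # 1 ⊗ # 1) ⊕ # 1) refl)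
    sign-agree false true true = ≤-reflexive (ring 0 (# 1 ⊗ (⊝ # 1 ⊗ ⊝ # 1) ⊜ # 1) refl)
    sign-agree true false false = by≤ 0≤1 (ring 0 (# 0 ⊕ # 0 ⊜ ⊝ # 1 ⊗ (# 1 ⊗ # 1) ⊕ # 1) refl)
    sign-agree true false true = ≤-reflexive (ring 0 (⊝ # 1 ⊗ (# 1 ⊗ ⊝ # 1) ⊜ # 1) refl)
    sign-agree true true false = ≤-reflexive (ring 0 (⊝ # 1 ⊗ (⊝ # 1 ⊗ # 1) ⊜ # 1) refl)
    sign-agree true true true = by≤ 0≤1 (ring 0 (# 0 ⊕ # 0 ⊜ ⊝ # 1 ⊗ (⊝ # 1 ⊗ ⊝ # 1) ⊕ # 1) refl)

    ∧-split : ∀ {a b} → a ∧ b ≡ true → (a ≡ true) × (b ≡ true)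
    ∧-split {true} {true} _ = ≡.refl , ≡.refl

    power : ∀ {A : Set} → (A → Carrier) → ∀ {n} → Vec A n → Carrier
    power μ [] = 1#
    power μ (x ∷ xs) = μ x * power μ xs

    power-nonNeg : ∀ {A : Set} {μ : A → Carrier} → (∀ x → 0# ≤ μ x) → ∀ {n} (xs : Vec A n) → 0# ≤ power μ xs
    power-nonNeg h [] = 0≤1
    power-nonNeg h (x ∷ xs) = *-nonNeg (h x) (power-nonNeg h xs)

    power-total : ∀ X {μ : Elem X → Carrier} → ∑ X μ ≈ 1# → ∀ n → ∑ (X ^ᶠ n) (power μ) ≈ 1#
    power-total X h zero = ∑-[] X _
    power-total X {μ} h (suc n) = trans (∑-∷ X n _) (trans (∑-cong X λ x → trans (∑-*ˡ (X ^ᶠ n) (μ x) (power μ))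
      (trans (*-congˡ (power-total X h n)) (*-identityʳ _))) h)

    module Bias (X Y : FinSet) (μ : Elem X → Carrier) (μ≥0 : ∀ x → 0# ≤ μ x) (ν : Elem Y → Carrier) (ν≥0 : ∀ y → 0# ≤ ν y)
      (f : Elem X × Elem Y → Bool) where

      Side : ℕ → Set
      Side n = Vec (Elem X) n → Carrier

      cofactor : ∀ {n} → Side (suc n) → Elem X → Side n
      cofactor a x xs = a (x ∷ xs)

      -- For fixed y, the correlation of the xor with Alice's weight a, whose closed form is
      -- `bias-sum`. The recursion exposes x one coordinate at a time.
      bias : ∀ {n} → Side n → Vec (Elem Y) n → Carrier
      bias a [] = a []
      bias a (y ∷ ys) = ∑ X λ x → μ x * (sign (f (x , y)) * bias (cofactor a x) ys)

      -- Each coordinate of f is the product of the signs of two consecutive biases.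
      predicted : ∀ {n} → Side n → Vec (Elem X) n → Vec (Elem Y) n → Bool
      predicted a [] [] = true
      predicted a (x ∷ xs) (y ∷ ys) =
        (f (x , y) == (negative? (bias a (y ∷ ys)) xor negative? (bias (cofactor a x) ys)))
        ∧ predicted (cofactor a x) xs ys

      -- With each bias written as sign times absolute value, the absolute bias becomes a sum over
      -- the absolute biases of the cofactors, each multiplied by a product of three signs. That
      -- product is at most the indicator that it is positive, which says that this coordinate is
      -- predicted.
      bias≤predicted : ∀ {n} (a : Side n) → (∀ xs → 0# ≤ a xs) → ∀ ys →
        ∣ bias a ys ∣ ≤ ∑ (X ^ᶠ n) (λ xs → power μ xs * (a xs * ⟦ predicted a xs ys ⟧))
      bias≤predicted {zero} a a≥0 [] = ≤-reflexive (trans (abs-pos (a≥0 [])) (sym (trans (∑-[] X _) (r (a [])))))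
        where r = ring 1 (λ b → # 1 ⊗ (b ⊗ # 1) ⊜ b) refl
      bias≤predicted {suc n} a a≥0 (y ∷ ys) = ≤-trans (≤-reflexive (trans (sym (sign-abs _)) (sym (∑-*ˡ X _ _))))
        (≤-trans (∑-mono X step) (≤-reflexive (sym (∑-∷ X n _))))
        where
        σ = negative? (bias a (y ∷ ys))
        step : ∀ x → sign σ * (μ x * (sign (f (x , y)) * bias (cofactor a x) ys)) ≤
          ∑ (X ^ᶠ n) (λ xs → power μ (x ∷ xs) * (a (x ∷ xs) * ⟦ predicted a (x ∷ xs) (y ∷ ys) ⟧))
        step x = ≤-trans (≤-reflexive e₁)
          (≤-trans (*-monoˡ-≤ (μ≥0 x) (*-mono-≤′ (⟦⟧-nonNeg right) (sign-agree σ (f (x , y)) τ) (bias≤predicted (cofactor a x) (λ xs → a≥0 (x ∷ xs)) ys)))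
          (≤-reflexive (trans (sym (trans (∑-*ˡ (X ^ᶠ n) _ _) (*-congˡ (∑-*ˡ (X ^ᶠ n) _ _)))) (∑-cong (X ^ᶠ n) λ xs →
            trans (r (μ x) ⟦ right ⟧ (power μ xs) (a (x ∷ xs)) ⟦ predicted (cofactor a x) xs ys ⟧)
              (*-congˡ (*-congˡ (sym (⟦⟧-∧ right _))))))))
          where
          τ = negative? (bias (cofactor a x) ys)
          right = f (x , y) == (σ xor τ)
          e₁ : sign σ * (μ x * (sign (f (x , y)) * bias (cofactor a x) ys)) ≈
               μ x * ((sign σ * (sign (f (x , y)) * sign τ)) * ∣ bias (cofactor a x) ys ∣)
          e₁ = trans (*-congˡ (*-congˡ (*-congˡ (sign-abs′ (bias (cofactor a x) ys)))))
            (r′ (sign σ) (μ x) (sign (f (x , y))) (sign τ) ∣ bias (cofactor a x) ys ∣)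
            where r′ = ring 5 (λ a b c d e → a ⊗ (b ⊗ (c ⊗ (d ⊗ e))) ⊜ b ⊗ (a ⊗ (c ⊗ d) ⊗ e)) refl
          *-mono-≤′ : ∀ {u v B} → 0# ≤ v → u ≤ v → ∣ bias (cofactor a x) ys ∣ ≤ B → u * ∣ bias (cofactor a x) ys ∣ ≤ v * B
          *-mono-≤′ r p q = ≤-trans (*-monoʳ-≤ (abs-nonNeg _) p) (*-monoˡ-≤ r q)
          r = ring 5 (λ m b p c d → m ⊗ (b ⊗ (p ⊗ (c ⊗ d))) ⊜ m ⊗ p ⊗ (c ⊗ (b ⊗ d))) refl

      bias-sum : ∀ {n} (a : Side n) ys →
        bias a ys ≈ ∑ (X ^ᶠ n) (λ xs → power μ xs * (a xs * sign (xorPower f n (xs , ys))))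
      bias-sum {zero} a [] = sym (trans (∑-[] X _) (r (a [])))
        where r = ring 1 (λ b → # 1 ⊗ (b ⊗ # 1) ⊜ b) refl
      bias-sum {suc n} a (y ∷ ys) = sym (trans (∑-∷ X n _) (∑-cong X λ x → trans (∑-cong (X ^ᶠ n) λ xs →
          trans (*-congˡ (*-congˡ (sign-xor (f (x , y)) _))) (r (μ x) (power μ xs) (a (x ∷ xs)) (sign (f (x , y))) _))
        (trans (∑-*ˡ (X ^ᶠ n) _ _) (*-congˡ (trans (∑-*ˡ (X ^ᶠ n) _ _) (*-congˡ (sym (bias-sum (cofactor a x) ys))))))))
        where r = ring 5 (λ m p a s t → m ⊗ p ⊗ (a ⊗ (s ⊗ t)) ⊜ m ⊗ (s ⊗ (p ⊗ (a ⊗ t)))) refl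

      restrict : ∀ {n} → (Vec (Elem X) n → Bool) → Bool → Side n → Side n
      restrict m β a xs = a xs * ⟦ β == m xs ⟧

      restrict-nonNeg : ∀ {n} (m : Vec (Elem X) n → Bool) β {a : Side n} → (∀ xs → 0# ≤ a xs) → ∀ xs → 0# ≤ restrict m β a xs
      restrict-nonNeg m β h xs = *-nonNeg (h xs) (⟦⟧-nonNeg (β == m xs))

      -- Membership in the event that all coordinates are predicted at the leaf reached.
      event : ∀ {n} → Tree (Vec (Elem X) n) (Vec (Elem Y) n) → Side n → Vec (Elem X) n → Vec (Elem Y) n → Bool
      event (output z) a xs ys = predicted a xs ys
      event (alice m t) a xs ys = event (t (m xs)) (restrict m (m xs) a) xs ys
      event (bob m t) a xs ys = event (t (m ys)) a xs ys

      correlation : ∀ {n} → Tree (Vec (Elem X) n) (Vec (Elem Y) n) → Side n → (Vec (Elem Y) n → Carrier) → Carrier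
      correlation {n} τ a b = ∑ (Y ^ᶠ n) λ ys → power ν ys * b ys *
        ∑ (X ^ᶠ n) λ xs → power μ xs * (a xs * sign (run τ xs ys xor xorPower f n (xs , ys)))

      event-mass : ∀ {n} → Tree (Vec (Elem X) n) (Vec (Elem Y) n) → Side n → (Vec (Elem Y) n → Carrier) → Carrier
      event-mass {n} τ a b = ∑ (Y ^ᶠ n) λ ys → power ν ys * b ys *
        ∑ (X ^ᶠ n) λ xs → power μ xs * (a xs * ⟦ event τ a xs ys ⟧)

      private
        splitA : ∀ {n} (m : Vec (Elem X) n → Bool) (a : Side n) (b : Vec (Elem Y) n → Carrier)
          (G : Bool → Vec (Elem X) n → Vec (Elem Y) n → Carrier) →
          (∑ (Y ^ᶠ n) λ ys → power ν ys * b ys * ∑ (X ^ᶠ n) λ xs → power μ xs * (a xs * G (m xs) xs ys)) ≈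
          (∑ (Y ^ᶠ n) λ ys → power ν ys * b ys * ∑ (X ^ᶠ n) λ xs → power μ xs * (restrict m false a xs * G false xs ys)) +
          (∑ (Y ^ᶠ n) λ ys → power ν ys * b ys * ∑ (X ^ᶠ n) λ xs → power μ xs * (restrict m true a xs * G true xs ys))
        splitA {n} m a b G = trans (∑-cong (Y ^ᶠ n) λ ys → trans (*-congˡ (trans (∑-cong (X ^ᶠ n) λ xs → pt xs ys) (∑-+ (X ^ᶠ n) _ _))) (d _ _ _)) (∑-+ (Y ^ᶠ n) _ _)
          where
          d = ring 3 (λ a b c → a ⊗ (b ⊕ c) ⊜ a ⊗ b ⊕ a ⊗ c) refl
          pt : ∀ xs ys → power μ xs * (a xs * G (m xs) xs ys) ≈
            power μ xs * (restrict m false a xs * G false xs ys) + power μ xs * (restrict m true a xs * G true xs ys)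
          pt xs ys with m xs
          ... | false = r (power μ xs) (a xs) (G false xs ys) (G true xs ys)
            where r = ring 4 (λ p a g h → p ⊗ (a ⊗ g) ⊜ p ⊗ (a ⊗ # 1 ⊗ g) ⊕ p ⊗ (a ⊗ # 0 ⊗ h)) refl
          ... | true = r (power μ xs) (a xs) (G false xs ys) (G true xs ys)
            where r = ring 4 (λ p a g h → p ⊗ (a ⊗ h) ⊜ p ⊗ (a ⊗ # 0 ⊗ g) ⊕ p ⊗ (a ⊗ # 1 ⊗ h)) refl

        splitB : ∀ {n} (m : Vec (Elem Y) n → Bool) (a : Side n) (b : Vec (Elem Y) n → Carrier)
          (G : Bool → Vec (Elem X) n → Vec (Elem Y) n → Carrier) →
          (∑ (Y ^ᶠ n) λ ys → power ν ys * b ys * ∑ (X ^ᶠ n) λ xs → power μ xs * (a xs * G (m ys) xs ys)) ≈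
          (∑ (Y ^ᶠ n) λ ys → power ν ys * (b ys * ⟦ false == m ys ⟧) * ∑ (X ^ᶠ n) λ xs → power μ xs * (a xs * G false xs ys)) +
          (∑ (Y ^ᶠ n) λ ys → power ν ys * (b ys * ⟦ true == m ys ⟧) * ∑ (X ^ᶠ n) λ xs → power μ xs * (a xs * G true xs ys))
        splitB {n} m a b G = trans (∑-cong (Y ^ᶠ n) pt) (∑-+ (Y ^ᶠ n) _ _)
          where
          H : Bool → Vec (Elem Y) n → Carrier
          H β ys = ∑ (X ^ᶠ n) λ xs → power μ xs * (a xs * G β xs ys)
          pt : ∀ ys → power ν ys * b ys * H (m ys) ys ≈
            power ν ys * (b ys * ⟦ false == m ys ⟧) * H false ys + power ν ys * (b ys * ⟦ true == m ys ⟧) * H true ys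
          pt ys with m ys
          ... | false = r (power ν ys) (b ys) (H false ys) (H true ys)
            where r = ring 4 (λ p a g h → p ⊗ a ⊗ g ⊜ p ⊗ (a ⊗ # 1) ⊗ g ⊕ p ⊗ (a ⊗ # 0) ⊗ h) refl
          ... | true = r (power ν ys) (b ys) (H false ys) (H true ys)
            where r = ring 4 (λ p a g h → p ⊗ a ⊗ h ⊜ p ⊗ (a ⊗ # 0) ⊗ g ⊕ p ⊗ (a ⊗ # 1) ⊗ h) refl

      -- At a leaf the output is constant, so for fixed y the correlation is at most the absolute
      -- bias. Bob's side b only weighs the outer sum over y, which is why the event is determined
      -- by Alice's side of the leaf.
      correlation≤event : ∀ {n} (τ : Tree (Vec (Elem X) n) (Vec (Elem Y) n)) {a : Side n} {b} →
        (∀ xs → 0# ≤ a xs) → (∀ ys → 0# ≤ b ys) → correlation τ a b ≤ event-mass τ a b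
      correlation≤event {n} (output z) {a} {b} a≥0 b≥0 = ∑-mono (Y ^ᶠ n) λ ys →
        *-monoˡ-≤ (*-nonNeg (power-nonNeg ν≥0 ys) (b≥0 ys)) (≤-trans (≤-reflexive (eq ys)) (≤-trans (signed z _) (bias≤predicted a a≥0 ys)))
        where
        eq : ∀ ys → ∑ (X ^ᶠ n) (λ xs → power μ xs * (a xs * sign (z xor xorPower f n (xs , ys)))) ≈ sign z * bias a ys
        eq ys = trans (∑-cong (X ^ᶠ n) λ xs → trans (*-congˡ (*-congˡ (sign-xor z (xorPower f n (xs , ys))))) (r (power μ xs) (a xs) (sign z) _))
          (trans (∑-*ˡ (X ^ᶠ n) _ _) (*-congˡ (sym (bias-sum a ys))))
          where r = ring 4 (λ p a s t → p ⊗ (a ⊗ (s ⊗ t)) ⊜ s ⊗ (p ⊗ (a ⊗ t))) refl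
        signed : ∀ z c → sign z * c ≤ ∣ c ∣
        signed false c = ≤-respˡ (sym (*-identityˡ c)) (≤-abs c)
        signed true c = ≤-trans (≤-reflexive (ring 1 (λ a → ⊝ # 1 ⊗ a ⊜ ⊝ a) refl _)) (neg≤-abs c)
      correlation≤event {n} (alice m t) {a} {b} a≥0 b≥0 = ≤-trans
        (≤-reflexive (splitA m a b (λ β xs ys → sign (run (t β) xs ys xor xorPower f n (xs , ys)))))
        (≤-trans (correlation≤event (t false) (restrict-nonNeg m false a≥0) b≥0 ⊞ correlation≤event (t true) (restrict-nonNeg m true a≥0) b≥0)
        (≤-reflexive (sym (splitA m a b (λ β xs ys → ⟦ event (t β) (restrict m β a) xs ys ⟧)))))
      correlation≤event {n} (bob m t) {a} {b} a≥0 b≥0 = ≤-trans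
        (≤-reflexive (splitB m a b (λ β xs ys → sign (run (t β) xs ys xor xorPower f n (xs , ys)))))
        (≤-trans (correlation≤event (t false) a≥0 (nn false) ⊞ correlation≤event (t true) a≥0 (nn true))
        (≤-reflexive (sym (splitB m a b (λ β xs ys → ⟦ event (t β) a xs ys ⟧)))))
        where nn : ∀ β ys → 0# ≤ b ys * ⟦ β == m ys ⟧
              nn β ys = *-nonNeg (b≥0 ys) (⟦⟧-nonNeg (β == m ys))

      -- The entry at i is the separate argument x, so that a leaf can be labelled by a function of
      -- this entry alone once the surroundings are fixed.
      aliceSign : ∀ {n} → Side n → Fin n → Vec (Elem X) n → Vec (Elem Y) n → Elem X → Bool
      aliceSign a zero (_ ∷ _) (_ ∷ ys) x = negative? (bias (cofactor a x) ys)
      aliceSign a (suc i) (x₀ ∷ xs) (_ ∷ ys) x = aliceSign (cofactor a x₀) i xs ys x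

      bobSign : ∀ {n} → Side n → Fin n → Vec (Elem X) n → Vec (Elem Y) n → Elem Y → Bool
      bobSign a zero (_ ∷ _) (_ ∷ ys) y = negative? (bias a (y ∷ ys))
      bobSign a (suc i) (x₀ ∷ xs) (_ ∷ ys) y = bobSign (cofactor a x₀) i xs ys y

      predicted-coordinate : ∀ {n} (a : Side n) i xs ys → predicted a xs ys ≡ true →
        f (lookup xs i , lookup ys i) ≡ bobSign a i xs ys (lookup ys i) xor aliceSign a i xs ys (lookup xs i)
      predicted-coordinate a zero (x ∷ xs) (y ∷ ys) p = ==-true _ _ (proj₁ (∧-split p))
      predicted-coordinate a (suc i) (x ∷ xs) (y ∷ ys) p =
        predicted-coordinate (cofactor a x) i xs ys (proj₂ (∧-split {f (x , y) == _} p))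

      AgreeAround : ∀ {n} → Fin n → (xs xs′ : Vec (Elem X) n) (ys ys′ : Vec (Elem Y) n) → Set
      AgreeAround i xs xs′ ys ys′ =
        (List.take (toℕ i) (toList xs) ≡ List.take (toℕ i) (toList xs′)) ×
        (List.drop (suc (toℕ i)) (toList ys) ≡ List.drop (suc (toℕ i)) (toList ys′))

      toList-injective : ∀ {A : Set} {n} (xs ys : Vec A n) → toList xs ≡ toList ys → xs ≡ ys
      toList-injective [] [] p = ≡.refl
      toList-injective (x ∷ xs) (y ∷ ys) p = ≡.cong₂ _∷_ (Listₚ.∷-injectiveˡ p) (toList-injective xs ys (Listₚ.∷-injectiveʳ p))

      aliceSign-agree : ∀ {n} (a : Side n) i xs xs′ ys ys′ → AgreeAround i xs xs′ ys ys′ →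
        ∀ x → aliceSign a i xs ys x ≡ aliceSign a i xs′ ys′ x
      aliceSign-agree a zero (_ ∷ _) (_ ∷ _) (_ ∷ ys) (_ ∷ ys′) (p , q) x rewrite toList-injective ys ys′ q = ≡.refl
      aliceSign-agree a (suc i) (x₀ ∷ xs) (x₀′ ∷ xs′) (_ ∷ ys) (_ ∷ ys′) (p , q) x
        rewrite Listₚ.∷-injectiveˡ p = aliceSign-agree (cofactor a x₀′) i xs xs′ ys ys′ (Listₚ.∷-injectiveʳ p , q) x

      bobSign-agree : ∀ {n} (a : Side n) i xs xs′ ys ys′ → AgreeAround i xs xs′ ys ys′ →
        ∀ y → bobSign a i xs ys y ≡ bobSign a i xs′ ys′ y
      bobSign-agree a zero (_ ∷ _) (_ ∷ _) (_ ∷ ys) (_ ∷ ys′) (p , q) y rewrite toList-injective ys ys′ q = ≡.refl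
      bobSign-agree a (suc i) (x₀ ∷ xs) (x₀′ ∷ xs′) (_ ∷ ys) (_ ∷ ys′) (p , q) y
        rewrite Listₚ.∷-injectiveˡ p = bobSign-agree (cofactor a x₀′) i xs xs′ ys ys′ (Listₚ.∷-injectiveʳ p , q) y

  -- Expected outputs of randomised protocols, and their derandomisation.

  module AchievableOutputs where
    open OrderedField
    open FiniteSums

    convex-≤ : ∀ {c p q r} → 0# ≤ c → c ≤ 1# → p ≤ r → q ≤ r → c * p + (1# - c) * q ≤ r
    convex-≤ c≥0 c≤1 p q = by≤ (*-monoˡ-≤ c≥0 p ⊞ *-monoˡ-≤ (0≤-diff c≤1) q) (ring 4 (λ a b c d → a ⊕ (b ⊗ c ⊕ (# 1 ⊖ b) ⊗ d) ⊜ b ⊗ c ⊕ (# 1 ⊖ b) ⊗ d ⊕ (b ⊗ a ⊕ (# 1 ⊖ b) ⊗ a)) refl _ _ _ _)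

    -- The expected signed outputs of protocols with public and private coins of
    -- depth at most c.
    data Achievable (A B : Set) : ℕ → (A → B → Carrier) → Set where
      answer : ∀ {c φ} b → (∀ x y → φ x y ≈ sign b) → Achievable A B c φ
      toss : ∀ {c φ ψ χ} l → 0# ≤ l → l ≤ 1# → Achievable A B c φ → Achievable A B c ψ →
        (∀ x y → χ x y ≈ l * φ x y + (1# - l) * ψ x y) → Achievable A B c χ
      sayˡ : ∀ {c φ ψ χ} (a : A → Carrier) → (∀ x → 0# ≤ a x) → (∀ x → a x ≤ 1#) →
        Achievable A B c φ → Achievable A B c ψ →
        (∀ x y → χ x y ≈ a x * φ x y + (1# - a x) * ψ x y) → Achievable A B (suc c) χ
      sayʳ : ∀ {c φ ψ χ} (b : B → Carrier) → (∀ y → 0# ≤ b y) → (∀ y → b y ≤ 1#) →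
        Achievable A B c φ → Achievable A B c ψ →
        (∀ x y → χ x y ≈ b y * φ x y + (1# - b y) * ψ x y) → Achievable A B (suc c) χ

    weaken : ∀ {A B c d φ} → c ℕ.≤ d → Achievable A B c φ → Achievable A B d φ
    weaken p (answer b e) = answer b e
    weaken p (toss l l≥0 l≤1 s t e) = toss l l≥0 l≤1 (weaken p s) (weaken p t) e
    weaken (ℕ.s≤s p) (sayˡ a a≥0 a≤1 s t e) = sayˡ a a≥0 a≤1 (weaken p s) (weaken p t) e
    weaken (ℕ.s≤s p) (sayʳ a a≥0 a≤1 s t e) = sayʳ a a≥0 a≤1 (weaken p s) (weaken p t) e

    respect : ∀ {A B c φ χ} → (∀ x y → χ x y ≈ φ x y) → Achievable A B c φ → Achievable A B c χ
    respect {φ = φ} {χ} e s = toss 1# 0≤1 ≤-refl s s λ x y → trans (e x y) (r (φ x y))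
      where r = ring 1 (λ a → a ⊜ # 1 ⊗ a ⊕ (# 1 ⊖ # 1) ⊗ a) refl

    -- The value of giving up: the output is a fair public coin.
    achieve-0 : ∀ {A B c} → Achievable A B c (λ _ _ → 0#)
    achieve-0 {A} {B} {c} = toss {φ = λ _ _ → 1#} {ψ = λ _ _ → - 1#} h (<⇒≤ (inv-pos (fromℕ-pos 1))) h≤1
        (answer false λ _ _ → refl) (answer true λ _ _ → refl)
        λ _ _ → by≈ (sym (*-inv (fromℕ-pos 1))) (r h)
      where
      h = fromℕ 2 ⁻¹
      h≤1 : h ≤ 1#
      h≤1 = by≤ (≤-reflexive (*-inv (fromℕ-pos 1)) ⊞ <⇒≤ (inv-pos (fromℕ-pos 1))) (r′ h)
        where r′ = ring 1 (λ a → # 1 ⊕ (# 2 ⊗ a ⊕ # 0) ⊜ a ⊕ (# 1 ⊕ a)) refl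
      r : ∀ h → (h * 1# + (1# - h) * - 1#) + 1# ≈ 0# + fromℕ 2 * h
      r h = ring 1 (λ h → h ⊗ # 1 ⊕ (# 1 ⊖ h) ⊗ ⊝ # 1 ⊕ # 1 ⊜ # 0 ⊕ # 2 ⊗ h) refl h

    private
      parity : ℕ → Bool
      parity zero = false
      parity (suc zero) = true
      parity (suc (suc k)) = parity k

      halve : ℕ → ℕ
      halve zero = zero
      halve (suc zero) = zero
      halve (suc (suc k)) = suc (halve k)

      double : Bool → ℕ → ℕ
      double b zero = if b then 1 else 0
      double b (suc j) = suc (suc (double b j))

      double-halve : ∀ k → double (parity k) (halve k) ≡ k
      double-halve zero = ≡.refl
      double-halve (suc zero) = ≡.refl
      double-halve (suc (suc k)) = ≡.cong (λ j → suc (suc j)) (double-halve k)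

      halve-< : ∀ k n → k ℕ.< n ℕ.+ n → halve k ℕ.< n
      halve-< zero (suc n) p = ℕ.s≤s ℕ.z≤n
      halve-< (suc zero) (suc n) p = ℕ.s≤s ℕ.z≤n
      halve-< (suc (suc k)) (suc n) (ℕ.s≤s p) = ℕ.s≤s (halve-< k n (ℕ.s≤s⁻¹ (≡.subst (suc (suc k) ℕ.≤_) (ℕₚ.+-suc n n) p)))

      pick : ∀ b {p q : Carrier} → (if b then p else q) ≈ ⟦ b ⟧ * p + (1# - ⟦ b ⟧) * q
      pick true {p} {q} = r p q
        where r = ring 2 (λ p q → p ⊜ # 1 ⊗ p ⊕ (# 1 ⊖ # 1) ⊗ q) refl
      pick false {p} {q} = r p q
        where r = ring 2 (λ p q → q ⊜ # 0 ⊗ p ⊕ (# 1 ⊖ # 0) ⊗ q) refl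

    achieve-signs : ∀ {A B : Set} (s : A → Bool) (t : B → Bool) → Achievable A B 2 (λ x y → sign (s x xor t y))
    achieve-signs {A} {B} s t = sayˡ (λ x → ⟦ s x ⟧) (λ x → ⟦⟧-nonNeg (s x)) (λ x → ⟦⟧-≤1 (s x)) (part true) (part false)
        λ x y → bitwise (s x) (λ b → sign (b xor t y))
      where
      bitwise : ∀ b (F : Bool → Carrier) → F b ≈ ⟦ b ⟧ * F true + (1# - ⟦ b ⟧) * F false
      bitwise true F = r (F true) (F false)
        where r = ring 2 (λ p q → p ⊜ # 1 ⊗ p ⊕ (# 1 ⊖ # 1) ⊗ q) refl
      bitwise false F = r (F true) (F false)
        where r = ring 2 (λ p q → q ⊜ # 0 ⊗ p ⊕ (# 1 ⊖ # 0) ⊗ q) refl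
      part : ∀ b → Achievable A B 1 (λ _ y → sign (b xor t y))
      part b = sayʳ (λ y → ⟦ t y ⟧) (λ y → ⟦⟧-nonNeg (t y)) (λ y → ⟦⟧-≤1 (t y))
        (answer (b xor true) λ _ _ → refl) (answer (b xor false) λ _ _ → refl) λ x y → bitwise (t y) (λ z → sign (b xor z))

    -- The number is sent in binary, least significant bit first, so that each message halves what
    -- remains. The family φ lets the continuation depend on the announced value.
    announceˡ : ∀ {A B c} ℓ (k : A → ℕ) → (∀ x → k x ℕ.< 2 ℕ.^ ℓ) → (φ : ℕ → A → B → Carrier) →
      (∀ j → Achievable A B c (φ j)) → Achievable A B (ℓ ℕ.+ c) (λ x y → φ (k x) x y)
    announceˡ zero k k< φ s = respect (λ x y → reflexive (≡.cong (λ j → φ j x y) (ℕₚ.n<1⇒n≡0 (k< x)))) (s 0)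
    announceˡ (suc ℓ) k k< φ s = sayˡ (λ x → ⟦ parity (k x) ⟧) (λ x → ⟦⟧-nonNeg (parity (k x))) (λ x → ⟦⟧-≤1 (parity (k x)))
      (announceˡ ℓ (λ x → halve (k x)) small (λ j → φ (double true j)) (λ j → s (double true j)))
      (announceˡ ℓ (λ x → halve (k x)) small (λ j → φ (double false j)) (λ j → s (double false j)))
      λ x y → trans (e x y (parity (k x)) (double-halve (k x))) (pick (parity (k x)))
      where
      small : ∀ x → halve (k x) ℕ.< 2 ℕ.^ ℓ
      small x = halve-< (k x) (2 ℕ.^ ℓ) (≡.subst (k x ℕ.<_) (≡.cong (2 ℕ.^ ℓ ℕ.+_) (ℕₚ.+-identityʳ (2 ℕ.^ ℓ))) (k< x))
      e : ∀ x y b → double b (halve (k x)) ≡ k x →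
        φ (k x) x y ≈ (if b then φ (double true (halve (k x))) x y else φ (double false (halve (k x))) x y)
      e x y true p = reflexive (≡.cong (λ j → φ j x y) (≡.sym p))
      e x y false p = reflexive (≡.cong (λ j → φ j x y) (≡.sym p))

    announceʳ : ∀ {A B c} ℓ (k : B → ℕ) → (∀ y → k y ℕ.< 2 ℕ.^ ℓ) → (φ : ℕ → A → B → Carrier) →
      (∀ j → Achievable A B c (φ j)) → Achievable A B (ℓ ℕ.+ c) (λ x y → φ (k y) x y)
    announceʳ zero k k< φ s = respect (λ x y → reflexive (≡.cong (λ j → φ j x y) (ℕₚ.n<1⇒n≡0 (k< y)))) (s 0)
    announceʳ (suc ℓ) k k< φ s = sayʳ (λ y → ⟦ parity (k y) ⟧) (λ y → ⟦⟧-nonNeg (parity (k y))) (λ y → ⟦⟧-≤1 (parity (k y)))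
      (announceʳ ℓ (λ y → halve (k y)) small (λ j → φ (double true j)) (λ j → s (double true j)))
      (announceʳ ℓ (λ y → halve (k y)) small (λ j → φ (double false j)) (λ j → s (double false j)))
      λ x y → trans (e x y (parity (k y)) (double-halve (k y))) (pick (parity (k y)))
      where
      small : ∀ y → halve (k y) ℕ.< 2 ℕ.^ ℓ
      small y = halve-< (k y) (2 ℕ.^ ℓ) (≡.subst (k y ℕ.<_) (≡.cong (2 ℕ.^ ℓ ℕ.+_) (ℕₚ.+-identityʳ (2 ℕ.^ ℓ))) (k< y))
      e : ∀ x y b → double b (halve (k y)) ≡ k y →
        φ (k y) x y ≈ (if b then φ (double true (halve (k y))) x y else φ (double false (halve (k y))) x y)
      e x y true p = reflexive (≡.cong (λ j → φ j x y) (≡.sym p))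
      e x y false p = reflexive (≡.cong (λ j → φ j x y) (≡.sym p))

    module Derandomise (X Y : FinSet) where
      value : (Elem X → Elem Y → Carrier) → (Elem X → Elem Y → Carrier) → Carrier
      value w φ = ∑ X λ x → ∑ Y λ y → w x y * φ x y

      signed : Tree (Elem X) (Elem Y) → Elem X → Elem Y → Carrier
      signed τ x y = sign (run τ x y)

      private
        branch : Tree (Elem X) (Elem Y) → Tree (Elem X) (Elem Y) → Bool → Tree (Elem X) (Elem Y)
        branch τ₁ τ₀ b = if b then τ₁ else τ₀

      -- Private coins are removed by letting the speaker choose the better branch
      -- for his own input.
      derandomise : ∀ {c φ} → Achievable (Elem X) (Elem Y) c φ → ∀ w →
        Σ[ τ ∈ Tree (Elem X) (Elem Y) ] depth τ ℕ.≤ c × value w φ ≤ value w (signed τ)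
      derandomise (answer b e) w = output b , ℕ.z≤n ,
        ≤-reflexive (∑-cong X λ x → ∑-cong Y λ y → *-congˡ (e x y))
      derandomise {c} {χ} (toss {φ = φ} {ψ} l l≥0 l≤1 s t e) w with derandomise s w | derandomise t w
      ... | τ₁ , d₁ , h₁ | τ₀ , d₀ , h₀ = better (total (value w (signed τ₁)) (value w (signed τ₀)))
        where
        eq : value w χ ≈ l * value w φ + (1# - l) * value w ψ
        eq = trans (∑-cong X λ x → trans (∑-cong Y λ y → trans (*-congˡ (e x y)) (r (w x y) l (φ x y) (ψ x y)))
               (trans (∑-+ Y _ _) (+-cong (∑-*ˡ Y _ _) (∑-*ˡ Y _ _))))
             (trans (∑-+ X _ _) (+-cong (∑-*ˡ X _ _) (∑-*ˡ X _ _)))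
          where r = ring 4 (λ w l p q → w ⊗ (l ⊗ p ⊕ (# 1 ⊖ l) ⊗ q) ⊜ l ⊗ (w ⊗ p) ⊕ (# 1 ⊖ l) ⊗ (w ⊗ q)) refl
        better : _ → Σ[ τ ∈ Tree (Elem X) (Elem Y) ] depth τ ℕ.≤ c × value w χ ≤ value w (signed τ)
        better (inj₁ p) = τ₀ , d₀ , ≤-respˡ (sym eq) (convex-≤ l≥0 l≤1 (≤-trans h₁ p) h₀)
        better (inj₂ p) = τ₁ , d₁ , ≤-respˡ (sym eq) (convex-≤ l≥0 l≤1 h₁ (≤-trans h₀ p))
      derandomise {_} {χ} (sayˡ {φ = φ} {ψ} a a≥0 a≤1 s t e) w
        with derandomise s (λ x y → a x * w x y) | derandomise t (λ x y → (1# - a x) * w x y)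
      ... | τ₁ , d₁ , h₁ | τ₀ , d₀ , h₀ = alice m (branch τ₁ τ₀) , ℕ.s≤s (ℕₚ.⊔-lub d₀ d₁) ,
        ≤-trans (≤-reflexive eq) (≤-trans (h₁ ⊞ h₀) (≤-trans (≤-reflexive (sym (∑-+ X _ _))) (∑-mono X best)))
        where
        R : Tree (Elem X) (Elem Y) → Elem X → Carrier
        R τ x = ∑ Y λ y → w x y * signed τ x y
        m : Elem X → Bool
        m x = does (R τ₀ x ≤? R τ₁ x)
        eq : value w χ ≈ value (λ x y → a x * w x y) φ + value (λ x y → (1# - a x) * w x y) ψ
        eq = trans (∑-cong X λ x → trans (∑-cong Y λ y → trans (*-congˡ (e x y)) (r (w x y) (a x) (φ x y) (ψ x y))) (∑-+ Y _ _)) (∑-+ X _ _)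
          where r = ring 4 (λ w l p q → w ⊗ (l ⊗ p ⊕ (# 1 ⊖ l) ⊗ q) ⊜ l ⊗ w ⊗ p ⊕ (# 1 ⊖ l) ⊗ w ⊗ q) refl
        best : ∀ x → (∑ Y λ y → a x * w x y * signed τ₁ x y) + (∑ Y λ y → (1# - a x) * w x y * signed τ₀ x y) ≤
          (∑ Y λ y → w x y * signed (alice m (branch τ₁ τ₀)) x y)
        best x = ≤-trans (≤-reflexive (+-cong (trans (∑-cong Y λ y → *-assoc _ _ _) (∑-*ˡ Y _ _)) (trans (∑-cong Y λ y → *-assoc _ _ _) (∑-*ˡ Y _ _)))) choose
          where
          choose : a x * R τ₁ x + (1# - a x) * R τ₀ x ≤ (∑ Y λ y → w x y * signed (branch τ₁ τ₀ (m x)) x y)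
          choose with R τ₀ x ≤? R τ₁ x
          ... | yes p = convex-≤ (a≥0 x) (a≤1 x) ≤-refl p
          ... | no p = convex-≤ (a≥0 x) (a≤1 x) (<⇒≤ (≰⇒> p)) ≤-refl
      derandomise {_} {χ} (sayʳ {φ = φ} {ψ} b b≥0 b≤1 s t e) w
        with derandomise s (λ x y → b y * w x y) | derandomise t (λ x y → (1# - b y) * w x y)
      ... | τ₁ , d₁ , h₁ | τ₀ , d₀ , h₀ = bob m (branch τ₁ τ₀) , ℕ.s≤s (ℕₚ.⊔-lub d₀ d₁) ,
        ≤-trans (≤-reflexive eq) (≤-trans (h₁ ⊞ h₀) (≤-trans (≤-reflexive (trans (+-cong (∑-swap X Y _) (∑-swap X Y _)) (sym (∑-+ Y _ _))))
          (≤-trans (∑-mono Y best) (≤-reflexive (sym (∑-swap X Y _))))))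
        where
        R : Tree (Elem X) (Elem Y) → Elem Y → Carrier
        R τ y = ∑ X λ x → w x y * signed τ x y
        m : Elem Y → Bool
        m y = does (R τ₀ y ≤? R τ₁ y)
        eq : value w χ ≈ value (λ x y → b y * w x y) φ + value (λ x y → (1# - b y) * w x y) ψ
        eq = trans (∑-cong X λ x → trans (∑-cong Y λ y → trans (*-congˡ (e x y)) (r (w x y) (b y) (φ x y) (ψ x y))) (∑-+ Y _ _)) (∑-+ X _ _)
          where r = ring 4 (λ w l p q → w ⊗ (l ⊗ p ⊕ (# 1 ⊖ l) ⊗ q) ⊜ l ⊗ w ⊗ p ⊕ (# 1 ⊖ l) ⊗ w ⊗ q) refl
        best : ∀ y → (∑ X λ x → b y * w x y * signed τ₁ x y) + (∑ X λ x → (1# - b y) * w x y * signed τ₀ x y) ≤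
          (∑ X λ x → w x y * signed (bob m (branch τ₁ τ₀)) x y)
        best y = ≤-trans (≤-reflexive (+-cong (trans (∑-cong X λ x → *-assoc _ _ _) (∑-*ˡ X _ _)) (trans (∑-cong X λ x → *-assoc _ _ _) (∑-*ˡ X _ _)))) choose
          where
          choose : b y * R τ₁ y + (1# - b y) * R τ₀ y ≤ (∑ X λ x → w x y * signed (branch τ₁ τ₀ (m y)) x y)
          choose with R τ₀ y ≤? R τ₁ y
          ... | yes p = convex-≤ (b≥0 y) (b≤1 y) ≤-refl p
          ... | no p = convex-≤ (b≥0 y) (b≤1 y) (<⇒≤ (≰⇒> p)) ≤-refl

  -- Martingales on a tree and walks with restarts.

  module RestartedWalk where
    open OrderedField
    open FiniteSums
    open AchievableOutputs

    mean : Carrier → Carrier → Carrier → Carrier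
    mean l p q = l * p + (1# - l) * q

    mean-≤ : ∀ {l p q r s} → 0# ≤ l → l ≤ 1# → p ≤ r → q ≤ s → mean l p q ≤ mean l r s
    mean-≤ l≥0 l≤1 p q = *-monoˡ-≤ l≥0 p ⊞ *-monoˡ-≤ (0≤-diff l≤1) q

    mean-cong : ∀ {l p q r s} → p ≈ r → q ≈ s → mean l p q ≈ mean l r s
    mean-cong e f = +-cong (*-congˡ e) (*-congˡ f)

    mean-const : ∀ l p → p ≈ mean l p p
    mean-const l p = ring 2 (λ p l → p ⊜ l ⊗ p ⊕ (# 1 ⊖ l) ⊗ p) refl p l

    mean-linear : ∀ l c d p q r s → c * mean l p q + d * mean l r s ≈ mean l (c * p + d * r) (c * q + d * s)
    mean-linear l c d p q r s = ring 7 (λ c l p q d r s → c ⊗ (l ⊗ p ⊕ (# 1 ⊖ l) ⊗ q) ⊕ d ⊗ (l ⊗ r ⊕ (# 1 ⊖ l) ⊗ s) ⊜ l ⊗ (c ⊗ p ⊕ d ⊗ r) ⊕ (# 1 ⊖ l) ⊗ (c ⊗ q ⊕ d ⊗ s)) refl c l p q d r s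

    mean-scale : ∀ l c p q → c * mean l p q ≈ mean l (c * p) (c * q)
    mean-scale l c p q = ring 4 (λ c l p q → c ⊗ (l ⊗ p ⊕ (# 1 ⊖ l) ⊗ q) ⊜ l ⊗ (c ⊗ p) ⊕ (# 1 ⊖ l) ⊗ (c ⊗ q)) refl c l p q

    module _ {A B : Set} where
      -- One step of a pair of positive martingales with independent coordinates
      -- and bounded growth.
      record Split (l : Carrier) (U U₁ U₀ : A → Carrier) (V V₁ V₀ : B → Carrier) : Set where
        field
          l≥0 : 0# ≤ l
          l≤1 : l ≤ 1#
          meanˡ : ∀ x → mean l (U₁ x) (U₀ x) ≈ U x
          meanʳ : ∀ y → mean l (V₁ y) (V₀ y) ≈ V y
          mean-product : ∀ x y → mean l (U₁ x * V₁ y) (U₀ x * V₀ y) ≈ U x * V y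
          U₁>0 : ∀ x → 0# < U₁ x
          U₀>0 : ∀ x → 0# < U₀ x
          V₁>0 : ∀ y → 0# < V₁ y
          V₀>0 : ∀ y → 0# < V₀ y
          U₁≤ : ∀ x → U₁ x ≤ fromℕ 4 * U x
          U₀≤ : ∀ x → U₀ x ≤ fromℕ 4 * U x
          V₁≤ : ∀ y → V₁ y ≤ fromℕ 4 * V y
          V₀≤ : ∀ y → V₀ y ≤ fromℕ 4 * V y

      -- The likelihood ratios U and V of the two players against a public prior,
      -- along a tree whose leaves carry a sign for each player.
      data Mart : (A → Carrier) → (B → Carrier) → Set where
        leaf : ∀ {U V} → (A → Bool) → (B → Bool) → Mart U V
        node : ∀ {U V l U₁ U₀ V₁ V₀} → Split l U U₁ U₀ V V₁ V₀ → Mart U₁ V₁ → Mart U₀ V₀ → Mart U V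

      height : ∀ {U V} → Mart U V → ℕ
      height (leaf _ _) = 0
      height (node _ M₁ M₀) = suc (height M₁ ⊔ height M₀)

      Payoff : Set
      Payoff = Bool → Bool → Carrier → Carrier → Carrier

      exits : (u bu v bv : Carrier) → Bool
      exits u bu v bv = does ((fromℕ 2 * bu) <? u) ∨ does ((fromℕ 2 * bv) <? v)

      -- The walk without restarts, under the public law. For a payoff with the factor u v this
      -- amounts to an expectation under the law whose likelihood ratio is u v.
      full : ∀ {U V} → Payoff → Mart U V → A → B → Carrier
      full {U} {V} F (leaf s t) x y = F (s x) (t y) (U x) (V y)
      full F (node {l = l} _ M₁ M₀) x y = mean l (full F M₁ x y) (full F M₀ x y)

      module Simulation (q : Carrier) (q≥0 : 0# ≤ q) (q≤1 : q ≤ 1#) where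

        -- The expected payoff of a walk that may restart its base point (bu, bv) at
        -- most J times, with a factor q for each restart.
        walk : ∀ {U V} → Payoff → ℕ → Carrier → Carrier → Mart U V → A → B → Carrier
        walk {U} {V} F J bu bv (leaf s t) x y = q * F (s x) (t y) (U x) (V y)
        walk {U} {V} F J bu bv (node {l = l} S M₁ M₀) x y =
          if exits (U x) bu (V y) bv then restart J else mean l (walk F J bu bv M₁ x y) (walk F J bu bv M₀ x y)
          where
          restart : ℕ → Carrier
          restart zero = 0#
          restart (suc J) = q * walk F J (U x) (V y) (node S M₁ M₀) x y

        module _ (x : A) (y : B) where
          -- The form 2F ≤ G + H suits the use in `pointwise` of `Restarted`: F counts correct
          -- leaves, G is the signed output, and H is the product u v, whose walk is at most one.
          walk-mono : ∀ {F G H : Payoff} → (∀ s t u v → 0# < u → 0# < v → fromℕ 2 * F s t u v ≤ G s t u v + H s t u v) →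
            ∀ J bu bv {U V} (M : Mart U V) → 0# < U x → 0# < V y →
            fromℕ 2 * walk F J bu bv M x y ≤ walk G J bu bv M x y + walk H J bu bv M x y
          walk-mono h J bu bv (leaf s t) U>0 V>0 = by≤ (*-monoˡ-≤ q≥0 (h (s x) (t y) _ _ U>0 V>0)) (ring 4 (λ a b c d → a ⊗ b ⊕ a ⊗ c ⊕ a ⊗ (# 2 ⊗ d) ⊜ # 2 ⊗ (a ⊗ d) ⊕ a ⊗ (b ⊕ c)) refl _ _ _ _)
          walk-mono h J bu bv {U} {V} (node {l = l} S M₁ M₀) U>0 V>0 with exits (U x) bu (V y) bv
          walk-mono h zero bu bv (node S M₁ M₀) U>0 V>0 | true = ≤-reflexive (ring 0 ((# 1 ⊕ (# 1 ⊕ # 0)) ⊗ # 0 ⊜ # 0 ⊕ # 0) refl)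
          walk-mono h (suc J) bu bv {U} {V} (node S M₁ M₀) U>0 V>0 | true =
            by≤ (*-monoˡ-≤ q≥0 (walk-mono h J (U x) (V y) (node S M₁ M₀) U>0 V>0)) (ring 4 (λ a b c d → a ⊗ b ⊕ a ⊗ c ⊕ a ⊗ (# 2 ⊗ d) ⊜ (# 1 ⊕ (# 1 ⊕ # 0)) ⊗ (a ⊗ d) ⊕ a ⊗ (b ⊕ c)) refl _ _ _ _)
          walk-mono h J bu bv (node {l = l} S M₁ M₀) U>0 V>0 | false = by≤
            (mean-≤ (Split.l≥0 S) (Split.l≤1 S) (walk-mono h J bu bv M₁ (Split.U₁>0 S x) (Split.V₁>0 S y))
                                                (walk-mono h J bu bv M₀ (Split.U₀>0 S x) (Split.V₀>0 S y))) (ring 7 (λ a b c d e f g → a ⊗ b ⊕ (# 1 ⊖ a) ⊗ c ⊕ (a ⊗ d ⊕ (# 1 ⊖ a) ⊗ e) ⊕ (a ⊗ (# 2 ⊗ f) ⊕ (# 1 ⊖ a) ⊗ (# 2 ⊗ g)) ⊜ (# 1 ⊕ (# 1 ⊕ # 0)) ⊗ (a ⊗ f ⊕ (# 1 ⊖ a) ⊗ g) ⊕ (a ⊗ (b ⊕ d) ⊕ (# 1 ⊖ a) ⊗ (c ⊕ e))) refl _ _ _ _ _ _ _)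

          product : Payoff
          product _ _ u v = u * v

          -- u v is a martingale along the tree, while the factors q and the abandoned paths can
          -- only lose.
          walk-product : ∀ J bu bv {U V} (M : Mart U V) → 0# < U x → 0# < V y → walk product J bu bv M x y ≤ U x * V y
          walk-product J bu bv {U} {V} (leaf s t) U>0 V>0 = ≤-respʳ (*-identityˡ _) (*-monoʳ-≤ (<⇒≤ (*-pos U>0 V>0)) q≤1)
          walk-product J bu bv {U} {V} (node S M₁ M₀) U>0 V>0 with exits (U x) bu (V y) bv
          walk-product zero bu bv (node S M₁ M₀) U>0 V>0 | true = <⇒≤ (*-pos U>0 V>0)
          walk-product (suc J) bu bv {U} {V} (node S M₁ M₀) U>0 V>0 | true =
            ≤-trans (*-monoˡ-≤ q≥0 (walk-product J (U x) (V y) (node S M₁ M₀) U>0 V>0))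
              (≤-respʳ (*-identityˡ _) (*-monoʳ-≤ (<⇒≤ (*-pos U>0 V>0)) q≤1))
          walk-product J bu bv (node S M₁ M₀) U>0 V>0 | false = ≤-trans
            (mean-≤ (Split.l≥0 S) (Split.l≤1 S) (walk-product J bu bv M₁ (Split.U₁>0 S x) (Split.V₁>0 S y))
                                                (walk-product J bu bv M₀ (Split.U₀>0 S x) (Split.V₀>0 S y)))
            (≤-reflexive (Split.mean-product S x y))

      sq-cancel : ∀ {a b} → 0# ≤ b → a * a ≤ b * b → a ≤ b
      sq-cancel {a} {b} b≥0 h = ≮⇒≥ λ b<a → <⇒≱ (*-mono-< b≥0 (≤-<-trans b≥0 b<a) b<a b<a) h

      -- (1 + u/bu)(1 + v/bv)/4 is a martingale, at least the square root of
      -- (u v)/(bu bv), and at least 9/8 times that (in squares) at an exit.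
      potential : (bu bv u v : Carrier) → Carrier
      potential bu bv u v = (bu + u) * (bv + v) * (fromℕ 4 * (bu * bv)) ⁻¹

      -- The value of (1 + t)²/(4t) at t = 2, the least that a ratio t = u/bu contributes at its
      -- exit.
      growth : Carrier
      growth = fromℕ 9 * fromℕ 8 ⁻¹

      private
        8⁻¹ : fromℕ 8 * fromℕ 8 ⁻¹ ≈ 1#
        8⁻¹ = *-inv (fromℕ-pos 7)

      growth-pos : 0# < growth
      growth-pos = *-pos (fromℕ-pos 8) (inv-pos (fromℕ-pos 7))

      module _ {bu bv u v : Carrier} (bu>0 : 0# < bu) (bv>0 : 0# < bv) (u>0 : 0# < u) (v>0 : 0# < v) where
        private
          d>0 : 0# < fromℕ 4 * (bu * bv)
          d>0 = *-pos (fromℕ-pos 3) (*-pos bu>0 bv>0)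
          inv : (fromℕ 4 * (bu * bv)) * (fromℕ 4 * (bu * bv)) ⁻¹ ≈ 1#
          inv = *-inv d>0

        potential-pos : 0# < potential bu bv u v
        potential-pos = *-pos (*-pos (+-pos bu>0 (<⇒≤ u>0)) (+-pos bv>0 (<⇒≤ v>0))) (inv-pos d>0)

        private
          -- 16 bu bv Φ² = ((bu + u)(bv + v))² / (bu bv)
          clear : ∀ c → c * (fromℕ 16 * (u * v) * (bu * bv)) ≤ ((bu + u) * (bu + u)) * ((bv + v) * (bv + v)) →
            c * (u * v) ≤ bu * bv * (potential bu bv u v * potential bu bv u v)
          clear c h = *-cancelˡ-≤ (*-pos (fromℕ-pos 15) (*-pos bu>0 bv>0)) (≤-trans (≤-reflexive (r₁ c (u * v) (bu * bv)))
            (≤-trans h (≤-reflexive (sym (trans (r₂ (bu * bv) ((bu + u) * (bv + v)) ((fromℕ 4 * (bu * bv)) ⁻¹))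
               (trans (*-congˡ (*-cong inv inv)) (r₃ (bu + u) (bv + v))))))))
            where
            r₁ = ring 3 (λ c p b → # 16 ⊗ b ⊗ (c ⊗ p) ⊜ c ⊗ (# 16 ⊗ p ⊗ b)) refl
            r₂ = ring 3 (λ b w i → # 16 ⊗ b ⊗ (b ⊗ (w ⊗ i ⊗ (w ⊗ i))) ⊜ w ⊗ w ⊗ (# 4 ⊗ b ⊗ i ⊗ (# 4 ⊗ b ⊗ i))) refl
            r₃ = ring 2 (λ a b → a ⊗ b ⊗ (a ⊗ b) ⊗ (# 1 ⊗ # 1) ⊜ a ⊗ a ⊗ (b ⊗ b)) refl

          am-gm : ∀ a b → fromℕ 4 * (a * b) ≤ (b + a) * (b + a)
          am-gm a b = by≤ (sq-nonNeg (b - a)) (ring 2 (λ a b → (a ⊕ b) ⊗ (a ⊕ b) ⊕ # 0 ⊜ # 4 ⊗ (b ⊗ a) ⊕ (a ⊖ b) ⊗ (a ⊖ b)) refl _ _)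

          -- The difference of the two sides is (a - 2b)(2a - b).
          am-gm-gap : ∀ {a b} → 0# < b → fromℕ 2 * b ≤ a → fromℕ 9 * (a * b) ≤ fromℕ 2 * ((b + a) * (b + a))
          am-gm-gap {a} {b} b>0 h = by≤ (*-nonNeg (0≤-diff h) (0≤-diff b≤2a)) (ring 2 (λ a b → # 2 ⊗ ((a ⊕ b) ⊗ (a ⊕ b)) ⊕ # 0 ⊜ # 9 ⊗ (b ⊗ a) ⊕ (b ⊖ # 2 ⊗ a) ⊗ (# 2 ⊗ b ⊖ a)) refl _ _)
            where b≤2a : b ≤ fromℕ 2 * a
                  b≤2a = by≤ (*-monoˡ-≤ (fromℕ-nonNeg 2) h ⊞ *-monoˡ-≤ (fromℕ-nonNeg 3) (<⇒≤ b>0)) (ring 2 (λ a b → # 2 ⊗ a ⊕ (# 2 ⊗ (# 2 ⊗ b) ⊕ # 3 ⊗ # 0) ⊜ b ⊕ (# 2 ⊗ a ⊕ # 3 ⊗ b)) refl _ _)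

        potential-sq : u * v ≤ bu * bv * (potential bu bv u v * potential bu bv u v)
        potential-sq = ≤-respˡ (*-identityˡ _) (clear 1# (≤-trans (≤-reflexive (r u v bu bv))
          (*-mono-≤ (*-nonNeg (fromℕ-nonNeg 4) (<⇒≤ (*-pos u>0 bu>0))) (sq-nonNeg (bv + v)) (am-gm u bu) (am-gm v bv))))
          where r = ring 4 (λ u v bu bv → # 1 ⊗ (# 16 ⊗ (u ⊗ v) ⊗ (bu ⊗ bv)) ⊜ # 4 ⊗ (u ⊗ bu) ⊗ (# 4 ⊗ (v ⊗ bv))) refl

        potential-exit : exits u bu v bv ≡ true → growth * (u * v) ≤ bu * bv * (potential bu bv u v * potential bu bv u v)
        potential-exit e = clear growth (*-cancelˡ-≤ (fromℕ-pos 1) (≤-trans (≤-reflexive (trans (r₀ (fromℕ 8 ⁻¹) u v bu bv) (trans (*-congʳ 8⁻¹) (*-identityˡ _)))) (cases e)))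
          where
          r₀ = ring 5 (λ i u v bu bv → # 2 ⊗ (# 9 ⊗ i ⊗ (# 16 ⊗ (u ⊗ v) ⊗ (bu ⊗ bv))) ⊜ # 8 ⊗ i ⊗ (# 36 ⊗ (u ⊗ v ⊗ (bu ⊗ bv)))) refl
          cases : exits u bu v bv ≡ true → fromℕ 36 * (u * v * (bu * bv)) ≤ fromℕ 2 * (((bu + u) * (bu + u)) * ((bv + v) * (bv + v)))
          cases e with (fromℕ 2 * bu) <? u | (fromℕ 2 * bv) <? v
          ... | yes p | _ = ≤-trans (≤-reflexive (r u v bu bv)) (≤-trans
            (*-mono-≤ (*-nonNeg (fromℕ-nonNeg 9) (<⇒≤ (*-pos u>0 bu>0))) (sq-nonNeg (bv + v)) (am-gm-gap bu>0 (<⇒≤ p)) (am-gm v bv))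
            (≤-reflexive (*-assoc _ _ _)))
            where r = ring 4 (λ u v bu bv → # 36 ⊗ (u ⊗ v ⊗ (bu ⊗ bv)) ⊜ # 9 ⊗ (u ⊗ bu) ⊗ (# 4 ⊗ (v ⊗ bv))) refl
          ... | no _ | yes p = ≤-trans (≤-reflexive (r u v bu bv)) (≤-trans
            (*-mono-≤ (*-nonNeg (fromℕ-nonNeg 4) (<⇒≤ (*-pos u>0 bu>0))) (*-nonNeg (fromℕ-nonNeg 2) (sq-nonNeg (bv + v))) (am-gm u bu) (am-gm-gap bv>0 (<⇒≤ p)))
            (≤-reflexive (r′ ((bu + u) * (bu + u)) ((bv + v) * (bv + v)))))
            where r = ring 4 (λ u v bu bv → # 36 ⊗ (u ⊗ v ⊗ (bu ⊗ bv)) ⊜ # 4 ⊗ (u ⊗ bu) ⊗ (# 9 ⊗ (v ⊗ bv))) refl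
                  r′ = ring 2 (λ a b → a ⊗ (# 2 ⊗ b) ⊜ # 2 ⊗ (a ⊗ b)) refl
          cases () | no _ | no _

      potential-start : ∀ {u v} → 0# < u → 0# < v → potential u v u v ≈ 1#
      potential-start {u} {v} u>0 v>0 = trans (r u v ((fromℕ 4 * (u * v)) ⁻¹)) (*-inv (*-pos (fromℕ-pos 3) (*-pos u>0 v>0)))
        where r = ring 3 (λ u v i → (u ⊕ u) ⊗ (v ⊕ v) ⊗ i ⊜ # 4 ⊗ (u ⊗ v) ⊗ i) refl

      potential-mean : ∀ {l U U₁ U₀ V V₁ V₀} → Split l U U₁ U₀ V V₁ V₀ → ∀ x y bu bv →
        mean l (potential bu bv (U₁ x) (V₁ y)) (potential bu bv (U₀ x) (V₀ y)) ≈ potential bu bv (U x) (V y)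
      potential-mean {l} {U} {U₁} {U₀} {V} {V₁} {V₀} S x y bu bv = trans
        (r l bu bv (U₁ x) (U₀ x) (V₁ y) (V₀ y) ((fromℕ 4 * (bu * bv)) ⁻¹))
        (trans (*-congʳ (+-cong (+-cong (+-cong refl (*-congˡ (Split.meanʳ S y))) (*-congʳ (Split.meanˡ S x))) (Split.mean-product S x y)))
          (*-congʳ (r′ bu bv (U x) (V y))))
        where
        r = ring 8 (λ l bu bv u₁ u₀ v₁ v₀ i → l ⊗ ((bu ⊕ u₁) ⊗ (bv ⊕ v₁) ⊗ i) ⊕ (# 1 ⊖ l) ⊗ ((bu ⊕ u₀) ⊗ (bv ⊕ v₀) ⊗ i) ⊜ (bu ⊗ bv ⊕ bu ⊗ (l ⊗ v₁ ⊕ (# 1 ⊖ l) ⊗ v₀) ⊕ (l ⊗ u₁ ⊕ (# 1 ⊖ l) ⊗ u₀) ⊗ bv ⊕ (l ⊗ (u₁ ⊗ v₁) ⊕ (# 1 ⊖ l) ⊗ (u₀ ⊗ v₀))) ⊗ i) refl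
        r′ = ring 4 (λ bu bv u v → bu ⊗ bv ⊕ bu ⊗ v ⊕ u ⊗ bv ⊕ u ⊗ v ⊜ (bu ⊕ u) ⊗ (bv ⊕ v)) refl

      module LowerBound (q : Carrier) (q≥0 : 0# ≤ q) (q≤1 : q ≤ 1#) (F : Payoff) (cap : Carrier) (κ : Carrier) (κ≥0 : 0# ≤ κ)
        (F≥0 : ∀ s t u v → 0# < u → 0# < v → 0# ≤ F s t u v)
        (F≤ : ∀ s t u v → 0# < u → 0# < v → F s t u v ≤ u * v)
        (F-capped : ∀ s t u v → 0# < u → 0# < v → F s t u v * (u * v) ≤ F s t u v * cap)
        (cap≥0 : 0# ≤ cap)
        (x : A) (y : B) where
        open Simulation q q≥0 q≤1

        -- P is the product of the potentials at the restarts so far.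
        record Started (k : ℕ) (P bu bv : Carrier) : Set where
          field
            bu>0 : 0# < bu
            bv>0 : 0# < bv
            P≥0 : 0# ≤ P
            P² : growth ^ k * (bu * bv) ≤ P * P

        open Started

        full-nonNeg : ∀ {U V} (M : Mart U V) → 0# < U x → 0# < V y → 0# ≤ full F M x y
        full-nonNeg (leaf s t) p q = F≥0 _ _ _ _ p q
        full-nonNeg (node S M₁ M₀) p q = +-nonNeg
          (*-nonNeg (Split.l≥0 S) (full-nonNeg M₁ (Split.U₁>0 S x) (Split.V₁>0 S y)))
          (*-nonNeg (0≤-diff (Split.l≤1 S)) (full-nonNeg M₀ (Split.U₀>0 S x) (Split.V₀>0 S y)))

        -- At a leaf F² ≤ uv · cap, the product of two bounds on F. After k restarts the cap is paid
        -- for by the factor growth^k contained in P². The potential is a martingale, so the bound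
        -- passes from the leaves to every node.
        full≤potential : ∀ {U V} (M : Mart U V) → 0# < U x → 0# < V y → ∀ {k P bu bv} → Started k P bu bv →
          cap ≤ κ * κ * growth ^ k → full F M x y ≤ κ * P * potential bu bv (U x) (V y)
        full≤potential {U} {V} (leaf s t) p q {k} {P} {bu} {bv} st c = sq-cancel
          (*-nonNeg (*-nonNeg κ≥0 (P≥0 st)) (<⇒≤ Φ>0))
          (≤-trans (*-monoˡ-≤ F₀ (F≤ _ _ _ _ p q)) (≤-trans (F-capped _ _ _ _ p q) (≤-trans (*-monoʳ-≤ cap≥0 (F≤ _ _ _ _ p q))
          (≤-trans (*-monoˡ-≤ (<⇒≤ (*-pos p q)) c) (≤-trans (≤-reflexive (r₁ (U x * V y) (κ * κ) (growth ^ k)))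
          (≤-trans (*-monoˡ-≤ (*-nonNeg (sq-nonNeg κ) (^-nonNeg k (<⇒≤ growth-pos))) (potential-sq (bu>0 st) (bv>0 st) p q))
          (≤-trans (≤-reflexive (r₂ (κ * κ) (growth ^ k) (bu * bv) (Φ * Φ)))
          (≤-trans (*-monoˡ-≤ (*-nonNeg (sq-nonNeg κ) (sq-nonNeg Φ)) (P² st)) (≤-reflexive (r₃ κ Φ P))))))))))
          where
          Φ = potential bu bv (U x) (V y)
          Φ>0 = potential-pos (bu>0 st) (bv>0 st) p q
          F₀ = F≥0 (s x) (t y) (U x) (V y) p q
          r₁ = ring 3 (λ a b c → a ⊗ (b ⊗ c) ⊜ b ⊗ c ⊗ a) refl
          r₂ = ring 4 (λ a b c d → a ⊗ b ⊗ (c ⊗ d) ⊜ a ⊗ d ⊗ (b ⊗ c)) refl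
          r₃ = ring 3 (λ k f p → k ⊗ k ⊗ (f ⊗ f) ⊗ (p ⊗ p) ⊜ k ⊗ p ⊗ f ⊗ (k ⊗ p ⊗ f)) refl
        full≤potential {U} {V} (node {l = l} S M₁ M₀) p q {k} {P} {bu} {bv} st c = ≤-trans
          (mean-≤ (Split.l≥0 S) (Split.l≤1 S) (full≤potential M₁ (Split.U₁>0 S x) (Split.V₁>0 S y) st c)
                                              (full≤potential M₀ (Split.U₀>0 S x) (Split.V₀>0 S y) st c))
          (≤-reflexive (trans (sym (mean-scale l (κ * P) _ _)) (*-congˡ (potential-mean S x y bu bv))))

        -- Apart from the factors q, the walk misses only the paths that exit with no restart left,
        -- and there `full≤potential` applies. At a restart the old potential is absorbed into P and
        -- the new one starts at one.
        walk-lower : ∀ J {U V} (M : Mart U V) → 0# < U x → 0# < V y → ∀ {k P bu bv} → Started k P bu bv →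
          cap ≤ κ * κ * growth ^ (k ℕ.+ J) →
          q ^ suc J * full F M x y ≤ walk F J bu bv M x y + κ * P * potential bu bv (U x) (V y)
        walk-lower J {U} {V} (leaf s t) p p′ {k} {P} {bu} {bv} st c = by≤
          (≤-trans (≤-reflexive (r q (q ^ J) (F (s x) (t y) (U x) (V y)))) (≤-respʳ (*-identityˡ _) (*-monoʳ-≤ (*-nonNeg q≥0 F₀) (^-≤1 J q≥0 q≤1)))
           ⊞ *-nonNeg (*-nonNeg κ≥0 (P≥0 st)) (<⇒≤ (potential-pos (bu>0 st) (bv>0 st) p p′))) (ring 10 (λ a b c d e f g h i j → a ⊗ b ⊕ c ⊗ d ⊗ ((e ⊕ f) ⊗ (g ⊕ h) ⊗ i) ⊕ (a ⊗ j ⊗ b ⊕ # 0) ⊜ a ⊗ j ⊗ b ⊕ (a ⊗ b ⊕ c ⊗ d ⊗ ((e ⊕ f) ⊗ (g ⊕ h) ⊗ i))) refl _ _ _ _ _ _ _ _ _ _)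
          where
          F₀ = F≥0 (s x) (t y) (U x) (V y) p p′
          r = ring 3 (λ a b c → a ⊗ b ⊗ c ⊜ b ⊗ (a ⊗ c)) refl
        walk-lower J {U} {V} (node S M₁ M₀) p p′ {k} {P} {bu} {bv} st c with exits (U x) bu (V y) bv in exit
        walk-lower zero {U} {V} (node S M₁ M₀) p p′ {k} {P} {bu} {bv} st c | true = ≤-trans
          (≤-trans (*-monoʳ-≤ (full-nonNeg (node S M₁ M₀) p p′) (^-≤1 1 q≥0 q≤1)) (≤-reflexive (*-identityˡ _)))
          (≤-respʳ (sym (+-identityˡ _)) (full≤potential (node S M₁ M₀) p p′ st (≡.subst (λ j → cap ≤ κ * κ * growth ^ j) (ℕₚ.+-identityʳ k) c)))
        walk-lower (suc J) {U} {V} (node S M₁ M₀) p p′ {k} {P} {bu} {bv} st c | true = ≤-trans (≤-reflexive (*-assoc q (q ^ suc J) _))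
          (≤-trans (*-monoˡ-≤ q≥0 (walk-lower J (node S M₁ M₀) p p′ {suc k} {P * Φ} {U x} {V y} st′ (≡.subst (λ j → cap ≤ κ * κ * growth ^ j) (ℕₚ.+-suc k J) c)))
          (≤-trans (≤-reflexive (trans (*-congˡ (+-congˡ (trans (*-congˡ (potential-start p p′)) (*-identityʳ _)))) (r q (walk F J (U x) (V y) (node S M₁ M₀) x y) κ P Φ)))
            (≤-refl ⊞ ≤-respʳ (*-identityˡ _) (*-monoʳ-≤ (*-nonNeg (*-nonNeg κ≥0 (P≥0 st)) (<⇒≤ Φ>0)) q≤1))))
          where
          Φ = potential bu bv (U x) (V y)
          Φ>0 = potential-pos (bu>0 st) (bv>0 st) p p′
          r = ring 5 (λ q w k P f → q ⊗ (w ⊕ k ⊗ (P ⊗ f)) ⊜ q ⊗ w ⊕ q ⊗ (k ⊗ P ⊗ f)) refl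
          st′ : Started (suc k) (P * Φ) (U x) (V y)
          st′ = record { bu>0 = p ; bv>0 = p′ ; P≥0 = *-nonNeg (P≥0 st) (<⇒≤ Φ>0) ; P² =
            ≤-trans (≤-reflexive (r₁ growth (growth ^ k) (U x * V y))) (≤-trans (*-monoˡ-≤ (^-nonNeg k (<⇒≤ growth-pos)) (potential-exit (bu>0 st) (bv>0 st) p p′ exit))
              (≤-trans (≤-reflexive (r₂ (growth ^ k) (bu * bv) (Φ * Φ))) (≤-trans (*-monoʳ-≤ (sq-nonNeg Φ) (P² st)) (≤-reflexive (r₃ P Φ))))) }
            where
            r₁ = ring 3 (λ g h a → g ⊗ h ⊗ a ⊜ h ⊗ (g ⊗ a)) refl
            r₂ = ring 3 (λ a b c → a ⊗ (b ⊗ c) ⊜ a ⊗ b ⊗ c) refl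
            r₃ = ring 2 (λ P f → P ⊗ P ⊗ (f ⊗ f) ⊜ P ⊗ f ⊗ (P ⊗ f)) refl
        walk-lower J {U} {V} (node {l = l} S M₁ M₀) p p′ {k} {P} {bu} {bv} st c | false = ≤-trans (≤-reflexive (mean-scale l (q ^ suc J) _ _))
          (≤-trans (mean-≤ (Split.l≥0 S) (Split.l≤1 S) (walk-lower J M₁ (Split.U₁>0 S x) (Split.V₁>0 S y) st c)
                                                       (walk-lower J M₀ (Split.U₀>0 S x) (Split.V₀>0 S y) st c))
          (≤-reflexive (trans (r l (walk F J bu bv M₁ x y) (walk F J bu bv M₀ x y) (κ * P) _ _) (+-congˡ (*-congˡ (potential-mean S x y bu bv))))))
          where r = ring 6 (λ l a b k c d → l ⊗ (a ⊕ k ⊗ c) ⊕ (# 1 ⊖ l) ⊗ (b ⊕ k ⊗ d) ⊜ l ⊗ a ⊕ (# 1 ⊖ l) ⊗ b ⊕ k ⊗ (l ⊗ c ⊕ (# 1 ⊖ l) ⊗ d)) refl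

  -- Rejection sampling of the restarted walk.

  module WalkSimulation where
    open OrderedField
    open FiniteSums
    open AchievableOutputs
    open RestartedWalk

    -- An acceptance probability must lie in the unit interval at every node that two announcements
    -- can name. At the true stopping node `stop-bound` shows that nothing is cut off.
    clip : Carrier → Carrier
    clip c with c ≤? 1#
    ... | yes _ = c
    ... | no _ = 1#

    clip-≤1 : ∀ c → clip c ≤ 1#
    clip-≤1 c with c ≤? 1#
    ... | yes p = p
    ... | no _ = ≤-refl

    clip-nonNeg : ∀ {c} → 0# ≤ c → 0# ≤ clip c
    clip-nonNeg {c} p with c ≤? 1#
    ... | yes _ = p
    ... | no _ = 0≤1

    clip-id : ∀ {c} → c ≤ 1# → clip c ≈ c
    clip-id {c} p with c ≤? 1#
    ... | yes _ = refl
    ... | no ¬p = ⊥-elim (¬p p)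

    module _ {A B : Set} where
      record Node : Set where
        constructor node-of
        field
          {NU} : A → Carrier
          {NV} : B → Carrier
          mart : Mart NU NV

      open Node

      record Positive (N : Node) : Set where
        field
          U>0 : ∀ x → 0# < NU N x
          V>0 : ∀ y → 0# < NV N y

      open Positive

      -- A root-to-leaf path, drawn publicly as a whole, so that each player can locate his own exit
      -- on it without interaction.
      data Path : ∀ {U V} → Mart {A} {B} U V → Set where
        end : ∀ {U V s t} → Path (leaf {U = U} {V} s t)
        up : ∀ {U V l U₁ U₀ V₁ V₀} {S : Split l U U₁ U₀ V V₁ V₀} {M₁ M₀} → Path M₁ → Path (node S M₁ M₀)
        down : ∀ {U V l U₁ U₀ V₁ V₀} {S : Split l U U₁ U₀ V V₁ V₀} {M₁ M₀} → Path M₀ → Path (node S M₁ M₀)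

      average : ∀ {U V} (M : Mart U V) → (Path M → Carrier) → Carrier
      average (leaf s t) K = K end
      average (node {l = l} _ M₁ M₀) K = mean l (average M₁ λ p → K (up p)) (average M₀ λ p → K (down p))

      average-cong : ∀ {U V} (M : Mart U V) {K L : Path M → Carrier} → (∀ p → K p ≈ L p) → average M K ≈ average M L
      average-cong (leaf _ _) h = h end
      average-cong (node _ M₁ M₀) h = mean-cong (average-cong M₁ λ p → h (up p)) (average-cong M₀ λ p → h (down p))

      average-const : ∀ {U V} (M : Mart U V) c → average M (λ _ → c) ≈ c
      average-const (leaf _ _) c = refl
      average-const (node {l = l} _ M₁ M₀) c = trans (mean-cong (average-const M₁ c) (average-const M₀ c)) (sym (mean-const l c))

      average-linear : ∀ {U V} (M : Mart U V) c d (K L : Path M → Carrier) →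
        average M (λ p → c * K p + d * L p) ≈ c * average M K + d * average M L
      average-linear (leaf _ _) c d K L = refl
      average-linear (node {l = l} _ M₁ M₀) c d K L = trans
        (mean-cong (average-linear M₁ c d (λ p → K (up p)) (λ p → L (up p))) (average-linear M₀ c d (λ p → K (down p)) (λ p → L (down p))))
        (sym (mean-linear l c d _ _ _ _))

      achieve-average : ∀ {c U V} (M : Mart U V) {K : Path M → A → B → Carrier} → (∀ p → Achievable A B c (K p)) →
        Achievable A B c (λ x y → average M λ p → K p x y)
      achieve-average (leaf _ _) h = h end
      achieve-average (node {l = l} S M₁ M₀) h = toss l (Split.l≥0 S) (Split.l≤1 S)
        (achieve-average M₁ λ p → h (up p)) (achieve-average M₀ λ p → h (down p)) λ _ _ → refl

      nodeAt : ∀ {U V} {M : Mart U V} → Path M → ℕ → Node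
      nodeAt {M = M} end _ = node-of M
      nodeAt {M = M} (up p) zero = node-of M
      nodeAt (up p) (suc k) = nodeAt p k
      nodeAt {M = M} (down p) zero = node-of M
      nodeAt (down p) (suc k) = nodeAt p k

      nodeAt-height : ∀ {U V} {M : Mart U V} (p : Path M) k → height (mart (nodeAt p k)) ℕ.≤ height M
      nodeAt-height end k = ℕₚ.≤-refl
      nodeAt-height (up p) zero = ℕₚ.≤-refl
      nodeAt-height (up {M₁ = M₁} {M₀} p) (suc k) = ℕₚ.m≤n⇒m≤1+n (ℕₚ.≤-trans (nodeAt-height p k) (ℕₚ.m≤m⊔n (height M₁) (height M₀)))
      nodeAt-height (down p) zero = ℕₚ.≤-refl
      nodeAt-height (down {M₁ = M₁} {M₀} p) (suc k) = ℕₚ.m≤n⇒m≤1+n (ℕₚ.≤-trans (nodeAt-height p k) (ℕₚ.m≤n⊔m (height M₁) (height M₀)))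

      nodeAt-positive : ∀ {U V} {M : Mart U V} → Positive (node-of M) → (p : Path M) → ∀ k → Positive (nodeAt p k)
      nodeAt-positive P end k = P
      nodeAt-positive P (up p) zero = P
      nodeAt-positive P (up {S = S} p) (suc k) = nodeAt-positive (record { U>0 = Split.U₁>0 S ; V>0 = Split.V₁>0 S }) p k
      nodeAt-positive P (down p) zero = P
      nodeAt-positive P (down {S = S} p) (suc k) = nodeAt-positive (record { U>0 = Split.U₀>0 S ; V>0 = Split.V₀>0 S }) p k

      exitsᵒ : Carrier → Carrier → Bool
      exitsᵒ u bu = does ((fromℕ 2 * bu) <? u)

      module _ (bU : A → Carrier) (x : A) where
        indexˡ : ∀ {U V} {M : Mart U V} → Path M → ℕ
        indexˡ end = 0
        indexˡ {U} (up p) = if exitsᵒ (U x) (bU x) then 0 else suc (indexˡ p)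
        indexˡ {U} (down p) = if exitsᵒ (U x) (bU x) then 0 else suc (indexˡ p)

        indexˡ-≤ : ∀ {U V} {M : Mart U V} (p : Path M) → indexˡ p ℕ.≤ height M
        indexˡ-≤ end = ℕ.z≤n
        indexˡ-≤ {U} (up {M₁ = M₁} {M₀} p) with exitsᵒ (U x) (bU x)
        ... | true = ℕ.z≤n
        ... | false = ℕ.s≤s (ℕₚ.≤-trans (indexˡ-≤ p) (ℕₚ.m≤m⊔n (height M₁) (height M₀)))
        indexˡ-≤ {U} (down {M₁ = M₁} {M₀} p) with exitsᵒ (U x) (bU x)
        ... | true = ℕ.z≤n
        ... | false = ℕ.s≤s (ℕₚ.≤-trans (indexˡ-≤ p) (ℕₚ.m≤n⊔m (height M₁) (height M₀)))

      module _ (bV : B → Carrier) (y : B) where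
        indexʳ : ∀ {U V} {M : Mart U V} → Path M → ℕ
        indexʳ end = 0
        indexʳ {V = V} (up p) = if exitsᵒ (V y) (bV y) then 0 else suc (indexʳ p)
        indexʳ {V = V} (down p) = if exitsᵒ (V y) (bV y) then 0 else suc (indexʳ p)

        indexʳ-≤ : ∀ {U V} {M : Mart U V} (p : Path M) → indexʳ p ℕ.≤ height M
        indexʳ-≤ end = ℕ.z≤n
        indexʳ-≤ {V = V} (up {M₁ = M₁} {M₀} p) with exitsᵒ (V y) (bV y)
        ... | true = ℕ.z≤n
        ... | false = ℕ.s≤s (ℕₚ.≤-trans (indexʳ-≤ p) (ℕₚ.m≤m⊔n (height M₁) (height M₀)))
        indexʳ-≤ {V = V} (down {M₁ = M₁} {M₀} p) with exitsᵒ (V y) (bV y)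
        ... | true = ℕ.z≤n
        ... | false = ℕ.s≤s (ℕₚ.≤-trans (indexʳ-≤ p) (ℕₚ.m≤n⊔m (height M₁) (height M₀)))

      module _ (bu bv : Carrier) (x : A) (y : B) where
        stop : ∀ {U V} {M : Mart U V} → Path M → Node
        stop {M = M} end = node-of M
        stop {U} {V} {M} (up p) = if exits {A} {B} (U x) bu (V y) bv then node-of M else stop p
        stop {U} {V} {M} (down p) = if exits {A} {B} (U x) bu (V y) bv then node-of M else stop p

        private
          within : ∀ {u v} → exits {A} {B} u bu v bv ≡ false → (u ≤ fromℕ 2 * bu) × (v ≤ fromℕ 2 * bv)
          within {u} {v} e with (fromℕ 2 * bu) <? u | (fromℕ 2 * bv) <? v
          ... | no p | no q = ≮⇒≥ p , ≮⇒≥ q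

          grow : ∀ {u′ u b} → u′ ≤ fromℕ 4 * u → u ≤ fromℕ 2 * b → u′ ≤ fromℕ 8 * b
          grow p q = by≤ (p ⊞ *-monoˡ-≤ (fromℕ-nonNeg 4) q) (ring 3 (λ a b c → # 8 ⊗ a ⊕ (b ⊕ # 4 ⊗ c) ⊜ b ⊕ (# 4 ⊗ c ⊕ # 4 ⊗ (# 2 ⊗ a))) refl _ _ _)

        -- Before the last step no ratio exceeded twice its base, and a step multiplies a ratio by
        -- at most 4; this is the 8 in the acceptance probabilities.
        stop-bound : ∀ {U V} {M : Mart U V} (p : Path M) → U x ≤ fromℕ 8 * bu → V y ≤ fromℕ 8 * bv →
          (NU (stop p) x ≤ fromℕ 8 * bu) × (NV (stop p) y ≤ fromℕ 8 * bv)
        stop-bound end h k = h , k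
        stop-bound {U} {V} (up {S = S} p) h k with exits {A} {B} (U x) bu (V y) bv in e
        ... | true = h , k
        ... | false = stop-bound p (grow (Split.U₁≤ S x) (proj₁ (within e))) (grow (Split.V₁≤ S y) (proj₂ (within e)))
        stop-bound {U} {V} (down {S = S} p) h k with exits {A} {B} (U x) bu (V y) bv in e
        ... | true = h , k
        ... | false = stop-bound p (grow (Split.U₀≤ S x) (proj₁ (within e))) (grow (Split.V₀≤ S y) (proj₂ (within e)))

        -- Optional stopping for the martingale u v.
        stop-product : ∀ {U V} (M : Mart U V) → average M (λ p → NU (stop p) x * NV (stop p) y) ≈ U x * V y
        stop-product (leaf _ _) = refl
        stop-product {U} {V} (node S M₁ M₀) with exits {A} {B} (U x) bu (V y) bv
        ... | true = average-const (node S M₁ M₀) (U x * V y)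
        ... | false = trans (mean-cong (stop-product M₁) (stop-product M₀)) (Split.mean-product S x y)

      -- The joint exit is the earlier of the two private exits, so announcing both indices
      -- determines it.
      stop-index : ∀ bU bV x y {U V} {M : Mart U V} (p : Path M) →
        nodeAt p (indexˡ bU x p ⊓ indexʳ bV y p) ≡ stop (bU x) (bV y) x y p
      stop-index bU bV x y end = ≡.refl
      stop-index bU bV x y {U} {V} (up p) with exitsᵒ (U x) (bU x) | exitsᵒ (V y) (bV y)
      ... | true | _ = ≡.refl
      ... | false | true = ≡.refl
      ... | false | false = stop-index bU bV x y p
      stop-index bU bV x y {U} {V} (down p) with exitsᵒ (U x) (bU x) | exitsᵒ (V y) (bV y)
      ... | true | _ = ≡.refl
      ... | false | true = ≡.refl
      ... | false | false = stop-index bU bV x y p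

      signedProduct : Payoff {A} {B}
      signedProduct s t u v = u * v * sign (s xor t)

      module Restart (q : Carrier) (q≥0 : 0# ≤ q) (q≤1 : q ≤ 1#) where
        open Simulation {A} {B} q q≥0 q≤1

        -- The conditional expected output of the walk restarted at its root.
        output-from : ∀ {U V} → ℕ → Mart U V → A → B → Carrier
        output-from {U} {V} J M x y = walk signedProduct J (U x) (V y) M x y * (U x * V y) ⁻¹

        continue : ℕ → Node → A → B → Carrier
        continue J (node-of (leaf s t)) x y = sign (s x xor t y)
        continue zero (node-of (node _ _ _)) x y = 0#
        continue (suc J) (node-of (node S M₁ M₀)) x y = output-from J (node S M₁ M₀) x y

        -- The walk up to its first exit is an expectation over public paths; `continue` contains
        -- everything after it.
        walk-average : ∀ J bu bv x y {U V} (M : Mart U V) → 0# < U x → 0# < V y →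
          walk signedProduct J bu bv M x y ≈
          q * average M (λ p → NU (stop bu bv x y p) x * NV (stop bu bv x y p) y * continue J (stop bu bv x y p) x y)
        walk-average J bu bv x y (leaf s t) p p′ = refl
        walk-average J bu bv x y {U} {V} (node S M₁ M₀) p p′ with exits {A} {B} (U x) bu (V y) bv
        walk-average zero bu bv x y {U} {V} (node S M₁ M₀) p p′ | true =
          sym (trans (*-congˡ (average-const (node S M₁ M₀) (U x * V y * 0#))) (trans (*-congˡ (zeroʳ _)) (zeroʳ _)))
        walk-average (suc J) bu bv x y {U} {V} (node S M₁ M₀) p p′ | true = *-congˡ (sym (trans
          (average-const (node S M₁ M₀) (U x * V y * output-from J (node S M₁ M₀) x y))
          (trans (r (U x * V y) (walk signedProduct J (U x) (V y) (node S M₁ M₀) x y) ((U x * V y) ⁻¹))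
            (trans (*-congˡ (*-inv (*-pos p p′))) (*-identityʳ _)))))
          where r = ring 3 (λ a w i → a ⊗ (w ⊗ i) ⊜ w ⊗ (a ⊗ i)) refl
        walk-average J bu bv x y (node {l = l} S M₁ M₀) p p′ | false = trans
          (mean-cong (walk-average J bu bv x y M₁ (Split.U₁>0 S x) (Split.V₁>0 S y)) (walk-average J bu bv x y M₀ (Split.U₀>0 S x) (Split.V₀>0 S y)))
          (sym (mean-scale l q _ _))

      module Rounds (ℓ R : ℕ) where
        -- Each player accepts with probability his ratio over 8 times its base. By optional
        -- stopping the expected product of the two is 1/64, whatever the inputs.
        reject : Carrier
        reject = fromℕ 63 * fromℕ 64 ⁻¹

        q : Carrier
        q = 1# - reject ^ R

        64⁻¹ : fromℕ 64 * fromℕ 64 ⁻¹ ≈ 1#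
        64⁻¹ = *-inv (fromℕ-pos 63)

        reject≥0 : 0# ≤ reject
        reject≥0 = *-nonNeg (fromℕ-nonNeg 63) (<⇒≤ (inv-pos (fromℕ-pos 63)))

        reject≤1 : reject ≤ 1#
        reject≤1 = by≤ (≤-reflexive 64⁻¹ ⊞ <⇒≤ (inv-pos (fromℕ-pos 63))) (r (fromℕ 64 ⁻¹))
          where r = ring 1 (λ i → # 1 ⊕ (# 64 ⊗ i ⊕ # 0) ⊜ # 63 ⊗ i ⊕ (# 1 ⊕ i)) refl

        q≥0 : 0# ≤ q
        q≥0 = by≤ (^-≤1 R reject≥0 reject≤1) (ring 1 (λ a → # 1 ⊖ a ⊕ a ⊜ # 0 ⊕ # 1) refl _)

        q≤1 : q ≤ 1#
        q≤1 = by≤ (^-nonNeg R reject≥0) (ring 1 (λ a → # 1 ⊕ # 0 ⊜ # 1 ⊖ a ⊕ a) refl _)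

        open Simulation {A} {B} q q≥0 q≤1
        open Restart q q≥0 q≤1 public

        step : ℕ
        step = ℓ ℕ.+ (ℓ ℕ.+ 2)

        cost-continue : ℕ → ℕ
        cost-continue zero = 2
        cost-continue (suc J) = R ℕ.* step ℕ.+ cost-continue J

        module _ (J : ℕ) {U V} (M : Mart U V) (P : Positive (node-of M)) (fits : height M ℕ.< 2 ℕ.^ ℓ)
          (c : ℕ) (go : ∀ N → Positive N → height (mart N) ℕ.< 2 ℕ.^ ℓ → Achievable A B c (continue J N)) where

          private
            acceptˡ : Node → A → Carrier
            acceptˡ N x = clip (NU N x * (fromℕ 8 * U x) ⁻¹)

            acceptʳ : Node → B → Carrier
            acceptʳ N y = clip (NV N y * (fromℕ 8 * V y) ⁻¹)

            accept : Node → (A → B → Carrier) → A → B → Carrier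
            accept N ψ x y = acceptˡ N x * (acceptʳ N y * continue J N x y + (1# - acceptʳ N y) * ψ x y) + (1# - acceptˡ N x) * ψ x y

            achieve-accept : ∀ {d N ψ} → Positive N → height (mart N) ℕ.< 2 ℕ.^ ℓ → c ℕ.≤ d → Achievable A B d ψ →
              Achievable A B (suc (suc d)) (accept N ψ)
            achieve-accept {N = N} PN hN c≤d s = sayˡ (acceptˡ N)
              (λ x → clip-nonNeg (*-nonNeg (<⇒≤ (U>0 PN x)) (<⇒≤ (inv-pos (*-pos (fromℕ-pos 7) (U>0 P x)))))) (λ x → clip-≤1 _)
              (sayʳ (acceptʳ N) (λ y → clip-nonNeg (*-nonNeg (<⇒≤ (V>0 PN y)) (<⇒≤ (inv-pos (*-pos (fromℕ-pos 7) (V>0 P y)))))) (λ y → clip-≤1 _)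
                (weaken c≤d (go N PN hN)) s λ _ _ → refl)
              (weaken (ℕₚ.n≤1+n _) s) λ _ _ → refl

          round : (A → B → Carrier) → A → B → Carrier
          round ψ x y = average M λ p → accept (nodeAt p (indexˡ U x p ⊓ indexʳ V y p)) ψ x y

          achieve-round : ∀ {d ψ} → c ℕ.≤ d → Achievable A B d ψ → Achievable A B (step ℕ.+ d) (round ψ)
          achieve-round {d} {ψ} c≤d s = ≡.subst (λ e → Achievable A B e (round ψ)) size-eq
            (achieve-average M λ p →
              announceˡ ℓ (λ x → indexˡ U x p) (λ x → ℕₚ.≤-<-trans (indexˡ-≤ U x p) fits)
                (λ j x y → accept (nodeAt p (j ⊓ indexʳ V y p)) ψ x y) λ j →
              announceʳ ℓ (λ y → indexʳ V y p) (λ y → ℕₚ.≤-<-trans (indexʳ-≤ V y p) fits)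
                (λ k x y → accept (nodeAt p (j ⊓ k)) ψ x y) λ k →
              achieve-accept (nodeAt-positive P p (j ⊓ k)) (ℕₚ.≤-<-trans (nodeAt-height p (j ⊓ k)) fits) c≤d s)
            where
            size-eq : ℓ ℕ.+ (ℓ ℕ.+ suc (suc d)) ≡ step ℕ.+ d
            size-eq = ≡.sym (≡.trans (ℕₚ.+-assoc ℓ (ℓ ℕ.+ 2) d) (≡.cong (ℓ ℕ.+_) (ℕₚ.+-assoc ℓ 2 d)))

          -- The expected output conditioned on acceptance.
          target : A → B → Carrier
          target x y = average M (λ p → NU (stop (U x) (V y) x y p) x * NV (stop (U x) (V y) x y p) y * continue J (stop (U x) (V y) x y p) x y) * (U x * V y) ⁻¹

          -- Accepted nodes have a law proportional to u v, and the chance of acceptance does not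
          -- depend on x and y. The rounds thus form a geometric series with ratio `reject`.
          round-value : ∀ ψ x y → round ψ x y ≈ fromℕ 64 ⁻¹ * target x y + reject * ψ x y
          round-value ψ x y = trans (average-cong M λ p → trans (reflexive (≡.cong (λ N → accept N ψ x y) (stop-index U V x y p))) (pointwise p))
            (trans (average-linear M (i * d) 1# _ _) (trans (+-congˡ (*-congˡ (trans (average-linear M (- (i * d * ψ x y)) (ψ x y) _ _)
              (+-cong (*-congˡ (stop-product (U x) (V y) x y M)) (*-congˡ (average-const M 1#))))))
            (trans (r₁ i d (average M λ p → NU (N′ p) x * NV (N′ p) y * continue J (N′ p) x y) (ψ x y) (U x * V y)) (+-congˡ (trans (*-congˡ (+-congˡ (-‿cong (trans (*-congˡ (trans (*-comm _ _) (*-inv UV>0))) (*-identityʳ i))))) reject-eq)))))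
            where
            i = fromℕ 64 ⁻¹
            UV>0 = *-pos (U>0 P x) (V>0 P y)
            d = (U x * V y) ⁻¹
            N′ : Path M → Node
            N′ p = stop (U x) (V y) x y p
            r₁ = ring 5 (λ i d t ψ w → i ⊗ d ⊗ t ⊕ # 1 ⊗ (⊝ (i ⊗ d ⊗ ψ) ⊗ w ⊕ ψ ⊗ # 1) ⊜ i ⊗ (t ⊗ d) ⊕ ψ ⊗ (# 1 ⊖ i ⊗ (d ⊗ w))) refl
            reject-eq : ψ x y * (1# - i) ≈ reject * ψ x y
            reject-eq = trans (*-comm _ _) (*-congʳ (by≈ (sym 64⁻¹) (r₂ i)))
              where r₂ = ring 1 (λ i → # 63 ⊗ i ⊕ # 1 ⊜ # 1 ⊖ i ⊕ # 64 ⊗ i) refl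
            ratio : ∀ {a b} → 0# < b → a ≤ fromℕ 8 * b → clip (a * (fromℕ 8 * b) ⁻¹) ≈ a * (fromℕ 8 * b) ⁻¹
            ratio {a} {b} b>0 h = clip-id (/-≤ (*-pos (fromℕ-pos 7) b>0) (≤-respʳ (sym (*-identityˡ _)) h))
            own : ∀ {a} → 0# < a → a ≤ fromℕ 8 * a
            own h = by≤ (*-monoˡ-≤ (fromℕ-nonNeg 7) (<⇒≤ h)) (ring 1 (λ a → # 8 ⊗ a ⊕ # 7 ⊗ # 0 ⊜ a ⊕ # 7 ⊗ a) refl _)
            inverses : (fromℕ 8 * U x) ⁻¹ * (fromℕ 8 * V y) ⁻¹ ≈ i * d
            inverses = *-cancelˡ-≈ (*-pos (fromℕ-pos 63) UV>0) (trans (r₃ (U x) (V y) ((fromℕ 8 * U x) ⁻¹) ((fromℕ 8 * V y) ⁻¹))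
              (trans (*-cong (*-inv (*-pos (fromℕ-pos 7) (U>0 P x))) (*-inv (*-pos (fromℕ-pos 7) (V>0 P y))))
              (sym (trans (r₄ (U x * V y) i d) (*-cong 64⁻¹ (*-inv UV>0))))))
              where r₃ = ring 4 (λ u v a b → # 64 ⊗ (u ⊗ v) ⊗ (a ⊗ b) ⊜ # 8 ⊗ u ⊗ a ⊗ (# 8 ⊗ v ⊗ b)) refl
                    r₄ = ring 3 (λ w i d → # 64 ⊗ w ⊗ (i ⊗ d) ⊜ # 64 ⊗ i ⊗ (w ⊗ d)) refl
            pointwise : ∀ p → accept (N′ p) ψ x y ≈
              (i * d) * (NU (N′ p) x * NV (N′ p) y * continue J (N′ p) x y) +
              1# * ((- (i * d * ψ x y)) * (NU (N′ p) x * NV (N′ p) y) + ψ x y * 1#)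
            pointwise p = trans (+-cong (*-cong a≈ (+-cong (*-congʳ b≈) (*-congʳ (+-congˡ (-‿cong b≈))))) (*-congʳ (+-congˡ (-‿cong a≈))))
              (trans (r₅ (NU (N′ p) x) (NV (N′ p) y) ((fromℕ 8 * U x) ⁻¹) ((fromℕ 8 * V y) ⁻¹) (continue J (N′ p) x y) (ψ x y))
              (trans (+-cong (*-congʳ inverses) (*-congˡ (+-congʳ (*-congʳ (-‿cong (*-congʳ inverses)))))) refl))
              where
              bound = stop-bound (U x) (V y) x y p (own (U>0 P x)) (own (V>0 P y))
              a≈ = ratio (U>0 P x) (proj₁ bound)
              b≈ = ratio (V>0 P y) (proj₂ bound)
              r₅ = ring 6 (λ u v a b c ψ → u ⊗ a ⊗ (v ⊗ b ⊗ c ⊕ (# 1 ⊖ v ⊗ b) ⊗ ψ) ⊕ (# 1 ⊖ u ⊗ a) ⊗ ψ ⊜ a ⊗ b ⊗ (u ⊗ v ⊗ c) ⊕ # 1 ⊗ (⊝ (a ⊗ b ⊗ ψ) ⊗ (u ⊗ v) ⊕ ψ ⊗ # 1)) refl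

          rounds : ℕ → A → B → Carrier
          rounds zero x y = 0#
          rounds (suc r) = round (rounds r)

          achieve-rounds : ∀ r → Achievable A B (r ℕ.* step ℕ.+ c) (rounds r)
          achieve-rounds zero = achieve-0
          achieve-rounds (suc r) = ≡.subst (λ e → Achievable A B e (rounds (suc r))) (≡.sym (ℕₚ.+-assoc step (r ℕ.* step) c))
            (achieve-round (ℕₚ.m≤n+m c (r ℕ.* step)) (achieve-rounds r))

          rounds-value : ∀ r x y → rounds r x y ≈ (1# - reject ^ r) * target x y
          rounds-value zero x y = trans (sym (zeroˡ _)) (*-congʳ (ring 0 (# 0 ⊜ # 1 ⊖ # 1) refl))
          rounds-value (suc r) x y = trans (round-value (rounds r) x y) (trans (+-congˡ (*-congˡ (rounds-value r x y)))
            (by≈ (*-congʳ {target x y} 64⁻¹) (e (fromℕ 64 ⁻¹) (reject ^ r) (target x y))))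
            where e = ring 3 (λ i s t → (# 1 ⊖ # 63 ⊗ i ⊗ s) ⊗ t ⊕ # 64 ⊗ i ⊗ t ⊜ i ⊗ t ⊕ # 63 ⊗ i ⊗ ((# 1 ⊖ s) ⊗ t) ⊕ # 1 ⊗ t) refl

          achieve-output : Achievable A B (R ℕ.* step ℕ.+ c) (output-from J M)
          achieve-output = respect (λ x y → trans (*-congʳ (walk-average J (U x) (V y) x y M (U>0 P x) (V>0 P y)))
            (trans (*-assoc _ _ _) (sym (rounds-value R x y)))) (achieve-rounds R)

        achieve-continue : ∀ J N → Positive N → height (mart N) ℕ.< 2 ℕ.^ ℓ → Achievable A B (cost-continue J) (continue J N)
        achieve-continue J (node-of (leaf s t)) P h = weaken (two≤ J) (achieve-signs s t)
          where
          two≤ : ∀ J → 2 ℕ.≤ cost-continue J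
          two≤ zero = ℕₚ.≤-refl
          two≤ (suc J) = ℕₚ.≤-trans (two≤ J) (ℕₚ.m≤n+m _ (R ℕ.* step))
        achieve-continue zero (node-of (node S M₁ M₀)) P h = achieve-0
        achieve-continue (suc J) (node-of (node S M₁ M₀)) P h =
          achieve-output J (node S M₁ M₀) P h (cost-continue J) (achieve-continue J)

        achieve-walk : ∀ J {U V} (M : Mart U V) → Positive (node-of M) → height M ℕ.< 2 ℕ.^ ℓ →
          Achievable A B (R ℕ.* step ℕ.+ cost-continue J) (output-from J M)
        achieve-walk J M P h = achieve-output J M P h (cost-continue J) (achieve-continue J)

  -- Refining skewed nodes so that ratios grow slowly.

  module GradualSplitting where
    open OrderedField
    open ExponentialLogarithm using (half; 2*half; half-pos)
    open RestartedWalk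

    half≤1 : half ≤ 1#
    half≤1 = by≤ (≤-reflexive 2*half ⊞ <⇒≤ half-pos) (r half)
      where r = ring 1 (λ h → # 1 ⊕ (# 2 ⊗ h ⊕ # 0) ⊜ h ⊕ (# 1 ⊕ h)) refl

    quarter-≤ : ∀ {l a b c} → half * half ≤ l → 0# ≤ a → 0# ≤ b → c ≈ l * a + b → a ≤ fromℕ 4 * c
    quarter-≤ {l} {a} {b} {c} h a≥0 b≥0 e = ≤-trans (≤-reflexive (sym (trans (r₁ half a) (trans (*-congʳ (*-cong 2*half 2*half)) (r₂ a)))))
      (*-monoˡ-≤ (fromℕ-nonNeg 4) (≤-trans (*-monoʳ-≤ a≥0 h) (≤-respʳ (sym e) (by≤ b≥0 (ring 3 (λ a b c → a ⊗ b ⊕ c ⊕ # 0 ⊜ a ⊗ b ⊕ c) refl _ _ _)))))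
      where r₁ = ring 2 (λ h a → # 4 ⊗ (h ⊗ h ⊗ a) ⊜ # 2 ⊗ h ⊗ (# 2 ⊗ h) ⊗ a) refl
            r₂ = ring 1 (λ a → # 1 ⊗ # 1 ⊗ a ⊜ a) refl

    module _ {A B : Set} where
      -- A `Split` without the bound on growth. `one-sided` says that at most one player's ratio
      -- moves, which makes u v a martingale.
      record Mixes (l : Carrier) (U U₁ U₀ : A → Carrier) (V V₁ V₀ : B → Carrier) : Set where
        field
          meanᵘ : ∀ x → mean l (U₁ x) (U₀ x) ≈ U x
          meanᵛ : ∀ y → mean l (V₁ y) (V₀ y) ≈ V y
          one-sided : ∀ x y → (U₁ x - U₀ x) * (V₁ y - V₀ y) ≈ 0#
          U₁⁺ : ∀ x → 0# < U₁ x
          U₀⁺ : ∀ x → 0# < U₀ x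
          V₁⁺ : ∀ y → 0# < V₁ y
          V₀⁺ : ∀ y → 0# < V₀ y

      open Mixes

      mean-pos : ∀ {l p q} → 0# ≤ l → l ≤ 1# → 0# < p → 0# < q → 0# < mean l p q
      mean-pos {l} {p} {q} l≥0 l≤1 p>0 q>0 with total p q
      ... | inj₁ p≤q = <-≤-trans p>0 (by≤ (*-nonNeg (0≤-diff l≤1) (0≤-diff p≤q)) (ring 3 (λ a b c → a ⊗ b ⊕ (# 1 ⊖ a) ⊗ c ⊕ # 0 ⊜ b ⊕ (# 1 ⊖ a) ⊗ (c ⊖ b)) refl _ _ _))
      ... | inj₂ q≤p = <-≤-trans q>0 (by≤ (*-nonNeg l≥0 (0≤-diff q≤p)) (ring 3 (λ a b c → a ⊗ b ⊕ (# 1 ⊖ a) ⊗ c ⊕ # 0 ⊜ c ⊕ a ⊗ (b ⊖ c)) refl _ _ _))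

      mix-product : ∀ {l U U₁ U₀ V V₁ V₀} → Mixes l U U₁ U₀ V V₁ V₀ → ∀ x y → mean l (U₁ x * V₁ y) (U₀ x * V₀ y) ≈ U x * V y
      mix-product {l} {U} {U₁} {U₀} {V} {V₁} {V₀} X x y = trans
        (by≈ (*-congˡ {l * (1# - l)} (one-sided X x y)) (r l (U₁ x) (U₀ x) (V₁ y) (V₀ y)))
        (*-cong (meanᵘ X x) (meanᵛ X y))
        where r = ring 5 (λ l a b c d → (l ⊗ a ⊕ (# 1 ⊖ l) ⊗ b) ⊗ (l ⊗ c ⊕ (# 1 ⊖ l) ⊗ d) ⊕ l ⊗ (# 1 ⊖ l) ⊗ ((a ⊖ b) ⊗ (c ⊖ d)) ⊜ l ⊗ (a ⊗ c) ⊕ (# 1 ⊖ l) ⊗ (b ⊗ d) ⊕ l ⊗ (# 1 ⊖ l) ⊗ # 0) refl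

      -- If both branches have probability at least 1/4, a positive martingale grows by a factor of
      -- at most 4.
      plain : ∀ {l U U₁ U₀ V V₁ V₀} → half * half ≤ l → half * half ≤ 1# - l → Mixes l U U₁ U₀ V V₁ V₀ → Split l U U₁ U₀ V V₁ V₀
      plain {l} h₁ h₀ X = record
        { l≥0 = l≥0 ; l≤1 = diff-0≤ 1-l≥0 ; meanˡ = meanᵘ X ; meanʳ = meanᵛ X ; mean-product = mix-product X
        ; U₁>0 = U₁⁺ X ; U₀>0 = U₀⁺ X ; V₁>0 = V₁⁺ X ; V₀>0 = V₀⁺ X
        ; U₁≤ = λ x → quarter-≤ h₁ (<⇒≤ (U₁⁺ X x)) (*-nonNeg 1-l≥0 (<⇒≤ (U₀⁺ X x))) (sym (meanᵘ X x))
        ; U₀≤ = λ x → quarter-≤ h₀ (<⇒≤ (U₀⁺ X x)) (*-nonNeg l≥0 (<⇒≤ (U₁⁺ X x))) (trans (sym (meanᵘ X x)) (+-comm _ _))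
        ; V₁≤ = λ y → quarter-≤ h₁ (<⇒≤ (V₁⁺ X y)) (*-nonNeg 1-l≥0 (<⇒≤ (V₀⁺ X y))) (sym (meanᵛ X y))
        ; V₀≤ = λ y → quarter-≤ h₀ (<⇒≤ (V₀⁺ X y)) (*-nonNeg l≥0 (<⇒≤ (V₁⁺ X y))) (trans (sym (meanᵛ X y)) (+-comm _ _)) }
        where
        l≥0 : 0# ≤ l
        l≥0 = ≤-trans (sq-nonNeg half) h₁
        1-l≥0 : 0# ≤ 1# - l
        1-l≥0 = ≤-trans (sq-nonNeg half) h₀

      half≥quarter : half * half ≤ half
      half≥quarter = ≤-respʳ (*-identityʳ half) (*-monoˡ-≤ (<⇒≤ half-pos) half≤1)

      1-half : half ≈ 1# - half
      1-half = by≈ 2*half (r half)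
        where r = ring 1 (λ h → # 1 ⊖ h ⊕ # 2 ⊗ h ⊜ h ⊕ # 1) refl

      -- The index k certifies that both probabilities are at least 2^-k. It drops by one when the
      -- smaller probability is doubled, so it bounds the number of refinement steps.
      data Balance (l : Carrier) : ℕ → Set where
        balanced : ∀ {k} → half * half ≤ l → half * half ≤ 1# - l → Balance l k
        low : ∀ {k} → 0# ≤ l → half ^ k ≤ fromℕ 2 * l → half ^ k ≤ 1# - fromℕ 2 * l → Balance l (suc k)
        high : ∀ {k} → l ≤ 1# → half ^ k ≤ fromℕ 2 * l - 1# → half ^ k ≤ 1# - (fromℕ 2 * l - 1#) → Balance l (suc k)

      half^-≤1 : ∀ k → half ^ k ≤ 1#
      half^-≤1 k = ^-≤1 k (<⇒≤ half-pos) half≤1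

      double-half : ∀ {k l} → half ^ suc k ≤ l → half ^ k ≤ fromℕ 2 * l
      double-half {k} {l} h = ≤-trans (≤-reflexive (sym (trans (sym (*-assoc (fromℕ 2) half (half ^ k))) (trans (*-congʳ 2*half) (*-identityˡ _)))))
        (*-monoˡ-≤ (fromℕ-nonNeg 2) h)

      low-rest : ∀ k {l} → l < half * half → half ^ suc k ≤ l → half ^ k ≤ 1# - fromℕ 2 * l
      low-rest zero p h = ⊥-elim (<⇒≱ (≤-<-trans (≤-trans (≤-reflexive (sym (*-identityʳ half))) h) p) half≥quarter)
      low-rest (suc k) {l} p h = ≤-trans (≤-respʳ (*-identityʳ half) (*-monoˡ-≤ (<⇒≤ half-pos) (half^-≤1 k)))
        (≤-trans (≤-reflexive 1-half) (by≤ (*-monoˡ-≤ (fromℕ-nonNeg 2) (<⇒≤ p) ⊞ ≤-reflexive (*-congʳ {half} 2*half)) (r l half)))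
        where r = ring 2 (λ l h → # 1 ⊖ # 2 ⊗ l ⊕ (# 2 ⊗ l ⊕ # 2 ⊗ h ⊗ h) ⊜ # 1 ⊖ h ⊕ (# 2 ⊗ (h ⊗ h) ⊕ # 1 ⊗ h)) refl

      balance : ∀ k l → half ^ k ≤ l → half ^ k ≤ 1# - l → Balance l k
      balance zero l h₁ h₀ = ⊥-elim (<⇒≱ 0<1 (by≤ (h₁ ⊞ h₀) (ring 1 (λ a → # 0 ⊕ (# 1 ⊕ # 1) ⊜ # 1 ⊕ (a ⊕ (# 1 ⊖ a))) refl _)))
      balance (suc k) l h₁ h₀ with half * half ≤? l | half * half ≤? (1# - l)
      ... | yes p | yes q = balanced p q
      ... | no p | _ = low (≤-trans (^-nonNeg (suc k) (<⇒≤ half-pos)) h₁) (double-half {k} h₁) (low-rest k (≰⇒> p) h₁)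
      ... | yes _ | no q = high (diff-0≤ (≤-trans (^-nonNeg (suc k) (<⇒≤ half-pos)) h₀))
        (≤-respʳ (r₁ l) (low-rest k (≰⇒> q) h₀)) (≤-respʳ (r₂ l) (double-half {k} h₀))
        where r₁ = ring 1 (λ l → # 1 ⊖ # 2 ⊗ (# 1 ⊖ l) ⊜ # 2 ⊗ l ⊖ # 1) refl
              r₂ = ring 1 (λ l → # 2 ⊗ (# 1 ⊖ l) ⊜ # 1 ⊖ (# 2 ⊗ l ⊖ # 1)) refl

      private
        mean-low : ∀ l p q → mean half (mean (fromℕ 2 * l) p q) q ≈ mean l p q
        mean-low l p q = by≈ (*-congʳ {l * (p - q)} 2*half) (r half l p q)
          where r = ring 4 (λ h l p q → l ⊗ p ⊕ (# 1 ⊖ l) ⊗ q ⊕ # 2 ⊗ h ⊗ (l ⊗ (p ⊖ q)) ⊜ h ⊗ (# 2 ⊗ l ⊗ p ⊕ (# 1 ⊖ # 2 ⊗ l) ⊗ q) ⊕ (# 1 ⊖ h) ⊗ q ⊕ # 1 ⊗ (l ⊗ (p ⊖ q))) refl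

        mean-high : ∀ l p q → mean half p (mean (fromℕ 2 * l - 1#) p q) ≈ mean l p q
        mean-high l p q = by≈ (*-congʳ {p - mean l p q} 2*half) (r half l p q)
          where r = ring 4 (λ h l p q → l ⊗ p ⊕ (# 1 ⊖ l) ⊗ q ⊕ # 2 ⊗ h ⊗ (p ⊖ (l ⊗ p ⊕ (# 1 ⊖ l) ⊗ q)) ⊜ h ⊗ p ⊕ (# 1 ⊖ h) ⊗ ((# 2 ⊗ l ⊖ # 1) ⊗ p ⊕ (# 1 ⊖ (# 2 ⊗ l ⊖ # 1)) ⊗ q) ⊕ # 1 ⊗ (p ⊖ (l ⊗ p ⊕ (# 1 ⊖ l) ⊗ q))) refl

      rebalance : ∀ {l U U₁ U₀ V V₁ V₀} m → 0# ≤ m → m ≤ 1# → Mixes l U U₁ U₀ V V₁ V₀ →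
        Mixes m (λ x → mean m (U₁ x) (U₀ x)) U₁ U₀ (λ y → mean m (V₁ y) (V₀ y)) V₁ V₀
      rebalance m m≥0 m≤1 X = record { meanᵘ = λ _ → refl ; meanᵛ = λ _ → refl ; one-sided = one-sided X
        ; U₁⁺ = U₁⁺ X ; U₀⁺ = U₀⁺ X ; V₁⁺ = V₁⁺ X ; V₀⁺ = V₀⁺ X }

      mix-low : ∀ {l U U₁ U₀ V V₁ V₀} → 0# ≤ fromℕ 2 * l → fromℕ 2 * l ≤ 1# → Mixes l U U₁ U₀ V V₁ V₀ →
        Mixes half U (λ x → mean (fromℕ 2 * l) (U₁ x) (U₀ x)) U₀ V (λ y → mean (fromℕ 2 * l) (V₁ y) (V₀ y)) V₀
      mix-low {l} {U} {U₁} {U₀} {V} {V₁} {V₀} h h′ X = record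
        { meanᵘ = λ x → trans (mean-low l (U₁ x) (U₀ x)) (meanᵘ X x) ; meanᵛ = λ y → trans (mean-low l (V₁ y) (V₀ y)) (meanᵛ X y)
        ; one-sided = λ x y → trans (r l (U₁ x) (U₀ x) (V₁ y) (V₀ y)) (trans (*-congˡ (one-sided X x y)) (zeroʳ _))
        ; U₁⁺ = λ x → mean-pos h h′ (U₁⁺ X x) (U₀⁺ X x) ; U₀⁺ = U₀⁺ X
        ; V₁⁺ = λ y → mean-pos h h′ (V₁⁺ X y) (V₀⁺ X y) ; V₀⁺ = V₀⁺ X }
        where r = ring 5 (λ l a b c d → (# 2 ⊗ l ⊗ a ⊕ (# 1 ⊖ # 2 ⊗ l) ⊗ b ⊖ b) ⊗ (# 2 ⊗ l ⊗ c ⊕ (# 1 ⊖ # 2 ⊗ l) ⊗ d ⊖ d) ⊜ # 4 ⊗ (l ⊗ l) ⊗ ((a ⊖ b) ⊗ (c ⊖ d))) refl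

      mix-high : ∀ {l U U₁ U₀ V V₁ V₀} → 0# ≤ fromℕ 2 * l - 1# → fromℕ 2 * l - 1# ≤ 1# → Mixes l U U₁ U₀ V V₁ V₀ →
        Mixes half U U₁ (λ x → mean (fromℕ 2 * l - 1#) (U₁ x) (U₀ x)) V V₁ (λ y → mean (fromℕ 2 * l - 1#) (V₁ y) (V₀ y))
      mix-high {l} {U} {U₁} {U₀} {V} {V₁} {V₀} h h′ X = record
        { meanᵘ = λ x → trans (mean-high l (U₁ x) (U₀ x)) (meanᵘ X x) ; meanᵛ = λ y → trans (mean-high l (V₁ y) (V₀ y)) (meanᵛ X y)
        ; one-sided = λ x y → trans (r l (U₁ x) (U₀ x) (V₁ y) (V₀ y)) (trans (*-congˡ (one-sided X x y)) (zeroʳ _))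
        ; U₀⁺ = λ x → mean-pos h h′ (U₁⁺ X x) (U₀⁺ X x) ; U₁⁺ = U₁⁺ X
        ; V₀⁺ = λ y → mean-pos h h′ (V₁⁺ X y) (V₀⁺ X y) ; V₁⁺ = V₁⁺ X }
        where r = ring 5 (λ l a b c d → (a ⊖ ((# 2 ⊗ l ⊖ # 1) ⊗ a ⊕ (# 1 ⊖ (# 2 ⊗ l ⊖ # 1)) ⊗ b)) ⊗ (c ⊖ ((# 2 ⊗ l ⊖ # 1) ⊗ c ⊕ (# 1 ⊖ (# 2 ⊗ l ⊖ # 1)) ⊗ d)) ⊜ # 4 ⊗ ((# 1 ⊖ l) ⊗ (# 1 ⊖ l)) ⊗ ((a ⊖ b) ⊗ (c ⊖ d))) refl

      private
        half-split : ∀ {U U₁ U₀ V V₁ V₀} → Mixes half U U₁ U₀ V V₁ V₀ → Split half U U₁ U₀ V V₁ V₀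
        half-split = plain half≥quarter (≤-respʳ 1-half half≥quarter)

        nonNeg-from : ∀ k {l} → half ^ k ≤ l → 0# ≤ l
        nonNeg-from k h = ≤-trans (^-nonNeg k (<⇒≤ half-pos)) h

      -- A skewed node is revealed gradually: the smaller of its two probabilities
      -- is doubled or the other child is reached, each with probability one half.
      gradual : ∀ k l {U U₁ U₀ V V₁ V₀} → half ^ k ≤ l → half ^ k ≤ 1# - l → Mixes l U U₁ U₀ V V₁ V₀ →
        Mart U₁ V₁ → Mart U₀ V₀ → Mart U V
      gradual k l h₁ h₀ X M₁ M₀ with balance k l h₁ h₀
      ... | balanced p q = node (plain p q X) M₁ M₀
      ... | low {k′} _ p q = node (half-split (mix-low m≥0 m≤1 X)) (gradual k′ (fromℕ 2 * l) p q (rebalance (fromℕ 2 * l) m≥0 m≤1 X) M₁ M₀) M₀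
        where m≥0 = nonNeg-from k′ p
              m≤1 = diff-0≤ (nonNeg-from k′ q)
      ... | high {k′} _ p q = node (half-split (mix-high m≥0 m≤1 X)) M₁ (gradual k′ (fromℕ 2 * l - 1#) p q (rebalance (fromℕ 2 * l - 1#) m≥0 m≤1 X) M₁ M₀)
        where m≥0 = nonNeg-from k′ p
              m≤1 = diff-0≤ (nonNeg-from k′ q)

      full-gradual : ∀ F k l {U U₁ U₀ V V₁ V₀} (h₁ : half ^ k ≤ l) (h₀ : half ^ k ≤ 1# - l) (X : Mixes l U U₁ U₀ V V₁ V₀) M₁ M₀ x y →
        full F (gradual k l h₁ h₀ X M₁ M₀) x y ≈ mean l (full F M₁ x y) (full F M₀ x y)
      full-gradual F k l h₁ h₀ X M₁ M₀ x y with balance k l h₁ h₀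
      ... | balanced p q = refl
      ... | low {k′} _ p q = trans (+-congʳ (*-congˡ (full-gradual F k′ (fromℕ 2 * l) p q (rebalance (fromℕ 2 * l) (nonNeg-from k′ p) (diff-0≤ (nonNeg-from k′ q)) X) M₁ M₀ x y)))
        (mean-low l _ _)
      ... | high {k′} _ p q = trans (+-congˡ (*-congˡ (full-gradual F k′ (fromℕ 2 * l - 1#) p q (rebalance (fromℕ 2 * l - 1#) (nonNeg-from k′ p) (diff-0≤ (nonNeg-from k′ q)) X) M₁ M₀ x y)))
        (mean-high l _ _)

      height-gradual : ∀ k l {U U₁ U₀ V V₁ V₀} (h₁ : half ^ k ≤ l) (h₀ : half ^ k ≤ 1# - l) (X : Mixes l U U₁ U₀ V V₁ V₀) M₁ M₀ →
        height (gradual k l h₁ h₀ X M₁ M₀) ℕ.≤ suc k ℕ.+ (height M₁ ⊔ height M₀)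
      height-gradual k l h₁ h₀ X M₁ M₀ with balance k l h₁ h₀
      ... | balanced p q = ℕ.s≤s (ℕₚ.m≤n+m _ k)
      ... | low {k′} _ p q = ℕ.s≤s (ℕₚ.⊔-lub
        (height-gradual k′ (fromℕ 2 * l) p q (rebalance (fromℕ 2 * l) (nonNeg-from k′ p) (diff-0≤ (nonNeg-from k′ q)) X) M₁ M₀)
        (ℕₚ.≤-trans (ℕₚ.m≤n⊔m (height M₁) (height M₀)) (ℕₚ.m≤n+m _ (suc k′))))
      ... | high {k′} _ p q = ℕ.s≤s (ℕₚ.⊔-lub
        (ℕₚ.≤-trans (ℕₚ.m≤m⊔n (height M₁) (height M₀)) (ℕₚ.m≤n+m _ (suc k′)))
        (height-gradual k′ (fromℕ 2 * l - 1#) p q (rebalance (fromℕ 2 * l - 1#) (nonNeg-from k′ p) (diff-0≤ (nonNeg-from k′ q)) X) M₁ M₀))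

  -- Transcripts on a sample space and their likelihood ratios.

  module TranscriptTrees where
    open OrderedField
    open ExponentialLogarithm hiding (e)
    open FiniteSums
    open Entropies
    open XorBias using (_==_)
    open RestartedWalk
    open GradualSplitting

    -- Protocol trees whose messages are arbitrary functions on a sample space.
    data Shape (Ω L : Set) : Set where
      leaf : L → Shape Ω L
      nodeˡ nodeʳ : (Ω → Bool) → Shape Ω L → Shape Ω L → Shape Ω L

    size′ : ∀ {Ω L} → Shape Ω L → ℕ
    size′ (leaf _) = 0
    size′ (nodeˡ _ t₁ t₀) = suc (size′ t₁ ⊔ size′ t₀)
    size′ (nodeʳ _ t₁ t₀) = suc (size′ t₁ ⊔ size′ t₀)

    trivial : ∀ {Ω} → Observable Ω
    trivial = record { value = λ _ → tt ; _≟ⱽ_ = ⊤ₚ._≟_ }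

    module LeafSums (Ω : FinSet) {L : Set} where
      open Weighted Ω public

      expect : Weight → Weight → Carrier
      expect w g = ∑ Ω λ ω → w ω * g ω

      part : Weight → (Elem Ω → Bool) → Bool → Weight
      part w m b ω = w ω * ⟦ b == m ω ⟧

      part-nonNeg : ∀ {w} m b → NonNeg w → NonNeg (part w m b)
      part-nonNeg m b w≥0 ω = *-nonNeg (w≥0 ω) (⟦⟧-nonNeg (b == m ω))

      part-≤ : ∀ {w} m b → NonNeg w → ∀ ω → part w m b ω ≤ w ω
      part-≤ m b w≥0 ω = ≤-respʳ (*-identityʳ _) (*-monoˡ-≤ (w≥0 ω) (⟦⟧-≤1 (b == m ω)))

      part-pos : ∀ {w} m b → NonNeg w → ∀ ω → 0# < part w m b ω → 0# < w ω
      part-pos m b w≥0 ω p = *-pos-factorˡ (w≥0 ω) p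

      part-on : ∀ {w} m b ω → m ω ≡ b → part w m b ω ≈ w ω
      part-on m true ω e rewrite e = *-identityʳ _
      part-on m false ω e rewrite e = *-identityʳ _

      part-sum : ∀ w m ω → part w m true ω + part w m false ω ≈ w ω
      part-sum w m ω with m ω
      ... | true = r (w ω)
        where r = ring 1 (λ a → a ⊗ # 1 ⊕ a ⊗ # 0 ⊜ a) refl
      ... | false = r (w ω)
        where r = ring 1 (λ a → a ⊗ # 0 ⊕ a ⊗ # 1 ⊜ a) refl

      expect-part : ∀ w m g → expect (part w m true) g + expect (part w m false) g ≈ expect w g
      expect-part w m g = trans (sym (∑-+ Ω _ _)) (∑-cong Ω λ ω → trans (r _ _ (g ω)) (*-congʳ (part-sum w m ω)))
        where r = ring 3 (λ a b g → a ⊗ g ⊕ b ⊗ g ⊜ (a ⊕ b) ⊗ g) refl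

      total-part : ∀ w m → ∑ Ω (part w m true) + ∑ Ω (part w m false) ≈ ∑ Ω w
      total-part w m = trans (sym (∑-+ Ω _ _)) (∑-cong Ω (part-sum w m))

      mass-part : ∀ A w m ω → mass A (part w m true) ω + mass A (part w m false) ω ≈ mass A w ω
      mass-part A w m ω = expect-part w m (same A ω)

      -- The entropy of A paired with the transcript, computed leaf by leaf: inside a leaf the mass
      -- of a class of A is the mass of the pair.
      leaf-entropy : Observable (Elem Ω) → Shape (Elem Ω) L → Weight → Carrier
      leaf-entropy A (leaf _) w = entropy A w
      leaf-entropy A (nodeˡ m t₁ t₀) w = leaf-entropy A t₁ (part w m true) + leaf-entropy A t₀ (part w m false)
      leaf-entropy A (nodeʳ m t₁ t₀) w = leaf-entropy A t₁ (part w m true) + leaf-entropy A t₀ (part w m false)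

      -- Minus the conditional entropy of the message m given A, that is, the expected
      -- log-probability of m when it is predicted from A.
      gain : Observable (Elem Ω) → (Elem Ω → Bool) → Weight → Carrier
      gain A m w = entropy A (part w m true) + entropy A (part w m false) - entropy A w

      -- The expected log-likelihood of the transcript when every player, before
      -- each message, conditions on the transcript so far and on A resp. B.
      log-likelihood : (A B : Observable (Elem Ω)) → Shape (Elem Ω) L → Weight → Carrier
      log-likelihood A B (leaf _) w = 0#
      log-likelihood A B (nodeˡ m t₁ t₀) w = gain A m w +
        (log-likelihood A B t₁ (part w m true) + log-likelihood A B t₀ (part w m false))
      log-likelihood A B (nodeʳ m t₁ t₀) w = gain B m w +
        (log-likelihood A B t₁ (part w m true) + log-likelihood A B t₀ (part w m false))

    ratio : Carrier → Carrier → Carrier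
    ratio a b with b ≟ 0#
    -- A default probability for conditioning on an event of weight zero.
    ... | yes _ = half
    ... | no _ = a * b ⁻¹

    ratio-unit : ∀ {a b} → 0# ≤ a → a ≤ b → (0# ≤ ratio a b) × (ratio a b ≤ 1#)
    ratio-unit {a} {b} p q with b ≟ 0#
    ... | yes _ = <⇒≤ half-pos , half≤1
    ... | no ne = *-nonNeg p (<⇒≤ (inv-pos b>0)) , /-≤ b>0 (≤-respʳ (sym (*-identityˡ b)) q)
      where b>0 : 0# < b
            b>0 = ≤-trans p q , λ e → ne (sym e)

    ratio-pos : ∀ {a b} → 0# < b → ratio a b ≈ a * b ⁻¹
    ratio-pos {a} {b} p with b ≟ 0#
    ... | yes e = ⊥-elim (pos⇒≉0 p e)
    ... | no _ = refl

    ln-2≤1 : ln (fromℕ 2) ≤ 1#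
    ln-2≤1 = by≤ (ln≤ {fromℕ 2} (fromℕ-pos 1)) (ring 1 (λ a → # 1 ⊕ a ⊜ a ⊕ (# 2 ⊖ # 1)) refl _)

    module Smoothing (K : ℕ) (θ>0 : 0# < 1# - fromℕ 2 * half ^ K) where
      -- A message probability r is replaced by θ r + δ. Both outcomes then have probability at
      -- least 2^-K, which keeps the ratios positive and lets `gradual` finish within its K steps.
      -- The price is at most a factor θ per level.
      δ θ : Carrier
      δ = half ^ K
      θ = 1# - fromℕ 2 * δ

      δ>0 : 0# < δ
      δ>0 = ^-pos K half-pos

      θ≤1 : θ ≤ 1#
      θ≤1 = by≤ (*-nonNeg (fromℕ-nonNeg 2) (<⇒≤ δ>0)) (r δ)
        where r = ring 1 (λ d → # 1 ⊕ # 0 ⊜ # 1 ⊖ # 2 ⊗ d ⊕ # 2 ⊗ d) refl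

      smooth : Carrier → Carrier
      smooth r = θ * r + δ

      module _ {r} (r≥0 : 0# ≤ r) (r≤1 : r ≤ 1#) where
        δ≤smooth : δ ≤ smooth r
        δ≤smooth = by≤ (*-nonNeg (<⇒≤ θ>0) r≥0) (e θ r δ)
          where e = ring 3 (λ t r d → t ⊗ r ⊕ d ⊕ # 0 ⊜ d ⊕ t ⊗ r) refl

        δ≤1-smooth : δ ≤ 1# - smooth r
        δ≤1-smooth = by≤ (*-monoˡ-≤ (<⇒≤ θ>0) r≤1) (e δ r)
          where e = ring 2 (λ d r → # 1 ⊖ ((# 1 ⊖ # 2 ⊗ d) ⊗ r ⊕ d) ⊕ (# 1 ⊖ # 2 ⊗ d) ⊗ r ⊜ d ⊕ (# 1 ⊖ # 2 ⊗ d) ⊗ # 1) refl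

        smooth-pos : 0# < smooth r
        smooth-pos = <-≤-trans δ>0 δ≤smooth

        1-smooth-pos : 0# < 1# - smooth r
        1-smooth-pos = <-≤-trans δ>0 δ≤1-smooth

      θ≤smooth : ∀ r → θ * r ≤ smooth r
      θ≤smooth r = by≤ (<⇒≤ δ>0) (ring 2 (λ a b → (# 1 ⊖ # 2 ⊗ a) ⊗ b ⊕ a ⊕ # 0 ⊜ (# 1 ⊖ # 2 ⊗ a) ⊗ b ⊕ a) refl _ _)

      θ≤1-smooth : ∀ r → θ * (1# - r) ≤ 1# - smooth r
      θ≤1-smooth r = by≤ (<⇒≤ δ>0) (e δ r)
        where e = ring 2 (λ d r → # 1 ⊖ ((# 1 ⊖ # 2 ⊗ d) ⊗ r ⊕ d) ⊕ # 0 ⊜ (# 1 ⊖ # 2 ⊗ d) ⊗ (# 1 ⊖ r) ⊕ d) refl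

      scale₁ scale₀ : Carrier → Carrier → Carrier → Carrier
      scale₁ l p u = u * (p * l ⁻¹)
      scale₀ l p u = u * ((1# - p) * (1# - l) ⁻¹)

      scale-mean : ∀ {l} p u → 0# < l → 0# < 1# - l → mean l (scale₁ l p u) (scale₀ l p u) ≈ u
      scale-mean {l} p u l>0 l<1 = trans (r l (1# - l) p u (l ⁻¹) ((1# - l) ⁻¹))
        (trans (*-congˡ (+-cong (*-congˡ (*-inv l>0)) (*-congˡ (*-inv l<1)))) (r′ u p))
        where r = ring 6 (λ l k p u i j → l ⊗ (u ⊗ (p ⊗ i)) ⊕ k ⊗ (u ⊗ ((# 1 ⊖ p) ⊗ j)) ⊜ u ⊗ (p ⊗ (l ⊗ i) ⊕ (# 1 ⊖ p) ⊗ (k ⊗ j))) refl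
              r′ = ring 2 (λ u p → u ⊗ (p ⊗ # 1 ⊕ (# 1 ⊖ p) ⊗ # 1) ⊜ u) refl

      module Build (Ω X Y : FinSet) (xv : Elem Ω → Elem X) (yv : Elem Ω → Elem Y) where
        Label : Set
        Label = (Elem X → Bool) × (Elem Y → Bool)

        open LeafSums Ω {Label} public

        obsX obsY obsXY : Observable (Elem Ω)
        obsX = record { value = xv ; _≟ⱽ_ = _≟ᴱ_ {X} }
        obsY = record { value = yv ; _≟ⱽ_ = _≟ᴱ_ {Y} }
        obsXY = record { value = λ ω → xv ω , yv ω ; _≟ⱽ_ = ≡-dec (_≟ᴱ_ {X}) (_≟ᴱ_ {Y}) }

        massX : Weight → Elem X → Carrier
        massX w x = ∑ Ω λ ω → w ω * ⟦ does (_≟ᴱ_ {X} x (xv ω)) ⟧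

        massY : Weight → Elem Y → Carrier
        massY w y = ∑ Ω λ ω → w ω * ⟦ does (_≟ᴱ_ {Y} y (yv ω)) ⟧

        prior : Weight → (Elem Ω → Bool) → Carrier
        prior w m = smooth (ratio (∑ Ω (part w m true)) (∑ Ω w))

        chanceX : Weight → (Elem Ω → Bool) → Elem X → Carrier
        chanceX w m x = smooth (ratio (massX (part w m true) x) (massX w x))

        chanceY : Weight → (Elem Ω → Bool) → Elem Y → Carrier
        chanceY w m y = smooth (ratio (massY (part w m true) y) (massY w y))

        module _ {w : Weight} (w≥0 : NonNeg w) (m : Elem Ω → Bool) where
          prior-unit : (0# ≤ ratio (∑ Ω (part w m true)) (∑ Ω w)) × (ratio (∑ Ω (part w m true)) (∑ Ω w) ≤ 1#)
          prior-unit = ratio-unit (∑-nonNeg Ω (part-nonNeg m true w≥0)) (∑-mono Ω (part-≤ m true w≥0))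

          private
            le : ∀ (z : Elem Ω → Bool) → (∑ Ω λ ω → part w m true ω * ⟦ z ω ⟧) ≤ (∑ Ω λ ω → w ω * ⟦ z ω ⟧)
            le z = ∑-mono Ω λ ω → *-monoʳ-≤ (⟦⟧-nonNeg (z ω)) (part-≤ m true w≥0 ω)
            nn : ∀ (z : Elem Ω → Bool) → 0# ≤ (∑ Ω λ ω → part w m true ω * ⟦ z ω ⟧)
            nn z = ∑-nonNeg Ω λ ω → *-nonNeg (part-nonNeg m true w≥0 ω) (⟦⟧-nonNeg (z ω))

          chanceX-unit : ∀ x → (0# ≤ ratio (massX (part w m true) x) (massX w x)) × (ratio (massX (part w m true) x) (massX w x) ≤ 1#)
          chanceX-unit x = ratio-unit (nn λ ω → does (_≟ᴱ_ {X} x (xv ω))) (le λ ω → does (_≟ᴱ_ {X} x (xv ω)))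

          chanceY-unit : ∀ y → (0# ≤ ratio (massY (part w m true) y) (massY w y)) × (ratio (massY (part w m true) y) (massY w y) ≤ 1#)
          chanceY-unit y = ratio-unit (nn λ ω → does (_≟ᴱ_ {Y} y (yv ω))) (le λ ω → does (_≟ᴱ_ {Y} y (yv ω)))

          prior-pos : 0# < prior w m
          prior-pos = smooth-pos (proj₁ prior-unit) (proj₂ prior-unit)

          prior-pos′ : 0# < 1# - prior w m
          prior-pos′ = 1-smooth-pos (proj₁ prior-unit) (proj₂ prior-unit)

          chanceX-pos : ∀ x → 0# < chanceX w m x
          chanceX-pos x = smooth-pos (proj₁ (chanceX-unit x)) (proj₂ (chanceX-unit x))

          chanceX-pos′ : ∀ x → 0# < 1# - chanceX w m x
          chanceX-pos′ x = 1-smooth-pos (proj₁ (chanceX-unit x)) (proj₂ (chanceX-unit x))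

          chanceY-pos : ∀ y → 0# < chanceY w m y
          chanceY-pos y = smooth-pos (proj₁ (chanceY-unit y)) (proj₂ (chanceY-unit y))

          chanceY-pos′ : ∀ y → 0# < 1# - chanceY w m y
          chanceY-pos′ y = 1-smooth-pos (proj₁ (chanceY-unit y)) (proj₂ (chanceY-unit y))

        scale-pos : ∀ {a b c} → 0# < a → 0# < b → 0# < c → 0# < a * (b * c ⁻¹)
        scale-pos p q r = *-pos p (*-pos q (inv-pos r))

        -- The public walk follows the smoothed law of the messages given the transcript. At each
        -- message the speaker's ratio is multiplied by the probability given his own entry over the
        -- public probability.
        build : Shape (Elem Ω) Label → ∀ {w} → NonNeg w → ∀ {U V} → (∀ x → 0# < U x) → (∀ y → 0# < V y) → Mart U V
        build (leaf (s , t)) w≥0 U>0 V>0 = leaf s t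
        build (nodeˡ m t₁ t₀) {w} w≥0 {U} {V} U>0 V>0 = gradual K l (δ≤smooth (proj₁ u) (proj₂ u)) (δ≤1-smooth (proj₁ u) (proj₂ u))
          (record
            { meanᵘ = λ x → scale-mean (chanceX w m x) (U x) (prior-pos w≥0 m) (prior-pos′ w≥0 m)
            ; meanᵛ = λ y → sym (mean-const l (V y))
            ; one-sided = λ x y → r (scale₁ l (chanceX w m x) (U x) - scale₀ l (chanceX w m x) (U x)) (V y)
            ; U₁⁺ = U₁⁺ ; U₀⁺ = U₀⁺ ; V₁⁺ = V>0 ; V₀⁺ = V>0 })
          (build t₁ (part-nonNeg m true w≥0) U₁⁺ V>0) (build t₀ (part-nonNeg m false w≥0) U₀⁺ V>0)
          where
          l = prior w m
          u = prior-unit w≥0 m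
          U₁⁺ : ∀ x → 0# < scale₁ l (chanceX w m x) (U x)
          U₁⁺ x = scale-pos (U>0 x) (chanceX-pos w≥0 m x) (prior-pos w≥0 m)
          U₀⁺ : ∀ x → 0# < scale₀ l (chanceX w m x) (U x)
          U₀⁺ x = scale-pos (U>0 x) (chanceX-pos′ w≥0 m x) (prior-pos′ w≥0 m)
          r = ring 2 (λ a v → a ⊗ (v ⊖ v) ⊜ # 0) refl
        build (nodeʳ m t₁ t₀) {w} w≥0 {U} {V} U>0 V>0 = gradual K l (δ≤smooth (proj₁ u) (proj₂ u)) (δ≤1-smooth (proj₁ u) (proj₂ u))
          (record
            { meanᵘ = λ x → sym (mean-const l (U x))
            ; meanᵛ = λ y → scale-mean (chanceY w m y) (V y) (prior-pos w≥0 m) (prior-pos′ w≥0 m)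
            ; one-sided = λ x y → r (scale₁ l (chanceY w m y) (V y) - scale₀ l (chanceY w m y) (V y)) (U x)
            ; U₁⁺ = U>0 ; U₀⁺ = U>0 ; V₁⁺ = V₁⁺ ; V₀⁺ = V₀⁺ })
          (build t₁ (part-nonNeg m true w≥0) U>0 V₁⁺) (build t₀ (part-nonNeg m false w≥0) U>0 V₀⁺)
          where
          l = prior w m
          u = prior-unit w≥0 m
          V₁⁺ : ∀ y → 0# < scale₁ l (chanceY w m y) (V y)
          V₁⁺ y = scale-pos (V>0 y) (chanceY-pos w≥0 m y) (prior-pos w≥0 m)
          V₀⁺ : ∀ y → 0# < scale₀ l (chanceY w m y) (V y)
          V₀⁺ y = scale-pos (V>0 y) (chanceY-pos′ w≥0 m y) (prior-pos′ w≥0 m)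
          r = ring 2 (λ a v → (v ⊖ v) ⊗ a ⊜ # 0) refl

        height-build : ∀ t {w} (w≥0 : NonNeg w) {U V} (U>0 : ∀ x → 0# < U x) (V>0 : ∀ y → 0# < V y) →
          height (build t w≥0 {U} {V} U>0 V>0) ℕ.≤ size′ t ℕ.* suc K
        height-build (leaf _) w≥0 U>0 V>0 = ℕ.z≤n
        height-build (nodeˡ m t₁ t₀) w≥0 U>0 V>0 = ℕₚ.≤-trans (height-gradual K _ _ _ _ _ _)
          (ℕₚ.+-monoʳ-≤ (suc K) (ℕₚ.⊔-lub
            (ℕₚ.≤-trans (height-build t₁ _ _ _) (ℕₚ.*-monoˡ-≤ (suc K) (ℕₚ.m≤m⊔n (size′ t₁) (size′ t₀))))
            (ℕₚ.≤-trans (height-build t₀ _ _ _) (ℕₚ.*-monoˡ-≤ (suc K) (ℕₚ.m≤n⊔m (size′ t₁) (size′ t₀))))))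
        height-build (nodeʳ m t₁ t₀) w≥0 U>0 V>0 = ℕₚ.≤-trans (height-gradual K _ _ _ _ _ _)
          (ℕₚ.+-monoʳ-≤ (suc K) (ℕₚ.⊔-lub
            (ℕₚ.≤-trans (height-build t₁ _ _ _) (ℕₚ.*-monoˡ-≤ (suc K) (ℕₚ.m≤m⊔n (size′ t₁) (size′ t₀))))
            (ℕₚ.≤-trans (height-build t₀ _ _ _) (ℕₚ.*-monoˡ-≤ (suc K) (ℕₚ.m≤n⊔m (size′ t₁) (size′ t₀))))))

  -- How much good mass the simulated transcript keeps.

  module LikelihoodEstimate where
    open OrderedField
    open ExponentialLogarithm hiding (e)
    open FiniteSums
    open Entropies
    open XorBias using (_==_)
    open RestartedWalk
    open GradualSplitting
    open TranscriptTrees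

    ==-self : ∀ {a b} → a ≡ b → (a == b) ≡ true
    ==-self {false} ≡.refl = ≡.refl
    ==-self {true} ≡.refl = ≡.refl

    module Likelihood (K : ℕ) (θ>0 : 0# < 1# - fromℕ 2 * half ^ K) (Ω X Y : FinSet) (xv : Elem Ω → Elem X) (yv : Elem Ω → Elem Y)
      (μ : Elem X → Carrier) (μ≥0 : ∀ x → 0# ≤ μ x) (μ-total : ∑ X μ ≈ 1#)
      (ν : Elem Y → Carrier) (ν≥0 : ∀ y → 0# ≤ ν y) (ν-total : ∑ Y ν ≈ 1#)
      (f : Elem X × Elem Y → Bool)
      (cap : Carrier) (cap>1 : 1# < cap) (c : Carrier) (c>1 : 1# < c) where

      open Smoothing K θ>0 public
      open Build Ω X Y xv yv public

      -- Counts the leaves that predict f and have a likelihood ratio below cap.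
      good : Elem X → Elem Y → Payoff {Elem X} {Elem Y}
      good x y s t u v = ⟦ does (u * v ≤? cap) ⟧ * (⟦ f (x , y) == (s xor t) ⟧ * (u * v))

      average₂ : (Elem X → Elem Y → Carrier) → Carrier
      average₂ F = ∑ X λ x → ∑ Y λ y → μ x * ν y * F x y

      average₂-cong : ∀ {F G} → (∀ x y → F x y ≈ G x y) → average₂ F ≈ average₂ G
      average₂-cong h = ∑-cong X λ x → ∑-cong Y λ y → *-congˡ (h x y)

      average₂-mean : ∀ l F G → average₂ (λ x y → mean l (F x y) (G x y)) ≈ mean l (average₂ F) (average₂ G)
      average₂-mean l F G = trans (∑-cong X λ x → trans (trans (∑-cong Y λ y → r (μ x * ν y) l (F x y) (G x y)) (∑-+ Y _ _)) (+-cong (∑-*ˡ Y _ _) (∑-*ˡ Y _ _)))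
          (trans (∑-+ X _ _) (+-cong (∑-*ˡ X _ _) (∑-*ˡ X _ _)))
        where r = ring 4 (λ w l a b → w ⊗ (l ⊗ a ⊕ (# 1 ⊖ l) ⊗ b) ⊜ l ⊗ (w ⊗ a) ⊕ (# 1 ⊖ l) ⊗ (w ⊗ b)) refl

      average₂-mono : ∀ {F G} → (∀ x y → F x y ≤ G x y) → average₂ F ≤ average₂ G
      average₂-mono h = ∑-mono X λ x → ∑-mono Y λ y → *-monoˡ-≤ (*-nonNeg (μ≥0 x) (ν≥0 y)) (h x y)

      average₂-one : average₂ (λ _ _ → 1#) ≈ 1#
      average₂-one = trans (∑-cong X λ x → trans (∑-cong Y λ y → *-identityʳ _) (trans (∑-*ˡ Y _ _) (trans (*-congˡ ν-total) (*-identityʳ _)))) μ-total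

      goodSum : ∀ {U V} → Mart U V → Carrier
      goodSum M = average₂ λ x y → full (good x y) M x y

      log-prior : Elem Ω → Carrier
      log-prior ω = ln (μ (xv ω)) + ln (ν (yv ω))

      c>0 : 0# < c
      c>0 = <-trans 0<1 c>1

      cap>0 : 0# < cap
      cap>0 = <-trans 0<1 cap>1

      ln-cap>0 : 0# < ln cap
      ln-cap>0 = ≰⇒> λ h → <⇒≱ cap>1 (≤-respˡ (exp-ln cap>0) (≤-respʳ exp-0 (exp-mono h)))

      -- Chosen so that c₃ ln cap = c - 1, the amount that a leaf with ratio above the cap has to
      -- pay in `pointwise`.
      c₃ : Carrier
      c₃ = (c - 1#) * ln cap ⁻¹

      c₃≥0 : 0# ≤ c₃
      c₃≥0 = *-nonNeg (0≤-diff (<⇒≤ c>1)) (<⇒≤ (inv-pos ln-cap>0))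

      c₃-ln : c₃ * ln cap ≈ c - 1#
      c₃-ln = /-* ln-cap>0

      -- The divergence of the pair of entries from the product of μ and ν given the transcript,
      -- weighted by the leaves.
      info : Shape (Elem Ω) Label → Weight → Carrier
      info t w = leaf-entropy obsXY t w - leaf-entropy trivial t w - expect w log-prior

      -- A lower bound for the good mass below a node of public weight Λ and ratios U, V. Its first
      -- two lines are the integral of ln r + 1 for the simulated law against the true one, with a
      -- loss of ln θ per level. The last two are the integrals of the penalties r/c and c₃ `slack`
      -- of `pointwise`, bounded leaf by leaf.
      estimate : ℕ → Shape (Elem Ω) Label → Weight → (U : Elem X → Carrier) (V : Elem Y → Carrier) → Carrier → Carrier
      estimate d t w U V Λ =
        expect w (λ ω → log-prior ω + (ln Λ + ln (U (xv ω)) + ln (V (yv ω)))) + log-likelihood obsX obsY t w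
        + fromℕ d * ln θ * ∑ Ω w - leaf-entropy obsXY t w + ∑ Ω w
        - c ⁻¹ * (Λ * average₂ (λ x y → U x * V y))
        - c₃ * (Λ * average₂ (λ x y → U x * V y) + info t w + fromℕ 2 * ∑ Ω w)

      Predicts : Shape (Elem Ω) Label → Weight → Set
      Predicts (leaf (s , t)) w = ∀ ω → 0# < w ω → f (xv ω , yv ω) ≡ s (xv ω) xor t (yv ω)
      Predicts (nodeˡ m t₁ t₀) w = Predicts t₁ (part w m true) × Predicts t₀ (part w m false)
      Predicts (nodeʳ m t₁ t₀) w = Predicts t₁ (part w m true) × Predicts t₀ (part w m false)

      Supported : Weight → Set
      Supported w = ∀ ω → 0# < w ω → (0# < μ (xv ω)) × (0# < ν (yv ω))

      lnθ≤0 : ln θ ≤ 0#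
      lnθ≤0 = ≤-respʳ ln-1 (ln-mono θ>0 θ≤1)

      module Leaf (s : Elem X → Bool) (t : Elem Y → Bool) {w : Weight} (w≥0 : NonNeg w) (supp : Supported w)
        (correct : ∀ ω → 0# < w ω → f (xv ω , yv ω) ≡ s (xv ω) xor t (yv ω))
        {U : Elem X → Carrier} {V : Elem Y → Carrier} (U>0 : ∀ x → 0# < U x) (V>0 : ∀ y → 0# < V y)
        {Λ : Carrier} (Λ>0 : 0# < Λ) (W≤ : ∑ Ω w ≤ fromℕ 2 * Λ) where

        UV : Elem Ω → Carrier
        UV ω = U (xv ω) * V (yv ω)

        μν : Elem Ω → Carrier
        μν ω = μ (xv ω) * ν (yv ω)

        R : Carrier
        R = Λ * average₂ (λ x y → U x * V y)

        -- r is the density of the simulated law over the true one, a the density of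
        -- the true law of the inputs at this leaf over the product distribution.
        r a a⁻¹ : Weight
        r ω = μν ω * (Λ * UV ω) * mass obsXY w ω ⁻¹
        a ω = mass obsXY w ω * (mass trivial w ω * μν ω) ⁻¹
        a⁻¹ ω = mass trivial w ω * (μν ω * mass obsXY w ω ⁻¹)

        ok : Elem Ω → Bool
        ok ω = does (UV ω ≤? cap)

        mass-trivial : ∀ ω → mass trivial w ω ≈ ∑ Ω w
        mass-trivial ω = ∑-cong Ω λ ω′ → *-identityʳ _

        module _ (ω : Elem Ω) (p : 0# < w ω) where
          μν>0 : 0# < μν ω
          μν>0 = *-pos (proj₁ (supp ω p)) (proj₂ (supp ω p))
          UV>0 : 0# < UV ω
          UV>0 = *-pos (U>0 _) (V>0 _)
          mxy>0 : 0# < mass obsXY w ω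
          mxy>0 = mass-pos w≥0 obsXY ω p
          m⊤>0 : 0# < mass trivial w ω
          m⊤>0 = mass-pos w≥0 trivial ω p
          r>0 : 0# < r ω
          r>0 = *-pos (*-pos μν>0 (*-pos Λ>0 UV>0)) (inv-pos mxy>0)
          a>0 : 0# < a ω
          a>0 = *-pos mxy>0 (inv-pos (*-pos m⊤>0 μν>0))
          a⁻¹>0 : 0# < a⁻¹ ω
          a⁻¹>0 = *-pos m⊤>0 (*-pos μν>0 (inv-pos mxy>0))

          a-inverse : a ω * a⁻¹ ω ≈ 1#
          a-inverse = trans (e (mass obsXY w ω) ((mass trivial w ω * μν ω) ⁻¹) (mass trivial w ω) (μν ω) (mass obsXY w ω ⁻¹))
            (trans (*-cong (*-inv mxy>0) (*-inv (*-pos m⊤>0 μν>0))) (*-identityˡ _))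
            where e = ring 5 (λ m i t q j → m ⊗ i ⊗ (t ⊗ (q ⊗ j)) ⊜ m ⊗ j ⊗ (t ⊗ q ⊗ i)) refl

          UV-eq : UV ω * (Λ * mass trivial w ω ⁻¹) ≈ r ω * a ω
          UV-eq = *-cancelˡ-≈ (*-pos m⊤>0 μν>0) (trans (e₁ (mass trivial w ω) (μν ω) (UV ω) Λ (mass trivial w ω ⁻¹))
            (trans (*-congˡ (*-inv m⊤>0)) (trans (sym (trans (*-congˡ (*-cong (*-inv mxy>0) (*-inv (*-pos m⊤>0 μν>0)))) (e₃ (μν ω) Λ (UV ω))))
            (sym (e₂ (mass trivial w ω) (μν ω) Λ (UV ω) (mass obsXY w ω ⁻¹) (mass obsXY w ω) ((mass trivial w ω * μν ω) ⁻¹))))))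
            where e₁ = ring 5 (λ t q u l i → t ⊗ q ⊗ (u ⊗ (l ⊗ i)) ⊜ q ⊗ (l ⊗ u) ⊗ (t ⊗ i)) refl
                  e₂ = ring 7 (λ t q l u j m i → t ⊗ q ⊗ (q ⊗ (l ⊗ u) ⊗ j ⊗ (m ⊗ i)) ⊜ q ⊗ (l ⊗ u) ⊗ (m ⊗ j ⊗ (t ⊗ q ⊗ i))) refl
                  e₃ = ring 3 (λ q l u → q ⊗ (l ⊗ u) ⊗ (# 1 ⊗ # 1) ⊜ q ⊗ (l ⊗ u) ⊗ # 1) refl

          -- UV times Λ over the total weight equals r a, and smoothing has kept Λ at least half
          -- that weight.
          UV≤ : UV ω ≤ fromℕ 2 * (r ω * a ω)
          UV≤ = ≤-trans (≤-reflexive (sym (trans (*-congˡ (*-inv m⊤>0)) (*-identityʳ _))))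
            (≤-trans (≤-reflexive (e₁ (UV ω) (mass trivial w ω) (mass trivial w ω ⁻¹)))
            (≤-trans (*-monoˡ-≤ (<⇒≤ (*-pos UV>0 (inv-pos m⊤>0))) (≤-trans (≤-reflexive (mass-trivial ω)) W≤))
            (≤-trans (≤-reflexive (e₂ (UV ω) (mass trivial w ω ⁻¹) Λ)) (*-monoˡ-≤ (fromℕ-nonNeg 2) (≤-reflexive UV-eq)))))
            where e₁ = ring 3 (λ u m i → u ⊗ (m ⊗ i) ⊜ u ⊗ i ⊗ m) refl
                  e₂ = ring 3 (λ u i l → u ⊗ i ⊗ (# 2 ⊗ l) ⊜ # 2 ⊗ (u ⊗ (l ⊗ i))) refl

          -- A nonnegative majorant of ln UV whose integral can be controlled: UV ≤ 2 r a gives ln 2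
          -- + ln r + ln a, and the summand a⁻¹ compensates for a negative ln a.
          slack : Carrier
          slack = r ω + ln (a ω) + a⁻¹ ω + 1#

          1≤ln-a : 1# ≤ ln (a ω) + a⁻¹ ω
          1≤ln-a = by≤ (≤-respˡ (by≈ (trans (sym (ln-* a>0 a⁻¹>0)) (trans (ln-cong (*-pos a>0 a⁻¹>0) a-inverse) ln-1)) (ring 2 (λ a b → ⊝ a ⊕ (a ⊕ b) ⊜ b ⊕ # 0) refl _ _)) (ln≤ a⁻¹>0)) (e (ln (a ω)) (a⁻¹ ω))
            where e = ring 2 (λ l i → l ⊕ i ⊖ l ⊜ # 1 ⊕ (i ⊖ # 1)) refl

          slack≥0 : 0# ≤ slack
          slack≥0 = by≤ (<⇒≤ r>0 ⊞ 1≤ln-a ⊞ 0≤1 ⊞ 0≤1) (e (r ω) (ln (a ω)) (a⁻¹ ω))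
            where e = ring 3 (λ r l i → r ⊕ l ⊕ i ⊕ # 1 ⊕ (# 0 ⊕ # 1 ⊕ # 0 ⊕ # 0) ⊜ # 0 ⊕ (r ⊕ (l ⊕ i) ⊕ # 1 ⊕ # 1)) refl

          ln-UV≤slack : ln (UV ω) ≤ slack
          ln-UV≤slack = ≤-trans (ln-mono UV>0 UV≤) (≤-trans (≤-reflexive (trans (ln-* (fromℕ-pos 1) (*-pos r>0 a>0)) (+-congˡ (ln-* r>0 a>0))))
            (by≤ (ln-2≤1 ⊞ ln≤ r>0 ⊞ <⇒≤ a⁻¹>0 ⊞ 0≤1) (e (ln (fromℕ 2)) (ln (r ω)) (r ω) (ln (a ω)) (a⁻¹ ω))))
            where e = ring 5 (λ z lr r la i → r ⊕ la ⊕ i ⊕ # 1 ⊕ (z ⊕ lr ⊕ # 0 ⊕ # 0) ⊜ z ⊕ (lr ⊕ la) ⊕ (# 1 ⊕ (r ⊖ # 1) ⊕ i ⊕ # 1)) refl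

          -- Below the cap this is ln r ≤ r - 1 with nonnegative penalties. Above it the left side
          -- must be at most zero: ln r ≤ r/c - 1 + ln c, and ln c ≤ c - 1 = c₃ ln cap is at most c₃
          -- ln UV, which the slack covers.
          pointwise : ln (r ω) + 1# - c ⁻¹ * r ω - c₃ * slack ≤ r ω * ⟦ ok ω ⟧
          pointwise with UV ω ≤? cap
          ... | yes _ = by≤ (ln≤ r>0 ⊞ *-nonNeg (<⇒≤ (inv-pos c>0)) (<⇒≤ r>0) ⊞ *-nonNeg c₃≥0 slack≥0)
              (e (ln (r ω)) (r ω) (c ⁻¹ * r ω) (c₃ * slack))
            where e = ring 4 (λ l r x y → r ⊗ # 1 ⊕ (l ⊕ # 0 ⊕ # 0) ⊜ l ⊕ # 1 ⊖ x ⊖ y ⊕ (r ⊖ # 1 ⊕ x ⊕ y)) refl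
          ... | no ¬p = by≤ (ln-r ⊞ ln≤ c>0 ⊞ ≤-reflexive (sym c₃-ln) ⊞ *-monoˡ-≤ c₃≥0 (≤-trans (ln-mono cap>0 (<⇒≤ (≰⇒> ¬p))) ln-UV≤slack))
              (e (ln (r ω)) (r ω) (c ⁻¹ * r ω) (c₃ * slack) (ln c) c (c₃ * ln cap))
            where
            ln-r : ln (r ω) ≤ c ⁻¹ * r ω - 1# + ln c
            ln-r = by≤ (≤-respˡ (trans (ln-* (inv-pos c>0) r>0) (+-congʳ (ln-inv c>0))) (ln≤ (*-pos (inv-pos c>0) r>0))) (e′ (c ⁻¹ * r ω) (ln c) (ln (r ω)))
              where e′ = ring 3 (λ x l r → x ⊖ # 1 ⊕ l ⊕ (⊝ l ⊕ r) ⊜ r ⊕ (x ⊖ # 1)) refl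
            e = ring 7 (λ l r x y lc c z → r ⊗ # 0 ⊕ (l ⊕ lc ⊕ (c ⊖ # 1) ⊕ z) ⊜ l ⊕ # 1 ⊖ x ⊖ y ⊕ (x ⊖ # 1 ⊕ lc ⊕ (c ⊖ # 1) ⊕ z ⊕ y)) refl

        push : (F : Elem X → Elem Y → Carrier) → (∀ x y → 0# ≤ F x y) →
          expect w (λ ω → μν ω * F (xv ω) (yv ω) * mass obsXY w ω ⁻¹) ≤ average₂ F
        push F F≥0 = ≤-trans (∑-pushforward w≥0 {X ×ᶠ Y} (λ ω → xv ω , yv ω) obsXY (λ e → e) {λ (x , y) → μ x * ν y * F x y}
            (λ (x , y) → *-nonNeg (*-nonNeg (μ≥0 x) (ν≥0 y)) (F≥0 x y)))
          (≤-reflexive (∑-× X Y _))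

        push-good : expect w (λ ω → r ω * ⟦ ok ω ⟧) ≤ Λ * goodSum {U} {V} (leaf s t)
        push-good = ≤-trans (∑-support Ω w≥0 λ ω p → ≤-reflexive (trans (e₁ (μν ω) Λ (UV ω) (mass obsXY w ω ⁻¹) ⟦ ok ω ⟧)
              (*-congˡ (*-congʳ (*-congˡ (*-congˡ (trans (sym (*-identityˡ (UV ω))) (*-congʳ (reflexive (≡.sym (≡.cong ⟦_⟧ (==-self (correct ω p)))))))))))))
          (≤-trans (≤-reflexive (trans (∑-cong Ω λ ω → e₂ (w ω) Λ (μν ω * good (xv ω) (yv ω) (s (xv ω)) (t (yv ω)) (U (xv ω)) (V (yv ω)) * mass obsXY w ω ⁻¹)) (∑-*ˡ Ω Λ _)))
          (*-monoˡ-≤ (<⇒≤ Λ>0) (push (λ x y → good x y (s x) (t y) (U x) (V y))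
            λ x y → *-nonNeg (⟦⟧-nonNeg (does (U x * V y ≤? cap))) (*-nonNeg (⟦⟧-nonNeg (f (x , y) == (s x xor t y))) (<⇒≤ (*-pos (U>0 x) (V>0 y)))))))
          where e₁ = ring 5 (λ q l u i b → q ⊗ (l ⊗ u) ⊗ i ⊗ b ⊜ l ⊗ (q ⊗ (b ⊗ u) ⊗ i)) refl
                e₂ = ring 3 (λ w l z → w ⊗ (l ⊗ z) ⊜ l ⊗ (w ⊗ z)) refl

        push-r : expect w r ≤ R
        push-r = ≤-trans (≤-reflexive (trans (∑-cong Ω λ ω → e (w ω) (μν ω) Λ (UV ω) (mass obsXY w ω ⁻¹)) (∑-*ˡ Ω Λ _)))
          (*-monoˡ-≤ (<⇒≤ Λ>0) (push (λ x y → U x * V y) λ x y → <⇒≤ (*-pos (U>0 x) (V>0 y))))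
          where e = ring 5 (λ w q l u i → w ⊗ (q ⊗ (l ⊗ u) ⊗ i) ⊜ l ⊗ (w ⊗ (q ⊗ u ⊗ i))) refl

        push-a : expect w a⁻¹ ≤ ∑ Ω w
        push-a = ≤-trans (≤-reflexive (trans (∑-cong Ω λ ω → trans (*-congˡ (*-congʳ (mass-trivial ω))) (e (w ω) (∑ Ω w) (μν ω) (mass obsXY w ω ⁻¹))) (∑-*ˡ Ω _ _)))
          (≤-respʳ (*-identityʳ _) (*-monoˡ-≤ (total-nonNeg w≥0) (≤-trans (push (λ _ _ → 1#) λ _ _ → 0≤1) (≤-reflexive average₂-one))))
          where e = ring 4 (λ w W q i → w ⊗ (W ⊗ (q ⊗ i)) ⊜ W ⊗ (w ⊗ (q ⊗ # 1 ⊗ i))) refl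

        T : Weight
        T ω = log-prior ω + (ln Λ + ln (U (xv ω)) + ln (V (yv ω)))

        expect-ln-r : expect w (λ ω → ln (r ω)) ≈ expect w T - entropy obsXY w
        expect-ln-r = trans (∑-support-cong Ω w≥0 split) (trans (∑-cong Ω λ ω → e (w ω) (T ω) (ln (mass obsXY w ω))) (∑-sub Ω _ _))
          where
          e = ring 3 (λ w a b → w ⊗ (a ⊖ b) ⊜ w ⊗ a ⊖ w ⊗ b) refl
          split : ∀ ω → 0# < w ω → ln (r ω) ≈ T ω - ln (mass obsXY w ω)
          split ω p = trans (ln-* (*-pos (μν>0 ω p) (*-pos Λ>0 (UV>0 ω p))) (inv-pos (mxy>0 ω p))) (+-cong
            (trans (ln-* (μν>0 ω p) (*-pos Λ>0 (UV>0 ω p))) (+-cong (ln-* (proj₁ (supp ω p)) (proj₂ (supp ω p)))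
              (trans (ln-* Λ>0 (UV>0 ω p)) (trans (+-congˡ (ln-* (U>0 _) (V>0 _))) (sym (+-assoc _ _ _)))))) (ln-inv (mxy>0 ω p)))

        expect-ln-a : expect w (λ ω → ln (a ω)) ≈ info (leaf (s , t)) w
        expect-ln-a = trans (∑-support-cong Ω w≥0 split) (trans (∑-cong Ω λ ω → e (w ω) (ln (mass obsXY w ω)) (ln (mass trivial w ω)) (log-prior ω))
            (trans (∑-sub Ω _ _) (+-congʳ (∑-sub Ω _ _))))
          where
          e = ring 4 (λ w a b c → w ⊗ (a ⊖ b ⊖ c) ⊜ w ⊗ a ⊖ w ⊗ b ⊖ w ⊗ c) refl
          split : ∀ ω → 0# < w ω → ln (a ω) ≈ ln (mass obsXY w ω) - ln (mass trivial w ω) - log-prior ω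
          split ω p = trans (ln-/ (mxy>0 ω p) (*-pos (m⊤>0 ω p) (μν>0 ω p))) (trans (+-congˡ (-‿cong (trans (ln-* (m⊤>0 ω p) (μν>0 ω p)) (+-congˡ (ln-* (proj₁ (supp ω p)) (proj₂ (supp ω p)))))))
            (e′ (ln (mass obsXY w ω)) (ln (mass trivial w ω)) (log-prior ω)))
            where e′ = ring 3 (λ a b c → a ⊖ (b ⊕ c) ⊜ a ⊖ b ⊖ c) refl

        leaf-estimate : ∀ d → estimate d (leaf (s , t)) w U V Λ ≤ Λ * goodSum {U} {V} (leaf s t)
        leaf-estimate d = ≤-trans (by≤ (≤-trans (≤-reflexive (sym total-eq)) (≤-trans (∑-support Ω w≥0 pointwise) push-good)
              ⊞ *-monoˡ-≤ (<⇒≤ (inv-pos c>0)) push-r ⊞ *-monoˡ-≤ c₃≥0 (push-r ⊞ push-a) ⊞ loss)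
            (e (Λ * goodSum {U} {V} (leaf s t)) (expect w T) (entropy obsXY w) (∑ Ω w) (c ⁻¹) c₃ R (expect w r) (info (leaf (s , t)) w) (expect w a⁻¹) (fromℕ d * ln θ * ∑ Ω w)))
            ≤-refl
          where
          loss : fromℕ d * ln θ * ∑ Ω w ≤ 0#
          loss = by≤ (*-nonNeg (*-nonNeg (fromℕ-nonNeg d) (0≤-diff lnθ≤0)) (total-nonNeg w≥0)) (e′ (fromℕ d) (ln θ) (∑ Ω w))
            where e′ = ring 3 (λ d l w → # 0 ⊕ # 0 ⊜ d ⊗ l ⊗ w ⊕ d ⊗ (# 0 ⊖ l) ⊗ w) refl
          total-eq : expect w (λ ω → ln (r ω) + 1# - c ⁻¹ * r ω - c₃ * (r ω + ln (a ω) + a⁻¹ ω + 1#)) ≈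
            (expect w T - entropy obsXY w) + ∑ Ω w - c ⁻¹ * expect w r - c₃ * (expect w r + info (leaf (s , t)) w + expect w a⁻¹ + ∑ Ω w)
          total-eq = trans (∑-cong Ω λ ω → e′ (w ω) (ln (r ω)) (c ⁻¹) (r ω) c₃ (ln (a ω)) (a⁻¹ ω)) (trans (∑-sub Ω _ _) (+-cong
              (trans (∑-sub Ω _ _) (+-cong (trans (∑-+ Ω _ _) (+-congʳ expect-ln-r)) (-‿cong (∑-*ˡ Ω _ _))))
              (-‿cong (trans (∑-*ˡ Ω _ _) (*-congˡ (trans (∑-+ Ω _ _) (+-congʳ (trans (∑-+ Ω _ _) (+-congʳ (trans (∑-+ Ω _ _) (+-congˡ expect-ln-a)))))))))))
            where e′ = ring 7 (λ w l i r c la ia → w ⊗ (l ⊕ # 1 ⊖ i ⊗ r ⊖ c ⊗ (r ⊕ la ⊕ ia ⊕ # 1)) ⊜ w ⊗ l ⊕ w ⊖ i ⊗ (w ⊗ r) ⊖ c ⊗ (w ⊗ r ⊕ w ⊗ la ⊕ w ⊗ ia ⊕ w)) refl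
          e = ring 11 (λ G T h W i c R er I ea z → G ⊕ (T ⊖ h ⊕ W ⊖ i ⊗ er ⊖ c ⊗ (er ⊕ I ⊕ ea ⊕ W) ⊕ i ⊗ er ⊕ c ⊗ (er ⊕ ea) ⊕ z) ⊜ T ⊕ # 0 ⊕ z ⊖ h ⊕ W ⊖ i ⊗ R ⊖ c ⊗ (R ⊕ I ⊕ # 2 ⊗ W) ⊕ (G ⊕ i ⊗ R ⊕ c ⊗ (R ⊕ W) ⊕ # 0)) refl

      module NodeStep {w : Weight} (w≥0 : NonNeg w) (m : Elem Ω → Bool) {Λ : Carrier} (Λ>0 : 0# < Λ) where
        w₁ w₀ : Weight
        w₁ = part w m true
        w₀ = part w m false

        w₁≥0 : NonNeg w₁
        w₁≥0 = part-nonNeg m true w≥0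

        w₀≥0 : NonNeg w₀
        w₀≥0 = part-nonNeg m false w≥0

        l : Carrier
        l = prior w m

        l>0 : 0# < l
        l>0 = prior-pos w≥0 m

        1-l>0 : 0# < 1# - l
        1-l>0 = prior-pos′ w≥0 m

        1-ratio : ∀ {a b s} → 0# < s → a + b ≈ s → 1# - ratio a s ≈ b * s ⁻¹
        1-ratio {a} {b} {s} s>0 e = trans (+-congˡ (-‿cong (ratio-pos s>0))) (by≈ (sym (trans (*-congʳ e) (*-inv s>0))) (r a b (s ⁻¹)))
          where r = ring 3 (λ a b i → b ⊗ i ⊕ # 1 ⊜ # 1 ⊖ a ⊗ i ⊕ (a ⊕ b) ⊗ i) refl

        -- θ times the true probability b/s of a message is at most its smoothed probability l, so
        -- descending one level spends one factor θ of the budget.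
        keep-budget : ∀ {b s k l d} → 0# ≤ b → b ≤ s → (0# < s → θ * (b * s ⁻¹) ≤ l) → 0# < l → s ≤ fromℕ 2 * Λ * θ ^ suc d → k ≈ l → b ≤ fromℕ 2 * (Λ * k) * θ ^ d
        keep-budget {b} {s} {k} {l} {d} b≥0 b≤s h l>0 budget k≈l with s ≟ 0#
        ... | yes e = ≤-trans b≤s (≤-trans (≤-reflexive e) (*-nonNeg (*-nonNeg (fromℕ-nonNeg 2) (*-nonNeg (<⇒≤ Λ>0) (<⇒≤ (<-respʳ-≈ (sym k≈l) l>0)))) (^-nonNeg d (<⇒≤ θ>0))))
        ... | no ne = ≤-trans (≤-reflexive (sym (trans (e₁ b (s ⁻¹) s) (trans (*-congˡ (*-inv s>0)) (*-identityʳ b)))))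
          (≤-trans (*-monoˡ-≤ (*-nonNeg b≥0 (<⇒≤ (inv-pos s>0))) budget)
          (≤-trans (≤-reflexive (e₂ (b * s ⁻¹) Λ θ (θ ^ d)))
          (≤-trans (*-monoˡ-≤ (*-nonNeg (*-nonNeg (fromℕ-nonNeg 2) (<⇒≤ Λ>0)) (^-nonNeg d (<⇒≤ θ>0))) (h s>0))
            (≤-reflexive (trans (*-congˡ (sym k≈l)) (e₃ Λ (θ ^ d) k))))))
          where
          s>0 : 0# < s
          s>0 = ≤-trans b≥0 b≤s , λ e → ne (sym e)
          e₁ = ring 3 (λ b i s → b ⊗ i ⊗ s ⊜ b ⊗ (s ⊗ i)) refl
          e₂ = ring 4 (λ b l t p → b ⊗ (# 2 ⊗ l ⊗ (t ⊗ p)) ⊜ # 2 ⊗ l ⊗ p ⊗ (t ⊗ b)) refl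
          e₃ = ring 3 (λ l p k → # 2 ⊗ l ⊗ p ⊗ k ⊜ # 2 ⊗ (l ⊗ k) ⊗ p) refl

        budget₁ : ∀ d → ∑ Ω w ≤ fromℕ 2 * Λ * θ ^ suc d → ∑ Ω w₁ ≤ fromℕ 2 * (Λ * l) * θ ^ d
        budget₁ d h = keep-budget {d = d} (∑-nonNeg Ω w₁≥0) (∑-mono Ω (part-≤ m true w≥0))
          (λ s>0 → ≤-trans (≤-reflexive (*-congˡ (sym (ratio-pos s>0)))) (θ≤smooth _)) l>0 h refl

        budget₀ : ∀ d → ∑ Ω w ≤ fromℕ 2 * Λ * θ ^ suc d → ∑ Ω w₀ ≤ fromℕ 2 * (Λ * (1# - l)) * θ ^ d
        budget₀ d h = keep-budget {d = d} (∑-nonNeg Ω w₀≥0) (∑-mono Ω (part-≤ m false w≥0))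
          (λ s>0 → ≤-trans (≤-reflexive (*-congˡ (sym (1-ratio s>0 (total-part w m))))) (θ≤1-smooth _)) 1-l>0 h refl

        lnT : (Elem X → Carrier) → (Elem Y → Carrier) → Carrier → Weight
        lnT U V Λ ω = ln Λ + ln (U (xv ω)) + ln (V (yv ω))

        -- Common to both kinds of node, with A what the speaker observes. Only the logarithms lose
        -- something, namely ln θ; all other terms are additive over the two children because UV is
        -- a martingale.
        combine : ∀ (A : Observable (Elem Ω)) d t₁ t₀ {U U₁ U₀ V V₁ V₀} →
          (∀ x y → mean l (U₁ x * V₁ y) (U₀ x * V₀ y) ≈ U x * V y) →
          (∀ ω → 0# < w₁ ω → lnT U V Λ ω + (ln θ + ln (mass A w₁ ω) - ln (mass A w ω)) ≤ lnT U₁ V₁ (Λ * l) ω) →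
          (∀ ω → 0# < w₀ ω → lnT U V Λ ω + (ln θ + ln (mass A w₀ ω) - ln (mass A w ω)) ≤ lnT U₀ V₀ (Λ * (1# - l)) ω) →
          expect w (λ ω → log-prior ω + lnT U V Λ ω) + (gain A m w + (log-likelihood obsX obsY t₁ w₁ + log-likelihood obsX obsY t₀ w₀))
          + fromℕ (suc d) * ln θ * ∑ Ω w - (leaf-entropy obsXY t₁ w₁ + leaf-entropy obsXY t₀ w₀) + ∑ Ω w
          - c ⁻¹ * (Λ * average₂ (λ x y → U x * V y))
          - c₃ * (Λ * average₂ (λ x y → U x * V y) +
              (leaf-entropy obsXY t₁ w₁ + leaf-entropy obsXY t₀ w₀ - (leaf-entropy trivial t₁ w₁ + leaf-entropy trivial t₀ w₀) - expect w log-prior)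
              + fromℕ 2 * ∑ Ω w)
          ≤ estimate d t₁ w₁ U₁ V₁ (Λ * l) + estimate d t₀ w₀ U₀ V₀ (Λ * (1# - l))
        combine A d t₁ t₀ {U} {U₁} {U₀} {V} {V₁} {V₀} mean-UV step₁ step₀ = ≤-trans (≤-reflexive rewrite-parent) (by≤ logs
          (e (expect w₁ (λ ω → log-prior ω + lnT U₁ V₁ (Λ * l) ω)) (expect w₀ (λ ω → log-prior ω + lnT U₀ V₀ (Λ * (1# - l)) ω))
             (expect w (λ ω → log-prior ω + lnT U V Λ ω)) (gain A m w)
             (log-likelihood obsX obsY t₁ w₁) (log-likelihood obsX obsY t₀ w₀) (fromℕ d) (ln θ) (∑ Ω w₁) (∑ Ω w₀)
             (leaf-entropy obsXY t₁ w₁) (leaf-entropy obsXY t₀ w₀) (leaf-entropy trivial t₁ w₁) (leaf-entropy trivial t₀ w₀)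
             (expect w₁ log-prior) (expect w₀ log-prior) (c ⁻¹) c₃ (Λ * l * average₂ (λ x y → U₁ x * V₁ y)) (Λ * (1# - l) * average₂ (λ x y → U₀ x * V₀ y))))
          where
          R-eq : Λ * average₂ (λ x y → U x * V y) ≈ Λ * l * average₂ (λ x y → U₁ x * V₁ y) + Λ * (1# - l) * average₂ (λ x y → U₀ x * V₀ y)
          R-eq = trans (*-congˡ (trans (average₂-cong λ x y → sym (mean-UV x y)) (average₂-mean l _ _))) (r Λ l _ _)
            where r = ring 4 (λ Λ l a b → Λ ⊗ (l ⊗ a ⊕ (# 1 ⊖ l) ⊗ b) ⊜ Λ ⊗ l ⊗ a ⊕ Λ ⊗ (# 1 ⊖ l) ⊗ b) refl
          W-eq : ∑ Ω w ≈ ∑ Ω w₁ + ∑ Ω w₀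
          W-eq = sym (total-part w m)
          P-eq : expect w log-prior ≈ expect w₁ log-prior + expect w₀ log-prior
          P-eq = sym (expect-part w m log-prior)
          one-side : ∀ {v U′ V′ Λ′} → NonNeg v → (∀ ω → 0# < v ω → lnT U V Λ ω + (ln θ + ln (mass A v ω) - ln (mass A w ω)) ≤ lnT U′ V′ Λ′ ω) →
            expect v (λ ω → log-prior ω + lnT U V Λ ω) + (ln θ * ∑ Ω v + entropy A v - expect v (λ ω → ln (mass A w ω))) ≤
            expect v (λ ω → log-prior ω + lnT U′ V′ Λ′ ω)
          one-side {v} v≥0 h = ≤-trans (≤-reflexive (sym (trans (∑-cong Ω λ ω → r (v ω) (log-prior ω) (lnT U V Λ ω) (ln θ) (ln (mass A v ω)) (ln (mass A w ω)))
                (trans (∑-+ Ω _ _) (+-congˡ (trans (∑-sub Ω _ _) (+-congʳ (trans (∑-+ Ω _ _) (+-congʳ (∑-*ˡ Ω _ _))))))))))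
              (∑-support Ω v≥0 λ ω p → by≤ (h ω p) (r′ (log-prior ω) _ _))
            where r = ring 6 (λ v p t θ a b → v ⊗ (p ⊕ (t ⊕ (θ ⊕ a ⊖ b))) ⊜ v ⊗ (p ⊕ t) ⊕ (θ ⊗ v ⊕ v ⊗ a ⊖ v ⊗ b)) refl
                  r′ = ring 3 (λ p a b → p ⊕ b ⊕ a ⊜ p ⊕ a ⊕ b) refl
          logs : expect w (λ ω → log-prior ω + lnT U V Λ ω) + gain A m w + ln θ * (∑ Ω w₁ + ∑ Ω w₀) ≤
            expect w₁ (λ ω → log-prior ω + lnT U₁ V₁ (Λ * l) ω) + expect w₀ (λ ω → log-prior ω + lnT U₀ V₀ (Λ * (1# - l)) ω)
          logs = ≤-trans (≤-reflexive (trans (+-congʳ (+-cong (sym (expect-part w m _)) (+-congˡ (-‿cong (sym (expect-part w m (λ ω → ln (mass A w ω))))))))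
              (r _ _ (entropy A w₁) (entropy A w₀) (expect w₁ (λ ω → ln (mass A w ω))) (expect w₀ (λ ω → ln (mass A w ω))) (ln θ) (∑ Ω w₁) (∑ Ω w₀))))
              (one-side {U′ = U₁} {V₁} w₁≥0 step₁ ⊞ one-side {U′ = U₀} {V₀} w₀≥0 step₀)
            where r = ring 9 (λ t₁ t₀ h₁ h₀ m₁ m₀ θ W₁ W₀ → t₁ ⊕ t₀ ⊕ (h₁ ⊕ h₀ ⊖ (m₁ ⊕ m₀)) ⊕ θ ⊗ (W₁ ⊕ W₀) ⊜ t₁ ⊕ (θ ⊗ W₁ ⊕ h₁ ⊖ m₁) ⊕ (t₀ ⊕ (θ ⊗ W₀ ⊕ h₀ ⊖ m₀))) refl
          rewrite-parent :
            expect w (λ ω → log-prior ω + lnT U V Λ ω) + (gain A m w + (log-likelihood obsX obsY t₁ w₁ + log-likelihood obsX obsY t₀ w₀))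
            + fromℕ (suc d) * ln θ * ∑ Ω w - (leaf-entropy obsXY t₁ w₁ + leaf-entropy obsXY t₀ w₀) + ∑ Ω w
            - c ⁻¹ * (Λ * average₂ (λ x y → U x * V y))
            - c₃ * (Λ * average₂ (λ x y → U x * V y) +
                (leaf-entropy obsXY t₁ w₁ + leaf-entropy obsXY t₀ w₀ - (leaf-entropy trivial t₁ w₁ + leaf-entropy trivial t₀ w₀) - expect w log-prior)
                + fromℕ 2 * ∑ Ω w)
            ≈ expect w (λ ω → log-prior ω + lnT U V Λ ω) + (gain A m w + (log-likelihood obsX obsY t₁ w₁ + log-likelihood obsX obsY t₀ w₀))
            + fromℕ (suc d) * ln θ * (∑ Ω w₁ + ∑ Ω w₀) - (leaf-entropy obsXY t₁ w₁ + leaf-entropy obsXY t₀ w₀) + (∑ Ω w₁ + ∑ Ω w₀)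
            - c ⁻¹ * (Λ * l * average₂ (λ x y → U₁ x * V₁ y) + Λ * (1# - l) * average₂ (λ x y → U₀ x * V₀ y))
            - c₃ * ((Λ * l * average₂ (λ x y → U₁ x * V₁ y) + Λ * (1# - l) * average₂ (λ x y → U₀ x * V₀ y)) +
                (leaf-entropy obsXY t₁ w₁ + leaf-entropy obsXY t₀ w₀ - (leaf-entropy trivial t₁ w₁ + leaf-entropy trivial t₀ w₀) - (expect w₁ log-prior + expect w₀ log-prior))
                + fromℕ 2 * (∑ Ω w₁ + ∑ Ω w₀))
          rewrite-parent = +-cong (+-cong (+-cong (+-congʳ (+-congˡ (*-congˡ W-eq))) W-eq) (-‿cong (*-congˡ R-eq)))
            (-‿cong (*-congˡ (+-cong (+-cong R-eq (+-congˡ (-‿cong P-eq))) (*-congˡ W-eq))))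
          e = ring 20 (λ E₁ E₀ E g L₁ L₀ d θ W₁ W₀ x₁ x₀ t₁ t₀ p₁ p₀ i c R₁ R₀ → E₁ ⊕ L₁ ⊕ d ⊗ θ ⊗ W₁ ⊖ x₁ ⊕ W₁ ⊖ i ⊗ R₁ ⊖ c ⊗ (R₁ ⊕ (x₁ ⊖ t₁ ⊖ p₁) ⊕ # 2 ⊗ W₁) ⊕ (E₀ ⊕ L₀ ⊕ d ⊗ θ ⊗ W₀ ⊖ x₀ ⊕ W₀ ⊖ i ⊗ R₀ ⊖ c ⊗ (R₀ ⊕ (x₀ ⊖ t₀ ⊖ p₀) ⊕ # 2 ⊗ W₀)) ⊕ (E ⊕ g ⊕ θ ⊗ (W₁ ⊕ W₀)) ⊜ E ⊕ (g ⊕ (L₁ ⊕ L₀)) ⊕ (# 1 ⊕ d) ⊗ θ ⊗ (W₁ ⊕ W₀) ⊖ (x₁ ⊕ x₀) ⊕ (W₁ ⊕ W₀) ⊖ i ⊗ (R₁ ⊕ R₀) ⊖ c ⊗ (R₁ ⊕ R₀ ⊕ (x₁ ⊕ x₀ ⊖ (t₁ ⊕ t₀) ⊖ (p₁ ⊕ p₀)) ⊕ # 2 ⊗ (W₁ ⊕ W₀)) ⊕ (E₁ ⊕ E₀)) refl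

        -- The smoothed message probability p, against the prior l, loses at most ln θ.
        ln-step : ∀ {u p mass′ mass l} → 0# < u → 0# < p → 0# < mass′ → 0# < mass → 0# < l → θ * (mass′ * mass ⁻¹) ≤ p →
          ln Λ + ln u + (ln θ + ln mass′ - ln mass) ≤ ln (Λ * l) + ln (u * (p * l ⁻¹))
        ln-step {u} {p} {mass′} {mass} {l} u>0 p>0 m′>0 m>0 l>0 h = ≤-trans
          (by≤ (≤-respˡ (trans (ln-* θ>0 (*-pos m′>0 (inv-pos m>0))) (+-congˡ (ln-/ m′>0 m>0))) (ln-mono (*-pos θ>0 (*-pos m′>0 (inv-pos m>0))) h))
            (r (ln Λ) (ln u) (ln θ) (ln mass′) (ln mass) (ln p) (ln l)))
          (≤-reflexive (sym (+-cong (ln-* Λ>0 l>0) (trans (ln-* u>0 (*-pos p>0 (inv-pos l>0))) (+-congˡ (ln-/ p>0 l>0))))))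
          where r = ring 7 (λ L u t a b p l → L ⊕ l ⊕ (u ⊕ (p ⊖ l)) ⊕ (t ⊕ (a ⊖ b)) ⊜ L ⊕ u ⊕ (t ⊕ a ⊖ b) ⊕ p) refl

      -- By `full-gradual` the refinement leaves expected payoffs unchanged, so the induction
      -- follows the unrefined tree. d bounds the levels that may still cost a factor θ.
      estimate≤ : ∀ t d {w} (w≥0 : NonNeg w) → Supported w → Predicts t w →
        ∀ {U V} (U>0 : ∀ x → 0# < U x) (V>0 : ∀ y → 0# < V y) {Λ} → 0# < Λ →
        size′ t ℕ.≤ d → ∑ Ω w ≤ fromℕ 2 * Λ * θ ^ d →
        estimate d t w U V Λ ≤ Λ * goodSum (build t w≥0 U>0 V>0)
      estimate≤ (leaf (s , t)) d {w} w≥0 supp pred U>0 V>0 {Λ} Λ>0 fits budget =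
        Leaf.leaf-estimate s t w≥0 supp pred U>0 V>0 Λ>0
          (≤-trans budget (≤-respʳ (*-identityʳ _) (*-monoˡ-≤ (*-nonNeg (fromℕ-nonNeg 2) (<⇒≤ Λ>0)) (^-≤1 d (<⇒≤ θ>0) θ≤1)))) d
      estimate≤ (nodeˡ m t₁ t₀) (suc d) {w} w≥0 supp (pred₁ , pred₀) {U} {V} U>0 V>0 {Λ} Λ>0 (ℕ.s≤s fits) budget =
        ≤-trans (combine obsX d t₁ t₀ {U} {λ x → scale₁ l (chanceX w m x) (U x)} {λ x → scale₀ l (chanceX w m x) (U x)} {V} {V} {V}
            (λ x y → trans (r l _ _ (V y)) (*-congʳ (scale-mean (chanceX w m x) (U x) l>0 1-l>0)))
            (λ ω p → by≤ (ln-step (U>0 (xv ω)) (chanceX-pos w≥0 m (xv ω)) (mass-pos w₁≥0 obsX ω p) (mass-pos w≥0 obsX ω (part-pos m true w≥0 ω p)) l>0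
               (≤-trans (≤-reflexive (*-congˡ (sym (ratio-pos (mass-pos w≥0 obsX ω (part-pos m true w≥0 ω p)))))) (θ≤smooth _)))
               (r′ (ln Λ) (ln (U (xv ω))) (ln (V (yv ω))) _ (ln (Λ * l)) _))
            (λ ω p → by≤ (ln-step (U>0 (xv ω)) (chanceX-pos′ w≥0 m (xv ω)) (mass-pos w₀≥0 obsX ω p) (mass-pos w≥0 obsX ω (part-pos m false w≥0 ω p)) 1-l>0
               (≤-trans (≤-reflexive (*-congˡ (sym (1-ratio (mass-pos w≥0 obsX ω (part-pos m false w≥0 ω p)) (mass-part obsX w m ω))))) (θ≤1-smooth _)))
               (r′ (ln Λ) (ln (U (xv ω))) (ln (V (yv ω))) _ (ln (Λ * (1# - l))) _)))
          (≤-trans (estimate≤ t₁ d w₁≥0 (λ ω p → supp ω (part-pos m true w≥0 ω p)) pred₁ _ _ (*-pos Λ>0 l>0) (ℕₚ.≤-trans (ℕₚ.m≤m⊔n (size′ t₁) (size′ t₀)) fits) (budget₁ d budget)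
             ⊞ estimate≤ t₀ d w₀≥0 (λ ω p → supp ω (part-pos m false w≥0 ω p)) pred₀ _ _ (*-pos Λ>0 1-l>0) (ℕₚ.≤-trans (ℕₚ.m≤n⊔m (size′ t₁) (size′ t₀)) fits) (budget₀ d budget))
          (≤-reflexive (sym (trans (*-congˡ (trans (average₂-cong λ x y → full-gradual (good x y) K _ _ _ _ _ _ x y) (average₂-mean l _ _))) (r″ Λ l _ _)))))
        where
        open NodeStep w≥0 m Λ>0
        r = ring 4 (λ l a b v → l ⊗ (a ⊗ v) ⊕ (# 1 ⊖ l) ⊗ (b ⊗ v) ⊜ (l ⊗ a ⊕ (# 1 ⊖ l) ⊗ b) ⊗ v) refl
        r′ = ring 6 (λ L u v z L′ u′ → L′ ⊕ u′ ⊕ v ⊕ (L ⊕ u ⊕ z) ⊜ L ⊕ u ⊕ v ⊕ z ⊕ (L′ ⊕ u′)) refl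
        r″ = ring 4 (λ Λ l a b → Λ ⊗ (l ⊗ a ⊕ (# 1 ⊖ l) ⊗ b) ⊜ Λ ⊗ l ⊗ a ⊕ Λ ⊗ (# 1 ⊖ l) ⊗ b) refl
      estimate≤ (nodeʳ m t₁ t₀) (suc d) {w} w≥0 supp (pred₁ , pred₀) {U} {V} U>0 V>0 {Λ} Λ>0 (ℕ.s≤s fits) budget =
        ≤-trans (combine obsY d t₁ t₀ {U} {U} {U} {V} {λ y → scale₁ l (chanceY w m y) (V y)} {λ y → scale₀ l (chanceY w m y) (V y)}
            (λ x y → trans (r l _ _ (U x)) (*-congˡ (scale-mean (chanceY w m y) (V y) l>0 1-l>0)))
            (λ ω p → by≤ (ln-step (V>0 (yv ω)) (chanceY-pos w≥0 m (yv ω)) (mass-pos w₁≥0 obsY ω p) (mass-pos w≥0 obsY ω (part-pos m true w≥0 ω p)) l>0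
               (≤-trans (≤-reflexive (*-congˡ (sym (ratio-pos (mass-pos w≥0 obsY ω (part-pos m true w≥0 ω p)))))) (θ≤smooth _)))
               (r′ (ln Λ) (ln (U (xv ω))) (ln (V (yv ω))) _ (ln (Λ * l)) _))
            (λ ω p → by≤ (ln-step (V>0 (yv ω)) (chanceY-pos′ w≥0 m (yv ω)) (mass-pos w₀≥0 obsY ω p) (mass-pos w≥0 obsY ω (part-pos m false w≥0 ω p)) 1-l>0
               (≤-trans (≤-reflexive (*-congˡ (sym (1-ratio (mass-pos w≥0 obsY ω (part-pos m false w≥0 ω p)) (mass-part obsY w m ω))))) (θ≤1-smooth _)))
               (r′ (ln Λ) (ln (U (xv ω))) (ln (V (yv ω))) _ (ln (Λ * (1# - l))) _)))
          (≤-trans (estimate≤ t₁ d w₁≥0 (λ ω p → supp ω (part-pos m true w≥0 ω p)) pred₁ _ _ (*-pos Λ>0 l>0) (ℕₚ.≤-trans (ℕₚ.m≤m⊔n (size′ t₁) (size′ t₀)) fits) (budget₁ d budget)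
             ⊞ estimate≤ t₀ d w₀≥0 (λ ω p → supp ω (part-pos m false w≥0 ω p)) pred₀ _ _ (*-pos Λ>0 1-l>0) (ℕₚ.≤-trans (ℕₚ.m≤n⊔m (size′ t₁) (size′ t₀)) fits) (budget₀ d budget))
          (≤-reflexive (sym (trans (*-congˡ (trans (average₂-cong λ x y → full-gradual (good x y) K _ _ _ _ _ _ x y) (average₂-mean l _ _))) (r″ Λ l _ _)))))
        where
        open NodeStep w≥0 m Λ>0
        r = ring 4 (λ l a b v → l ⊗ (v ⊗ a) ⊕ (# 1 ⊖ l) ⊗ (v ⊗ b) ⊜ v ⊗ (l ⊗ a ⊕ (# 1 ⊖ l) ⊗ b)) refl
        r′ = ring 6 (λ L u v z L′ v′ → L′ ⊕ u ⊕ v′ ⊕ (L ⊕ v ⊕ z) ⊜ L ⊕ u ⊕ v ⊕ z ⊕ (L′ ⊕ v′)) refl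
        r″ = ring 4 (λ Λ l a b → Λ ⊗ (l ⊗ a ⊕ (# 1 ⊖ l) ⊗ b) ⊜ Λ ⊗ l ⊗ a ⊕ Λ ⊗ (# 1 ⊖ l) ⊗ b) refl

  -- Chain rules for transcripts and Kraft's inequality.

  module TranscriptEntropies where
    open OrderedField
    open ExponentialLogarithm hiding (e; term)
    open FiniteSums
    open Entropies
    open TranscriptTrees

    sum-+ : ∀ (a b : ℕ → Carrier) n → partialSum (λ i → a i + b i) n ≈ partialSum a n + partialSum b n
    sum-+ a b zero = ring 0 (# 0 ⊜ # 0 ⊕ # 0) refl
    sum-+ a b (suc n) = trans (+-congʳ (sum-+ a b n)) (ring 4 (λ a b c d → a ⊕ b ⊕ (c ⊕ d) ⊜ a ⊕ c ⊕ (b ⊕ d)) refl _ _ _ _)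

    sum-sub : ∀ (a b : ℕ → Carrier) n → partialSum (λ i → a i - b i) n ≈ partialSum a n - partialSum b n
    sum-sub a b zero = ring 0 (# 0 ⊜ # 0 ⊖ # 0) refl
    sum-sub a b (suc n) = trans (+-congʳ (sum-sub a b n)) (ring 4 (λ a b c d → a ⊖ b ⊕ (c ⊖ d) ⊜ a ⊕ c ⊖ (b ⊕ d)) refl _ _ _ _)

    sum-mono : ∀ {a b : ℕ → Carrier} n → (∀ i → i ℕ.< n → a i ≤ b i) → partialSum a n ≤ partialSum b n
    sum-mono zero h = ≤-refl
    sum-mono (suc n) h = sum-mono n (λ i p → h i (ℕₚ.m<n⇒m<1+n p)) ⊞ h n ℕₚ.≤-refl

    sum-const : ∀ c n → partialSum (λ _ → c) n ≈ fromℕ n * c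
    sum-const c zero = sym (zeroˡ c)
    sum-const c (suc n) = trans (+-congʳ (sum-const c n)) (r (fromℕ n))
      where r : ∀ a → a * c + c ≈ (1# + a) * c
            r a = ring 2 (λ a b → a ⊗ b ⊕ b ⊜ (# 1 ⊕ a) ⊗ b) refl _ _

    sum-scale : ∀ c (a : ℕ → Carrier) n → partialSum (λ i → c * a i) n ≈ c * partialSum a n
    sum-scale c a zero = sym (zeroʳ c)
    sum-scale c a (suc n) = trans (+-congʳ (sum-scale c a n)) (ring 3 (λ a b c → a ⊗ b ⊕ a ⊗ c ⊜ a ⊗ (b ⊕ c)) refl _ _ _)

    telescope : ∀ (g : ℕ → Carrier) n → partialSum (λ i → g i - g (suc i)) n ≈ g 0 - g n
    telescope g zero = r (g 0)
      where r = ring 1 (λ a → # 0 ⊜ a ⊖ a) refl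
    telescope g (suc n) = trans (+-congʳ (telescope g n)) (ring 3 (λ a b c → a ⊖ b ⊕ (b ⊖ c) ⊜ a ⊖ c) refl _ _ _)

    take-suc : ∀ {A : Set} i {l l′ : List A} → take (suc i) l ≡ take (suc i) l′ → take i l ≡ take i l′
    take-suc zero p = ≡.refl
    take-suc (suc i) {[]} {[]} p = ≡.refl
    take-suc (suc i) {x ∷ l} {x′ ∷ l′} p = ≡.cong₂ _∷_ (Listₚ.∷-injectiveˡ p) (take-suc i (Listₚ.∷-injectiveʳ p))

    drop-suc : ∀ {A : Set} i {l l′ : List A} → drop i l ≡ drop i l′ → drop (suc i) l ≡ drop (suc i) l′
    drop-suc zero {l} {l′} p = ≡.cong (drop 1) p
    drop-suc (suc i) {[]} {[]} p = ≡.refl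
    drop-suc (suc i) {[]} {x ∷ l′} p = helper i l′ p
      where helper : ∀ {A : Set} i (l : List A) → [] ≡ drop i l → [] ≡ drop (suc i) l
            helper zero [] p = ≡.refl
            helper (suc i) [] p = ≡.refl
            helper (suc i) (x ∷ l) p = helper i l p
    drop-suc (suc i) {x ∷ l} {[]} p = helper i l p
      where helper : ∀ {A : Set} i (l : List A) → drop i l ≡ [] → drop (suc i) l ≡ []
            helper zero [] p = ≡.refl
            helper (suc i) [] p = ≡.refl
            helper (suc i) (x ∷ l) p = helper i l p
    drop-suc (suc i) {x ∷ l} {x′ ∷ l′} p = drop-suc i p

    take-toList : ∀ {A : Set} {n} (v : Vec A n) → take n (toList v) ≡ toList v
    take-toList [] = ≡.refl
    take-toList (x ∷ v) = ≡.cong (x ∷_) (take-toList v)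

    toList-inj : ∀ {A : Set} {n} (v w : Vec A n) → toList v ≡ toList w → v ≡ w
    toList-inj [] [] p = ≡.refl
    toList-inj (x ∷ v) (y ∷ w) p = ≡.cong₂ _∷_ (Listₚ.∷-injectiveˡ p) (toList-inj v w (Listₚ.∷-injectiveʳ p))

    module LeafLemmas (Ω : FinSet) {L : Set} where
      open LeafSums Ω {L} public

      entropy-cong : ∀ {A w w′} → NonNeg w → (∀ ω → w ω ≈ w′ ω) → entropy A w ≈ entropy A w′
      entropy-cong {A} {w} {w′} w≥0 h = trans
        (∑-support-cong Ω w≥0 λ ω p → ln-cong (mass-pos w≥0 A ω p) (∑-cong Ω λ ω′ → *-congʳ (h ω′)))
        (∑-cong Ω λ ω → *-congʳ (h ω))

      entropy-refine : ∀ {A B w} → NonNeg w → A refines B → B refines A → entropy A w ≈ entropy B w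
      entropy-refine {A} {B} {w} w≥0 p q = ∑-support-cong Ω w≥0 λ ω pos →
        ln-cong (mass-pos w≥0 A ω pos) (∑-cong Ω λ ω′ → *-congˡ (same-cong A B p q ω ω′))

      leaf-entropy-refine : ∀ {A B} t {w} → NonNeg w → A refines B → B refines A → leaf-entropy A t w ≈ leaf-entropy B t w
      leaf-entropy-refine {A} {B} (leaf _) w≥0 p q = entropy-refine {A} {B} w≥0 p q
      leaf-entropy-refine {A} {B} (nodeˡ m t₁ t₀) w≥0 p q = +-cong (leaf-entropy-refine {A} {B} t₁ (part-nonNeg m true w≥0) p q) (leaf-entropy-refine {A} {B} t₀ (part-nonNeg m false w≥0) p q)
      leaf-entropy-refine {A} {B} (nodeʳ m t₁ t₀) w≥0 p q = +-cong (leaf-entropy-refine {A} {B} t₁ (part-nonNeg m true w≥0) p q) (leaf-entropy-refine {A} {B} t₀ (part-nonNeg m false w≥0) p q)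

      Determines : Observable (Elem Ω) → (Elem Ω → Bool) → Set
      Determines A m = ∀ {ω ω′} → value A ω ≡ value A ω′ → m ω ≡ m ω′

      -- A message determined by A splits no class of A, so every mass survives unchanged on its
      -- side.
      gain-zero : ∀ {A m w} → NonNeg w → Determines A m → gain A m w ≈ 0#
      gain-zero {A} {m} {w} w≥0 det = trans (+-congʳ (trans (+-cong (side true) (side false)) (expect-part w m _))) (r (entropy A w))
        where
        r = ring 1 (λ a → a ⊖ a ⊜ # 0) refl
        on-side : ∀ b ω → 0# < part w m b ω → b ≡ m ω
        on-side b ω p with b | m ω
        ... | true | true = ≡.refl
        ... | false | false = ≡.refl
        ... | true | false = ⊥-elim (<-irrefl (sym (zeroʳ _)) p)
        ... | false | true = ⊥-elim (<-irrefl (sym (zeroʳ _)) p)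
        side : ∀ b → entropy A (part w m b) ≈ expect (part w m b) (λ ω → ln (mass A w ω))
        side b = ∑-support-cong Ω (part-nonNeg m b w≥0) λ ω p → ln-cong (mass-pos (part-nonNeg m b w≥0) A ω p) (∑-cong Ω λ ω′ → term ω ω′ (on-side b ω p))
          where
          term : ∀ ω ω′ → b ≡ m ω → part w m b ω′ * same A ω ω′ ≈ w ω′ * same A ω ω′
          term ω ω′ e with _≟ⱽ_ A (value A ω) (value A ω′)
          ... | no _ = trans (zeroʳ _) (sym (zeroʳ _))
          ... | yes q = *-congʳ (part-on {w} m b ω′ (≡.trans (≡.sym (det q)) (≡.sym e)))

      leaf-supermodular : ∀ (A B C D : Observable (Elem Ω)) → A refines C → B refines C →
        (∀ {ω ω′} → value A ω ≡ value A ω′ → value B ω ≡ value B ω′ → value D ω ≡ value D ω′) →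
        ∀ t {w} → NonNeg w → leaf-entropy A t w + leaf-entropy B t w ≤ leaf-entropy C t w + leaf-entropy D t w
      leaf-supermodular A B C D AC BC ABD (leaf _) w≥0 = supermodular w≥0 A B C D AC BC ABD
      leaf-supermodular A B C D AC BC ABD (nodeˡ m t₁ t₀) w≥0 = by≤
        (leaf-supermodular A B C D AC BC ABD t₁ (part-nonNeg m true w≥0) ⊞ leaf-supermodular A B C D AC BC ABD t₀ (part-nonNeg m false w≥0)) (ring 8 (λ a b c d e f g h → a ⊕ b ⊕ (c ⊕ d) ⊕ (e ⊕ f ⊕ (g ⊕ h)) ⊜ e ⊕ g ⊕ (f ⊕ h) ⊕ (a ⊕ c ⊕ (b ⊕ d))) refl _ _ _ _ _ _ _ _)
      leaf-supermodular A B C D AC BC ABD (nodeʳ m t₁ t₀) w≥0 = by≤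
        (leaf-supermodular A B C D AC BC ABD t₁ (part-nonNeg m true w≥0) ⊞ leaf-supermodular A B C D AC BC ABD t₀ (part-nonNeg m false w≥0)) (ring 8 (λ a b c d e f g h → a ⊕ b ⊕ (c ⊕ d) ⊕ (e ⊕ f ⊕ (g ⊕ h)) ⊜ e ⊕ g ⊕ (f ⊕ h) ⊕ (a ⊕ c ⊕ (b ⊕ d))) refl _ _ _ _ _ _ _ _)

      data Spoken (A B : Observable (Elem Ω)) : Shape (Elem Ω) L → Set where
        leaf : ∀ {l} → Spoken A B (leaf l)
        nodeˡ : ∀ {m t₁ t₀} → Determines A m → Spoken A B t₁ → Spoken A B t₀ → Spoken A B (nodeˡ m t₁ t₀)
        nodeʳ : ∀ {m t₁ t₀} → Determines B m → Spoken A B t₁ → Spoken A B t₀ → Spoken A B (nodeʳ m t₁ t₀)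

      leaf-entropy-determined : ∀ {A B C t w} → NonNeg w → Spoken A B t → C refines A → C refines B → leaf-entropy C t w ≈ entropy C w
      leaf-entropy-determined w≥0 leaf CA CB = refl
      leaf-entropy-determined {C = C} {w = w} w≥0 (nodeˡ {m} d s₁ s₀) CA CB = trans
        (+-cong (leaf-entropy-determined (part-nonNeg m true w≥0) s₁ CA CB) (leaf-entropy-determined (part-nonNeg m false w≥0) s₀ CA CB))
        (by≈ (gain-zero {C} {m} {w} w≥0 λ e → d (CA e)) (ring 3 (λ a b c → a ⊕ (b ⊕ c ⊖ a) ⊜ b ⊕ c ⊕ # 0) refl _ _ _))
      leaf-entropy-determined {C = C} {w = w} w≥0 (nodeʳ {m} d s₁ s₀) CA CB = trans
        (+-cong (leaf-entropy-determined (part-nonNeg m true w≥0) s₁ CA CB) (leaf-entropy-determined (part-nonNeg m false w≥0) s₀ CA CB))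
        (by≈ (gain-zero {C} {m} {w} w≥0 λ e → d (CB e)) (ring 3 (λ a b c → a ⊕ (b ⊕ c ⊖ a) ⊜ b ⊕ c ⊕ # 0) refl _ _ _))

      -- Along any sequence of observables from Bob's input to Alice's, the
      -- log-likelihoods telescope, since each player knows his own messages.
      module Telescoping (z : ℕ → Observable (Elem Ω)) where
        Φ : ℕ → Shape (Elem Ω) L → Weight → Carrier
        Φ j t w = leaf-entropy (z j) t w - entropy (z j) w

        -- At Alice's nodes the gains run over z 1, ..., z n, and the last vanishes because z n
        -- determines her messages. At Bob's they run over z 0, ..., z (n - 1), where the first
        -- vanishes; shifting the index adds the gain of z n, which Φ n takes away again.
        likelihood-sum : ∀ n t {w} → NonNeg w → Spoken (z n) (z 0) t →
          partialSum (λ i → log-likelihood (z (suc i)) (z i) t w) n ≈ partialSum (λ i → Φ (suc i) t w) n - Φ n t w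
        likelihood-sum n (leaf _) {w} w≥0 leaf = trans (sum-zero n) (sym (trans (+-cong (zeros n) (-‿cong (r (entropy (z n) w)))) (ring 0 (# 0 ⊖ # 0 ⊜ # 0) refl)))
          where
          r = ring 1 (λ a → a ⊖ a ⊜ # 0) refl
          sum-zero : ∀ n → partialSum (λ i → 0#) n ≈ 0#
          sum-zero n = trans (sum-const 0# n) (zeroʳ _)
          zeros : ∀ n → partialSum (λ i → entropy (z (suc i)) w - entropy (z (suc i)) w) n ≈ 0#
          zeros n = trans (ps-cong (λ i → r (entropy (z (suc i)) w)) n) (sum-zero n)
        likelihood-sum n (nodeˡ m t₁ t₀) {w} w≥0 (nodeˡ d s₁ s₀) = trans (sum-+ _ _ n) (trans (+-congˡ (trans (sum-+ _ _ n)
            (+-cong (likelihood-sum n t₁ (part-nonNeg m true w≥0) s₁) (likelihood-sum n t₀ (part-nonNeg m false w≥0) s₀))))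
          (trans (r _ _ _ _ _) (sym (+-cong (trans (ps-cong (λ i → split (suc i)) n) (trans (sum-+ _ _ n) (+-congˡ (sum-+ _ _ n))))
             (-‿cong (trans (split n) (trans (+-congʳ (gain-zero {z n} {m} {w} w≥0 d)) (+-identityˡ _))))))))
          where
          split : ∀ j → Φ j (nodeˡ m t₁ t₀) w ≈ gain (z j) m w + (Φ j t₁ (part w m true) + Φ j t₀ (part w m false))
          split j = ring 5 (λ a b c d e → a ⊕ b ⊖ c ⊜ d ⊕ e ⊖ c ⊕ (a ⊖ d ⊕ (b ⊖ e))) refl _ _ _ _ _
          r = ring 5 (λ g a b c d → g ⊕ (a ⊖ b ⊕ (c ⊖ d)) ⊜ g ⊕ (a ⊕ c) ⊖ (b ⊕ d)) refl
        likelihood-sum n (nodeʳ m t₁ t₀) {w} w≥0 (nodeʳ d s₁ s₀) = trans (sum-+ _ _ n) (trans (+-congˡ (trans (sum-+ _ _ n)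
            (+-cong (likelihood-sum n t₁ (part-nonNeg m true w≥0) s₁) (likelihood-sum n t₀ (part-nonNeg m false w≥0) s₀))))
          (trans (r _ _ _ _ _ (gain (z n) m w)) (sym (+-cong (trans (ps-cong (λ i → split (suc i)) n) (trans (sum-+ _ _ n) (+-cong shift-gain (sum-+ _ _ n))))
             (-‿cong (split n))))))
          where
          g : ℕ → Carrier
          g j = gain (z j) m w
          split : ∀ j → Φ j (nodeʳ m t₁ t₀) w ≈ gain (z j) m w + (Φ j t₁ (part w m true) + Φ j t₀ (part w m false))
          split j = ring 5 (λ a b c d e → a ⊕ b ⊖ c ⊜ d ⊕ e ⊖ c ⊕ (a ⊖ d ⊕ (b ⊖ e))) refl _ _ _ _ _
          shift-gain : partialSum (λ i → gain (z (suc i)) m w) n ≈ partialSum (λ i → gain (z i) m w) n + gain (z n) m w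
          shift-gain = sym (trans (ps-left g n) (trans (+-congʳ (gain-zero {z 0} {m} {w} w≥0 d)) (+-identityˡ _)))
          r = ring 6 (λ s a b c d g → s ⊕ (a ⊖ b ⊕ (c ⊖ d)) ⊜ s ⊕ g ⊕ (a ⊕ c) ⊖ (g ⊕ (b ⊕ d))) refl

      -- At s = 1 and total weight one it reads E ln G ≤ `leaf-entropy A t w` + d ln 2: d bits of
      -- transcript add at most d ln 2 to an entropy bounded through the law G. The scale s is the
      -- share of Kraft's sum allotted to the node.
      KraftBound : Observable (Elem Ω) → Weight → ℕ → Shape (Elem Ω) L → Weight → Carrier → Set
      KraftBound A G d t w s = expect w (λ ω → ln (G ω)) + ∑ Ω w * ln s - fromℕ d * ln (fromℕ 2) * ∑ Ω w ≤ leaf-entropy A t w + s - ∑ Ω w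

      kraft-node : ∀ {A G} m t₁ t₀ d {w s} → 0# < s →
        KraftBound A G d t₁ (part w m true) (s * half) → KraftBound A G d t₀ (part w m false) (s * half) →
        expect w (λ ω → ln (G ω)) + ∑ Ω w * ln s - fromℕ (suc d) * ln (fromℕ 2) * ∑ Ω w ≤
        (leaf-entropy A t₁ (part w m true) + leaf-entropy A t₀ (part w m false)) + s - ∑ Ω w
      kraft-node {A} {G} m t₁ t₀ d {w} {s} s>0 h₁ h₀ = ≤-trans (≤-reflexive (+-cong (+-cong (sym (expect-part w m _)) (*-congʳ W-eq)) (-‿cong (*-congˡ W-eq))))
        (≤-trans (by≤ (h₁ ⊞ h₀ ⊞ ≤-reflexive (halves s)) (trans (+-congˡ (+-congʳ (+-cong
            (+-congʳ (+-congˡ (*-congˡ ln-half))) (+-congʳ (+-congˡ (*-congˡ ln-half))))))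
            (r (expect (part w m true) λ ω → ln (G ω)) (expect (part w m false) λ ω → ln (G ω)) (∑ Ω (part w m true)) (∑ Ω (part w m false))
               (ln s) (ln (fromℕ 2)) (fromℕ d) (leaf-entropy A t₁ (part w m true)) (leaf-entropy A t₀ (part w m false)) (s * half) s)))
          (≤-reflexive (+-congˡ (-‿cong (sym W-eq)))))
        where
        W-eq : ∑ Ω w ≈ ∑ Ω (part w m true) + ∑ Ω (part w m false)
        W-eq = sym (total-part w m)
        ln-half : ln (s * half) ≈ ln s - ln (fromℕ 2)
        ln-half = ln-/ s>0 (fromℕ-pos 1)
        r = ring 11 (λ E₁ E₀ W₁ W₀ l t d h₁ h₀ k s → h₁ ⊕ h₀ ⊕ s ⊖ (W₁ ⊕ W₀) ⊕ (E₁ ⊕ W₁ ⊗ (l ⊖ t) ⊖ d ⊗ t ⊗ W₁ ⊕ (E₀ ⊕ W₀ ⊗ (l ⊖ t) ⊖ d ⊗ t ⊗ W₀) ⊕ (k ⊕ k)) ⊜ E₁ ⊕ E₀ ⊕ (W₁ ⊕ W₀) ⊗ l ⊖ (# 1 ⊕ d) ⊗ t ⊗ (W₁ ⊕ W₀) ⊕ (h₁ ⊕ k ⊖ W₁ ⊕ (h₀ ⊕ k ⊖ W₀) ⊕ s)) refl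

      -- Kraft's inequality enters through halving the scale at every node.
      kraft : ∀ {A : Observable (Elem Ω)} {G : Weight} → (∀ {w} → NonNeg w → ∑ Ω (λ ω → w ω * (G ω * mass A w ω ⁻¹)) ≤ 1#) →
        ∀ t d {w} → NonNeg w → (∀ ω → 0# < w ω → 0# < G ω) → size′ t ℕ.≤ d → ∀ {s} → 0# < s →
        KraftBound A G d t w s
      kraft {A} {G} norm (leaf _) d {w} w≥0 G>0 fits {s} s>0 = by≤
        (≤-trans (≤-reflexive (+-congʳ (sym split))) (≤-trans (gibbs w≥0 {λ ω → s * (G ω * mass A w ω ⁻¹)} r>0) (≤-trans (≤-reflexive scaled) (*-monoˡ-≤ (<⇒≤ s>0) (norm w≥0))))
          ⊞ *-nonNeg (*-nonNeg (fromℕ-nonNeg d) (<⇒≤ ln-2-pos)) (total-nonNeg w≥0))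
        (r (expect w λ ω → ln (G ω)) (∑ Ω w) (ln s) (fromℕ d * ln (fromℕ 2) * ∑ Ω w) (entropy A w) s)
        where
        r>0 : ∀ ω → 0# < w ω → 0# < s * (G ω * mass A w ω ⁻¹)
        r>0 ω p = *-pos s>0 (*-pos (G>0 ω p) (inv-pos (mass-pos w≥0 A ω p)))
        scaled : ∑ Ω (λ ω → w ω * (s * (G ω * mass A w ω ⁻¹))) ≈ s * ∑ Ω (λ ω → w ω * (G ω * mass A w ω ⁻¹))
        scaled = trans (∑-cong Ω λ ω → r′ (w ω) s _) (∑-*ˡ Ω _ _)
          where r′ = ring 3 (λ a b c → a ⊗ (b ⊗ c) ⊜ b ⊗ (a ⊗ c)) refl
        split : expect w (λ ω → ln (s * (G ω * mass A w ω ⁻¹))) ≈ ∑ Ω w * ln s + expect w (λ ω → ln (G ω)) - entropy A w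
        split = trans (∑-support-cong Ω w≥0 λ ω p → trans (ln-* s>0 (*-pos (G>0 ω p) (inv-pos (mass-pos w≥0 A ω p)))) (+-congˡ (ln-/ (G>0 ω p) (mass-pos w≥0 A ω p))))
          (trans (∑-cong Ω λ ω → r′ (w ω) (ln s) (ln (G ω)) (ln (mass A w ω))) (trans (∑-sub Ω _ _) (+-congʳ (trans (∑-+ Ω _ _) (+-congʳ (∑-*ʳ Ω _ _))))))
          where r′ = ring 4 (λ w s g m → w ⊗ (s ⊕ (g ⊖ m)) ⊜ w ⊗ s ⊕ w ⊗ g ⊖ w ⊗ m) refl
        r = ring 6 (λ E W l z h s → h ⊕ s ⊖ W ⊕ (W ⊗ l ⊕ E ⊖ h ⊕ W ⊕ # 0) ⊜ E ⊕ W ⊗ l ⊖ z ⊕ (s ⊗ # 1 ⊕ z)) refl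
      kraft {A} {G} norm (nodeˡ m t₁ t₀) (suc d) {w} w≥0 G>0 (ℕ.s≤s fits) {s} s>0 = kraft-node {A} {G} m t₁ t₀ d s>0
        (kraft norm t₁ d (part-nonNeg m true w≥0) (λ ω p → G>0 ω (part-pos m true w≥0 ω p)) (ℕₚ.≤-trans (ℕₚ.m≤m⊔n (size′ t₁) (size′ t₀)) fits) (*-pos s>0 half-pos))
        (kraft norm t₀ d (part-nonNeg m false w≥0) (λ ω p → G>0 ω (part-pos m false w≥0 ω p)) (ℕₚ.≤-trans (ℕₚ.m≤n⊔m (size′ t₁) (size′ t₀)) fits) (*-pos s>0 half-pos))
      kraft {A} {G} norm (nodeʳ m t₁ t₀) (suc d) {w} w≥0 G>0 (ℕ.s≤s fits) {s} s>0 = kraft-node {A} {G} m t₁ t₀ d s>0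
        (kraft norm t₁ d (part-nonNeg m true w≥0) (λ ω p → G>0 ω (part-pos m true w≥0 ω p)) (ℕₚ.≤-trans (ℕₚ.m≤m⊔n (size′ t₁) (size′ t₀)) fits) (*-pos s>0 half-pos))
        (kraft norm t₀ d (part-nonNeg m false w≥0) (λ ω p → G>0 ω (part-pos m false w≥0 ω p)) (ℕₚ.≤-trans (ℕₚ.m≤n⊔m (size′ t₁) (size′ t₀)) fits) (*-pos s>0 half-pos))

  -- Divergence and information summed over the coordinates.

  module InformationBudget where
    open OrderedField
    open ExponentialLogarithm hiding (e; term)
    open FiniteSums
    open Entropies
    open XorBias using (power; power-nonNeg; power-total)
    open TranscriptTrees
    open TranscriptEntropies

    lnAt : ∀ {A : Set} → (A → Carrier) → ℕ → List A → Carrier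
    lnAt μ i [] = 0#
    lnAt μ zero (x ∷ _) = ln (μ x)
    lnAt μ (suc i) (_ ∷ l) = lnAt μ i l

    lnAt-lookup : ∀ {A : Set} (μ : A → Carrier) {n} (v : Vec A n) i → lnAt μ (toℕ i) (toList v) ≡ ln (μ (lookup v i))
    lnAt-lookup μ (x ∷ v) zero = ≡.refl
    lnAt-lookup μ (x ∷ v) (suc i) = lnAt-lookup μ v i

    power-pos : ∀ {A : Set} {μ : A → Carrier} → (∀ x → 0# ≤ μ x) → ∀ {n} (v : Vec A n) → 0# < power μ v → ∀ i → 0# < μ (lookup v i)
    power-pos μ≥0 (x ∷ v) p zero = *-pos-factorˡ (μ≥0 x) p
    power-pos μ≥0 (x ∷ v) p (suc i) = power-pos μ≥0 v (*-pos-factorʳ (power-nonNeg μ≥0 v) p) i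

    lnAt-sum : ∀ {A : Set} {μ : A → Carrier} → (∀ x → 0# ≤ μ x) → ∀ {n} (v : Vec A n) → 0# < power μ v →
      partialSum (λ i → lnAt μ i (toList v)) n ≈ ln (power μ v)
    lnAt-sum μ≥0 [] p = sym ln-1
    lnAt-sum {μ = μ} μ≥0 {suc n} (x ∷ v) p = trans (ps-left (λ i → lnAt μ i (x ∷ toList v)) n)
      (trans (+-congˡ (lnAt-sum μ≥0 v q)) (sym (ln-* (*-pos-factorˡ (μ≥0 x) p) q)))
      where q = *-pos-factorʳ (power-nonNeg μ≥0 v) p

    module Around (X Y : FinSet) (n : ℕ) where
      Ω : FinSet
      Ω = (X ^ᶠ n) ×ᶠ (Y ^ᶠ n)

      -- Values are lists because the length of a prefix or suffix varies with i.
      obs : (List (Elem X) → List (Elem X)) → (List (Elem Y) → List (Elem Y)) → Observable (Elem Ω)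
      obs a b = record { value = λ (xs , ys) → a (toList xs) , b (toList ys)
                       ; _≟ⱽ_ = ≡-dec (Listₚ.≡-dec (_≟ᴱ_ {X})) (Listₚ.≡-dec (_≟ᴱ_ {Y})) }

      -- What is known around coordinate i: the entries of x before i and those of
      -- y after i, with neither, one or both of x_i and y_i.
      ctx cut both : ℕ → Observable (Elem Ω)
      ctx i = obs (take i) (drop (suc i))
      cut i = obs (take i) (drop i)
      both i = obs (take (suc i)) (drop i)

      obsXs obsYs obsXYs : Observable (Elem Ω)
      obsXs = obs id (λ _ → [])
      obsYs = obs (λ _ → []) id
      obsXYs = obs id id

      module _ (μ : Elem X → Carrier) (μ≥0 : ∀ x → 0# ≤ μ x) (μ-total : ∑ X μ ≈ 1#)
               (ν : Elem Y → Carrier) (ν≥0 : ∀ y → 0# ≤ ν y) (ν-total : ∑ Y ν ≈ 1#) where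
        open LeafLemmas Ω {⊤}

        ℓ : ℕ → Elem Ω → Carrier
        ℓ i (xs , ys) = lnAt μ i (toList xs) + lnAt ν i (toList ys)

        module _ (t : Shape (Elem Ω) ⊤) (d : ℕ) (fits : size′ t ℕ.≤ d) (spoken : Spoken (cut n) (cut 0) t)
          {Q : Weight} (Q≥0 : NonNeg Q) (Q-total : ∑ Ω Q ≈ 1#)
          (supp : ∀ ω → 0# < Q ω → (0# < power μ (proj₁ ω)) × (0# < power ν (proj₂ ω)))
          (B : Carrier) (B-bound : entropy obsXYs Q ≤ expect Q (λ ω → ln (power μ (proj₁ ω)) + ln (power ν (proj₂ ω))) + B) where

          -- Given the context at i, `divergence i` compares the true law of transcript and pair
          -- with the simulated one. `information i` compares the pair with μ and ν, given the
          -- transcript as well.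
          divergence information : ℕ → Carrier
          divergence i = leaf-entropy (both i) t Q - entropy (ctx i) Q - expect Q (ℓ i) - log-likelihood (cut (suc i)) (cut i) t Q
          information i = leaf-entropy (both i) t Q - leaf-entropy (ctx i) t Q - expect Q (ℓ i)

          private
            Eμ Eν : Carrier
            Eμ = expect Q λ ω → ln (power μ (proj₁ ω))
            Eν = expect Q λ ω → ln (power ν (proj₂ ω))

            -- Chains between one player's input and the pair of inputs, along which the sums over i
            -- telescope.
            xd ty : ℕ → Observable (Elem Ω)
            xd i = obs id (drop i)
            ty i = obs (take i) id

            pair : ∀ {A B : Set} {a a′ : A} {b b′ : B} → a ≡ a′ → b ≡ b′ → (a , b) ≡ (a′ , b′)
            pair = ≡.cong₂ _,_

            drop-end : ∀ (ω : Elem Ω) → drop n (toList (proj₂ ω)) ≡ []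
            drop-end (_ , ys) = go ys
              where go : ∀ {A : Set} {m} (v : Vec A m) → drop m (toList v) ≡ []
                    go [] = ≡.refl
                    go (x ∷ v) = go v

            bobs-part : ∀ t → (∀ i → leaf-entropy (both i) t Q + leaf-entropy (xd (suc i)) t Q ≤ leaf-entropy (cut (suc i)) t Q + leaf-entropy (xd i) t Q)
            bobs-part t i = leaf-supermodular (both i) (xd (suc i)) (cut (suc i)) (xd i)
              (λ e → pair (,-injectiveˡ e) (drop-suc i (,-injectiveʳ e)))
              (λ e → pair (≡.cong (take (suc i)) (,-injectiveˡ e)) (,-injectiveʳ e))
              (λ e e′ → pair (,-injectiveˡ e′) (,-injectiveʳ e)) t Q≥0

            alices-part : ∀ t → (∀ i → leaf-entropy (cut (suc i)) t Q + leaf-entropy (ty i) t Q ≤ leaf-entropy (ctx i) t Q + leaf-entropy (ty (suc i)) t Q)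
            alices-part t i = leaf-supermodular (cut (suc i)) (ty i) (ctx i) (ty (suc i))
              (λ e → pair (take-suc i (,-injectiveˡ e)) (,-injectiveʳ e))
              (λ e → pair (,-injectiveˡ e) (≡.cong (drop (suc i)) (,-injectiveʳ e)))
              (λ e e′ → pair (,-injectiveˡ e) (,-injectiveʳ e′)) t Q≥0

            -- Knowing all of x instead of its first i + 1 entries only lowers the entropy of Bob's
            -- entry i; after this replacement the sum telescopes.
            bobs-sum : ∀ t → partialSum (λ i → leaf-entropy (both i) t Q - leaf-entropy (cut (suc i)) t Q) n ≤ leaf-entropy (xd 0) t Q - leaf-entropy (xd n) t Q
            bobs-sum t = ≤-trans (sum-mono n λ i _ → by≤ (bobs-part t i) (r _ _ _ _))
              (≤-reflexive (telescope (λ i → leaf-entropy (xd i) t Q) n))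
              where r = ring 4 (λ a b c d → d ⊖ b ⊕ (a ⊕ b) ⊜ a ⊖ c ⊕ (c ⊕ d)) refl

            alices-sum : ∀ t → partialSum (λ i → leaf-entropy (cut (suc i)) t Q - leaf-entropy (ctx i) t Q) n ≤ leaf-entropy (ty n) t Q - leaf-entropy (ty 0) t Q
            alices-sum t = ≤-trans (sum-mono n λ i _ → by≤ (alices-part t i) (r _ _ (leaf-entropy (ctx i) t Q) _))
              (≤-reflexive (trans (sum-sub _ _ n) (trans (r′ _ _) (trans (-‿cong (trans (sym (sum-sub _ _ n)) (telescope (λ i → leaf-entropy (ty i) t Q) n))) (sym (r′ _ _))))))
              where r = ring 4 (λ a b c d → d ⊖ b ⊕ (a ⊕ b) ⊜ a ⊖ c ⊕ (c ⊕ d)) refl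
                    r′ = ring 2 (λ a b → a ⊖ b ⊜ ⊝ (b ⊖ a)) refl

            xd-0 : ∀ t → leaf-entropy (xd 0) t Q ≈ leaf-entropy obsXYs t Q
            xd-0 t = leaf-entropy-refine {xd 0} {obsXYs} t Q≥0 (λ e → e) (λ e → e)
            xd-n : ∀ t → leaf-entropy (xd n) t Q ≈ leaf-entropy obsXs t Q
            xd-n t = leaf-entropy-refine {xd n} {obsXs} t Q≥0 (λ e → pair (,-injectiveˡ e) ≡.refl)
              (λ {ω} {ω′} e → pair (,-injectiveˡ e) (≡.trans (drop-end ω) (≡.sym (drop-end ω′))))
            ty-n : ∀ t → leaf-entropy (ty n) t Q ≈ leaf-entropy obsXYs t Q
            ty-n t = leaf-entropy-refine {ty n} {obsXYs} t Q≥0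
              (λ {ω} {ω′} e → pair (≡.trans (≡.sym (take-toList (proj₁ ω))) (≡.trans (,-injectiveˡ e) (take-toList (proj₁ ω′)))) (,-injectiveʳ e))
              (λ e → pair (≡.cong (take n) (,-injectiveˡ e)) (,-injectiveʳ e))
            ty-0 : ∀ t → leaf-entropy (ty 0) t Q ≈ leaf-entropy obsYs t Q
            ty-0 t = leaf-entropy-refine {ty 0} {obsYs} t Q≥0 (λ e → e) (λ e → e)
            cut-n : ∀ t → leaf-entropy (cut n) t Q ≈ leaf-entropy obsXs t Q
            cut-n t = leaf-entropy-refine {cut n} {obsXs} t Q≥0
              (λ {ω} {ω′} e → pair (≡.trans (≡.sym (take-toList (proj₁ ω))) (≡.trans (,-injectiveˡ e) (take-toList (proj₁ ω′)))) ≡.refl)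
              (λ {ω} {ω′} e → pair (≡.cong (take n) (,-injectiveˡ e)) (≡.trans (drop-end ω) (≡.sym (drop-end ω′))))

            hXY : leaf-entropy obsXYs t Q ≈ entropy obsXYs Q
            hXY = leaf-entropy-determined Q≥0 spoken (λ e → pair (≡.cong (take n) (,-injectiveˡ e)) (≡.cong (drop n) (,-injectiveʳ e)))
              (λ e → pair ≡.refl (,-injectiveʳ e))

            ℓ-sum : partialSum (λ i → expect Q (ℓ i)) n ≈ Eμ + Eν
            ℓ-sum = trans (sym (swap n)) (trans (∑-support-cong Ω Q≥0 λ ω p → trans (sum-+ _ _ n) (+-cong (lnAt-sum μ≥0 (proj₁ ω) (proj₁ (supp ω p))) (lnAt-sum ν≥0 (proj₂ ω) (proj₂ (supp ω p)))))
              (trans (∑-cong Ω λ ω → r (Q ω) _ _) (∑-+ Ω _ _)))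
              where
              r = ring 3 (λ a b c → a ⊗ (b ⊕ c) ⊜ a ⊗ b ⊕ a ⊗ c) refl
              swap : ∀ m → expect Q (λ ω → partialSum (λ i → ℓ i ω) m) ≈ partialSum (λ i → expect Q (ℓ i)) m
              swap zero = ∑-zero Ω λ ω → zeroʳ _
              swap (suc m) = trans (∑-cong Ω λ ω → r (Q ω) _ _) (trans (∑-+ Ω _ _) (+-congʳ (swap m)))

            normX : ∀ {w} → NonNeg w → ∑ Ω (λ ω → w ω * (power μ (proj₁ ω) * mass obsXs w ω ⁻¹)) ≤ 1#
            normX w≥0 = ≤-trans (∑-pushforward w≥0 {X ^ᶠ n} proj₁ obsXs (λ e → pair (≡.cong toList e) ≡.refl) {power μ} (power-nonNeg μ≥0))
              (≤-reflexive (power-total X μ-total n))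
            normY : ∀ {w} → NonNeg w → ∑ Ω (λ ω → w ω * (power ν (proj₂ ω) * mass obsYs w ω ⁻¹)) ≤ 1#
            normY w≥0 = ≤-trans (∑-pushforward w≥0 {Y ^ᶠ n} proj₂ obsYs (λ e → pair ≡.refl (≡.cong toList e)) {power ν} (power-nonNeg ν≥0))
              (≤-reflexive (power-total Y ν-total n))

            kraft₁ : ∀ (A : Observable (Elem Ω)) (G : Weight) → (∀ {w} → NonNeg w → ∑ Ω (λ ω → w ω * (G ω * mass A w ω ⁻¹)) ≤ 1#) →
              (∀ ω → 0# < Q ω → 0# < G ω) → ∀ t d → size′ t ℕ.≤ d → expect Q (λ ω → ln (G ω)) ≤ leaf-entropy A t Q + fromℕ d * ln (fromℕ 2)
            kraft₁ A G norm G>0 t d fits = by≤ (≤-trans (≤-reflexive (+-cong (+-congˡ (sym (trans (*-congˡ ln-1) (zeroʳ _)))) (-‿cong (trans (sym (*-identityʳ _)) (*-congˡ (sym Q-total))))))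
                (≤-trans (kraft {A} {G} norm t d Q≥0 G>0 fits 0<1) (≤-reflexive (+-congˡ (-‿cong Q-total)))))
              (r (leaf-entropy A t Q) (expect Q (λ ω → ln (G ω))) (fromℕ d * ln (fromℕ 2)))
              where r = ring 3 (λ h E z → h ⊕ z ⊕ (E ⊕ # 0 ⊖ z) ⊜ E ⊕ (h ⊕ # 1 ⊖ # 1)) refl

            zero-d : ∀ {h E} → E ≤ h + fromℕ 0 * ln (fromℕ 2) → E ≤ h
            zero-d p = by≤ p (ring 3 (λ a b c → a ⊕ b ⊜ b ⊕ (a ⊕ # 0 ⊗ c)) refl _ _ _)

            B′ : entropy obsXYs Q ≤ Eμ + Eν + B
            B′ = ≤-trans B-bound (≤-reflexive (+-congʳ (trans (∑-cong Ω λ ω → r (Q ω) _ _) (∑-+ Ω _ _))))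
              where r = ring 3 (λ a b c → a ⊗ (b ⊕ c) ⊜ a ⊗ b ⊕ a ⊗ c) refl

          -- Bob's sum is taken with the transcript and Alice's without it, and `likelihood-sum`
          -- supplies exactly the difference. The transcript cancels, leaving twice the entropy of
          -- the pair of inputs minus those of x and of y and the prior; each of the two halves
          -- contributes at most B.
          divergence-sum : partialSum divergence n ≤ fromℕ 2 * B
          divergence-sum = by≤ (bobs-sum t ⊞ alices-sum (leaf tt)
              ⊞ zero-d (kraft₁ obsXs (λ ω → power μ (proj₁ ω)) normX (λ ω p → proj₁ (supp ω p)) (leaf tt) 0 ℕ.z≤n)
              ⊞ zero-d (kraft₁ obsYs (λ ω → power ν (proj₂ ω)) normY (λ ω p → proj₂ (supp ω p)) (leaf tt) 0 ℕ.z≤n) ⊞ B′ ⊞ B′)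
            (trans (+-congˡ (+-congʳ (+-congʳ (+-congʳ (+-congʳ (+-cong (sum-sub _ _ n) (sum-sub _ _ n)))))))
              (trans (r B Eμ Eν (entropy obsXYs Q) (partialSum (λ i → leaf-entropy (both i) t Q) n) (partialSum (λ i → leaf-entropy (cut (suc i)) t Q) n)
                 (partialSum (λ i → entropy (cut (suc i)) Q) n) (partialSum (λ i → entropy (ctx i) Q) n)
                 (leaf-entropy obsXs t Q) (entropy obsXs Q) (entropy obsYs Q))
               (sym (+-cong sum-eq (+-congʳ (+-congʳ (+-congʳ (+-congʳ (+-cong
                 (+-cong (trans (xd-0 t) hXY) (-‿cong (xd-n t))) (+-cong (ty-n (leaf tt)) (-‿cong (ty-0 (leaf tt)))))))))))))
            where
            sum-eq : partialSum divergence n ≈ partialSum (λ i → leaf-entropy (both i) t Q) n - partialSum (λ i → entropy (ctx i) Q) n - (Eμ + Eν)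
              - (partialSum (λ i → leaf-entropy (cut (suc i)) t Q) n - partialSum (λ i → entropy (cut (suc i)) Q) n - (leaf-entropy obsXs t Q - entropy obsXs Q))
            sum-eq = trans (sum-sub _ _ n) (+-cong (trans (sum-sub _ _ n) (+-cong (sum-sub _ _ n) (-‿cong ℓ-sum)))
              (-‿cong (trans (Telescoping.likelihood-sum cut n t Q≥0 spoken)
                (+-cong (sum-sub _ _ n) (-‿cong (+-cong (cut-n t) (-‿cong (cut-n (leaf tt)))))))))
            r = ring 11 (λ B m v h P c k x hX X′ Y′ → # 2 ⊗ B ⊕ (P ⊖ c ⊕ (k ⊖ x) ⊕ m ⊕ v ⊕ h ⊕ h) ⊜ P ⊖ x ⊖ (m ⊕ v) ⊖ (c ⊖ k ⊖ (hX ⊖ X′)) ⊕ (h ⊖ hX ⊕ (h ⊖ Y′) ⊕ X′ ⊕ Y′ ⊕ (m ⊕ v ⊕ B) ⊕ (m ⊕ v ⊕ B))) refl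

          -- Both sums now include the transcript, and each of the two marginal bounds pays d ln 2
          -- by Kraft's inequality.
          information-sum : partialSum information n ≤ fromℕ 2 * B + fromℕ 2 * (fromℕ d * ln (fromℕ 2))
          information-sum = by≤ (bobs-sum t ⊞ alices-sum t
              ⊞ kraft₁ obsXs (λ ω → power μ (proj₁ ω)) normX (λ ω p → proj₁ (supp ω p)) t d fits
              ⊞ kraft₁ obsYs (λ ω → power ν (proj₂ ω)) normY (λ ω p → proj₂ (supp ω p)) t d fits ⊞ B′ ⊞ B′)
            (trans (+-congˡ (+-congʳ (+-congʳ (+-congʳ (+-congʳ (+-cong (sum-sub _ _ n) (sum-sub _ _ n)))))))
              (trans (r B Eμ Eν (entropy obsXYs Q) (partialSum (λ i → leaf-entropy (both i) t Q) n) (partialSum (λ i → leaf-entropy (cut (suc i)) t Q) n)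
                 (partialSum (λ i → leaf-entropy (ctx i) t Q) n) (leaf-entropy obsXs t Q) (leaf-entropy obsYs t Q) (fromℕ d * ln (fromℕ 2)))
               (sym (+-cong (trans (sum-sub _ _ n) (+-cong (sum-sub _ _ n) (-‿cong ℓ-sum))) (+-congʳ (+-congʳ (+-congʳ (+-congʳ (+-cong
                 (+-cong (trans (xd-0 t) hXY) (-‿cong (xd-n t))) (+-cong (trans (ty-n t) hXY) (-‿cong (ty-0 t))))))))))))
            where
            r = ring 10 (λ B m v h P c x hX hY z → # 2 ⊗ B ⊕ # 2 ⊗ z ⊕ (P ⊖ c ⊕ (c ⊖ x) ⊕ m ⊕ v ⊕ h ⊕ h) ⊜ P ⊖ x ⊖ (m ⊕ v) ⊕ (h ⊖ hX ⊕ (h ⊖ hY) ⊕ (hX ⊕ z) ⊕ (hY ⊕ z) ⊕ (m ⊕ v ⊕ B) ⊕ (m ⊕ v ⊕ B))) refl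

  -- Disintegration of a weight over the classes of an observable.

  module ConditionalWeights where
    open OrderedField
    open ExponentialLogarithm hiding (e; term)
    open FiniteSums
    open Entropies
    open TranscriptTrees
    open TranscriptEntropies
    open XorBias using (_==_)

    relabel : ∀ {Ω L L′} → (L → L′) → Shape Ω L → Shape Ω L′
    relabel g (leaf l) = leaf (g l)
    relabel g (nodeˡ m t₁ t₀) = nodeˡ m (relabel g t₁) (relabel g t₀)
    relabel g (nodeʳ m t₁ t₀) = nodeʳ m (relabel g t₁) (relabel g t₀)

    size-relabel : ∀ {Ω L L′} (g : L → L′) (t : Shape Ω L) → size′ (relabel g t) ≡ size′ t
    size-relabel g (leaf _) = ≡.refl
    size-relabel g (nodeˡ m t₁ t₀) = ≡.cong suc (≡.cong₂ _⊔_ (size-relabel g t₁) (size-relabel g t₀))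
    size-relabel g (nodeʳ m t₁ t₀) = ≡.cong suc (≡.cong₂ _⊔_ (size-relabel g t₁) (size-relabel g t₀))

    record Joint {Ω} (A C A⁺ : Observable Ω) : Set where
      field
        join : ∀ {ω ω′} → value A ω ≡ value A ω′ → value C ω ≡ value C ω′ → value A⁺ ω ≡ value A⁺ ω′
        left : A⁺ refines A
        right : A⁺ refines C

    -- Averaging, over ω₀ drawn from Q, the conditional weights given the value of C
    -- at ω₀.
    module Fibers (Ω : FinSet) (C : Observable (Elem Ω)) {Q : Elem Ω → Carrier} (Q≥0 : ∀ ω → 0# ≤ Q ω) where
      open Weighted Ω

      fiber : Weight → Elem Ω → Weight
      fiber v ω₀ ω = v ω * same C ω₀ ω

      fiber-nonNeg : ∀ {v} → NonNeg v → ∀ ω₀ → NonNeg (fiber v ω₀)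
      fiber-nonNeg v≥0 ω₀ ω = *-nonNeg (v≥0 ω) (same-nonNeg C ω₀ ω)

      fiber-pos : ∀ {v} → NonNeg v → ∀ ω₀ ω → 0# < fiber v ω₀ ω → (0# < v ω) × (value C ω₀ ≡ value C ω)
      fiber-pos v≥0 ω₀ ω p = *-pos-factorˡ (v≥0 ω) p , same-pos C (*-pos-factorʳ (same-nonNeg C ω₀ ω) p)

      -- Fibres stay unnormalised, and the division by the mass of the class is made here.
      -- `tower-expect` is the resulting law of total expectation.
      tower : Weight → Carrier
      tower F = ∑ Ω λ ω₀ → Q ω₀ * (mass C Q ω₀ ⁻¹ * F ω₀)

      tower-cong : ∀ {F G} → (∀ ω → F ω ≈ G ω) → tower F ≈ tower G
      tower-cong h = ∑-cong Ω λ ω → *-congˡ (*-congˡ (h ω))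

      tower-+ : ∀ F G → tower (λ ω → F ω + G ω) ≈ tower F + tower G
      tower-+ F G = trans (∑-cong Ω λ ω → r (Q ω) (mass C Q ω ⁻¹) (F ω) (G ω)) (∑-+ Ω _ _)
        where r = ring 4 (λ q m f g → q ⊗ (m ⊗ (f ⊕ g)) ⊜ q ⊗ (m ⊗ f) ⊕ q ⊗ (m ⊗ g)) refl

      tower-scale : ∀ c F → tower (λ ω → c * F ω) ≈ c * tower F
      tower-scale c F = trans (∑-cong Ω λ ω → r (Q ω) (mass C Q ω ⁻¹) (F ω)) (∑-*ˡ Ω _ _)
        where r : ∀ q m f → q * (m * (c * f)) ≈ c * (q * (m * f))
              r q m f = ring 4 (λ a b c d → a ⊗ (b ⊗ (c ⊗ d)) ⊜ c ⊗ (a ⊗ (b ⊗ d))) refl _ _ _ _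

      tower-neg : ∀ F → tower (λ ω → - F ω) ≈ - tower F
      tower-neg F = trans (∑-cong Ω λ ω → r (Q ω) (mass C Q ω ⁻¹) (F ω)) (∑-neg Ω _)
        where r = ring 3 (λ q m f → q ⊗ (m ⊗ ⊝ f) ⊜ ⊝ (q ⊗ (m ⊗ f))) refl

      tower-sub : ∀ F G → tower (λ ω → F ω - G ω) ≈ tower F - tower G
      tower-sub F G = trans (tower-+ F _) (+-congˡ (tower-neg G))

      tower-mono : ∀ {F G} → (∀ ω → 0# < Q ω → F ω ≤ G ω) → tower F ≤ tower G
      tower-mono h = ∑-support Ω Q≥0 λ ω p → *-monoˡ-≤ (<⇒≤ (inv-pos (mass-pos Q≥0 C ω p))) (h ω p)

      tower-mass : ∀ (G : Weight) → tower (λ ω → mass C Q ω * G ω) ≈ ∑ Ω (λ ω → Q ω * G ω)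
      tower-mass G = ∑-support-cong Ω Q≥0 λ ω p → trans (r (mass C Q ω) (mass C Q ω ⁻¹) (G ω)) (trans (*-congʳ (*-inv (mass-pos Q≥0 C ω p))) (*-identityˡ _))
        where r = ring 3 (λ m i g → i ⊗ (m ⊗ g) ⊜ m ⊗ i ⊗ g) refl

      Dominated : Weight → Set
      Dominated v = ∀ ω → 0# < v ω → 0# < Q ω

      tower-expect : ∀ {v} → NonNeg v → Dominated v → ∀ (G : Weight) → tower (λ ω₀ → ∑ Ω λ ω → fiber v ω₀ ω * G ω) ≈ ∑ Ω (λ ω → v ω * G ω)
      tower-expect {v} v≥0 v≪Q G = trans (∑-cong Ω λ ω₀ → trans (*-congˡ (sym (∑-*ˡ Ω _ _))) (sym (∑-*ˡ Ω _ _)))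
        (trans (∑-swap Ω Ω _) (trans (∑-cong Ω λ ω → trans (∑-cong Ω λ ω₀ → r (Q ω₀) (mass C Q ω₀ ⁻¹) (v ω) (same C ω₀ ω) (G ω)) (trans (∑-*ˡ Ω _ _) (*-assoc _ _ _)))
          (∑-support-cong Ω v≥0 λ ω p → trans (*-congˡ (one ω p)) (*-identityʳ _))))
          where
          r = ring 5 (λ q m v s g → q ⊗ (m ⊗ (v ⊗ s ⊗ g)) ⊜ v ⊗ g ⊗ (q ⊗ s ⊗ m)) refl
          one : ∀ ω → 0# < v ω → ∑ Ω (λ ω₀ → Q ω₀ * same C ω₀ ω * mass C Q ω₀ ⁻¹) ≈ 1#
          one ω p = trans (∑-cong Ω λ ω₀ → swap ω₀) (trans (∑-*ʳ Ω _ _) (*-inv m>0))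
            where
            m>0 : 0# < mass C Q ω
            m>0 = mass-pos Q≥0 C ω (v≪Q ω p)
            swap : ∀ ω₀ → Q ω₀ * same C ω₀ ω * mass C Q ω₀ ⁻¹ ≈ Q ω₀ * same C ω ω₀ * mass C Q ω ⁻¹
            swap ω₀ with _≟ⱽ_ C (value C ω₀) (value C ω)
            ... | yes q = *-cong (*-congˡ (sym (same-yes C (≡.sym q)))) (sym (inv-cong m>0 (mass-same Q≥0 C (≡.sym q))))
            ... | no q = trans (*-congʳ (zeroʳ _)) (trans (zeroˡ _) (sym (trans (*-congʳ (trans (*-congˡ (same-no C λ e → q (≡.sym e))) (zeroʳ _))) (zeroˡ _))))

      -- Inside the fibre over ω₀, a class of A is a class of A⁺ in the whole space, with the same
      -- mass.
      entropy-fiber : ∀ {A A⁺} → Joint A C A⁺ → ∀ {v} → NonNeg v → ∀ ω₀ →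
        entropy A (fiber v ω₀) ≈ ∑ Ω λ ω → fiber v ω₀ ω * ln (mass A⁺ v ω)
      entropy-fiber {A} {A⁺} j {v} v≥0 ω₀ = ∑-support-cong Ω (fiber-nonNeg v≥0 ω₀) λ ω p →
        ln-cong (mass-pos (fiber-nonNeg v≥0 ω₀) A ω p) (∑-cong Ω λ ω′ → term ω ω′ (proj₂ (fiber-pos v≥0 ω₀ ω p)))
        where
        term : ∀ ω ω′ → value C ω₀ ≡ value C ω → fiber v ω₀ ω′ * same A ω ω′ ≈ v ω′ * same A⁺ ω ω′
        term ω ω′ e with _≟ⱽ_ A⁺ (value A⁺ ω) (value A⁺ ω′)
        ... | yes q = *-cong (trans (*-congˡ (same-yes C (≡.trans e (Joint.right j q)))) (*-identityʳ _)) (same-yes A (Joint.left j q))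
        ... | no q with _≟ⱽ_ C (value C ω₀) (value C ω′) | _≟ⱽ_ A (value A ω) (value A ω′)
        ...   | yes p | yes p′ = ⊥-elim (q (Joint.join j p′ (≡.trans (≡.sym e) p)))
        ...   | no p | _ = trans (*-congʳ (zeroʳ _)) (trans (zeroˡ _) (sym (zeroʳ _)))
        ...   | yes _ | no _ = trans (zeroʳ _) (sym (zeroʳ _))

      tower-entropy : ∀ {A A⁺} → Joint A C A⁺ → ∀ {v} → NonNeg v → Dominated v →
        tower (λ ω₀ → entropy A (fiber v ω₀)) ≈ entropy A⁺ v
      tower-entropy {A} {A⁺} j {v} v≥0 v≪Q = trans (tower-cong λ ω₀ → entropy-fiber {A} {A⁺} j v≥0 ω₀) (tower-expect v≥0 v≪Q (λ ω → ln (mass A⁺ v ω)))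

      module _ {L L₁ L₂ : Set} (g : Elem Ω → L → L₁) (k : L → L₂) where
        private
          module S₁ = LeafLemmas Ω {L₁}
          module S₂ = LeafLemmas Ω {L₂}

          part-fiber : ∀ v m b ω₀ ω → S₁.part (fiber v ω₀) m b ω ≈ fiber (S₁.part v m b) ω₀ ω
          part-fiber v m b ω₀ ω = r (v ω) (same C ω₀ ω) ⟦ b == m ω ⟧
            where r = ring 3 (λ a b c → a ⊗ b ⊗ c ⊜ a ⊗ c ⊗ b) refl

          part-dominated : ∀ {v} m b → NonNeg v → Dominated v → Dominated (S₁.part v m b)
          part-dominated m b v≥0 v≪Q ω p = v≪Q ω (S₁.part-pos m b v≥0 ω p)

        leaf-entropy-cong : ∀ A (t : Shape (Elem Ω) L₁) {w w′} → NonNeg w → (∀ ω → w ω ≈ w′ ω) → S₁.leaf-entropy A t w ≈ S₁.leaf-entropy A t w′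
        leaf-entropy-cong A (leaf _) w≥0 h = S₁.entropy-cong {A} w≥0 h
        leaf-entropy-cong A (nodeˡ m t₁ t₀) w≥0 h = +-cong
          (leaf-entropy-cong A t₁ (S₁.part-nonNeg m true w≥0) λ ω → *-congʳ (h ω)) (leaf-entropy-cong A t₀ (S₁.part-nonNeg m false w≥0) λ ω → *-congʳ (h ω))
        leaf-entropy-cong A (nodeʳ m t₁ t₀) w≥0 h = +-cong
          (leaf-entropy-cong A t₁ (S₁.part-nonNeg m true w≥0) λ ω → *-congʳ (h ω)) (leaf-entropy-cong A t₀ (S₁.part-nonNeg m false w≥0) λ ω → *-congʳ (h ω))

        log-likelihood-cong : ∀ A B (t : Shape (Elem Ω) L₁) {w w′} → NonNeg w → (∀ ω → w ω ≈ w′ ω) → S₁.log-likelihood A B t w ≈ S₁.log-likelihood A B t w′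
        log-likelihood-cong A B (leaf _) w≥0 h = refl
        log-likelihood-cong A B (nodeˡ m t₁ t₀) w≥0 h = +-cong
          (+-cong (+-cong (S₁.entropy-cong {A} (S₁.part-nonNeg m true w≥0) λ ω → *-congʳ (h ω)) (S₁.entropy-cong {A} (S₁.part-nonNeg m false w≥0) λ ω → *-congʳ (h ω)))
            (-‿cong (S₁.entropy-cong {A} w≥0 h)))
          (+-cong (log-likelihood-cong A B t₁ (S₁.part-nonNeg m true w≥0) λ ω → *-congʳ (h ω)) (log-likelihood-cong A B t₀ (S₁.part-nonNeg m false w≥0) λ ω → *-congʳ (h ω)))
        log-likelihood-cong A B (nodeʳ m t₁ t₀) w≥0 h = +-cong
          (+-cong (+-cong (S₁.entropy-cong {B} (S₁.part-nonNeg m true w≥0) λ ω → *-congʳ (h ω)) (S₁.entropy-cong {B} (S₁.part-nonNeg m false w≥0) λ ω → *-congʳ (h ω)))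
            (-‿cong (S₁.entropy-cong {B} w≥0 h)))
          (+-cong (log-likelihood-cong A B t₁ (S₁.part-nonNeg m true w≥0) λ ω → *-congʳ (h ω)) (log-likelihood-cong A B t₀ (S₁.part-nonNeg m false w≥0) λ ω → *-congʳ (h ω)))

        private
          part-fiber-nonNeg : ∀ {v} m b → NonNeg v → ∀ ω₀ → NonNeg (S₁.part (fiber v ω₀) m b)
          part-fiber-nonNeg m b v≥0 ω₀ = S₁.part-nonNeg m b (fiber-nonNeg v≥0 ω₀)

        -- The labels of the leaves vary with ω₀ through g, but entropies do not see them, so the
        -- average is expressed by a single tree relabelled by k.
        tower-leaf-entropy : ∀ {A A⁺} → Joint A C A⁺ → ∀ t {v} → NonNeg v → Dominated v →
          tower (λ ω₀ → S₁.leaf-entropy A (relabel (g ω₀) t) (fiber v ω₀)) ≈ S₂.leaf-entropy A⁺ (relabel k t) v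
        tower-leaf-entropy-children : ∀ {A A⁺} → Joint A C A⁺ → ∀ m t₁ t₀ {v} → NonNeg v → Dominated v →
          tower (λ ω₀ → S₁.leaf-entropy A (relabel (g ω₀) t₁) (S₁.part (fiber v ω₀) m true) + S₁.leaf-entropy A (relabel (g ω₀) t₀) (S₁.part (fiber v ω₀) m false)) ≈
          S₂.leaf-entropy A⁺ (relabel k t₁) (S₂.part v m true) + S₂.leaf-entropy A⁺ (relabel k t₀) (S₂.part v m false)
        tower-leaf-entropy {A} {A⁺} j (leaf _) v≥0 v≪Q = tower-entropy {A} {A⁺} j v≥0 v≪Q
        tower-leaf-entropy {A} {A⁺} j (nodeˡ m t₁ t₀) v≥0 v≪Q = tower-leaf-entropy-children {A} {A⁺} j m t₁ t₀ v≥0 v≪Q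
        tower-leaf-entropy {A} {A⁺} j (nodeʳ m t₁ t₀) v≥0 v≪Q = tower-leaf-entropy-children {A} {A⁺} j m t₁ t₀ v≥0 v≪Q
        tower-leaf-entropy-children {A} {A⁺} j m t₁ t₀ {v} v≥0 v≪Q = trans (tower-+ _ _) (+-cong
          (trans (tower-cong λ ω₀ → leaf-entropy-cong A (relabel (g ω₀) t₁) (part-fiber-nonNeg m true v≥0 ω₀) (part-fiber v m true ω₀))
            (tower-leaf-entropy {A} {A⁺} j t₁ (S₁.part-nonNeg m true v≥0) (part-dominated m true v≥0 v≪Q)))
          (trans (tower-cong λ ω₀ → leaf-entropy-cong A (relabel (g ω₀) t₀) (part-fiber-nonNeg m false v≥0 ω₀) (part-fiber v m false ω₀))
            (tower-leaf-entropy {A} {A⁺} j t₀ (S₁.part-nonNeg m false v≥0) (part-dominated m false v≥0 v≪Q))))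

        tower-gain : ∀ {A A⁺} → Joint A C A⁺ → ∀ m {v} → NonNeg v → Dominated v → tower (λ ω₀ → S₁.gain A m (fiber v ω₀)) ≈ S₂.gain A⁺ m v
        tower-gain {A} {A⁺} j m {v} v≥0 v≪Q = trans (tower-sub _ _) (+-cong (trans (tower-+ _ _) (+-cong
            (trans (tower-cong λ ω₀ → S₁.entropy-cong {A} (part-fiber-nonNeg m true v≥0 ω₀) (part-fiber v m true ω₀)) (tower-entropy {A} {A⁺} j (S₁.part-nonNeg m true v≥0) (part-dominated m true v≥0 v≪Q)))
            (trans (tower-cong λ ω₀ → S₁.entropy-cong {A} (part-fiber-nonNeg m false v≥0 ω₀) (part-fiber v m false ω₀)) (tower-entropy {A} {A⁺} j (S₁.part-nonNeg m false v≥0) (part-dominated m false v≥0 v≪Q)))))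
          (-‿cong (tower-entropy {A} {A⁺} j v≥0 v≪Q)))

        tower-log-likelihood : ∀ {A B A⁺ B⁺} → Joint A C A⁺ → Joint B C B⁺ → ∀ t {v} → NonNeg v → Dominated v →
          tower (λ ω₀ → S₁.log-likelihood A B (relabel (g ω₀) t) (fiber v ω₀)) ≈ S₂.log-likelihood A⁺ B⁺ (relabel k t) v
        tower-log-likelihood-children : ∀ {A B A⁺ B⁺} → Joint A C A⁺ → Joint B C B⁺ → ∀ m t₁ t₀ {v} → NonNeg v → Dominated v →
          tower (λ ω₀ → S₁.log-likelihood A B (relabel (g ω₀) t₁) (S₁.part (fiber v ω₀) m true) + S₁.log-likelihood A B (relabel (g ω₀) t₀) (S₁.part (fiber v ω₀) m false)) ≈
          S₂.log-likelihood A⁺ B⁺ (relabel k t₁) (S₂.part v m true) + S₂.log-likelihood A⁺ B⁺ (relabel k t₀) (S₂.part v m false)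
        tower-log-likelihood jA jB (leaf _) v≥0 v≪Q = ∑-zero Ω λ ω → trans (*-congˡ (zeroʳ _)) (zeroʳ _)
        tower-log-likelihood {A} {B} {A⁺} {B⁺} jA jB (nodeˡ m t₁ t₀) v≥0 v≪Q = trans (tower-+ _ _)
          (+-cong (tower-gain {A} {A⁺} jA m v≥0 v≪Q) (tower-log-likelihood-children {A} {B} {A⁺} {B⁺} jA jB m t₁ t₀ v≥0 v≪Q))
        tower-log-likelihood {A} {B} {A⁺} {B⁺} jA jB (nodeʳ m t₁ t₀) v≥0 v≪Q = trans (tower-+ _ _)
          (+-cong (tower-gain {B} {B⁺} jB m v≥0 v≪Q) (tower-log-likelihood-children {A} {B} {A⁺} {B⁺} jA jB m t₁ t₀ v≥0 v≪Q))
        tower-log-likelihood-children {A} {B} {A⁺} {B⁺} jA jB m t₁ t₀ {v} v≥0 v≪Q = trans (tower-+ _ _) (+-cong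
          (trans (tower-cong λ ω₀ → log-likelihood-cong A B (relabel (g ω₀) t₁) (part-fiber-nonNeg m true v≥0 ω₀) (part-fiber v m true ω₀))
            (tower-log-likelihood {A} {B} {A⁺} {B⁺} jA jB t₁ (S₁.part-nonNeg m true v≥0) (part-dominated m true v≥0 v≪Q)))
          (trans (tower-cong λ ω₀ → log-likelihood-cong A B (relabel (g ω₀) t₀) (part-fiber-nonNeg m false v≥0 ω₀) (part-fiber v m false ω₀))
            (tower-log-likelihood {A} {B} {A⁺} {B⁺} jA jB t₀ (S₁.part-nonNeg m false v≥0) (part-dominated m false v≥0 v≪Q))))

  -- The transcript tree seen from one coordinate.

  module SingleCoordinate where
    open OrderedField
    open ExponentialLogarithm hiding (e; term)
    open FiniteSums
    open Entropies
    open XorBias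
    open TranscriptTrees
    open TranscriptEntropies
    open InformationBudget
    open ConditionalWeights
    open RestartedWalk
    open LikelihoodEstimate

    take-extend : ∀ {A : Set} {n} (i : Fin n) (v w : Vec A n) → take (toℕ i) (toList v) ≡ take (toℕ i) (toList w) →
      lookup v i ≡ lookup w i → take (suc (toℕ i)) (toList v) ≡ take (suc (toℕ i)) (toList w)
    take-extend zero (x ∷ v) (y ∷ w) p q = ≡.cong (_∷ []) q
    take-extend (suc i) (x ∷ v) (y ∷ w) p q = ≡.cong₂ _∷_ (Listₚ.∷-injectiveˡ p) (take-extend i v w (Listₚ.∷-injectiveʳ p) q)

    take-lookup : ∀ {A : Set} {n} (i : Fin n) (v w : Vec A n) → take (suc (toℕ i)) (toList v) ≡ take (suc (toℕ i)) (toList w) → lookup v i ≡ lookup w i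
    take-lookup zero (x ∷ v) (y ∷ w) p = Listₚ.∷-injectiveˡ p
    take-lookup (suc i) (x ∷ v) (y ∷ w) p = take-lookup i v w (Listₚ.∷-injectiveʳ p)

    drop-extend : ∀ {A : Set} {n} (i : Fin n) (v w : Vec A n) → drop (suc (toℕ i)) (toList v) ≡ drop (suc (toℕ i)) (toList w) →
      lookup v i ≡ lookup w i → drop (toℕ i) (toList v) ≡ drop (toℕ i) (toList w)
    drop-extend zero (x ∷ v) (y ∷ w) p q = ≡.cong₂ _∷_ q p
    drop-extend (suc i) (x ∷ v) (y ∷ w) p q = drop-extend i v w p q

    drop-lookup : ∀ {A : Set} {n} (i : Fin n) (v w : Vec A n) → drop (toℕ i) (toList v) ≡ drop (toℕ i) (toList w) → lookup v i ≡ lookup w i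
    drop-lookup zero (x ∷ v) (y ∷ w) p = Listₚ.∷-injectiveˡ p
    drop-lookup (suc i) (x ∷ v) (y ∷ w) p = drop-lookup i v w p

    module Unrolled (X Y : FinSet) (μ : Elem X → Carrier) (μ≥0 : ∀ x → 0# ≤ μ x) (μ-total : ∑ X μ ≈ 1#)
      (ν : Elem Y → Carrier) (ν≥0 : ∀ y → 0# ≤ ν y) (ν-total : ∑ Y ν ≈ 1#) (f : Elem X × Elem Y → Bool) (n : ℕ) where
      open Bias X Y μ μ≥0 ν ν≥0 f public
      open Around X Y n public

      InputTree : Set
      InputTree = Tree (Vec (Elem X) n) (Vec (Elem Y) n)

      -- Leaves are labelled by the indicator of Alice's side of the rectangle.
      unroll : InputTree → Side n → Shape (Elem Ω) (Side n)
      unroll (output z) a = leaf a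
      unroll (alice m t) a = nodeˡ (λ ω → m (proj₁ ω)) (unroll (t true) (restrict m true a)) (unroll (t false) (restrict m false a))
      unroll (bob m t) a = nodeʳ (λ ω → m (proj₂ ω)) (unroll (t true) a) (unroll (t false) a)

      size-unroll : ∀ τ a → size′ (unroll τ a) ℕ.≤ depth τ
      size-unroll (output z) a = ℕ.z≤n
      size-unroll (alice m t) a = ℕ.s≤s (ℕₚ.⊔-lub (ℕₚ.≤-trans (size-unroll (t true) _) (ℕₚ.m≤n⊔m _ _)) (ℕₚ.≤-trans (size-unroll (t false) _) (ℕₚ.m≤m⊔n _ _)))
      size-unroll (bob m t) a = ℕ.s≤s (ℕₚ.⊔-lub (ℕₚ.≤-trans (size-unroll (t true) _) (ℕₚ.m≤n⊔m _ _)) (ℕₚ.≤-trans (size-unroll (t false) _) (ℕₚ.m≤m⊔n _ _)))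

      plain : InputTree → Shape (Elem Ω) ⊤
      plain τ = relabel (λ _ → tt) (unroll τ (λ _ → 1#))

      spoken : ∀ τ → LeafLemmas.Spoken Ω (cut n) (cut 0) (plain τ)
      spoken τ = go τ (λ _ → 1#)
        where
        open LeafLemmas Ω {⊤}
        go : ∀ τ a → Spoken (cut n) (cut 0) (relabel (λ _ → tt) (unroll τ a))
        go (output z) a = leaf
        go (alice m t) a = nodeˡ (λ {ω} {ω′} e → ≡.cong m (toList-inj (proj₁ ω) (proj₁ ω′)
            (≡.trans (≡.sym (take-toList (proj₁ ω))) (≡.trans (,-injectiveˡ e) (take-toList (proj₁ ω′))))))
          (go (t true) _) (go (t false) _)
        go (bob m t) a = nodeʳ (λ {ω} {ω′} e → ≡.cong m (toList-inj (proj₂ ω) (proj₂ ω′) (,-injectiveʳ e))) (go (t true) _) (go (t false) _)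

      module At (i : Fin n) (τ : InputTree) {Q : Elem Ω → Carrier} (Q≥0 : ∀ ω → 0# ≤ Q ω) (Q-total : ∑ Ω Q ≈ 1#)
        (supp : ∀ ω → 0# < Q ω → (0# < power μ (proj₁ ω)) × (0# < power ν (proj₂ ω)))
        (in-event : ∀ ω → 0# < Q ω → event τ (λ _ → 1#) (proj₁ ω) (proj₂ ω) ≡ true)
        (K : ℕ) (θ>0 : 0# < 1# - fromℕ 2 * half ^ K) (cap : Carrier) (cap>1 : 1# < cap) (c : Carrier) (c>1 : 1# < c) where

        xv : Elem Ω → Elem X
        xv ω = lookup (proj₁ ω) i

        yv : Elem Ω → Elem Y
        yv ω = lookup (proj₂ ω) i

        C : Observable (Elem Ω)
        C = ctx (toℕ i)

        open Likelihood K θ>0 Ω X Y xv yv μ μ≥0 μ-total ν ν≥0 ν-total f cap cap>1 c c>1 public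
        open Fibers Ω C Q≥0 public

        -- The context at ω₀ fixes the two signs as functions of the entries at i. By
        -- `aliceSign-agree` and `bobSign-agree` they are correct on the whole fibre of this
        -- context.
        labels : Elem Ω → Side n → Label
        labels ω₀ a = aliceSign a i (proj₁ ω₀) (proj₂ ω₀) , bobSign a i (proj₁ ω₀) (proj₂ ω₀)

        shape : Elem Ω → Shape (Elem Ω) Label
        shape ω₀ = relabel (labels ω₀) (unroll τ (λ _ → 1#))

        size-shape : ∀ ω₀ → size′ (shape ω₀) ℕ.≤ depth τ
        size-shape ω₀ = ℕₚ.≤-trans (ℕₚ.≤-reflexive (size-relabel (labels ω₀) (unroll τ (λ _ → 1#)))) (size-unroll τ (λ _ → 1#))

        agree : ∀ {ω₀ ω} → value C ω₀ ≡ value C ω → AgreeAround i (proj₁ ω) (proj₁ ω₀) (proj₂ ω) (proj₂ ω₀)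
        agree e = ≡.sym (,-injectiveˡ e) , ≡.sym (,-injectiveʳ e)

        part-side : ∀ {v} m b → NonNeg v → ∀ ω → 0# < part v m b ω → b ≡ m ω
        part-side m b v≥0 ω p = ==-true b (m ω) (positive-bit (b == m ω) (*-pos-factorʳ (⟦⟧-nonNeg (b == m ω)) p))
          where positive-bit : ∀ z → 0# < ⟦ z ⟧ → z ≡ true
                positive-bit true _ = ≡.refl
                positive-bit false p = ⊥-elim (<-irrefl refl p)

        predicts : ∀ ω₀ τ a {v} → NonNeg v → (∀ ω → 0# < v ω → event τ a (proj₁ ω) (proj₂ ω) ≡ true × value C ω₀ ≡ value C ω) →
          Predicts (relabel (labels ω₀) (unroll τ a)) v
        predicts ω₀ (output z) a v≥0 h ω p = ≡.trans (predicted-coordinate a i (proj₁ ω) (proj₂ ω) (proj₁ (h ω p)))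
          (≡.trans (≡.cong₂ _xor_ (bobSign-agree a i (proj₁ ω) (proj₁ ω₀) (proj₂ ω) (proj₂ ω₀) ag (yv ω)) (aliceSign-agree a i (proj₁ ω) (proj₁ ω₀) (proj₂ ω) (proj₂ ω₀) ag (xv ω))) (Boolₚ.xor-comm (bobSign a i (proj₁ ω₀) (proj₂ ω₀) (yv ω)) _))
          where ag = agree {ω₀} {ω} (proj₂ (h ω p))
        predicts ω₀ (alice m t) a {v} v≥0 h = side true , side false
          where
          side : ∀ b → Predicts (relabel (labels ω₀) (unroll (t b) (restrict m b a))) (part v (λ ω → m (proj₁ ω)) b)
          side b = predicts ω₀ (t b) (restrict m b a) (part-nonNeg (λ ω → m (proj₁ ω)) b v≥0) λ ω p →
            ≡.subst (λ z → event (t z) (restrict m z a) (proj₁ ω) (proj₂ ω) ≡ true) (≡.sym (part-side (λ ω → m (proj₁ ω)) b v≥0 ω p)) (proj₁ (h ω (part-pos (λ ω → m (proj₁ ω)) b v≥0 ω p)))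
            , proj₂ (h ω (part-pos (λ ω → m (proj₁ ω)) b v≥0 ω p))
        predicts ω₀ (bob m t) a {v} v≥0 h = side true , side false
          where
          side : ∀ b → Predicts (relabel (labels ω₀) (unroll (t b) a)) (part v (λ ω → m (proj₂ ω)) b)
          side b = predicts ω₀ (t b) a (part-nonNeg (λ ω → m (proj₂ ω)) b v≥0) λ ω p →
            ≡.subst (λ z → event (t z) a (proj₁ ω) (proj₂ ω) ≡ true) (≡.sym (part-side (λ ω → m (proj₂ ω)) b v≥0 ω p)) (proj₁ (h ω (part-pos (λ ω → m (proj₂ ω)) b v≥0 ω p)))
            , proj₂ (h ω (part-pos (λ ω → m (proj₂ ω)) b v≥0 ω p))

        joinX : Joint obsX C (cut (suc (toℕ i)))
        joinX = record
          { join = λ {ω} {ω′} p q → ≡.cong₂ _,_ (take-extend i (proj₁ ω) (proj₁ ω′) (,-injectiveˡ q) p) (,-injectiveʳ q)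
          ; left = λ {ω} {ω′} e → take-lookup i (proj₁ ω) (proj₁ ω′) (,-injectiveˡ e)
          ; right = λ e → ≡.cong₂ _,_ (take-suc (toℕ i) (,-injectiveˡ e)) (,-injectiveʳ e) }

        joinY : Joint obsY C (cut (toℕ i))
        joinY = record
          { join = λ {ω} {ω′} p q → ≡.cong₂ _,_ (,-injectiveˡ q) (drop-extend i (proj₂ ω) (proj₂ ω′) (,-injectiveʳ q) p)
          ; left = λ {ω} {ω′} e → drop-lookup i (proj₂ ω) (proj₂ ω′) (,-injectiveʳ e)
          ; right = λ e → ≡.cong₂ _,_ (,-injectiveˡ e) (drop-suc (toℕ i) (,-injectiveʳ e)) }

        joinXY : Joint obsXY C (both (toℕ i))
        joinXY = record
          { join = λ {ω} {ω′} p q → ≡.cong₂ _,_ (take-extend i (proj₁ ω) (proj₁ ω′) (,-injectiveˡ q) (,-injectiveˡ p)) (drop-extend i (proj₂ ω) (proj₂ ω′) (,-injectiveʳ q) (,-injectiveʳ p))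
          ; left = λ {ω} {ω′} e → ≡.cong₂ _,_ (take-lookup i (proj₁ ω) (proj₁ ω′) (,-injectiveˡ e)) (drop-lookup i (proj₂ ω) (proj₂ ω′) (,-injectiveʳ e))
          ; right = λ e → ≡.cong₂ _,_ (take-suc (toℕ i) (,-injectiveˡ e)) (drop-suc (toℕ i) (,-injectiveʳ e)) }

        joinT : Joint trivial C C
        joinT = record { join = λ _ q → q ; left = λ _ → ≡.refl ; right = λ e → e }

        w : Elem Ω → Weight
        w ω₀ = fiber Q ω₀

        w≥0 : ∀ ω₀ → NonNeg (w ω₀)
        w≥0 = fiber-nonNeg Q≥0

        supported : ∀ ω₀ → Supported (w ω₀)
        supported ω₀ ω p = power-pos μ≥0 (proj₁ ω) (proj₁ (supp ω q)) i , power-pos ν≥0 (proj₂ ω) (proj₂ (supp ω q)) i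
          where q = proj₁ (fiber-pos Q≥0 ω₀ ω p)

        correct : ∀ ω₀ → Predicts (shape ω₀) (w ω₀)
        correct ω₀ = predicts ω₀ τ (λ _ → 1#) (w≥0 ω₀) λ ω p → in-event ω (proj₁ (fiber-pos Q≥0 ω₀ ω p)) , proj₂ (fiber-pos Q≥0 ω₀ ω p)

        self : Dominated Q
        self _ p = p

        module P = LeafLemmas Ω {⊤}

        Λ : Elem Ω → Carrier
        Λ ω₀ = mass C Q ω₀

        Λ>0 : ∀ ω₀ → 0# < Q ω₀ → 0# < Λ ω₀
        Λ>0 = mass-pos Q≥0 C

        tower-Λ : tower Λ ≈ 1#
        tower-Λ = trans (tower-cong λ ω → sym (*-identityʳ _)) (trans (tower-mass (λ _ → 1#)) (trans (∑-cong Ω λ ω → *-identityʳ _) Q-total))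

        log-prior-eq : expect Q log-prior ≈ expect Q (ℓ μ μ≥0 μ-total ν ν≥0 ν-total (toℕ i))
        log-prior-eq = ∑-cong Ω λ ω → *-congˡ (reflexive (≡.sym (≡.cong₂ _+_ (lnAt-lookup μ (proj₁ ω) i) (lnAt-lookup ν (proj₂ ω) i))))

        information-at : Carrier
        information-at = P.leaf-entropy (both (toℕ i)) (plain τ) Q - P.leaf-entropy C (plain τ) Q - expect Q (ℓ μ μ≥0 μ-total ν ν≥0 ν-total (toℕ i))

        divergence-at : Carrier
        divergence-at = P.leaf-entropy (both (toℕ i)) (plain τ) Q - entropy C Q - expect Q (ℓ μ μ≥0 μ-total ν ν≥0 ν-total (toℕ i))
          - P.log-likelihood (cut (suc (toℕ i))) (cut (toℕ i)) (plain τ) Q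

        tower-info : tower (λ ω₀ → info (shape ω₀) (w ω₀)) ≈ information-at
        tower-info = trans (tower-sub _ _) (+-cong (trans (tower-sub _ _) (+-cong
            (tower-leaf-entropy labels (λ _ → tt) {obsXY} {both (toℕ i)} joinXY (unroll τ (λ _ → 1#)) Q≥0 self)
            (-‿cong (tower-leaf-entropy labels (λ _ → tt) {trivial} {C} joinT (unroll τ (λ _ → 1#)) Q≥0 self))))
          (-‿cong (trans (tower-expect Q≥0 self log-prior) log-prior-eq)))

        simulated : ∀ ω₀ → Mart (λ _ → 1#) (λ _ → 1#)
        simulated ω₀ = build (shape ω₀) (w≥0 ω₀) (λ _ → 0<1) (λ _ → 0<1)

        module _ (d : ℕ) (fits : depth τ ℕ.≤ d) (budget : 1# ≤ fromℕ 2 * θ ^ d) where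
          private
            simple : Elem Ω → Carrier
            simple ω₀ = expect (w ω₀) log-prior + expect (w ω₀) (λ ω → ln (mass C Q ω)) + log-likelihood obsX obsY (shape ω₀) (w ω₀)
              + fromℕ d * ln θ * Λ ω₀ - leaf-entropy obsXY (shape ω₀) (w ω₀) + Λ ω₀ - c ⁻¹ * Λ ω₀
              - c₃ * (Λ ω₀ + info (shape ω₀) (w ω₀) + fromℕ 2 * Λ ω₀)

            Λ-average : ∀ ω₀ → Λ ω₀ * average₂ (λ _ _ → 1# * 1#) ≈ Λ ω₀
            Λ-average ω₀ = trans (*-congˡ (trans (average₂-cong λ _ _ → *-identityˡ 1#) average₂-one)) (*-identityʳ _)

            simple≈ : ∀ ω₀ → estimate d (shape ω₀) (w ω₀) (λ _ → 1#) (λ _ → 1#) (Λ ω₀) ≈ simple ω₀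
            simple≈ ω₀ = +-cong (+-cong (+-cong (+-cong (+-cong (+-cong logs refl) refl) refl) refl) (-‿cong (*-congˡ (Λ-average ω₀))))
              (-‿cong (*-congˡ (+-cong (+-cong (Λ-average ω₀) refl) refl)))
              where
              logs : expect (w ω₀) (λ ω → log-prior ω + (ln (Λ ω₀) + ln 1# + ln 1#)) ≈ expect (w ω₀) log-prior + expect (w ω₀) (λ ω → ln (mass C Q ω))
              logs = trans (∑-support-cong Ω (w≥0 ω₀) λ ω p → +-congˡ (trans (+-cong (+-cong (const ω p) ln-1) ln-1) (r (ln (mass C Q ω)))))
                (trans (∑-cong Ω λ ω → r′ (w ω₀ ω) _ _) (∑-+ Ω _ _))
                where
                r = ring 1 (λ a → a ⊕ # 0 ⊕ # 0 ⊜ a) refl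
                r′ = ring 3 (λ a b c → a ⊗ (b ⊕ c) ⊜ a ⊗ b ⊕ a ⊗ c) refl
                const : ∀ ω → 0# < w ω₀ ω → ln (Λ ω₀) ≈ ln (mass C Q ω)
                const ω p = sym (ln-cong (mass-pos Q≥0 C ω (proj₁ (fiber-pos Q≥0 ω₀ ω p))) (sym (mass-same Q≥0 C {ω₀} {ω} (proj₂ (fiber-pos Q≥0 ω₀ ω p)))))

            tower-simple : tower simple ≈ 1# - divergence-at + fromℕ d * ln θ - c ⁻¹ - c₃ * (fromℕ 3 + information-at)
            tower-simple = trans (tower-sub _ _) (trans (+-cong
                (trans (tower-sub _ _) (+-cong (trans (tower-+ _ _) (+-cong (trans (tower-sub _ _) (+-cong (trans (tower-+ _ _) (+-cong (trans (tower-+ _ _)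
                  (+-cong (trans (tower-+ _ _) (+-cong (trans (tower-expect Q≥0 self log-prior) log-prior-eq) (tower-expect Q≥0 self (λ ω → ln (mass C Q ω)))))
                    (tower-log-likelihood labels (λ _ → tt) {obsX} {obsY} {cut (suc (toℕ i))} {cut (toℕ i)} joinX joinY (unroll τ (λ _ → 1#)) Q≥0 self)))
                  (trans (tower-scale (fromℕ d * ln θ) Λ) (*-congˡ tower-Λ))))
                  (-‿cong (tower-leaf-entropy labels (λ _ → tt) {obsXY} {both (toℕ i)} joinXY (unroll τ (λ _ → 1#)) Q≥0 self)))) tower-Λ))
                  (-‿cong (trans (tower-scale (c ⁻¹) Λ) (*-congˡ tower-Λ)))))
                (-‿cong (trans (tower-scale c₃ _) (*-congˡ (trans (tower-+ _ _) (+-cong (trans (tower-+ _ _) (+-cong tower-Λ tower-info))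
                  (trans (tower-scale (fromℕ 2) Λ) (*-congˡ tower-Λ))))))))
              (r (expect Q (ℓ μ μ≥0 μ-total ν ν≥0 ν-total (toℕ i))) (entropy C Q) (P.log-likelihood (cut (suc (toℕ i))) (cut (toℕ i)) (plain τ) Q)
                 (fromℕ d * ln θ) (P.leaf-entropy (both (toℕ i)) (plain τ) Q) (c ⁻¹) c₃ information-at))
              where r = ring 8 (λ E h L z H i c I → E ⊕ h ⊕ L ⊕ z ⊗ # 1 ⊖ H ⊕ # 1 ⊖ i ⊗ # 1 ⊖ c ⊗ (# 1 ⊕ I ⊕ # 2 ⊗ # 1) ⊜ # 1 ⊖ (H ⊖ h ⊖ E ⊖ L) ⊕ z ⊖ i ⊖ c ⊗ (# 3 ⊕ I)) refl

          -- `estimate≤` is applied to each fibre at the root, with both ratios one and Λ the total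
          -- weight of the fibre, and averaged by `tower`; the averages of the local quantities are
          -- those of the telescoping sums.
          coordinate-bound : ∀ {G} → (∀ ω₀ → 0# < Q ω₀ → goodSum (simulated ω₀) ≤ G) →
            1# - divergence-at + fromℕ d * ln θ - c ⁻¹ - c₃ * (fromℕ 3 + information-at) ≤ G
          coordinate-bound {G} h = ≤-trans (≤-reflexive (sym tower-simple)) (≤-trans (tower-mono {simple} {λ ω₀ → Λ ω₀ * G} λ ω₀ p →
              ≤-trans (≤-reflexive (sym (simple≈ ω₀))) (≤-trans
                (estimate≤ (shape ω₀) d (w≥0 ω₀) (supported ω₀) (correct ω₀) (λ _ → 0<1) (λ _ → 0<1) (Λ>0 ω₀ p) (ℕₚ.≤-trans (size-shape ω₀) fits)
                  (≤-trans (≤-respˡ (*-identityʳ _) (*-monoˡ-≤ (<⇒≤ (Λ>0 ω₀ p)) budget)) (≤-reflexive (r (Λ ω₀) (θ ^ d)))))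
                (*-monoˡ-≤ (<⇒≤ (Λ>0 ω₀ p)) (h ω₀ p))))
            (≤-reflexive (trans (tower-mass (λ _ → G)) (trans (∑-*ʳ Ω G Q) (trans (*-congʳ Q-total) (*-identityˡ G))))))
            where r = ring 2 (λ l t → l ⊗ (# 2 ⊗ t) ⊜ # 2 ⊗ l ⊗ t) refl

  -- Guessing a short transcript without looking at the inputs.

  module TranscriptGuessing where
    open OrderedField
    open ExponentialLogarithm hiding (e; term)
    open FiniteSums
    open Entropies
    open XorBias
    open AchievableOutputs
    open TranscriptTrees
    open TranscriptEntropies
    open InformationBudget
    open ConditionalWeights
    open RestartedWalk
    open WalkSimulation
    open LikelihoodEstimate
    open SingleCoordinate

    sign-correct : ∀ a b → sign a * sign b ≈ fromℕ 2 * ⟦ a == b ⟧ - 1#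
    sign-correct false false = ring 0 (# 1 ⊗ # 1 ⊜ # 2 ⊗ # 1 ⊖ # 1) refl
    sign-correct false true = ring 0 (# 1 ⊗ ⊝ # 1 ⊜ # 2 ⊗ # 0 ⊖ # 1) refl
    sign-correct true false = ring 0 (⊝ # 1 ⊗ # 1 ⊜ # 2 ⊗ # 0 ⊖ # 1) refl
    sign-correct true true = ring 0 (⊝ # 1 ⊗ ⊝ # 1 ⊜ # 2 ⊗ # 1 ⊖ # 1) refl

    module Guess (K : ℕ) (θ>0 : 0# < 1# - fromℕ 2 * half ^ K) (Ω X Y : FinSet) (xv : Elem Ω → Elem X) (yv : Elem Ω → Elem Y)
      (μ : Elem X → Carrier) (μ≥0 : ∀ x → 0# ≤ μ x) (μ-total : ∑ X μ ≈ 1#)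
      (ν : Elem Y → Carrier) (ν≥0 : ∀ y → 0# ≤ ν y) (ν-total : ∑ Y ν ≈ 1#)
      (f : Elem X × Elem Y → Bool)
      (cap : Carrier) (cap>1 : 1# < cap) (c : Carrier) (c>1 : 1# < c) where

      open Likelihood K θ>0 Ω X Y xv yv μ μ≥0 μ-total ν ν≥0 ν-total f cap cap>1 c c>1

      chance : Weight → (Elem Ω → Bool) → Carrier
      chance w m = ratio (∑ Ω (part w m true)) (∑ Ω w)

      -- The transcript is drawn publicly, without looking at the inputs.
      guess correctness : Shape (Elem Ω) Label → Weight → Elem X → Elem Y → Carrier
      guess (leaf (s , t)) w x y = sign (s x xor t y)
      guess (nodeˡ m t₁ t₀) w x y = mean (chance w m) (guess t₁ (part w m true) x y) (guess t₀ (part w m false) x y)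
      guess (nodeʳ m t₁ t₀) w x y = mean (chance w m) (guess t₁ (part w m true) x y) (guess t₀ (part w m false) x y)
      correctness (leaf (s , t)) w x y = ⟦ f (x , y) == (s x xor t y) ⟧
      correctness (nodeˡ m t₁ t₀) w x y = mean (chance w m) (correctness t₁ (part w m true) x y) (correctness t₀ (part w m false) x y)
      correctness (nodeʳ m t₁ t₀) w x y = mean (chance w m) (correctness t₁ (part w m true) x y) (correctness t₀ (part w m false) x y)

      guess-correct : ∀ t w x y → sign (f (x , y)) * guess t w x y ≈ fromℕ 2 * correctness t w x y - 1#
      mean-correct : ∀ s l {p q g h} → s * p ≈ fromℕ 2 * g - 1# → s * q ≈ fromℕ 2 * h - 1# → s * mean l p q ≈ fromℕ 2 * mean l g h - 1#
      guess-correct (leaf (s , t)) w x y = sign-correct (f (x , y)) (s x xor t y)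
      guess-correct (nodeˡ m t₁ t₀) w x y = mean-correct _ (chance w m) (guess-correct t₁ _ x y) (guess-correct t₀ _ x y)
      guess-correct (nodeʳ m t₁ t₀) w x y = mean-correct _ (chance w m) (guess-correct t₁ _ x y) (guess-correct t₀ _ x y)
      mean-correct s l {p} {q} {g} {h} e₁ e₀ = trans (mean-scale l s p q) (trans (mean-cong e₁ e₀) (r l g h))
        where r = ring 3 (λ l g h → l ⊗ (# 2 ⊗ g ⊖ # 1) ⊕ (# 1 ⊖ l) ⊗ (# 2 ⊗ h ⊖ # 1) ⊜ # 2 ⊗ (l ⊗ g ⊕ (# 1 ⊖ l) ⊗ h) ⊖ # 1) refl

      achieve-guess : ∀ t {w} → NonNeg w → Achievable (Elem X) (Elem Y) 2 (guess t w)
      achieve-guess (leaf (s , t)) w≥0 = achieve-signs s t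
      achieve-guess (nodeˡ m t₁ t₀) {w} w≥0 = toss (chance w m) (proj₁ (prior-unit w≥0 m)) (proj₂ (prior-unit w≥0 m))
        (achieve-guess t₁ (part-nonNeg m true w≥0)) (achieve-guess t₀ (part-nonNeg m false w≥0)) λ _ _ → refl
      achieve-guess (nodeʳ m t₁ t₀) {w} w≥0 = toss (chance w m) (proj₁ (prior-unit w≥0 m)) (proj₂ (prior-unit w≥0 m))
        (achieve-guess t₁ (part-nonNeg m true w≥0)) (achieve-guess t₀ (part-nonNeg m false w≥0)) λ _ _ → refl

      private
        weigh : ∀ {w} → NonNeg w → ∀ m a b → ∑ Ω w * mean (chance w m) a b ≈ ∑ Ω (part w m true) * a + ∑ Ω (part w m false) * b
        weigh {w} w≥0 m a b = trans (r (∑ Ω w) (chance w m) a b) (trans (+-congˡ (*-congʳ (+-congʳ (sym (total-part w m)))))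
            (trans (+-cong (*-congʳ W₁) (*-congʳ (+-congˡ (-‿cong W₁)))) (r′ _ _ a b)))
          where
          r = ring 4 (λ W l a b → W ⊗ (l ⊗ a ⊕ (# 1 ⊖ l) ⊗ b) ⊜ W ⊗ l ⊗ a ⊕ (W ⊖ W ⊗ l) ⊗ b) refl
          r′ = ring 4 (λ p q a b → p ⊗ a ⊕ (p ⊕ q ⊖ p) ⊗ b ⊜ p ⊗ a ⊕ q ⊗ b) refl
          W₁ : ∑ Ω w * chance w m ≈ ∑ Ω (part w m true)
          W₁ with ∑ Ω w ≟ 0#
          ... | yes e = trans (*-congʳ e) (trans (zeroˡ _) (sym (antisym (≤-trans (∑-mono Ω (part-≤ m true w≥0)) (≤-reflexive e)) (∑-nonNeg Ω (part-nonNeg m true w≥0)))))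
          ... | no ne = trans (*-comm _ _) (/-* (∑-nonNeg Ω w≥0 , λ e → ne (sym e)))

        node-bound : ∀ {w} → NonNeg w → ∀ m t₁ t₀ {F₁ F₀} →
          ∑ Ω (part w m true) - info t₁ (part w m true) ≤ ∑ Ω (part w m true) * average₂ F₁ →
          ∑ Ω (part w m false) - info t₀ (part w m false) ≤ ∑ Ω (part w m false) * average₂ F₀ →
          ∑ Ω w - (leaf-entropy obsXY t₁ (part w m true) + leaf-entropy obsXY t₀ (part w m false)
            - (leaf-entropy trivial t₁ (part w m true) + leaf-entropy trivial t₀ (part w m false)) - expect w log-prior)
          ≤ ∑ Ω w * average₂ (λ x y → mean (chance w m) (F₁ x y) (F₀ x y))
        node-bound {w} w≥0 m t₁ t₀ {F₁} {F₀} h₁ h₀ = ≤-trans (≤-reflexive (trans (+-cong (sym (total-part w m)) (-‿cong (+-congˡ (-‿cong (sym (expect-part w m log-prior))))))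
            (r (∑ Ω (part w m true)) (∑ Ω (part w m false)) (leaf-entropy obsXY t₁ (part w m true)) (leaf-entropy obsXY t₀ (part w m false))
               (leaf-entropy trivial t₁ (part w m true)) (leaf-entropy trivial t₀ (part w m false)) (expect (part w m true) log-prior) (expect (part w m false) log-prior))))
          (≤-trans (h₁ ⊞ h₀) (≤-reflexive (sym (trans (*-congˡ (average₂-mean (chance w m) F₁ F₀)) (weigh w≥0 m _ _)))))
          where r = ring 8 (λ W₁ W₀ x₁ x₀ t₁ t₀ p₁ p₀ → W₁ ⊕ W₀ ⊖ (x₁ ⊕ x₀ ⊖ (t₁ ⊕ t₀) ⊖ (p₁ ⊕ p₀)) ⊜ W₁ ⊖ (x₁ ⊖ t₁ ⊖ p₁) ⊕ (W₀ ⊖ (x₀ ⊖ t₀ ⊖ p₀))) refl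

      -- At a leaf this is `gibbs` for a⁻¹, the density of μ and ν relative to the conditional law.
      -- Only correct pairs carry weight, so the integral of a⁻¹ sees only the prior probability of
      -- correct pairs.
      correctness-bound : ∀ t {w} → NonNeg w → Supported w → Predicts t w →
        ∑ Ω w - info t w ≤ ∑ Ω w * average₂ (correctness t w)
      correctness-bound (leaf (s , t)) {w} w≥0 supp pred = ≤-trans (≤-reflexive (trans (+-congˡ (-‿cong (sym expect-ln-a))) (+-comm _ _)))
        (≤-trans (≤-reflexive (+-congʳ (sym neg-ln))) (≤-trans (gibbs w≥0 {a⁻¹} a⁻¹>0)
        (≤-trans (∑-support Ω w≥0 λ ω p → ≤-reflexive (trans (*-congʳ (mass-trivial ω)) (*-congˡ (*-congʳ (trans (sym (*-identityʳ _)) (*-congˡ (reflexive (≡.cong ⟦_⟧ (≡.sym (==-self (pred ω p)))))))))))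
        (≤-trans (≤-reflexive (trans (∑-cong Ω λ ω → swapˡ (w ω) (∑ Ω w) _) (∑-*ˡ Ω _ _)))
        (*-monoˡ-≤ (total-nonNeg w≥0) (push (λ x y → ⟦ f (x , y) == (s x xor t y) ⟧) λ x y → ⟦⟧-nonNeg (f (x , y) == (s x xor t y))))))))
        where
        -- `Leaf` is opened with Λ equal to one plus the total weight, which is positive even if w
        -- vanishes.
        budget : ∑ Ω w ≤ fromℕ 2 * (1# + ∑ Ω w)
        budget = by≤ (total-nonNeg w≥0 ⊞ 0≤1 ⊞ 0≤1) (r′ (∑ Ω w))
          where r′ = ring 1 (λ W → # 2 ⊗ (# 1 ⊕ W) ⊕ (# 0 ⊕ # 0 ⊕ # 0) ⊜ W ⊕ (W ⊕ # 1 ⊕ # 1)) refl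
        open Leaf s t w≥0 supp pred {λ _ → 1#} {λ _ → 1#} (λ _ → 0<1) (λ _ → 0<1) (+-pos 0<1 (total-nonNeg w≥0)) budget
        swapˡ = ring 3 (λ a b c → a ⊗ (b ⊗ c) ⊜ b ⊗ (a ⊗ c)) refl
        neg-ln : expect w (λ ω → ln (a⁻¹ ω)) ≈ - expect w (λ ω → ln (a ω))
        neg-ln = trans (∑-support-cong Ω w≥0 λ ω p → inverse-ln ω p) (trans (∑-cong Ω λ ω → r′ (w ω) _) (∑-neg Ω _))
          where
          r′ = ring 2 (λ w l → w ⊗ ⊝ l ⊜ ⊝ (w ⊗ l)) refl
          inverse-ln : ∀ ω → 0# < w ω → ln (a⁻¹ ω) ≈ - ln (a ω)
          inverse-ln ω p = by≈ (trans (sym (trans (sym (ln-cong (*-pos (a>0 ω p) (a⁻¹>0 ω p)) (a-inverse ω p))) (ln-* (a>0 ω p) (a⁻¹>0 ω p)))) ln-1) (r″ (ln (a ω)) (ln (a⁻¹ ω)))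
            where r″ = ring 2 (λ l i → ⊝ l ⊕ (l ⊕ i) ⊜ i ⊕ # 0) refl
      correctness-bound (nodeˡ m t₁ t₀) {w} w≥0 supp (p₁ , p₀) = node-bound w≥0 m t₁ t₀
        (correctness-bound t₁ (part-nonNeg m true w≥0) (λ ω p → supp ω (part-pos m true w≥0 ω p)) p₁)
        (correctness-bound t₀ (part-nonNeg m false w≥0) (λ ω p → supp ω (part-pos m false w≥0 ω p)) p₀)
      correctness-bound (nodeʳ m t₁ t₀) {w} w≥0 supp (p₁ , p₀) = node-bound w≥0 m t₁ t₀
        (correctness-bound t₁ (part-nonNeg m true w≥0) (λ ω p → supp ω (part-pos m true w≥0 ω p)) p₁)
        (correctness-bound t₀ (part-nonNeg m false w≥0) (λ ω p → supp ω (part-pos m false w≥0 ω p)) p₀)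

  -- Protocols, deterministic trees and the product distribution.

  module ProtocolTrees where
    open OrderedField
    open FiniteSums
    open XorBias
    open AchievableOutputs

    along : ∀ {A B A′ B′ : Set} → (A → A′) → (B → B′) → Tree A′ B′ → Tree A B
    along g h (output z) = output z
    along g h (alice m t) = alice (λ a → m (g a)) (λ b → along g h (t b))
    along g h (bob m t) = bob (λ b → m (h b)) (λ c → along g h (t c))

    run-along : ∀ {A B A′ B′ : Set} (g : A → A′) (h : B → B′) t a b → run (along g h t) a b ≡ run t (g a) (h b)
    run-along g h (output z) a b = ≡.refl
    run-along g h (alice m t) a b = run-along g h (t (m (g a))) a b
    run-along g h (bob m t) a b = run-along g h (t (m (h b))) a b

    depth-along : ∀ {A B A′ B′ : Set} (g : A → A′) (h : B → B′) t → depth (along g h t) ≡ depth t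
    depth-along g h (output z) = ≡.refl
    depth-along g h (alice m t) = ≡.cong suc (≡.cong₂ _⊔_ (depth-along g h (t false)) (depth-along g h (t true)))
    depth-along g h (bob m t) = ≡.cong suc (≡.cong₂ _⊔_ (depth-along g h (t false)) (depth-along g h (t true)))

    depth≤cost : ∀ {X Y} (π : Protocol X Y) r → depth (Protocol.tree π r) ℕ.≤ cost π
    depth≤cost π = go (λ r → depth (Protocol.tree π r))
      where go : ∀ {m} (h : Fin m → ℕ) r → h r ℕ.≤ Vector.foldr _⊔_ 0 h
            go h zero = ℕₚ.m≤m⊔n _ _
            go h (suc r) = ℕₚ.≤-trans (go (λ s → h (suc s)) r) (ℕₚ.m≤n⊔m (h zero) _)

    weight-total′ : ∀ {X} (D : Distribution X) → ∑ X (weight D) ≈ 1#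
    weight-total′ {X} D = trans (reflexive (∑≡∑ᶠ X (weight D))) (weight-total D)

    average-≤ : ∀ {X} (D : Distribution X) {F : Elem X → Carrier} {b} → (∀ x → F x ≤ b) → ∑ X (λ x → weight D x * F x) ≤ b
    average-≤ {X} D {F} {b} h = ≤-trans (∑-mono X λ x → *-monoˡ-≤ (weight-nonNeg D x) (h x))
      (≤-reflexive (trans (∑-*ʳ X b (weight D)) (trans (*-congʳ (weight-total′ D)) (*-identityˡ b))))

    module _ {X Y : FinSet} (ν : Elem (X ×ᶠ Y) → Carrier) (g : Elem (X ×ᶠ Y) → Bool) where
      treeAdvantage : Tree (Elem X) (Elem Y) → Carrier
      treeAdvantage τ = ∑ (X ×ᶠ Y) λ (x , y) → ν (x , y) * sign (run τ x y xor g (x , y))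

      fixCoins : (π : Protocol X Y) → _ → _ → _ → Tree (Elem X) (Elem Y)
      fixCoins π r a b = along (_, a) (_, b) (Protocol.tree π r)

      -- A protocol is a convex combination of the trees obtained by fixing all its coins.
      advantage-≤ : ∀ (π : Protocol X Y) {E} → (∀ r a b → treeAdvantage (fixCoins π r a b) ≤ E) → advantage {X} {Y} ν g π ≤ E
      advantage-≤ π {E} h = ≤-trans (≤-reflexive (trans (reflexive (advantage≡∑ {X} {Y} ν g π)) rearrange))
        (average-≤ public-coins λ r → average-≤ alice-coins λ a → average-≤ bob-coins λ b → h r a b)
        where
        open Protocol π
        term : Elem X × Elem Y → _ → _ → _ → Carrier
        term (x , y) r a b = sign (run (tree r) (x , a) (y , b) xor g (x , y))
        rearrange : (∑ (X ×ᶠ Y) λ (x , y) → ∑ (fin pubSize) λ r → ∑ (fin aliceSize) λ a → ∑ (fin bobSize) λ b →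
            ν (x , y) * weight public-coins r * weight alice-coins a * weight bob-coins b * term (x , y) r a b) ≈
          (∑ (fin pubSize) λ r → weight public-coins r * ∑ (fin aliceSize) λ a → weight alice-coins a * ∑ (fin bobSize) λ b →
            weight bob-coins b * treeAdvantage (fixCoins π r a b))
        rearrange = trans (∑-swap (X ×ᶠ Y) (fin pubSize) _) (∑-cong (fin pubSize) λ r →
          trans (∑-swap (X ×ᶠ Y) (fin aliceSize) _) (trans (∑-cong (fin aliceSize) λ a →
          trans (∑-swap (X ×ᶠ Y) (fin bobSize) _) (trans (∑-cong (fin bobSize) λ b →
            trans (∑-cong (X ×ᶠ Y) λ (x , y) → trans (*-congˡ (reflexive (≡.cong (λ z → sign (z xor g (x , y))) (≡.sym (run-along (_, a) (_, b) (tree r) x y)))))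
                (e (ν (x , y)) (weight public-coins r) (weight alice-coins a) (weight bob-coins b) (sign (run (fixCoins π r a b) x y xor g (x , y)))))
              (trans (∑-*ˡ (X ×ᶠ Y) _ _) (*-assoc _ _ _))) (trans (∑-*ˡ (fin bobSize) _ _) (*-assoc _ _ _)))) (∑-*ˡ (fin aliceSize) _ _)))
          where e = ring 5 (λ n r a b s → n ⊗ r ⊗ a ⊗ b ⊗ s ⊜ r ⊗ a ⊗ b ⊗ (n ⊗ s)) refl

      treeAdvantage-≤1 : (∀ z → 0# ≤ ν z) → ∑ (X ×ᶠ Y) ν ≈ 1# → ∀ τ → treeAdvantage τ ≤ 1#
      treeAdvantage-≤1 ν≥0 total τ = ≤-trans (∑-mono (X ×ᶠ Y) λ z → ≤-respʳ (*-identityʳ _) (*-monoˡ-≤ (ν≥0 z) (sign-≤1 (run τ (proj₁ z) (proj₂ z) xor g z)))) (≤-reflexive total)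

      private
        coin : Distribution (fin 1)
        coin = record { weight = λ _ → 1# ; weight-nonNeg = λ _ → 0≤1 ; weight-total = +-identityʳ 1# }

      deterministic : Tree (Elem X) (Elem Y) → Protocol X Y
      deterministic τ = record { pubSize = 1 ; aliceSize = 1 ; bobSize = 1
        ; public-coins = coin ; alice-coins = coin ; bob-coins = coin ; tree = λ _ → along proj₁ proj₁ τ }

      cost-deterministic : ∀ τ → cost (deterministic τ) ≡ depth τ
      cost-deterministic τ = ≡.trans (ℕₚ.⊔-identityʳ _) (depth-along proj₁ proj₁ τ)

      advantage-deterministic : ∀ τ → advantage {X} {Y} ν g (deterministic τ) ≈ treeAdvantage τ
      advantage-deterministic τ = trans (reflexive (advantage≡∑ {X} {Y} ν g (deterministic τ))) (∑-cong (X ×ᶠ Y) λ (x , y) →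
        trans (single _) (trans (single _) (trans (single _) (trans (*-congˡ (reflexive (≡.cong (λ z → sign (z xor g (x , y))) (run-along proj₁ proj₁ τ (x , zero) (y , zero)))))
          (e (ν (x , y)) _)))))
        where
        single : ∀ (F : Fin 1 → Carrier) → ∑ (fin 1) F ≈ F zero
        single F = trans (reflexive (∑≡∑ᶠ (fin 1) F)) (+-identityʳ _)
        e = ring 2 (λ n s → n ⊗ # 1 ⊗ # 1 ⊗ # 1 ⊗ s ⊜ n ⊗ s) refl

    module Margins {X Y : FinSet} (D : Distribution (X ×ᶠ Y)) (product : IsProduct {X} {Y} D) where
      μ : Elem X → Carrier
      μ = marginalˡ {X} {Y} (weight D)

      ν : Elem Y → Carrier
      ν = marginalʳ {X} {Y} (weight D)

      μ≥0 : ∀ x → 0# ≤ μ x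
      μ≥0 x = ≤-respʳ (reflexive (≡.sym (marginalˡ≡∑ {X} {Y} (weight D) x))) (∑-nonNeg Y λ y → weight-nonNeg D (x , y))

      ν≥0 : ∀ y → 0# ≤ ν y
      ν≥0 y = ≤-respʳ (reflexive (≡.sym (marginalʳ≡∑ {X} {Y} (weight D) y))) (∑-nonNeg X λ x → weight-nonNeg D (x , y))

      μ-total : ∑ X μ ≈ 1#
      μ-total = trans (∑-cong X λ x → reflexive (marginalˡ≡∑ {X} {Y} (weight D) x)) (trans (sym (∑-× X Y (weight D))) (weight-total′ D))

      ν-total : ∑ Y ν ≈ 1#
      ν-total = trans (∑-cong Y λ y → reflexive (marginalʳ≡∑ {X} {Y} (weight D) y)) (trans (sym (∑-swap X Y _)) (trans (sym (∑-× X Y (weight D))) (weight-total′ D)))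

      productPower-eq : ∀ n xs ys → productPower (weight D) n (xs , ys) ≈ power μ xs * power ν ys
      productPower-eq zero [] [] = ring 0 (# 1 ⊜ # 1 ⊗ # 1) refl
      productPower-eq (suc n) (x ∷ xs) (y ∷ ys) = trans (*-cong (product x y) (productPower-eq n xs ys)) (r (μ x) (ν y) (power μ xs) (power ν ys))
        where r = ring 4 (λ a b c d → a ⊗ b ⊗ (c ⊗ d) ⊜ a ⊗ c ⊗ (b ⊗ d)) refl

      correlated : (Elem X × Elem Y → Bool) → (Elem X → Elem Y → Carrier) → Carrier
      correlated f φ = ∑ X λ x → ∑ Y λ y → μ x * ν y * (sign (f (x , y)) * φ x y)

      -- Derandomising against μ ν times the sign of f yields a deterministic protocol that is at
      -- least as correlated with f and belongs to the set under the supremum.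
      achievable-≤-adv : ∀ (f : Elem X × Elem Y → Bool) (C : Carrier) {c φ} → fromℕ c ≤ C → Achievable (Elem X) (Elem Y) c φ →
        correlated f φ ≤ adv X Y (weight D) C f
      achievable-≤-adv f C {c} {φ} c≤C s with Derandomise.derandomise X Y s (λ x y → μ x * ν y * sign (f (x , y)))
      ... | τ , small , h = ≤-trans (≤-reflexive (∑-cong X λ x → ∑-cong Y λ y → sym (*-assoc _ _ _))) (≤-trans h (≤-trans (≤-reflexive eq)
          (sup-upper S (_ , member) bounded member)))
        where
        S : Carrier → Set
        S v = ∃ λ (π : Protocol X Y) → (fromℕ (cost π) ≤ C) × (v ≈ advantage {X} {Y} (weight D) f π)
        member : S (advantage {X} {Y} (weight D) f (deterministic {X} {Y} (weight D) f τ))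
        member = deterministic {X} {Y} (weight D) f τ ,
          ≤-trans (fromℕ-mono (≡.subst (ℕ._≤ c) (≡.sym (cost-deterministic {X} {Y} (weight D) f τ)) small)) c≤C , refl
        bounded : ∃ (IsUpperBound S)
        bounded = 1# , λ (π , _ , e) → ≤-trans (≤-reflexive e) (advantage-≤ {X} {Y} (weight D) f π
          λ r a b → treeAdvantage-≤1 {X} {Y} (weight D) f (weight-nonNeg D) (weight-total′ D) (fixCoins {X} {Y} (weight D) f π r a b))
        eq : Derandomise.value X Y (λ x y → μ x * ν y * sign (f (x , y))) (Derandomise.signed X Y τ) ≈
          advantage {X} {Y} (weight D) f (deterministic {X} {Y} (weight D) f τ)
        eq = trans (∑-cong X λ x → ∑-cong Y λ y → trans (*-congʳ (*-congʳ (sym (product x y)))) (trans (*-assoc _ _ _) (*-congˡ (trans (*-comm _ _) (sym (sign-xor (run τ x y) (f (x , y))))))))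
          (trans (sym (∑-× X Y _)) (sym (advantage-deterministic {X} {Y} (weight D) f τ)))

  -- Hardness of f bounds the good mass of a walk.

  module WalkValue where
    open OrderedField
    open ExponentialLogarithm hiding (e; term)
    open FiniteSums
    open XorBias
    open AchievableOutputs
    open TranscriptTrees
    open RestartedWalk
    open WalkSimulation
    open LikelihoodEstimate
    open TranscriptGuessing

    module _ {A B : Set} (q : Carrier) (q≥0 : 0# ≤ q) (q≤1 : q ≤ 1#) where
      open Simulation {A} {B} q q≥0 q≤1

      walk-scale : ∀ k (F : Payoff {A} {B}) J bu bv {U V} (M : Mart U V) x y →
        walk (λ s t u v → k * F s t u v) J bu bv M x y ≈ k * walk F J bu bv M x y
      walk-scale k F J bu bv (leaf s t) x y = ring 3 (λ a b c → a ⊗ (b ⊗ c) ⊜ b ⊗ (a ⊗ c)) refl _ _ _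
      walk-scale k F J bu bv {U} {V} (node S M₁ M₀) x y with exits {A} {B} (U x) bu (V y) bv
      walk-scale k F zero bu bv (node S M₁ M₀) x y | true = sym (zeroʳ k)
      walk-scale k F (suc J) bu bv {U} {V} (node S M₁ M₀) x y | true =
        trans (*-congˡ (walk-scale k F J (U x) (V y) (node S M₁ M₀) x y)) (ring 3 (λ a b c → a ⊗ (b ⊗ c) ⊜ b ⊗ (a ⊗ c)) refl _ _ _)
      walk-scale k F J bu bv (node {l = l} S M₁ M₀) x y | false =
        trans (mean-cong (walk-scale k F J bu bv M₁ x y) (walk-scale k F J bu bv M₀ x y)) (sym (mean-scale l k _ _))

    module GoodSum (K : ℕ) (θ>0 : 0# < 1# - fromℕ 2 * half ^ K) (Ω X Y : FinSet) (xv : Elem Ω → Elem X) (yv : Elem Ω → Elem Y)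
      (μ : Elem X → Carrier) (μ≥0 : ∀ x → 0# ≤ μ x) (μ-total : ∑ X μ ≈ 1#)
      (ν : Elem Y → Carrier) (ν≥0 : ∀ y → 0# ≤ ν y) (ν-total : ∑ Y ν ≈ 1#)
      (f : Elem X × Elem Y → Bool)
      (cap : Carrier) (cap>1 : 1# < cap) (c : Carrier) (c>1 : 1# < c)
      (κ : Carrier) (C : Carrier)
      (hard : ∀ {d φ} → fromℕ d ≤ C → Achievable (Elem X) (Elem Y) d φ →
        (∑ X λ x → ∑ Y λ y → μ x * ν y * (sign (f (x , y)) * φ x y)) ≤ κ) where

      open Likelihood K θ>0 Ω X Y xv yv μ μ≥0 μ-total ν ν≥0 ν-total f cap cap>1 c c>1

      average₂-+ : ∀ F G → average₂ (λ x y → F x y + G x y) ≈ average₂ F + average₂ G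
      average₂-+ F G = trans (∑-cong X λ x → trans (∑-cong Y λ y → r _ _ _) (∑-+ Y _ _)) (∑-+ X _ _)
        where r = ring 3 (λ a b c → a ⊗ (b ⊕ c) ⊜ a ⊗ b ⊕ a ⊗ c) refl

      average₂-scale : ∀ k F → average₂ (λ x y → k * F x y) ≈ k * average₂ F
      average₂-scale k F = trans (∑-cong X λ x → trans (∑-cong Y λ y → r (μ x * ν y) k (F x y)) (∑-*ˡ Y _ _)) (∑-*ˡ X _ _)
        where r = ring 3 (λ a b c → a ⊗ (b ⊗ c) ⊜ b ⊗ (a ⊗ c)) refl

      average₂-const : ∀ k → average₂ (λ _ _ → k) ≈ k
      average₂-const k = trans (average₂-cong λ _ _ → sym (*-identityʳ k)) (trans (average₂-scale k (λ _ _ → 1#)) (trans (*-congˡ average₂-one) (*-identityʳ k)))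

      goodSum-nonNeg : (M : Mart {Elem X} {Elem Y} (λ _ → 1#) (λ _ → 1#)) → 0# ≤ goodSum M
      goodSum-nonNeg M = ∑-nonNeg X λ x → ∑-nonNeg Y λ y → *-nonNeg (*-nonNeg (μ≥0 x) (ν≥0 y)) (nn x y M (λ _ → 0<1) (λ _ → 0<1))
        where
        nn : ∀ x y {U V} (M : Mart U V) → (∀ x → 0# < U x) → (∀ y → 0# < V y) → 0# ≤ full (good x y) M x y
        nn x y {U} {V} (leaf s t) U>0 V>0 = *-nonNeg (⟦⟧-nonNeg (does (U x * V y ≤? cap))) (*-nonNeg (⟦⟧-nonNeg (f (x , y) == (s x xor t y))) (<⇒≤ (*-pos (U>0 x) (V>0 y))))
        nn x y (node S M₁ M₀) _ _ = +-nonNeg (*-nonNeg (Split.l≥0 S) (nn x y M₁ (Split.U₁>0 S) (Split.V₁>0 S)))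
          (*-nonNeg (0≤-diff (Split.l≤1 S)) (nn x y M₀ (Split.U₀>0 S) (Split.V₀>0 S)))

      module Restarted (q : Carrier) (q≥0 : 0# ≤ q) (q≤1 : q ≤ 1#) (J : ℕ)
        (κ′ : Carrier) (κ′≥0 : 0# ≤ κ′) (cap≤ : cap ≤ κ′ * κ′ * growth {Elem X} {Elem Y} ^ J)
        (M : Mart {Elem X} {Elem Y} (λ _ → 1#) (λ _ → 1#)) where
        open Simulation {Elem X} {Elem Y} q q≥0 q≤1
        open Restart {Elem X} {Elem Y} q q≥0 q≤1

        good-walk : Elem X → Elem Y → Carrier
        good-walk x y = walk (good x y) J 1# 1# M x y

        φ : Elem X → Elem Y → Carrier
        φ = output-from J M

        good-vs-sign : ∀ x y s t u v → 0# < u → 0# < v →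
          fromℕ 2 * good x y s t u v ≤ sign (f (x , y)) * (u * v * sign (s xor t)) + u * v
        good-vs-sign x y s t u v u>0 v>0 = ≤-trans
          (*-monoˡ-≤ (fromℕ-nonNeg 2) (≤-respʳ (*-identityˡ _) (*-monoʳ-≤ (*-nonNeg (⟦⟧-nonNeg (f (x , y) == (s xor t))) (<⇒≤ (*-pos u>0 v>0))) (⟦⟧-≤1 (does (u * v ≤? cap))))))
          (≤-reflexive (sym (trans (r (sign (f (x , y))) (u * v) (sign (s xor t))) (trans (*-congˡ (+-congʳ (sign-correct (f (x , y)) (s xor t)))) (r′ _ _)))))
          where r = ring 3 (λ a b c → a ⊗ (b ⊗ c) ⊕ b ⊜ b ⊗ (a ⊗ c ⊕ # 1)) refl
                r′ = ring 2 (λ b e → b ⊗ (# 2 ⊗ e ⊖ # 1 ⊕ # 1) ⊜ # 2 ⊗ (e ⊗ b)) refl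

        pointwise : ∀ x y → fromℕ 2 * good-walk x y ≤ sign (f (x , y)) * φ x y + 1#
        pointwise x y = ≤-trans (walk-mono x y {good x y} {λ s t u v → sign (f (x , y)) * signedProduct {Elem X} {Elem Y} s t u v} {product x y}
            (λ s t u v → good-vs-sign x y s t u v) J 1# 1# M 0<1 0<1)
          (≤-reflexive (trans (walk-scale q q≥0 q≤1 (sign (f (x , y))) (signedProduct {Elem X} {Elem Y}) J 1# 1# M x y) (*-congˡ φ-eq))
            ⊞ ≤-trans (walk-product x y J 1# 1# M 0<1 0<1) (≤-reflexive (*-identityˡ 1#)))
          where
          φ-eq : walk (signedProduct {Elem X} {Elem Y}) J 1# 1# M x y ≈ φ x y
          φ-eq = trans (sym (*-identityʳ _)) (*-congˡ (inv-unique (*-pos 0<1 0<1) r))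
            where r : 1# * 1# * 1# ≈ 1#
                  r = ring 0 (# 1 ⊗ # 1 ⊗ # 1 ⊜ # 1) refl

        lower : ∀ x y → q ^ suc J * full (good x y) M x y ≤ good-walk x y + κ′
        lower x y = ≤-trans (walk-lower J M 0<1 0<1 {0} {1#} {1#} {1#} (record { bu>0 = 0<1 ; bv>0 = 0<1 ; P≥0 = 0≤1 ; P² = ≤-reflexive (ring 0 (# 1 ⊗ (# 1 ⊗ # 1) ⊜ # 1 ⊗ # 1) refl) }) cap≤)
          (≤-reflexive (+-congˡ (trans (*-congˡ (potential-start {Elem X} {Elem Y} 0<1 0<1)) (trans (*-identityʳ _) (*-identityʳ _)))))
          where
          capped : ∀ s t u v → 0# < u → 0# < v → good x y s t u v * (u * v) ≤ good x y s t u v * cap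
          capped s t u v u>0 v>0 with u * v ≤? cap
          ... | yes p = *-monoˡ-≤ (*-nonNeg 0≤1 (*-nonNeg (⟦⟧-nonNeg (f (x , y) == (s xor t))) (<⇒≤ (*-pos u>0 v>0)))) p
          ... | no _ = ≤-reflexive (trans (*-congʳ (zeroˡ _)) (trans (zeroˡ _) (sym (trans (*-congʳ (zeroˡ _)) (zeroˡ _)))))
          open LowerBound {Elem X} {Elem Y} q q≥0 q≤1 (good x y) cap κ′ κ′≥0
            (λ s t u v u>0 v>0 → *-nonNeg (⟦⟧-nonNeg (does (u * v ≤? cap))) (*-nonNeg (⟦⟧-nonNeg (f (x , y) == (s xor t))) (<⇒≤ (*-pos u>0 v>0))))
            (λ s t u v u>0 v>0 → ≤-trans (≤-respʳ (*-identityˡ _) (*-monoʳ-≤ (*-nonNeg (⟦⟧-nonNeg (f (x , y) == (s xor t))) (<⇒≤ (*-pos u>0 v>0))) (⟦⟧-≤1 (does (u * v ≤? cap)))))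
               (≤-respʳ (*-identityˡ _) (*-monoʳ-≤ (<⇒≤ (*-pos u>0 v>0)) (⟦⟧-≤1 (f (x , y) == (s xor t))))))
            (λ s t u v u>0 v>0 → capped s t u v u>0 v>0) (<⇒≤ cap>0) x y

        -- By `lower` the walk keeps the good mass up to κ′ and a factor q^(J+1). By `pointwise`
        -- twice the mass it keeps is at most one plus the correlation of its output with f, and
        -- hardness limits that correlation to κ.
        bound : average₂ (λ x y → sign (f (x , y)) * φ x y) ≤ κ → fromℕ 2 * (q ^ suc J * goodSum M) ≤ κ + 1# + fromℕ 2 * κ′
        bound correlation≤κ = by≤ (*-monoˡ-≤ (fromℕ-nonNeg 2) (≤-trans (≤-reflexive (sym (average₂-scale (q ^ suc J) _))) (≤-trans (average₂-mono lower)
              (≤-reflexive (trans (average₂-+ good-walk (λ _ _ → κ′)) (+-congˡ (average₂-const κ′))))))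
            ⊞ ≤-trans (≤-reflexive (sym (average₂-scale (fromℕ 2) good-walk))) (≤-trans (average₂-mono pointwise)
              (≤-trans (≤-reflexive (trans (average₂-+ (λ x y → sign (f (x , y)) * φ x y) (λ _ _ → 1#)) (+-congˡ average₂-one)))
                (correlation≤κ ⊞ ≤-refl))))
          (r κ κ′ (average₂ good-walk) (q ^ suc J * goodSum M))
          where r = ring 4 (λ k k′ g s → k ⊕ # 1 ⊕ # 2 ⊗ k′ ⊕ (# 2 ⊗ s ⊕ # 2 ⊗ g) ⊜ # 2 ⊗ s ⊕ (# 2 ⊗ (g ⊕ k′) ⊕ (k ⊕ # 1))) refl

      goodSum-bound : ∀ ℓ R J → fromℕ (R ℕ.* Rounds.step {Elem X} {Elem Y} ℓ R ℕ.+ Rounds.cost-continue {Elem X} {Elem Y} ℓ R J) ≤ C →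
        ∀ κ′ → 0# ≤ κ′ → cap ≤ κ′ * κ′ * growth {Elem X} {Elem Y} ^ J → (M : Mart {Elem X} {Elem Y} (λ _ → 1#) (λ _ → 1#)) → height M ℕ.< 2 ℕ.^ ℓ →
        fromℕ 2 * (Rounds.q {Elem X} {Elem Y} ℓ R ^ suc J * goodSum M) ≤ κ + 1# + fromℕ 2 * κ′
      goodSum-bound ℓ R J cheap κ′ κ′≥0 cap≤ M fits = Restarted.bound q q≥0 q≤1 J κ′ κ′≥0 cap≤ M
        (hard cheap (achieve-walk J M (record { U>0 = λ _ → 0<1 ; V>0 = λ _ → 0<1 }) fits))
        where open Rounds {Elem X} {Elem Y} ℓ R

  -- Conditioning on the event, and the two ways to solve one copy.

  module ConditionedInput where
    open OrderedField
    open ExponentialLogarithm hiding (e; term)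
    open FiniteSums
    open Entropies
    open XorBias
    open AchievableOutputs
    open TranscriptTrees
    open TranscriptEntropies
    open InformationBudget
    open ConditionalWeights
    open RestartedWalk
    open WalkSimulation
    open LikelihoodEstimate
    open SingleCoordinate
    open TranscriptGuessing
    open WalkValue

    module Conditioned (X Y : FinSet) (μ : Elem X → Carrier) (μ≥0 : ∀ x → 0# ≤ μ x) (μ-total : ∑ X μ ≈ 1#)
      (ν : Elem Y → Carrier) (ν≥0 : ∀ y → 0# ≤ ν y) (ν-total : ∑ Y ν ≈ 1#) (f : Elem X × Elem Y → Bool) (n : ℕ)
      (τ : Tree (Vec (Elem X) n) (Vec (Elem Y) n)) where
      open Unrolled X Y μ μ≥0 μ-total ν ν≥0 ν-total f n

      weighed : Elem Ω → Carrier
      weighed ω = power μ (proj₁ ω) * power ν (proj₂ ω) * ⟦ event τ (λ _ → 1#) (proj₁ ω) (proj₂ ω) ⟧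

      β : Carrier
      β = ∑ Ω weighed

      event-mass-β : event-mass τ (λ _ → 1#) (λ _ → 1#) ≈ β
      event-mass-β = sym (trans (∑-× (X ^ᶠ n) (Y ^ᶠ n) weighed) (trans (∑-swap (X ^ᶠ n) (Y ^ᶠ n) _) (∑-cong (Y ^ᶠ n) λ ys →
          trans (∑-cong (X ^ᶠ n) λ xs → r (power μ xs) (power ν ys) ⟦ event τ (λ _ → 1#) xs ys ⟧) (∑-*ˡ (X ^ᶠ n) _ _))))
        where r = ring 3 (λ p q e → p ⊗ q ⊗ e ⊜ q ⊗ # 1 ⊗ (p ⊗ (# 1 ⊗ e))) refl

      module _ (B : Carrier) (β-large : exp (- B) ≤ β) where
        β>0 : 0# < β
        β>0 = <-≤-trans (exp-pos (- B)) β-large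

        Q : Elem Ω → Carrier
        Q ω = weighed ω * β ⁻¹

        prior≥0 : ∀ (ω : Elem Ω) → 0# ≤ power μ (proj₁ ω) * power ν (proj₂ ω)
        prior≥0 ω = *-nonNeg (power-nonNeg μ≥0 (proj₁ ω)) (power-nonNeg ν≥0 (proj₂ ω))

        weighed≥0 : ∀ (ω : Elem Ω) → 0# ≤ weighed ω
        weighed≥0 ω = *-nonNeg (prior≥0 ω) (⟦⟧-nonNeg (event τ (λ _ → 1#) (proj₁ ω) (proj₂ ω)))

        Q≥0 : ∀ (ω : Elem Ω) → 0# ≤ Q ω
        Q≥0 ω = *-nonNeg (weighed≥0 ω) (<⇒≤ (inv-pos β>0))

        Q-total : ∑ Ω Q ≈ 1#
        Q-total = trans (∑-*ʳ Ω _ _) (*-inv β>0)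

        weighed>0 : ∀ (ω : Elem Ω) → 0# < Q ω → 0# < weighed ω
        weighed>0 ω p = *-pos-factorˡ (weighed≥0 ω) p

        supp : ∀ (ω : Elem Ω) → 0# < Q ω → (0# < power μ (proj₁ ω)) × (0# < power ν (proj₂ ω))
        supp ω p = *-pos-factorˡ (power-nonNeg μ≥0 (proj₁ ω)) q , *-pos-factorʳ (power-nonNeg ν≥0 (proj₂ ω)) q
          where q = *-pos-factorˡ (prior≥0 ω) (weighed>0 ω p)

        in-event : ∀ (ω : Elem Ω) → 0# < Q ω → event τ (λ _ → 1#) (proj₁ ω) (proj₂ ω) ≡ true
        in-event ω p = bit _ (*-pos-factorʳ (⟦⟧-nonNeg (event τ (λ _ → 1#) (proj₁ ω) (proj₂ ω))) (weighed>0 ω p))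
          where bit : ∀ z → 0# < ⟦ z ⟧ → z ≡ true
                bit true _ = ≡.refl
                bit false p = ⊥-elim (<-irrefl refl p)

        open Weighted Ω using (mass; entropy; mass-pos)

        mass-point : ∀ (ω : Elem Ω) → mass obsXYs Q ω ≈ Q ω
        mass-point ω = trans (∑-cong Ω λ ω′ → trans (*-comm _ _) (*-congʳ (point ω′))) (∑-point Ω ω Q)
          where
          point : ∀ ω′ → same obsXYs ω ω′ ≈ ⟦ does (_≟ᴱ_ {Ω} ω ω′) ⟧
          point ω′ with _≟ᴱ_ {Ω} ω ω′
          ... | yes ≡.refl = same-yes obsXYs {ω} {ω} ≡.refl
          ... | no ne = same-no obsXYs {ω} {ω′} λ p → ne (≡.cong₂ _,_ (toList-inj (proj₁ ω) (proj₁ ω′) (,-injectiveˡ p)) (toList-inj (proj₂ ω) (proj₂ ω′) (,-injectiveʳ p)))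

        -- On the event Q is the prior divided by β, and -ln β ≤ B.
        entropy-bound : entropy obsXYs Q ≤ ∑ Ω (λ ω → Q ω * (ln (power μ (proj₁ ω)) + ln (power ν (proj₂ ω)))) + B
        entropy-bound = ≤-trans (∑-support Ω Q≥0 λ ω p → point ω p)
          (≤-reflexive (trans (∑-cong Ω λ ω → r (Q ω) _ B) (trans (∑-+ Ω _ _) (+-congˡ (trans (∑-*ʳ Ω B Q) (trans (*-congʳ Q-total) (*-identityˡ B)))))))
          where
          r = ring 3 (λ a b c → a ⊗ (b ⊕ c) ⊜ a ⊗ b ⊕ a ⊗ c) refl
          -lnβ≤B : - ln β ≤ B
          -lnβ≤B = by≤ (≤-respˡ (ln-exp (- B)) (ln-mono (exp-pos (- B)) β-large)) (ring 2 (λ a b → a ⊖ a ⊜ ⊝ b ⊕ b) refl _ _)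
          point : ∀ ω → 0# < Q ω → ln (mass obsXYs Q ω) ≤ (ln (power μ (proj₁ ω)) + ln (power ν (proj₂ ω))) + B
          point ω p = ≤-trans (≤-reflexive (trans (ln-cong (mass-pos Q≥0 obsXYs ω p) (trans (mass-point ω)
              (*-congʳ (trans (*-congˡ (reflexive (≡.cong ⟦_⟧ (in-event ω p)))) (*-identityʳ _)))))
              (trans (ln-* pq>0 (inv-pos β>0)) (+-cong (ln-* (proj₁ (supp ω p)) (proj₂ (supp ω p))) (ln-inv β>0)))))
            (≤-refl ⊞ -lnβ≤B)
            where pq>0 = *-pos (proj₁ (supp ω p)) (proj₂ (supp ω p))

        T : ℕ
        T = depth τ

        size-plain : size′ (plain τ) ℕ.≤ T
        size-plain = ℕₚ.≤-trans (ℕₚ.≤-reflexive (size-relabel (λ _ → tt) (unroll τ (λ _ → 1#)))) (size-unroll τ (λ _ → 1#))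

        div inf : ℕ → Carrier
        div = divergence μ μ≥0 μ-total ν ν≥0 ν-total (plain τ) T size-plain (spoken τ) Q≥0 Q-total supp B entropy-bound
        inf = information μ μ≥0 μ-total ν ν≥0 ν-total (plain τ) T size-plain (spoken τ) Q≥0 Q-total supp B entropy-bound

        div-sum : partialSum div n ≤ fromℕ 2 * B
        div-sum = divergence-sum μ μ≥0 μ-total ν ν≥0 ν-total (plain τ) T size-plain (spoken τ) Q≥0 Q-total supp B entropy-bound

        inf-sum : partialSum inf n ≤ fromℕ 2 * B + fromℕ 2 * (fromℕ T * ln (fromℕ 2))
        inf-sum = information-sum μ μ≥0 μ-total ν ν≥0 ν-total (plain τ) T size-plain (spoken τ) Q≥0 Q-total supp B entropy-bound

        sum-bound : ∀ (F : ℕ → Carrier) G → (∀ (i : Fin n) → F (toℕ i) ≤ G) → partialSum F n ≤ fromℕ n * G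
        sum-bound F G h = ≤-trans (sum-mono n λ i p → ≡.subst (λ j → F j ≤ G) (Finₚ.toℕ-fromℕ< p) (h (fromℕ< p))) (≤-reflexive (sum-const G n))

        module Hard (κ C : Carrier)
          (hard : ∀ {d φ} → fromℕ d ≤ C → Achievable (Elem X) (Elem Y) d φ →
            (∑ X λ x → ∑ Y λ y → μ x * ν y * (sign (f (x , y)) * φ x y)) ≤ κ) where

          module CaseB (2≤C : fromℕ 2 ≤ C) where
            2>1 : 1# < fromℕ 2
            2>1 = by< {x = 1#} {y = fromℕ 2} 0<1 (ring 0 (# 2 ⊕ # 0 ⊜ # 1 ⊕ # 1) refl)

            -- 2 is the least exponent K with θ positive; the modules shared with the other case are
            -- instantiated at it and at cap = c = 2.
            θ>0 : 0# < 1# - fromℕ 2 * half ^ 2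
            θ>0 = <-respʳ-≈ (sym eq) half-pos
              where eq : 1# - fromℕ 2 * half ^ 2 ≈ half
                    eq = trans (r half) (trans (+-cong (sym 2*half) (-‿cong (trans (*-congʳ 2*half) (*-identityˡ half)))) (r′ half))
                      where r = ring 1 (λ h → # 1 ⊖ # 2 ⊗ (h ⊗ (h ⊗ # 1)) ⊜ # 1 ⊖ # 2 ⊗ h ⊗ h) refl
                            r′ = ring 1 (λ h → # 2 ⊗ h ⊖ h ⊜ h) refl

            -- Guessing costs two bits, so hardness limits its correctness on each fibre to (1 +
            -- κ)/2; `correctness-bound` is then averaged over the fibres.
            coordinate : ∀ (i : Fin n) → 1# - inf (toℕ i) ≤ (1# + κ) * half
            coordinate i = ≤-trans (≤-reflexive (+-cong (sym tower-Λ) (-‿cong (sym tower-info)))) (≤-trans (≤-reflexive (sym (tower-sub _ _)))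
              (≤-trans (tower-mono {λ ω₀ → Λ ω₀ - info (shape ω₀) (w ω₀)} {λ ω₀ → Λ ω₀ * ((1# + κ) * half)} λ ω₀ p →
                  ≤-trans (Guess.correctness-bound 2 θ>0 Ω X Y xv yv μ μ≥0 μ-total ν ν≥0 ν-total f (fromℕ 2) 2>1 (fromℕ 2) 2>1 (shape ω₀) (w≥0 ω₀) (supported ω₀) (correct ω₀))
                    (*-monoˡ-≤ (<⇒≤ (Λ>0 ω₀ p)) (guess-bound ω₀)))
                (≤-reflexive (trans (tower-mass (λ _ → (1# + κ) * half)) (trans (∑-*ʳ Ω _ Q) (trans (*-congʳ Q-total) (*-identityˡ _)))))))
              where
              open At i τ Q≥0 Q-total supp in-event 2 θ>0 (fromℕ 2) 2>1 (fromℕ 2) 2>1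
              guess correctness : Shape (Elem Ω) Label → (Elem Ω → Carrier) → Elem X → Elem Y → Carrier
              guess = Guess.guess 2 θ>0 Ω X Y xv yv μ μ≥0 μ-total ν ν≥0 ν-total f (fromℕ 2) 2>1 (fromℕ 2) 2>1
              correctness = Guess.correctness 2 θ>0 Ω X Y xv yv μ μ≥0 μ-total ν ν≥0 ν-total f (fromℕ 2) 2>1 (fromℕ 2) 2>1
              guess-bound : ∀ ω₀ → average₂ (correctness (shape ω₀) (w ω₀)) ≤ (1# + κ) * half
              guess-bound ω₀ = *-cancelˡ-≤ (fromℕ-pos 1) (≤-trans (by≤ (≤-trans (≤-reflexive (sym signed)) (hard 2≤C (Guess.achieve-guess 2 θ>0 Ω X Y xv yv μ μ≥0 μ-total ν ν≥0 ν-total f (fromℕ 2) 2>1 (fromℕ 2) 2>1 (shape ω₀) (w≥0 ω₀)))) (ring 2 (λ a b → # 1 ⊕ a ⊕ (# 2 ⊗ b ⊖ # 1) ⊜ (# 1 ⊕ (# 1 ⊕ # 0)) ⊗ b ⊕ a) refl _ _))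
                  (≤-reflexive (sym (trans (r (1# + κ) half) (trans (*-congʳ 2*half) (*-identityˡ _))))))
                where
                r = ring 2 (λ a h → # 2 ⊗ (a ⊗ h) ⊜ # 2 ⊗ h ⊗ a) refl
                signed : average₂ (λ x y → sign (f (x , y)) * guess (shape ω₀) (w ω₀) x y) ≈ fromℕ 2 * average₂ (correctness (shape ω₀) (w ω₀)) - 1#
                signed = trans (average₂-cong λ x y → Guess.guess-correct 2 θ>0 Ω X Y xv yv μ μ≥0 μ-total ν ν≥0 ν-total f (fromℕ 2) 2>1 (fromℕ 2) 2>1 (shape ω₀) (w ω₀) x y)
                  (trans (∑-cong X λ x → trans (∑-cong Y λ y → r′ (μ x * ν y) _) (trans (∑-sub Y _ _) (+-congʳ (∑-*ˡ Y _ _))))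
                  (trans (∑-sub X _ _) (+-cong (∑-*ˡ X _ _) (-‿cong average₂-one))))
                  where r′ = ring 2 (λ a b → a ⊗ (# 2 ⊗ b ⊖ # 1) ⊜ # 2 ⊗ (a ⊗ b) ⊖ a ⊗ # 1) refl

            summed : fromℕ n ≤ fromℕ n * ((1# + κ) * half) + (fromℕ 2 * B + fromℕ 2 * (fromℕ T * ln (fromℕ 2)))
            summed = by≤ (sum-bound (λ i → 1# - inf i) _ coordinate ⊞ inf-sum)
              (trans (+-congˡ (+-congʳ (trans (sum-sub (λ _ → 1#) inf n) (+-congʳ (sum-const 1# n))))) (r (fromℕ n) (fromℕ n * ((1# + κ) * half)) _ (partialSum inf n)))
              where r = ring 4 (λ n g b i → g ⊕ b ⊕ (n ⊗ # 1 ⊖ i ⊕ i) ⊜ n ⊕ (g ⊕ b)) refl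

          module CaseA (K : ℕ) (θ>0 : 0# < 1# - fromℕ 2 * half ^ K) (budget : 1# ≤ fromℕ 2 * (1# - fromℕ 2 * half ^ K) ^ T)
            (cap : Carrier) (cap>1 : 1# < cap) (c : Carrier) (c>1 : 1# < c) (ℓ′ R J : ℕ)
            (cheap : fromℕ (R ℕ.* Rounds.step {Elem X} {Elem Y} ℓ′ R ℕ.+ Rounds.cost-continue {Elem X} {Elem Y} ℓ′ R J) ≤ C)
            (κ′ : Carrier) (κ′≥0 : 0# ≤ κ′) (cap≤ : cap ≤ κ′ * κ′ * growth {Elem X} {Elem Y} ^ J)
            (short : T ℕ.* suc K ℕ.< 2 ℕ.^ ℓ′)
            (G : Carrier)
            (conclude : ∀ {g} → 0# ≤ g → fromℕ 2 * (Rounds.q {Elem X} {Elem Y} ℓ′ R ^ suc J * g) ≤ κ + 1# + fromℕ 2 * κ′ → g ≤ G) where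

            θ′ : Carrier
            θ′ = 1# - fromℕ 2 * half ^ K

            d₃ : Carrier
            d₃ = (c - 1#) * ln cap ⁻¹

            coordinate : ∀ (i : Fin n) → 1# - div (toℕ i) + fromℕ T * ln θ′ - c ⁻¹ - d₃ * (fromℕ 3 + inf (toℕ i)) ≤ G
            coordinate i = coordinate-bound T ℕₚ.≤-refl budget {G} λ ω₀ p → conclude
                (GoodSum.goodSum-nonNeg K θ>0 Ω X Y xv yv μ μ≥0 μ-total ν ν≥0 ν-total f cap cap>1 c c>1 κ C hard (simulated ω₀))
                  (GoodSum.goodSum-bound K θ>0 Ω X Y xv yv μ μ≥0 μ-total ν ν≥0 ν-total f cap cap>1 c c>1 κ C hard ℓ′ R J cheap κ′ κ′≥0 cap≤ (simulated ω₀) (fits ω₀))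
              where
              open At i τ Q≥0 Q-total supp in-event K θ>0 cap cap>1 c c>1 hiding (C)
              fits : ∀ ω₀ → height (simulated ω₀) ℕ.< 2 ℕ.^ ℓ′
              fits ω₀ = ℕₚ.≤-<-trans (height-build (shape ω₀) (w≥0 ω₀) (λ _ → 0<1) (λ _ → 0<1))
                (ℕₚ.≤-<-trans (ℕₚ.*-monoˡ-≤ (suc K) (size-shape ω₀)) short)

            d₃≥0 : 0# ≤ d₃
            d₃≥0 = *-nonNeg (0≤-diff (<⇒≤ c>1)) (<⇒≤ (inv-pos ln-cap>0))
              where ln-cap>0 : 0# < ln cap
                    ln-cap>0 = ≰⇒> λ h → <⇒≱ cap>1 (≤-respˡ (exp-ln (<-trans 0<1 cap>1)) (≤-respʳ exp-0 (exp-mono h)))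

            summed : fromℕ n * (1# + fromℕ T * ln θ′ - c ⁻¹ - d₃ * fromℕ 3) ≤
              fromℕ n * G + fromℕ 2 * B + d₃ * (fromℕ 2 * B + fromℕ 2 * (fromℕ T * ln (fromℕ 2)))
            summed = by≤ (sum-bound (λ i → 1# - div i + fromℕ T * ln θ′ - c ⁻¹ - d₃ * (fromℕ 3 + inf i)) G coordinate ⊞ div-sum ⊞ *-monoˡ-≤ d₃≥0 inf-sum)
              (trans (+-congˡ (+-congʳ (+-congʳ total-eq))) (r (fromℕ n) (fromℕ T * ln θ′) (c ⁻¹) d₃ G (fromℕ 2 * B) (fromℕ 2 * B + fromℕ 2 * (fromℕ T * ln (fromℕ 2))) (partialSum div n) (partialSum inf n)))
              where
              total-eq : partialSum (λ i → 1# - div i + fromℕ T * ln θ′ - c ⁻¹ - d₃ * (fromℕ 3 + inf i)) n ≈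
                fromℕ n * (1# + fromℕ T * ln θ′ - c ⁻¹ - d₃ * fromℕ 3) - partialSum div n - d₃ * partialSum inf n
              total-eq = trans (ps-cong (λ i → r′ (div i) (fromℕ T * ln θ′) (c ⁻¹) d₃ (inf i)) n)
                (trans (sum-sub _ _ n) (+-cong (trans (sum-sub _ _ n) (+-congʳ (sum-const _ n))) (-‿cong (sum-scale d₃ inf n))))
                where r′ = ring 5 (λ d z i e f → # 1 ⊖ d ⊕ z ⊖ i ⊖ e ⊗ (# 3 ⊕ f) ⊜ # 1 ⊕ z ⊖ i ⊖ e ⊗ # 3 ⊖ d ⊖ e ⊗ f) refl
              r = ring 9 (λ n z i e G b b′ d f → n ⊗ G ⊕ b ⊕ e ⊗ b′ ⊕ (n ⊗ (# 1 ⊕ z ⊖ i ⊖ e ⊗ # 3) ⊖ d ⊖ e ⊗ f ⊕ d ⊕ e ⊗ f) ⊜ n ⊗ (# 1 ⊕ z ⊖ i ⊖ e ⊗ # 3) ⊕ (n ⊗ G ⊕ b ⊕ e ⊗ b′)) refl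

  -- Powers of two and elementary numerical bounds.

  module Binary where
    open OrderedField
    open ExponentialLogarithm hiding (e; term)

    ^-* : ∀ x m k → x ^ (m ℕ.* k) ≈ (x ^ k) ^ m
    ^-* x zero k = refl
    ^-* x (suc m) k = trans (^-+ x k (m ℕ.* k)) (*-congˡ (^-* x m k))

    fromℕ-^ : ∀ m k → fromℕ (m ℕ.^ k) ≈ fromℕ m ^ k
    fromℕ-^ m zero = +-identityʳ 1#
    fromℕ-^ m (suc k) = trans (fromℕ-* m (m ℕ.^ k)) (*-congˡ (fromℕ-^ m k))

    2^*half^ : ∀ k → fromℕ 2 ^ k * half ^ k ≈ 1#
    2^*half^ k = trans (sym (^-distrib (fromℕ 2) half k)) (trans (^-cong k 2*half) (1^ k))

    1≤2^ : ∀ k → 1 ℕ.≤ 2 ℕ.^ k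
    1≤2^ k = ℕₚ.m^n>0 2 k

    n<2^n : ∀ n → n ℕ.< 2 ℕ.^ n
    n<2^n zero = ℕₚ.≤-refl
    n<2^n (suc n) = ℕₚ.≤-trans (ℕₚ.+-mono-≤ (1≤2^ n) (n<2^n n)) (ℕₚ.+-monoʳ-≤ (2 ℕ.^ n) (ℕₚ.m≤m+n _ 0))

    n+8≤2^[n+3] : ∀ n → n ℕ.+ 8 ℕ.≤ 2 ℕ.^ (n ℕ.+ 3)
    n+8≤2^[n+3] zero = ℕₚ.≤-refl
    n+8≤2^[n+3] (suc n) = ℕₚ.≤-trans (ℕₚ.+-mono-≤ (1≤2^ (n ℕ.+ 3)) (n+8≤2^[n+3] n)) (ℕₚ.+-monoʳ-≤ (2 ℕ.^ (n ℕ.+ 3)) (ℕₚ.m≤m+n _ 0))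

    half≤ln2 : half ≤ ln (fromℕ 2)
    half≤ln2 = by≤ (ln≤ half-pos ⊞ ≤-reflexive (sym (ln-inv (fromℕ-pos 1))) ⊞ ≤-reflexive 2*half) (r half (ln half) (ln (fromℕ 2)))
      where r = ring 3 (λ h m l → l ⊕ (m ⊖ l ⊕ # 2 ⊗ h) ⊜ h ⊕ (h ⊖ # 1 ⊕ m ⊕ # 1)) refl

    1≤fromℕ : ∀ {k} → 1 ℕ.≤ k → 1# ≤ fromℕ k
    1≤fromℕ {k} p = ≤-trans (≤-reflexive (ring 0 (# 1 ⊜ # 1 ⊕ # 0) refl)) (fromℕ-mono {1} {k} p)

    1≤2^ʳ : ∀ k → 1# ≤ fromℕ 2 ^ k
    1≤2^ʳ k = ≤-respʳ (fromℕ-^ 2 k) (1≤fromℕ (1≤2^ k))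

    1<2^ : ∀ {k} → 1 ℕ.≤ k → 1# < fromℕ 2 ^ k
    1<2^ {suc k} _ = <-≤-trans (by< {x = 1#} {y = fromℕ 2} 0<1 (ring 0 (# 2 ⊕ # 0 ⊜ # 1 ⊕ # 1) refl)) (≤-respˡ (*-identityʳ _) (*-monoˡ-≤ (fromℕ-nonNeg 2) (1≤2^ʳ k)))

    binary-scale : ∀ m {z} → 1# ≤ z → z < fromℕ 2 ^ m → ∃[ L ] (fromℕ 2 ^ L ≤ z) × (z < fromℕ 2 ^ suc L)
    binary-scale zero p q = contradiction p (<⇒≱ q)
    binary-scale (suc m) {z} p q with fromℕ 2 ^ m ≤? z
    ... | yes h = m , h , q
    ... | no h = binary-scale m p (≰⇒> h)

    [1+1/m]^m≥2 : ∀ m → fromℕ 2 ≤ (fromℕ (suc (suc m)) * fromℕ (suc m) ⁻¹) ^ suc m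
    [1+1/m]^m≥2 m = ≤-trans (≤-reflexive (trans r (+-congˡ (sym (*-inv (fromℕ-pos m))))))
      (≤-respʳ (^-cong (suc m) (trans (+-congʳ (sym (*-inv (fromℕ-pos m)))) (r′ (fromℕ m) (fromℕ (suc m) ⁻¹))))
        (bernoulli (suc m) (+-nonNeg 0≤1 i≥0) (inj₁ i≥0)))
      where
      i≥0 = <⇒≤ (inv-pos (fromℕ-pos m))
      r : fromℕ 2 ≈ 1# + 1#
      r = ring 0 (# 2 ⊜ # 1 ⊕ # 1) refl
      r′ : ∀ m i → (1# + m) * i + i ≈ (1# + (1# + m)) * i
      r′ m i = ring 2 (λ m i → (# 1 ⊕ m) ⊗ i ⊕ i ⊜ (# 1 ⊕ (# 1 ⊕ m)) ⊗ i) refl m i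

    -- The base is the reciprocal of that in `[1+1/m]^m≥2`, and the additional power helps because
    -- that base is at least one.
    [1-1/m]^m≤half : ∀ m → (fromℕ (suc m) * fromℕ (suc (suc m)) ⁻¹) ^ suc (suc m) ≤ half
    [1-1/m]^m≤half m = *-cancelˡ-≤ (fromℕ-pos 1) (≤-trans (*-monoʳ-≤ (^-nonNeg (suc (suc m)) ρ≥0) 2≤) (≤-reflexive
        (trans (sym (^-distrib σ ρ (suc (suc m)))) (trans (^-cong (suc (suc m)) στ) (trans (1^ (suc (suc m))) (sym 2*half))))))
      where
      σ ρ : Carrier
      σ = fromℕ (suc (suc m)) * fromℕ (suc m) ⁻¹
      ρ = fromℕ (suc m) * fromℕ (suc (suc m)) ⁻¹
      ρ≥0 : 0# ≤ ρ
      ρ≥0 = *-nonNeg (fromℕ-nonNeg (suc m)) (<⇒≤ (inv-pos (fromℕ-pos (suc m))))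
      στ : σ * ρ ≈ 1#
      στ = trans (r (fromℕ (suc (suc m))) (fromℕ (suc m)) (fromℕ (suc m) ⁻¹) (fromℕ (suc (suc m)) ⁻¹))
        (trans (*-cong (*-inv (fromℕ-pos (suc m))) (*-inv (fromℕ-pos m))) (*-identityˡ 1#))
        where r = ring 4 (λ a b i j → a ⊗ i ⊗ (b ⊗ j) ⊜ a ⊗ j ⊗ (b ⊗ i)) refl
      1≤σ : 1# ≤ σ
      1≤σ = ≤-trans (≤-reflexive (sym (*-inv (fromℕ-pos m)))) (*-monoʳ-≤ (<⇒≤ (inv-pos (fromℕ-pos m))) (fromℕ-mono (ℕₚ.n≤1+n (suc m))))
      2≤ : fromℕ 2 ≤ σ ^ suc (suc m)
      2≤ = ≤-trans ([1+1/m]^m≥2 m) (≤-respˡ (*-identityˡ _) (*-monoʳ-≤ (^-nonNeg (suc m) (≤-trans 0≤1 1≤σ)) 1≤σ))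

  -- Numerical parameters of the restarted walk.

  module ParameterChoice where
    open OrderedField
    open ExponentialLogarithm hiding (e; term)
    open Binary

    -- The parameters of the restarted walk for a tree of depth T < 2^(L+1) on n = m + 1 copies.
    module Parameters (m T L : ℕ) (1≤L : 1 ℕ.≤ L) (T<2^ : T ℕ.< 2 ℕ.^ suc L) where
      -- K makes 32 T 2^-K at most one, so smoothing costs only a constant over the whole tree. 2^ℓ
      -- exceeds the height T (K + 1) of the refined tree. R is 64 (L + 22) because 64 rounds halve
      -- the failure probability, and J + 1 failure probabilities must add up to at most 1/64.
      n K ℓ R : ℕ
      n = suc m
      K = L ℕ.+ 6
      ℓ = suc L ℕ.+ (L ℕ.+ 3)
      R = (L ℕ.+ 22) ℕ.* 64

      abstract
        -- A proxy for 1 + T/n. The lower bound 4n + 2T on n S dominates the summed information and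
        -- constants in `load`; the upper bound 6n + 2T keeps the cost of order 1 + T/n.
        S : ℕ
        S = 6 ℕ.+ 2 ℕ.* (T ℕ./ n)

        1≤S : 1 ℕ.≤ S
        1≤S = ℕ.s≤s ℕ.z≤n

        T/n*n≤T : T ℕ./ n ℕ.* n ℕ.≤ T
        T/n*n≤T = DivMod.m/n*n≤m T n

        nS≤ : n ℕ.* S ℕ.≤ 6 ℕ.* n ℕ.+ 2 ℕ.* T
        nS≤ = ℕₚ.≤-trans (ℕₚ.≤-reflexive (solve 2 (λ n q → n :* (con 6 :+ con 2 :* q) := con 6 :* n :+ con 2 :* (q :* n)) ≡.refl n (T ℕ./ n)))
          (ℕₚ.+-monoʳ-≤ (6 ℕ.* n) (ℕₚ.*-monoʳ-≤ 2 T/n*n≤T))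
          where open +-*-Solver

        nS≥ : 4 ℕ.* n ℕ.+ 2 ℕ.* T ℕ.≤ n ℕ.* S
        nS≥ = ℕₚ.≤-trans (ℕₚ.+-monoʳ-≤ (4 ℕ.* n) (ℕₚ.*-monoʳ-≤ 2 T≤))
          (ℕₚ.≤-reflexive (solve 2 (λ n q → con 4 :* n :+ con 2 :* (n :+ q :* n) := n :* (con 6 :+ con 2 :* q)) ≡.refl n (T ℕ./ n)))
          where open +-*-Solver
                T≤ : T ℕ.≤ n ℕ.+ T ℕ./ n ℕ.* n
                T≤ = ≡.subst (ℕ._≤ n ℕ.+ T ℕ./ n ℕ.* n) (≡.sym (DivMod.m≡m%n+[m/n]*n T n)) (ℕₚ.+-monoˡ-≤ (T ℕ./ n ℕ.* n) (ℕₚ.<⇒≤ (DivMod.m%n<n T n)))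

        S≤2^ : S ℕ.≤ 2 ℕ.^ (4 ℕ.+ L)
        S≤2^ = ℕₚ.≤-trans (ℕₚ.+-mono-≤ (ℕₚ.*-monoʳ-≤ 6 (1≤2^ L)) (ℕₚ.*-monoʳ-≤ 2 (ℕₚ.≤-trans (DivMod.m/n≤m T n) (ℕₚ.<⇒≤ T<2^))))
          (ℕₚ.≤-trans (ℕₚ.m≤m+n _ (6 ℕ.* 2 ℕ.^ L)) (ℕₚ.≤-reflexive (solve 1 (λ p → con 6 :* p :+ con 2 :* (con 2 :* p) :+ con 6 :* p := con 2 :* (con 2 :* (con 2 :* (con 2 :* p)))) ≡.refl (2 ℕ.^ L))))
          where open +-*-Solver

      -- ln cap has to reach 15 · 16 S, and ln 2 ≥ 1/2 doubles the exponent. Eight restarts at least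
      -- double the squared potential, so J pays for the cap and for 12 further doublings, the
      -- factor 64² that cancels w².
      cap-exponent J : ℕ
      cap-exponent = 2 ℕ.* (15 ℕ.* 16) ℕ.* S
      J = (cap-exponent ℕ.+ 12) ℕ.* 8

      -- The common allowance 1/64: for κ, for walks that run out of restarts, and for failures of
      -- rejection sampling.
      w : Carrier
      w = fromℕ 64 ⁻¹

      64w : fromℕ 64 * w ≈ 1#
      64w = *-inv (fromℕ-pos 63)

      w>0 : 0# < w
      w>0 = inv-pos (fromℕ-pos 63)

      short : T ℕ.* suc K ℕ.< 2 ℕ.^ ℓ
      short = ℕₚ.≤-<-trans (ℕₚ.*-monoʳ-≤ T below)
        (≡.subst (T ℕ.* 2 ℕ.^ (L ℕ.+ 3) ℕ.<_) (≡.sym (ℕₚ.^-distribˡ-+-* 2 (suc L) (L ℕ.+ 3)))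
          (ℕₚ.*-monoˡ-< (2 ℕ.^ (L ℕ.+ 3)) {{ℕ.>-nonZero (1≤2^ (L ℕ.+ 3))}} T<2^))
        where below : suc (L ℕ.+ 6) ℕ.≤ 2 ℕ.^ (L ℕ.+ 3)
              below = ℕₚ.≤-trans (ℕₚ.≤-reflexive (≡.sym (ℕₚ.+-suc L 6)))
                (ℕₚ.≤-trans (ℕₚ.+-monoʳ-≤ L (ℕₚ.n≤1+n 7)) (n+8≤2^[n+3] L))

      δ : Carrier
      δ = half ^ K

      δ≥0 : 0# ≤ δ
      δ≥0 = ^-nonNeg K (<⇒≤ half-pos)

      64·2^L·δ : fromℕ 64 * (fromℕ 2 ^ L * δ) ≈ 1#
      64·2^L·δ = trans (r (fromℕ 2 ^ L) δ) (trans (*-congʳ (trans (*-congˡ 2^6) (sym (^-+ (fromℕ 2) L 6)))) (2^*half^ K))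
        where r = ring 2 (λ p d → # 64 ⊗ (p ⊗ d) ⊜ p ⊗ # 64 ⊗ d) refl
              2^6 : fromℕ 64 ≈ fromℕ 2 ^ 6
              2^6 = fromℕ-^ 2 6

      64δ≤1 : fromℕ 64 * δ ≤ 1#
      64δ≤1 = ≤-respʳ 64·2^L·δ (*-monoˡ-≤ (fromℕ-nonNeg 64) (≤-respˡ (*-identityˡ δ) (*-monoʳ-≤ δ≥0 (1≤2^ʳ L))))

      32Tδ≤1 : fromℕ 32 * (fromℕ T * δ) ≤ 1#
      32Tδ≤1 = ≤-respʳ (trans (r (fromℕ 2 ^ L) δ) 64·2^L·δ)
        (*-monoˡ-≤ (fromℕ-nonNeg 32) (*-monoʳ-≤ δ≥0 (≤-respʳ (fromℕ-^ 2 (suc L)) (fromℕ-mono (ℕₚ.<⇒≤ T<2^)))))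
        where r = ring 2 (λ p d → # 32 ⊗ (# 2 ⊗ p ⊗ d) ⊜ # 64 ⊗ (p ⊗ d)) refl

      Tδ≥0 : 0# ≤ fromℕ T * δ
      Tδ≥0 = *-nonNeg (fromℕ-nonNeg T) δ≥0

      θ : Carrier
      θ = 1# - fromℕ 2 * δ

      half≤θ : half ≤ θ
      half≤θ = *-cancelˡ-≤ (fromℕ-pos 31) (by≤ (64δ≤1 ⊞ fromℕ-nonNeg 15 ⊞ *-monoˡ-≤ (fromℕ-nonNeg 16) (≤-reflexive 2*half)) (r half δ))
        where r = ring 2 (λ h d → # 32 ⊗ (# 1 ⊖ # 2 ⊗ d) ⊕ (# 64 ⊗ d ⊕ # 0 ⊕ # 16 ⊗ (# 2 ⊗ h)) ⊜ # 32 ⊗ h ⊕ (# 1 ⊕ # 15 ⊕ # 16 ⊗ # 1)) refl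

      θ>0 : 0# < θ
      θ>0 = <-≤-trans half-pos half≤θ

      budget : 1# ≤ fromℕ 2 * θ ^ T
      budget = by≤ (*-monoˡ-≤ (fromℕ-nonNeg 2) (bernoulli T (<⇒≤ θ>0) (inj₂ (by≤ (*-nonNeg (fromℕ-nonNeg 2) δ≥0) (ring 1 (λ a → # 0 ⊕ # 0 ⊜ ⊝ (# 2 ⊗ a) ⊕ # 2 ⊗ a) refl _))))
          ⊞ 32Tδ≤1 ⊞ *-nonNeg (fromℕ-nonNeg 28) Tδ≥0) (r (fromℕ T) δ (θ ^ T))
        where r = ring 3 (λ t d p → # 2 ⊗ p ⊕ (# 2 ⊗ (# 1 ⊕ t ⊗ ⊝ (# 2 ⊗ d)) ⊕ # 32 ⊗ (t ⊗ d) ⊕ # 0) ⊜ # 1 ⊕ (# 2 ⊗ p ⊕ # 1 ⊕ # 28 ⊗ (t ⊗ d))) refl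

      ln-θ : - ln θ ≤ fromℕ 4 * δ
      ln-θ = by≤ (≤-reflexive (sym (ln-inv θ>0)) ⊞ ln≤ (inv-pos θ>0) ⊞ θ⁻¹≤) (r δ (ln θ) (ln (θ ⁻¹)) (θ ⁻¹))
        where
        θ⁻¹≤ : θ ⁻¹ ≤ 1# + fromℕ 4 * δ
        θ⁻¹≤ = *-cancelˡ-≤ (*-pos (fromℕ-pos 7) θ>0) (by≤ (*-nonNeg δ≥0 (0≤-diff 64δ≤1) ⊞ *-nonNeg (fromℕ-nonNeg 15) δ≥0 ⊞
            *-monoˡ-≤ (fromℕ-nonNeg 8) (≤-reflexive (*-inv θ>0))) (r′ δ (θ ⁻¹)))
          where r′ = ring 2 (λ d i → # 8 ⊗ (# 1 ⊖ # 2 ⊗ d) ⊗ (# 1 ⊕ # 4 ⊗ d) ⊕ (# 0 ⊕ # 0 ⊕ # 8 ⊗ ((# 1 ⊖ # 2 ⊗ d) ⊗ i)) ⊜ # 8 ⊗ (# 1 ⊖ # 2 ⊗ d) ⊗ i ⊕ (d ⊗ (# 1 ⊖ # 64 ⊗ d) ⊕ # 15 ⊗ d ⊕ # 8 ⊗ # 1)) refl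
        r = ring 4 (λ d l l′ i → # 4 ⊗ d ⊕ (⊝ l ⊕ l′ ⊕ i) ⊜ ⊝ l ⊕ (l′ ⊕ (i ⊖ # 1) ⊕ (# 1 ⊕ # 4 ⊗ d))) refl

      T·ln-θ : 0# ≤ 1# + fromℕ 8 * (fromℕ T * ln θ)
      T·ln-θ = by≤ (*-monoˡ-≤ (fromℕ-nonNeg 8) (*-monoˡ-≤ (fromℕ-nonNeg T) ln-θ) ⊞ 32Tδ≤1) (r (fromℕ T) δ (ln θ))
        where r = ring 3 (λ t d l → # 1 ⊕ # 8 ⊗ (t ⊗ l) ⊕ (# 8 ⊗ (t ⊗ ⊝ l) ⊕ # 32 ⊗ (t ⊗ d)) ⊜ # 0 ⊕ (# 8 ⊗ (t ⊗ (# 4 ⊗ d)) ⊕ # 1)) refl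

      -- 3937 = 1 + 8 (480 + 12), with the constants absorbed by S ≥ 1.
      suc-J≤ : suc J ℕ.≤ 3937 ℕ.* S
      suc-J≤ = bound (2 ℕ.* (15 ℕ.* 16)) 12 8 S 1≤S
        where
        open +-*-Solver
        bound : ∀ a b c s → 1 ℕ.≤ s → suc ((a ℕ.* s ℕ.+ b) ℕ.* c) ℕ.≤ (1 ℕ.+ (a ℕ.+ b) ℕ.* c) ℕ.* s
        bound a b c s@(suc _) p = ℕₚ.≤-trans (ℕₚ.+-mono-≤ p (ℕₚ.*-monoˡ-≤ c (ℕₚ.+-monoʳ-≤ (a ℕ.* s) (ℕₚ.m≤m*n b s))))
          (ℕₚ.≤-reflexive (solve 4 (λ a b c s → s :+ (a :* s :+ b :* s) :* c := (con 1 :+ (a :+ b) :* c) :* s) ≡.refl a b c s))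

      -- 64 = 2^6, 3937 ≤ 2^12 and S ≤ 2^(L + 4), which is where 22 comes from.
      64·suc-J≤ : 64 ℕ.* suc J ℕ.≤ 2 ℕ.^ (L ℕ.+ 22)
      64·suc-J≤ = ℕₚ.≤-trans (ℕₚ.*-monoʳ-≤ 64 (ℕₚ.≤-trans suc-J≤ (ℕₚ.*-mono-≤ (ℕₚ.≤ᵇ⇒≤ 3937 4096 tt) S≤2^)))
        (ℕₚ.≤-reflexive (≡.trans (≡.sym (ℕₚ.*-assoc 64 4096 (2 ℕ.^ (4 ℕ.+ L)))) (powers 18 4)))
        where
        powers : ∀ i j → 2 ℕ.^ i ℕ.* 2 ℕ.^ (j ℕ.+ L) ≡ 2 ℕ.^ (L ℕ.+ (i ℕ.+ j))
        powers i j = ≡.trans (≡.sym (ℕₚ.^-distribˡ-+-* 2 i (j ℕ.+ L)))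
          (≡.cong (2 ℕ.^_) (≡.trans (≡.sym (ℕₚ.+-assoc i j L)) (ℕₚ.+-comm (i ℕ.+ j) L)))

      reject : Carrier
      reject = fromℕ 63 * fromℕ 64 ⁻¹

      reject≥0 : 0# ≤ reject
      reject≥0 = *-nonNeg (fromℕ-nonNeg 63) (<⇒≤ w>0)

      reject^R≤ : reject ^ R ≤ half ^ (L ℕ.+ 22)
      reject^R≤ = ≤-respˡ (sym (^-* reject (L ℕ.+ 22) 64)) (^-mono (L ℕ.+ 22) (^-nonNeg 64 reject≥0) ([1-1/m]^m≤half 62))

      suc-J·reject≤ : fromℕ (suc J) * reject ^ R ≤ w
      suc-J·reject≤ = *-cancelˡ-≤ (fromℕ-pos 63) (≤-trans (≤-reflexive (sym (*-assoc (fromℕ 64) (fromℕ (suc J)) (reject ^ R))))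
        (≤-trans (*-mono-≤ (*-nonNeg (fromℕ-nonNeg 64) (fromℕ-nonNeg (suc J))) (^-nonNeg (L ℕ.+ 22) (<⇒≤ half-pos))
            (≤-trans (≤-reflexive (sym (fromℕ-* 64 (suc J)))) (fromℕ-mono 64·suc-J≤)) reject^R≤)
          (≤-reflexive (trans (*-congʳ (fromℕ-^ 2 (L ℕ.+ 22))) (trans (2^*half^ (L ℕ.+ 22)) (sym 64w))))))

      survive : 1# - w ≤ (1# - reject ^ R) ^ suc J
      survive = power-bound (reject ^ R) (^-nonNeg R reject≥0) (^-≤1 R reject≥0 reject≤1) (suc J) suc-J·reject≤
        where
        reject≤1 : reject ≤ 1#
        reject≤1 = by≤ (≤-reflexive 64w ⊞ <⇒≤ w>0) (r′ w)
          where r′ = ring 1 (λ i → # 1 ⊕ (# 64 ⊗ i ⊕ # 0) ⊜ # 63 ⊗ i ⊕ (# 1 ⊕ i)) refl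
        power-bound : ∀ p → 0# ≤ p → p ≤ 1# → ∀ k → fromℕ k * p ≤ w → 1# - w ≤ (1# - p) ^ k
        power-bound p p≥0 p≤1 k kp≤w = ≤-trans (by≤ kp≤w (r w (fromℕ k) p)) (bernoulli k (0≤-diff p≤1) (inj₂ (by≤ p≥0 (ring 1 (λ a → # 0 ⊕ # 0 ⊜ ⊝ a ⊕ a) refl _))))
          where r = ring 3 (λ w k p → # 1 ⊕ k ⊗ ⊝ p ⊕ k ⊗ p ⊜ # 1 ⊖ w ⊕ w) refl

      cap : Carrier
      cap = fromℕ 2 ^ cap-exponent

      cap>1 : 1# < cap
      cap>1 = 1<2^ (ℕₚ.≤-trans 1≤S (ℕₚ.m≤n*m S 480))

      cap≤ : cap ≤ w * w * (fromℕ 9 * fromℕ 8 ⁻¹) ^ J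
      cap≤ = ≤-trans (≤-reflexive (trans (sym (*-identityˡ cap)) (trans (*-congʳ (sym e)) (r w (fromℕ 2 ^ 6) cap))))
        (*-monoˡ-≤ (*-nonNeg (<⇒≤ w>0) (<⇒≤ w>0)) (≤-trans (≤-reflexive (trans (*-congˡ (sym (^-+ (fromℕ 2) 6 6))) (sym (^-+ (fromℕ 2) cap-exponent 12))))
          (≤-respʳ (sym (^-* (fromℕ 9 * fromℕ 8 ⁻¹) (cap-exponent ℕ.+ 12) 8)) (^-mono (cap-exponent ℕ.+ 12) (fromℕ-nonNeg 2) ([1+1/m]^m≥2 7)))))
        where
        r = ring 3 (λ w b c → b ⊗ w ⊗ (b ⊗ w) ⊗ c ⊜ w ⊗ w ⊗ (c ⊗ (b ⊗ b))) refl
        2^6·w : fromℕ 2 ^ 6 * w ≈ 1#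
        2^6·w = trans (*-congʳ (sym (fromℕ-^ 2 6))) 64w
        e : fromℕ 2 ^ 6 * w * (fromℕ 2 ^ 6 * w) ≈ 1#
        e = trans (*-cong 2^6·w 2^6·w) (*-identityˡ 1#)

      -- 1/c is one of the sixteenths lost in `compression-absurd`.
      c : Carrier
      c = fromℕ 16

      c>1 : 1# < c
      c>1 = by< (fromℕ-pos 14) (r 1#)
        where r = ring 1 (λ o → o ⊕ # 15 ⊕ # 0 ⊜ o ⊕ # 15) refl

      d : Carrier
      d = (c - 1#) * ln cap ⁻¹

      ln-cap≥ : fromℕ 15 * (fromℕ 16 * fromℕ S) ≤ ln cap
      ln-cap≥ = ≤-trans (≤-reflexive (trans (trans (sym (*-assoc (fromℕ 15) (fromℕ 16) (fromℕ S))) (*-congʳ (sym (fromℕ-* 15 16)))) (half-twice (fromℕ (15 ℕ.* 16)) (fromℕ S))))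
        (≤-trans (*-monoˡ-≤ (*-nonNeg (*-nonNeg (fromℕ-nonNeg 2) (fromℕ-nonNeg (15 ℕ.* 16))) (fromℕ-nonNeg S)) half≤ln2)
          (≤-reflexive (trans (*-congʳ (sym (trans (fromℕ-* (2 ℕ.* (15 ℕ.* 16)) S) (*-congʳ (fromℕ-* 2 (15 ℕ.* 16)))))) (sym (ln-^ cap-exponent (fromℕ-pos 1))))))
        where half-twice : ∀ a s → a * s ≈ fromℕ 2 * a * s * half
              half-twice a s = trans (trans (sym (*-identityˡ _)) (*-congʳ (sym 2*half))) (r a s half)
                where r = ring 3 (λ a s h → # 2 ⊗ h ⊗ (a ⊗ s) ⊜ # 2 ⊗ a ⊗ s ⊗ h) refl

      S>0 : 0# < fromℕ S
      S>0 = <-≤-trans 0<1 (1≤fromℕ 1≤S)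

      ln-cap>0 : 0# < ln cap
      ln-cap>0 = <-≤-trans (*-pos (fromℕ-pos 14) (*-pos (fromℕ-pos 15) S>0)) ln-cap≥

      d≥0 : 0# ≤ d
      d≥0 = *-nonNeg (0≤-diff (<⇒≤ c>1)) (<⇒≤ (inv-pos ln-cap>0))

      d≤ : d * (fromℕ 16 * fromℕ S) ≤ 1#
      d≤ = ≤-trans (≤-reflexive (r (fromℕ S) (ln cap ⁻¹))) (≤-respʳ (*-inv ln-cap>0) (*-monoʳ-≤ (<⇒≤ (inv-pos ln-cap>0)) ln-cap≥))
        where r = ring 2 (λ s i → (# 16 ⊖ # 1) ⊗ i ⊗ (# 16 ⊗ s) ⊜ # 15 ⊗ (# 16 ⊗ s) ⊗ i) refl

      -- With 16 w ≤ 1, the inequality 2 (1 - w) g ≤ 1 + 3 w gives g ≤ 19/30, rounded up to 2/3.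
      G : Carrier
      G = fromℕ 2 * fromℕ 3 ⁻¹

      3G : fromℕ 3 * G ≈ fromℕ 2
      3G = trans (r (fromℕ 3 ⁻¹)) (trans (*-congˡ (*-inv (fromℕ-pos 2))) (*-identityʳ _))
        where r = ring 1 (λ i → # 3 ⊗ (# 2 ⊗ i) ⊜ # 2 ⊗ (# 3 ⊗ i)) refl

      conclude : ∀ {κ} → κ ≤ w → ∀ {g} → 0# ≤ g → fromℕ 2 * ((1# - reject ^ R) ^ suc J * g) ≤ κ + 1# + fromℕ 2 * w → g ≤ G
      conclude {κ} κ≤w {g} g≥0 h = *-cancelˡ-≤ (fromℕ-pos 29) (by≤
          (*-monoˡ-≤ (fromℕ-nonNeg 16) surviving ⊞ *-monoˡ-≤ (fromℕ-nonNeg 2) (*-monoʳ-≤ g≥0 16w≤1) ⊞ *-monoˡ-≤ (fromℕ-nonNeg 3) 16w≤1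
            ⊞ *-monoˡ-≤ (fromℕ-nonNeg 10) (≤-reflexive (sym 3G)) ⊞ 0≤1)
          (r w g G))
        where
        16w≤1 : fromℕ 16 * w ≤ 1#
        16w≤1 = by≤ (≤-reflexive 64w ⊞ *-nonNeg (fromℕ-nonNeg 48) (<⇒≤ w>0)) (r₁ w)
          where r₁ = ring 1 (λ w → # 1 ⊕ (# 64 ⊗ w ⊕ # 0) ⊜ # 16 ⊗ w ⊕ (# 1 ⊕ # 48 ⊗ w)) refl
        surviving : fromℕ 2 * ((1# - w) * g) ≤ 1# + fromℕ 3 * w
        surviving = by≤ (*-monoˡ-≤ (fromℕ-nonNeg 2) (*-monoʳ-≤ g≥0 survive) ⊞ h ⊞ κ≤w) (r₂ w κ (fromℕ 2 * ((1# - w) * g)) (fromℕ 2 * ((1# - reject ^ R) ^ suc J * g)))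
          where r₂ = ring 4 (λ w κ s p → # 1 ⊕ # 3 ⊗ w ⊕ (s ⊕ p ⊕ κ) ⊜ s ⊕ (p ⊕ (κ ⊕ # 1 ⊕ # 2 ⊗ w) ⊕ w)) refl
        r = ring 3 (λ w g G → # 30 ⊗ G ⊕ (# 16 ⊗ (# 2 ⊗ ((# 1 ⊖ w) ⊗ g)) ⊕ # 2 ⊗ (# 16 ⊗ w ⊗ g) ⊕ # 3 ⊗ (# 16 ⊗ w) ⊕ # 10 ⊗ # 2 ⊕ # 0) ⊜ # 30 ⊗ g ⊕ (# 16 ⊗ (# 1 ⊕ # 3 ⊗ w) ⊕ # 2 ⊗ (# 1 ⊗ g) ⊕ # 3 ⊗ # 1 ⊕ # 10 ⊗ (# 3 ⊗ G) ⊕ # 1)) refl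

  -- The universal constant and the two numerical contradictions.

  module Constants where
    open OrderedField
    open ExponentialLogarithm hiding (e; term)
    open Binary
    open ParameterChoice

    -- A bounds the constant in the cost of the restarted walk; it is sealed so that
    -- the numeral is never unfolded.
    abstract
      A : ℕ
      A = 134217728

      enough : 3937 ℕ.* (1472 ℕ.* 14) ℕ.+ 2 ℕ.≤ A
      enough = ℕₚ.≤ᵇ⇒≤ _ _ tt

      1≤A : 1 ℕ.≤ A
      1≤A = ℕₚ.≤ᵇ⇒≤ _ _ tt

    -- The factor 64 puts κ below the allowance `w` and B = 2κn below n/32. The factor a keeps the
    -- cost a S L² of the walk below C.
    a κ : Carrier
    a = fromℕ A
    κ = (fromℕ 64 * a) ⁻¹

    a≥1 : 1# ≤ a
    a≥1 = 1≤fromℕ 1≤A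

    64a>0 : 0# < fromℕ 64 * a
    64a>0 = *-pos (fromℕ-pos 63) (<-≤-trans 0<1 a≥1)

    κ>0 : 0# < κ
    κ>0 = inv-pos 64a>0

    64aκ : fromℕ 64 * a * κ ≈ 1#
    64aκ = *-inv 64a>0

    κ≤ : κ ≤ fromℕ 64 ⁻¹
    κ≤ = inv-≤ (fromℕ-pos 63) (≤-respˡ (*-identityʳ _) (*-monoˡ-≤ (fromℕ-nonNeg 64) a≥1))

    64κ≤1 : fromℕ 64 * κ ≤ 1#
    64κ≤1 = ≤-respʳ (*-inv (fromℕ-pos 63)) (*-monoˡ-≤ (fromℕ-nonNeg 64) κ≤)

    module _ (m T L : ℕ) (1≤L : 1 ℕ.≤ L) (T<2^ : T ℕ.< 2 ℕ.^ suc L) where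
      open Parameters m T L 1≤L T<2^

      L²>0 : 0# < fromℕ L * fromℕ L
      L²>0 = *-pos L>0 L>0
        where L>0 = <-≤-trans 0<1 (1≤fromℕ 1≤L)

      -- The source of log²: the rounds per restart and the bits per round are each O(L), and J + 1
      -- is O(S).
      cost≤ : suc J ℕ.* (R ℕ.* (ℓ ℕ.+ (ℓ ℕ.+ 2))) ℕ.+ 2 ℕ.≤ A ℕ.* (S ℕ.* (L ℕ.* L))
      cost≤ = ℕₚ.≤-trans (ℕₚ.+-mono-≤ (ℕₚ.*-mono-≤ suc-J≤ (ℕₚ.*-mono-≤ R≤ ℓ≤)) (ℕₚ.*-monoʳ-≤ 2 1≤SLL))
        (ℕₚ.≤-trans (ℕₚ.≤-reflexive (collect 3937 1472 14 S L)) (ℕₚ.*-monoˡ-≤ (S ℕ.* (L ℕ.* L)) enough))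
        where
        open +-*-Solver
        1≤SLL : 1 ℕ.≤ S ℕ.* (L ℕ.* L)
        1≤SLL = ℕₚ.*-mono-≤ 1≤S (ℕₚ.*-mono-≤ 1≤L 1≤L)
        pad : ∀ k → k ℕ.≤ k ℕ.* L
        pad k = ℕₚ.m≤m*n k L {{ℕ.>-nonZero 1≤L}}
        R≤ : R ℕ.≤ 1472 ℕ.* L
        R≤ = ℕₚ.≤-trans (ℕₚ.*-monoˡ-≤ 64 (ℕₚ.+-monoʳ-≤ L (pad 22))) (ℕₚ.≤-reflexive (e 22 64 L))
          where e : ∀ b c l → (l ℕ.+ b ℕ.* l) ℕ.* c ≡ suc b ℕ.* c ℕ.* l
                e = solve 3 (λ b c l → (l :+ b :* l) :* c := (con 1 :+ b) :* c :* l) ≡.refl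
        ℓ≤ : ℓ ℕ.+ (ℓ ℕ.+ 2) ℕ.≤ 14 ℕ.* L
        ℓ≤ = ℕₚ.≤-trans (ℕₚ.≤-reflexive (solve 1 (λ l → (con 1 :+ l :+ (l :+ con 3)) :+ ((con 1 :+ l :+ (l :+ con 3)) :+ con 2) := con 4 :* l :+ con 10) ≡.refl L))
          (ℕₚ.≤-trans (ℕₚ.+-monoʳ-≤ (4 ℕ.* L) (pad 10)) (ℕₚ.≤-reflexive (solve 1 (λ l → con 4 :* l :+ con 10 :* l := con 14 :* l) ≡.refl L)))
        collect : ∀ j r s S L → j ℕ.* S ℕ.* (r ℕ.* L ℕ.* (s ℕ.* L)) ℕ.+ 2 ℕ.* (S ℕ.* (L ℕ.* L)) ≡ (j ℕ.* (r ℕ.* s) ℕ.+ 2) ℕ.* (S ℕ.* (L ℕ.* L))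
        collect = solve 5 (λ j r s S L → j :* S :* (r :* L :* (s :* L)) :+ con 2 :* (S :* (L :* L)) := (j :* (r :* s) :+ con 2) :* (S :* (L :* L))) ≡.refl

      module _ {C : Carrier} (C≥0 : 0# ≤ C) (T-small : fromℕ T * (fromℕ L * fromℕ L) ≤ κ * C * fromℕ n) where
        -- In n S ≤ 6n + 2T the part 6n costs at most C n/2 by the threshold 12 a L², and the part
        -- 2T at most C n/32 by the choice of κ.
        affordable : fromℕ 12 * a * (fromℕ L * fromℕ L) ≤ C → ∀ {k} → k ℕ.≤ A ℕ.* (S ℕ.* (L ℕ.* L)) → fromℕ k ≤ C
        affordable 12aL²≤C {k} k≤ = *-cancelˡ-≤ (fromℕ-pos m) (*-cancelˡ-≤ (fromℕ-pos 31) (≤-trans (*-monoˡ-≤ (fromℕ-nonNeg 32) (*-monoˡ-≤ (fromℕ-nonNeg n) k≤ʳ))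
          (by≤ (*-monoˡ-≤ aL²≥0 nS≤ʳ ⊞ *-monoˡ-≤ (*-nonNeg (fromℕ-nonNeg 64) (fromℕ-nonNeg A)) T-small ⊞ *-monoˡ-≤ (fromℕ-nonNeg 16) (*-monoʳ-≤ (fromℕ-nonNeg n) 12aL²≤C)
              ⊞ *-monoʳ-≤ (*-nonNeg C≥0 (fromℕ-nonNeg n)) (≤-reflexive 64aκ) ⊞ *-nonNeg (fromℕ-nonNeg 15) (*-nonNeg C≥0 (fromℕ-nonNeg n)))
            (r a (fromℕ S) (fromℕ L) (fromℕ n) (fromℕ T) κ C))))
          where
          k≤ʳ : fromℕ k ≤ a * (fromℕ S * (fromℕ L * fromℕ L))
          k≤ʳ = ≤-trans (fromℕ-mono k≤) (≤-reflexive (trans (fromℕ-* A (S ℕ.* (L ℕ.* L))) (*-congˡ (trans (fromℕ-* S (L ℕ.* L)) (*-congˡ (fromℕ-* L L))))))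
          nS≤ʳ : fromℕ n * fromℕ S ≤ fromℕ 6 * fromℕ n + fromℕ 2 * fromℕ T
          nS≤ʳ = ≤-trans (≤-reflexive (sym (fromℕ-* n S))) (≤-trans (fromℕ-mono nS≤)
            (≤-reflexive (trans (fromℕ-+ (6 ℕ.* n) (2 ℕ.* T)) (+-cong (fromℕ-* 6 n) (fromℕ-* 2 T)))))
          aL²≥0 : 0# ≤ fromℕ 32 * a * (fromℕ L * fromℕ L)
          aL²≥0 = *-nonNeg (*-nonNeg (fromℕ-nonNeg 32) (fromℕ-nonNeg A)) (<⇒≤ L²>0)
          r = ring 7 (λ a S L n T κ C → # 32 ⊗ (n ⊗ C) ⊕ (# 32 ⊗ a ⊗ (L ⊗ L) ⊗ (n ⊗ S) ⊕ # 64 ⊗ a ⊗ (T ⊗ (L ⊗ L)) ⊕ # 16 ⊗ (# 12 ⊗ a ⊗ (L ⊗ L) ⊗ n) ⊕ # 64 ⊗ a ⊗ κ ⊗ (C ⊗ n) ⊕ # 0) ⊜ # 32 ⊗ (n ⊗ (a ⊗ (S ⊗ (L ⊗ L)))) ⊕ (# 32 ⊗ a ⊗ (L ⊗ L) ⊗ (# 6 ⊗ n ⊕ # 2 ⊗ T) ⊕ # 64 ⊗ a ⊗ (κ ⊗ C ⊗ n) ⊕ # 16 ⊗ (C ⊗ n) ⊕ # 1 ⊗ (C ⊗ n) ⊕ # 15 ⊗ (C ⊗ n))) refl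

        -- T L² ≤ κ C n ≤ 12 a κ n L², and 12 a κ = 12/64 = 3/16.
        few-bits : C ≤ fromℕ 12 * a * (fromℕ L * fromℕ L) → fromℕ 16 * fromℕ T ≤ fromℕ 3 * fromℕ n
        few-bits h = *-cancelˡ-≤ L²>0 (by≤ (*-monoˡ-≤ (fromℕ-nonNeg 16) T-small ⊞ *-monoˡ-≤ (*-nonNeg (*-nonNeg (fromℕ-nonNeg 16) (<⇒≤ κ>0)) (fromℕ-nonNeg n)) h
              ⊞ *-monoʳ-≤ (*-nonNeg (*-nonNeg (fromℕ-nonNeg 3) (fromℕ-nonNeg n)) (<⇒≤ L²>0)) (≤-reflexive 64aκ))
            (r a κ (fromℕ n) C (fromℕ L) (fromℕ T)))
          where r = ring 6 (λ a κ n C L T → L ⊗ L ⊗ (# 3 ⊗ n) ⊕ (# 16 ⊗ (T ⊗ (L ⊗ L)) ⊕ # 16 ⊗ κ ⊗ n ⊗ C ⊕ # 64 ⊗ a ⊗ κ ⊗ (# 3 ⊗ n ⊗ (L ⊗ L))) ⊜ L ⊗ L ⊗ (# 16 ⊗ T) ⊕ (# 16 ⊗ (κ ⊗ C ⊗ n) ⊕ # 16 ⊗ κ ⊗ n ⊗ (# 12 ⊗ a ⊗ (L ⊗ L)) ⊕ # 1 ⊗ (# 3 ⊗ n ⊗ (L ⊗ L)))) refl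

      module _ {B u : Carrier} (32B≤n : fromℕ 32 * B ≤ fromℕ n) (u≤T : u ≤ fromℕ T) where
        -- In units of n/32 the right side is at most 16 + 1 + 2 + 12 = 31, from one half, κ/2, 2B
        -- and 2u.
        low-information-absurd : fromℕ 16 * fromℕ T ≤ fromℕ 3 * fromℕ n →
          fromℕ n ≤ fromℕ n * ((1# + κ) * half) + (fromℕ 2 * B + fromℕ 2 * u) → ⊥
        low-information-absurd 16T≤3n h = <⇒≱ (fromℕ-pos m) (by≤
            (*-monoˡ-≤ (fromℕ-nonNeg 32) h ⊞ *-monoˡ-≤ (fromℕ-nonNeg 2) 32B≤n ⊞ *-monoˡ-≤ (fromℕ-nonNeg 64) u≤T ⊞ *-monoˡ-≤ (fromℕ-nonNeg 4) 16T≤3n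
              ⊞ *-monoˡ-≤ (fromℕ-nonNeg n) 16κ≤1 ⊞ ≤-reflexive (*-congˡ {fromℕ 16 * fromℕ n * (1# + κ)} 2*half))
            (r (fromℕ n) κ half B u (fromℕ T)))
          where
          16κ≤1 : fromℕ 16 * κ ≤ 1#
          16κ≤1 = by≤ (64κ≤1 ⊞ *-nonNeg (fromℕ-nonNeg 48) (<⇒≤ κ>0)) (r′ κ)
            where r′ = ring 1 (λ w → # 1 ⊕ (# 64 ⊗ w ⊕ # 0) ⊜ # 16 ⊗ w ⊕ (# 1 ⊕ # 48 ⊗ w)) refl
          r = ring 6 (λ n κ h B u T → # 0 ⊕ (# 32 ⊗ n ⊕ # 2 ⊗ (# 32 ⊗ B) ⊕ # 64 ⊗ u ⊕ # 4 ⊗ (# 16 ⊗ T) ⊕ n ⊗ (# 16 ⊗ κ) ⊕ # 16 ⊗ n ⊗ (# 1 ⊕ κ) ⊗ (# 2 ⊗ h)) ⊜ n ⊕ (# 32 ⊗ (n ⊗ ((# 1 ⊕ κ) ⊗ h) ⊕ (# 2 ⊗ B ⊕ # 2 ⊗ u)) ⊕ # 2 ⊗ n ⊕ # 64 ⊗ T ⊕ # 4 ⊗ (# 3 ⊗ n) ⊕ n ⊗ # 1 ⊕ # 16 ⊗ n ⊗ (# 1 ⊕ κ) ⊗ # 1)) refl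

        -- Five sixteenths are lost: two to smoothing and one each to 1/c, to the divergence and to
        -- the cap. The remaining 11/16 exceed G = 2/3.
        compression-absurd : ∀ {t i} → 0# ≤ 1# + fromℕ 8 * t → fromℕ 16 * i ≈ 1# →
          fromℕ n * (1# + t - i - d * fromℕ 3) ≤ fromℕ n * G + fromℕ 2 * B + d * (fromℕ 2 * B + fromℕ 2 * u) → ⊥
        compression-absurd {t} {i} t≥ 16i h = <⇒≱ (fromℕ-pos m) (by≤
            (*-monoˡ-≤ (fromℕ-nonNeg 3) main ⊞ ≤-reflexive (*-congˡ {fromℕ 16 * fromℕ n} 3G))
            (r₄ (fromℕ n) G))
          where
          2B≤n : fromℕ 2 * B ≤ fromℕ n
          2B≤n = *-cancelˡ-≤ (fromℕ-pos 15) (by≤ (32B≤n ⊞ *-nonNeg (fromℕ-nonNeg 15) (fromℕ-nonNeg n)) (r₁ (fromℕ n) B))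
            where r₁ = ring 2 (λ n B → # 16 ⊗ n ⊕ (# 32 ⊗ B ⊕ # 0) ⊜ # 16 ⊗ (# 2 ⊗ B) ⊕ (n ⊕ # 15 ⊗ n)) refl
          nS≥ʳ : fromℕ 4 * fromℕ n + fromℕ 2 * fromℕ T ≤ fromℕ n * fromℕ S
          nS≥ʳ = ≤-trans (≤-reflexive (sym (trans (fromℕ-+ (4 ℕ.* n) (2 ℕ.* T)) (+-cong (fromℕ-* 4 n) (fromℕ-* 2 T)))))
            (≤-trans (fromℕ-mono nS≥) (≤-reflexive (fromℕ-* n S)))
          load : fromℕ 3 * fromℕ n + fromℕ 2 * B + fromℕ 2 * u ≤ fromℕ n * fromℕ S
          load = by≤ (nS≥ʳ ⊞ 2B≤n ⊞ *-monoˡ-≤ (fromℕ-nonNeg 2) u≤T) (r₂ (fromℕ n) B u (fromℕ T) (fromℕ n * fromℕ S))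
            where r₂ = ring 5 (λ n B u T s → s ⊕ (# 4 ⊗ n ⊕ # 2 ⊗ T ⊕ # 2 ⊗ B ⊕ # 2 ⊗ u) ⊜ # 3 ⊗ n ⊕ # 2 ⊗ B ⊕ # 2 ⊗ u ⊕ (s ⊕ n ⊕ # 2 ⊗ T)) refl
          main : fromℕ 11 * fromℕ n ≤ fromℕ 16 * fromℕ n * G
          main = by≤ (*-monoˡ-≤ (fromℕ-nonNeg 16) h ⊞ *-monoˡ-≤ (*-nonNeg (fromℕ-nonNeg 2) (fromℕ-nonNeg n)) t≥ ⊞ *-monoˡ-≤ (fromℕ-nonNeg n) (≤-reflexive 16i)
              ⊞ 32B≤n ⊞ *-monoˡ-≤ (*-nonNeg (fromℕ-nonNeg 16) d≥0) load ⊞ *-monoˡ-≤ (fromℕ-nonNeg n) d≤)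
            (r₃ (fromℕ n) t i d G B u (fromℕ S))
            where r₃ = ring 8 (λ n t i d G B u S → # 16 ⊗ n ⊗ G ⊕ (# 16 ⊗ (n ⊗ (# 1 ⊕ t ⊖ i ⊖ d ⊗ # 3)) ⊕ # 2 ⊗ n ⊗ # 0 ⊕ n ⊗ (# 16 ⊗ i) ⊕ # 32 ⊗ B ⊕ # 16 ⊗ d ⊗ (# 3 ⊗ n ⊕ # 2 ⊗ B ⊕ # 2 ⊗ u) ⊕ n ⊗ (d ⊗ (# 16 ⊗ S))) ⊜ # 11 ⊗ n ⊕ (# 16 ⊗ (n ⊗ G ⊕ # 2 ⊗ B ⊕ d ⊗ (# 2 ⊗ B ⊕ # 2 ⊗ u)) ⊕ # 2 ⊗ n ⊗ (# 1 ⊕ # 8 ⊗ t) ⊕ n ⊗ # 1 ⊕ n ⊕ # 16 ⊗ d ⊗ (n ⊗ S) ⊕ n ⊗ # 1)) refl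
          r₄ = ring 2 (λ n G → # 0 ⊕ (# 3 ⊗ (# 11 ⊗ n) ⊕ # 16 ⊗ n ⊗ (# 3 ⊗ G)) ⊜ n ⊕ (# 3 ⊗ (# 16 ⊗ n ⊗ G) ⊕ # 16 ⊗ n ⊗ # 2)) refl

  -- Refuting a good tree and passing to the supremum.

  module Assembly where
    open OrderedField
    open ExponentialLogarithm hiding (e; term)
    open FiniteSums
    open XorBias
    open AchievableOutputs
    open TranscriptTrees using (ln-2≤1)
    open WalkSimulation using (module Rounds)
    open ProtocolTrees
    open ConditionedInput
    open Binary
    open ParameterChoice
    open Constants

    cost-continue-eq : ∀ {A B : Set} ℓ R J → Rounds.cost-continue {A} {B} ℓ R J ≡ J ℕ.* (R ℕ.* Rounds.step {A} {B} ℓ R) ℕ.+ 2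
    cost-continue-eq ℓ R zero = ≡.refl
    cost-continue-eq {A} {B} ℓ R (suc J) = ≡.trans (≡.cong (R ℕ.* Rounds.step {A} {B} ℓ R ℕ.+_) (cost-continue-eq {A} {B} ℓ R J))
      (≡.sym (ℕₚ.+-assoc (R ℕ.* Rounds.step {A} {B} ℓ R) _ 2))

    module Hypotheses (X Y : FinSet) (f : Elem X × Elem Y → Bool) (D : Distribution (X ×ᶠ Y)) (product : IsProduct {X} {Y} D)
      (m : ℕ) (C : Carrier) (1/κ<C : 1# / κ < C) (adv<κ : adv X Y (weight D) C f < κ) where
      open Margins {X} {Y} D product

      n : ℕ
      n = suc m

      n≥1 : 1# ≤ fromℕ n
      n≥1 = 1≤fromℕ {suc m} (ℕ.s≤s ℕ.z≤n)

      z : Carrier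
      z = C * fromℕ n

      64a≤C : fromℕ 64 * a ≤ C
      64a≤C = *-cancelˡ-≤ κ>0 (≤-trans (≤-reflexive (trans (*-comm κ (fromℕ 64 * a)) 64aκ))
        (≤-respˡ (trans (*-congˡ (*-identityˡ (κ ⁻¹))) (*-inv κ>0)) (*-monoˡ-≤ (<⇒≤ κ>0) (<⇒≤ 1/κ<C))))

      2≤C : fromℕ 2 ≤ C
      2≤C = ≤-trans (≤-trans (fromℕ-mono {2} {64} (ℕ.s≤s (ℕ.s≤s ℕ.z≤n))) (≤-respˡ (*-identityʳ (fromℕ 64)) (*-monoˡ-≤ (fromℕ-nonNeg 64) a≥1))) 64a≤C

      C≥0 : 0# ≤ C
      C≥0 = ≤-trans (fromℕ-nonNeg 2) 2≤C

      2≤z : fromℕ 2 ≤ z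
      2≤z = ≤-trans 2≤C (≤-respˡ (*-identityʳ C) (*-monoˡ-≤ C≥0 n≥1))

      z≥0 : 0# ≤ z
      z≥0 = ≤-trans (fromℕ-nonNeg 2) 2≤z

      logz≥1 : 1# ≤ log₂ z
      logz≥1 = ≤-respˡ (+-identityʳ 1#) (≤-log₂ 1 (≤-respˡ (sym (*-identityʳ (fromℕ 2))) 2≤z))

      log²>0 : 0# < log₂ z ^ 2
      log²>0 = ^-pos 2 (<-≤-trans 0<1 logz≥1)

      -- Twice the exponent to be proved, so that the weak bound on the supremum yields a strict
      -- one.
      B : Carrier
      B = fromℕ 2 * κ * fromℕ n

      32B≤n : fromℕ 32 * B ≤ fromℕ n
      32B≤n = ≤-trans (≤-reflexive (r κ (fromℕ n))) (≤-respʳ (*-identityˡ (fromℕ n)) (*-monoʳ-≤ (fromℕ-nonNeg n) 64κ≤1))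
        where r = ring 2 (λ κ n → # 32 ⊗ (# 2 ⊗ κ ⊗ n) ⊜ # 64 ⊗ κ ⊗ n) refl

      hard : ∀ {d φ} → fromℕ d ≤ C → Achievable (Elem X) (Elem Y) d φ → correlated f φ ≤ κ
      hard d≤C s = ≤-trans (achievable-≤-adv f C d≤C s) (<⇒≤ adv<κ)

      value : Tree (Vec (Elem X) n) (Vec (Elem Y) n) → Carrier
      value = treeAdvantage {X ^ᶠ n} {Y ^ᶠ n} (productPower (weight D) n) (xorPower f n)

      module Refute (τ : Tree (Vec (Elem X) n) (Vec (Elem Y) n)) (good : exp (- B) ≤ value τ)
        (bits : fromℕ (depth τ) * log₂ z ^ 2 ≤ κ * C * fromℕ n)
        (L : ℕ) (2^L≤z : fromℕ 2 ^ L ≤ z) (z<2^ : z < fromℕ 2 ^ suc L) where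
        open Bias X Y μ μ≥0 ν ν≥0 f using (correlation; correlation≤event)

        value≈ : value τ ≈ correlation τ (λ _ → 1#) (λ _ → 1#)
        value≈ = trans (∑-× (X ^ᶠ n) (Y ^ᶠ n) _) (trans (∑-swap (X ^ᶠ n) (Y ^ᶠ n) _) (∑-cong (Y ^ᶠ n) λ ys →
          trans (∑-cong (X ^ᶠ n) λ xs → trans (*-congʳ (productPower-eq n xs ys)) (r (power μ xs) (power ν ys) _)) (∑-*ˡ (X ^ᶠ n) _ _)))
          where r = ring 3 (λ p q s → p ⊗ q ⊗ s ⊜ q ⊗ # 1 ⊗ (p ⊗ (# 1 ⊗ s))) refl

        β : Carrier
        β = Conditioned.β X Y μ μ≥0 μ-total ν ν≥0 ν-total f n τ

        β-large : exp (- B) ≤ β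
        β-large = ≤-trans good (≤-trans (≤-reflexive value≈) (≤-trans (correlation≤event τ (λ _ → 0≤1) (λ _ → 0≤1)) (≤-reflexive (Conditioned.event-mass-β X Y μ μ≥0 μ-total ν ν≥0 ν-total f n τ))))

        1≤L : 1 ℕ.≤ L
        1≤L = positive L z<2^
          where positive : ∀ L → z < fromℕ 2 ^ suc L → 1 ℕ.≤ L
                positive zero h = contradiction 2≤z (<⇒≱ (<-respʳ-≈ (*-identityʳ (fromℕ 2)) h))
                positive (suc _) _ = ℕ.s≤s ℕ.z≤n

        T-small : fromℕ (depth τ) * (fromℕ L * fromℕ L) ≤ κ * C * fromℕ n
        T-small = ≤-trans (*-monoˡ-≤ (fromℕ-nonNeg (depth τ)) (≤-respʳ (*-congˡ (sym (*-identityʳ (log₂ z))))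
          (*-mono-≤ (fromℕ-nonNeg L) (≤-trans 0≤1 logz≥1) L≤ L≤))) bits
          where L≤ = ≤-log₂ L 2^L≤z

        -- Since L ≥ 1 and κ ≤ 1, the depth is at most z, so the binary scale of z also measures the
        -- tree.
        T<2^ : depth τ ℕ.< 2 ℕ.^ suc L
        T<2^ = ℕₚ.≰⇒> λ h → <⇒≱ z<2^ (≤-trans (≤-reflexive (sym (fromℕ-^ 2 (suc L)))) (≤-trans (fromℕ-mono h) T≤z))
          where
          T≤z : fromℕ (depth τ) ≤ z
          T≤z = ≤-trans (≤-respˡ (*-identityʳ _) (*-monoˡ-≤ (fromℕ-nonNeg (depth τ)) (≤-respˡ (*-identityˡ 1#) (*-mono-≤ 0≤1 (fromℕ-nonNeg L) (1≤fromℕ 1≤L) (1≤fromℕ 1≤L)))))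
            (≤-trans T-small (≤-trans (≤-reflexive (*-assoc κ C (fromℕ n))) (≤-respʳ (*-identityˡ z) (*-monoʳ-≤ z≥0 κ≤1))))
            where κ≤1 = ≤-trans (≤-respˡ (*-identityˡ κ) (*-monoʳ-≤ (<⇒≤ κ>0) (1≤fromℕ {64} (ℕ.s≤s ℕ.z≤n)))) 64κ≤1

        u≤T : fromℕ (depth τ) * ln (fromℕ 2) ≤ fromℕ (depth τ)
        u≤T = ≤-respʳ (*-identityʳ _) (*-monoˡ-≤ (fromℕ-nonNeg (depth τ)) ln-2≤1)

        open Parameters m (depth τ) L 1≤L T<2^ hiding (n)

        absurd : ⊥
        absurd with fromℕ 12 * a * (fromℕ L * fromℕ L) ≤? C
        ... | no h = low-information-absurd m (depth τ) L 1≤L T<2^ 32B≤n u≤T (few-bits m (depth τ) L 1≤L T<2^ C≥0 T-small (<⇒≤ (≰⇒> h)))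
            (Conditioned.Hard.CaseB.summed X Y μ μ≥0 μ-total ν ν≥0 ν-total f n τ B β-large κ C hard 2≤C)
        ... | yes h = compression-absurd m (depth τ) L 1≤L T<2^ 32B≤n u≤T T·ln-θ (*-inv (fromℕ-pos 15))
            (Conditioned.Hard.CaseA.summed X Y μ μ≥0 μ-total ν ν≥0 ν-total f n τ B β-large κ C hard K θ>0 budget cap cap>1 c c>1 ℓ R J cheap w (<⇒≤ w>0) cap≤ short G (conclude κ≤))
          where
          cheap : fromℕ (R ℕ.* Rounds.step {Elem X} {Elem Y} ℓ R ℕ.+ Rounds.cost-continue {Elem X} {Elem Y} ℓ R J) ≤ C
          cheap = affordable m (depth τ) L 1≤L T<2^ C≥0 T-small h (ℕₚ.≤-trans (ℕₚ.≤-reflexive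
              (≡.trans (≡.cong (R ℕ.* Rounds.step {Elem X} {Elem Y} ℓ R ℕ.+_) (cost-continue-eq {Elem X} {Elem Y} ℓ R J))
                (≡.sym (ℕₚ.+-assoc (R ℕ.* Rounds.step {Elem X} {Elem Y} ℓ R) (J ℕ.* (R ℕ.* Rounds.step {Elem X} {Elem Y} ℓ R)) 2))))
            (cost≤ m (depth τ) L 1≤L T<2^))

      -- L is found by a search that needs a natural bound on z. Such a bound may be assumed because
      -- the goal is decidable.
      value-≤ : ∀ τ → fromℕ (depth τ) * log₂ z ^ 2 ≤ κ * C * fromℕ n → value τ ≤ exp (- B)
      value-≤ τ bits = with-bound (value τ ≤? exp (- B)) z λ k z≤k → ≮⇒≥ λ h →
        let L , 2^L≤z , z<2^ = binary-scale k (≤-trans (1≤fromℕ {2} (ℕ.s≤s ℕ.z≤n)) 2≤z)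
              (≤-<-trans z≤k (<-≤-trans (≤∧≢ k) (≤-reflexive (fromℕ-^ 2 k))))
        in Refute.absurd τ (<⇒≤ h) bits L 2^L≤z z<2^
        where ≤∧≢ : ∀ k → fromℕ k < fromℕ (2 ℕ.^ k)
              ≤∧≢ k = <-≤-trans (by< {x = fromℕ k} {y = 1# + fromℕ k} 0<1 (ring 1 (λ a → # 1 ⊕ a ⊕ # 0 ⊜ a ⊕ # 1) refl _)) (fromℕ-mono (n<2^n k))

      exponentially-small : adv (X ^ᶠ n) (Y ^ᶠ n) (productPower (weight D) n) ((κ * C * fromℕ n) / (log₂ z ^ 2)) (xorPower f n) < exp (- (κ * fromℕ n))
      exponentially-small = ≤-<-trans (sup-least _ (_ , silent , cheap , refl) λ (π , small , v≈) →
          ≤-trans (≤-reflexive v≈) (advantage-≤ {X ^ᶠ n} {Y ^ᶠ n} (productPower (weight D) n) (xorPower f n) π λ r a b →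
            value-≤ (fixCoins {X ^ᶠ n} {Y ^ᶠ n} (productPower (weight D) n) (xorPower f n) π r a b) (within π small r a b)))
        (exp-strict (by< (*-pos κ>0 (fromℕ-pos m)) (r κ (fromℕ n))))
        where
        -- `sup-least` asks for a member of the set; a constant output costs nothing.
        silent : Protocol (X ^ᶠ n) (Y ^ᶠ n)
        silent = deterministic {X ^ᶠ n} {Y ^ᶠ n} (productPower (weight D) n) (xorPower f n) (output false)
        cheap : fromℕ (cost silent) ≤ (κ * C * fromℕ n) / (log₂ z ^ 2)
        cheap = ≤-trans (≤-reflexive (reflexive (≡.cong fromℕ (cost-deterministic {X ^ᶠ n} {Y ^ᶠ n} (productPower (weight D) n) (xorPower f n) (output false)))))
          (≤-/ log²>0 (≤-trans (≤-reflexive (zeroˡ _)) (*-nonNeg (*-nonNeg (<⇒≤ κ>0) C≥0) (fromℕ-nonNeg n))))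
        r = ring 2 (λ κ n → ⊝ (κ ⊗ n) ⊕ # 0 ⊜ ⊝ (# 2 ⊗ κ ⊗ n) ⊕ κ ⊗ n) refl
        within : ∀ π → fromℕ (cost π) ≤ (κ * C * fromℕ n) / (log₂ z ^ 2) → ∀ r a b →
          fromℕ (depth (fixCoins {X ^ᶠ n} {Y ^ᶠ n} (productPower (weight D) n) (xorPower f n) π r a b)) * log₂ z ^ 2 ≤ κ * C * fromℕ n
        within π small r a b = ≤-trans (*-monoʳ-≤ (<⇒≤ log²>0) (≤-trans (fromℕ-mono
            (≡.subst (ℕ._≤ cost π) (≡.sym (depth-along (_, a) (_, b) (Protocol.tree π r))) (depth≤cost π r))) small))
          (≤-reflexive (/-* log²>0))

theorem14 : (ℝ : CompleteOrderedField) →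
    let open CompleteOrderedField ℝ
        open Communication ℝ
    in
    ∃[ κ ] (0# < κ ×
      ((X Y : FinSet) (f : Elem X × Elem Y → Bool)
       (μ : Distribution (X ×ᶠ Y)) → IsProduct {X} {Y} μ →
       (n : ℕ) → 1 ℕ.≤ n →
       (C : Carrier) → 1# / κ < C →
       adv X Y (weight μ) C f < κ →
       adv (X ^ᶠ n) (Y ^ᶠ n) (productPower (weight μ) n)
           ((κ * C * fromℕ n) / (log₂ (C * fromℕ n) ^ 2))
           (xorPower f n)
         < exp (- (κ * fromℕ n))))
theorem14 ℝ = κ , κ>0 , λ { X Y f μ product (suc m) _ → exponentially-small X Y f μ product m }
  where open Development.Constants ℝ using (κ; κ>0)
        open Development.Assembly.Hypotheses ℝ using (exponentially-small)
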